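{- Let $\beta$ be a Pisot or Salem number. For $i=1,2,3$ let $(u_i(n))_{n=1}^{\infty}$ be a sequence of positive integers, and assume: Condition (1): there exists a constant $C$ with $0<C<1$ such that, for each $i=1,2,3$, $\log^{+}u_i(n)=o(n^{1-C})$ as $n\to\infty$. Condition (2): $\displaystyle\lim_{n\to\infty}\frac{u_1(n)}{u_2(n)}=\infty$. Then the following hold. (1) For any real numbers $x,y$ with $0<x<y$, the three numbers $$\sum_{n=1}^{\infty}u_1(n)\beta^{ -\lfloor\exp((\log n)^{1+x})\rfloor},\quad \sum_{n=1}^{\infty}u_2(n)\beta^{ -\lfloor\exp((\log n)^{1+x})\rfloor},\quad \sum_{n=1}^{\infty}u_3(n)\beta^{ -\lfloor\exp((\log n)^{1+y})\rfloor}$$ are algebraically independent. (2) The three numbers $$\sum_{n=3}^{\infty}u_1(n)\beta^{ -\lfloor n^{\log\log n}\rfloor},\quad \sum_{n=3}^{\infty}u_2(n)\beta^{ -\lfloor n^{\log\log n}\rfloor},\quad \sum_{n=1}^{\infty}u_3(n)\beta^{ -\lfloor n^{\log n}\rfloor}$$ are algebraically independent. (3) Let $r$ be a real number greater than $1$. Then the three numbers $$\sum_{n=1}^{\infty}u_1(n)\beta^{ -\lfloor n^{\log n}\rfloor},\quad \sum_{n=1}^{\infty}u_2(n)\beta^{ -\lfloor n^{\log n}\rfloor},\quad \sum_{n=1}^{\infty}u_3(n)\beta^{ -\lfloor r^{n}\rfloor}$$ are algebraically independent.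
   Context: For real $x$, $\lfloor x\rfloor$ is the integral part of $x$ and $\log^{+}x=\log\max\{1,x\}$. A Pisot number is an algebraic integer greater than $1$ whose conjugates other than itself all have absolute value less than $1$ (in particular every integer greater than $1$ is a Pisot number). A Salem number is an algebraic integer greater than $1$ whose conjugates other than itself all have absolute value at most $1$, with at least one conjugate of absolute value $1$. Algebraic independence is over $\mathbb{Q}$: complex numbers $\xi_1,\xi_2,\xi_3$ are algebraically independent if $P(\xi_1,\xi_2,\xi_3)\neq0$ for every nonzero $P\in\mathbb{Z}[X_1,X_2,X_3]$. -}

module Defs where

open import Algebra.Bundles using (CommutativeRing; RawRing; Semiring)
open import Algebra.Structures using (IsCommutativeRing)
import Algebra.Construct.NaturalChoice.Max as Max
import Algebra.Definitions.RawSemiring as RawSemiringDefinitions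
open import Axiom.ExcludedMiddle using (ExcludedMiddle)
open import Data.Fin.Base using (Fin; toℕ)
open import Data.Integer.Base as ℤ using (ℤ; +_; -[1+_])
open import Data.Nat.Base as ℕ using (ℕ; suc; _!)
open import Data.Product.Base using (∃; ∃₂; _×_; _,_)
open import Data.Rational.Base using (ℚ; ↥_; ↧_)
open import Data.Vec.Functional using (Vector)
open import Level using (0ℓ)
open import Relation.Binary.Bundles using (TotalOrder)
import Relation.Binary.Construct.NonStrictToStrict as Strict
open import Relation.Binary.PropositionalEquality.Core using (_≢_)
open import Relation.Binary.Structures using (IsTotalOrder)
open import Relation.Nullary using (¬_; yes; no)

-- The usual axioms for ℝ, which determine it up to unique isomorphism.
-- _⁻¹ is total for convenience; its value at 0 is unconstrained.
record CompleteOrderedField : Set₁ where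
  infix  4 _≈_ _≤_
  infixl 6 _+_
  infixl 7 _*_
  infix  8 -_
  infix  9 _⁻¹
  field
    Carrier : Set
    _≈_ _≤_ : Carrier → Carrier → Set
    _+_ _*_ : Carrier → Carrier → Carrier
    -_ _⁻¹  : Carrier → Carrier
    0# 1#   : Carrier

    isCommutativeRing : IsCommutativeRing _≈_ _+_ _*_ -_ 0# 1#
    0≉1               : ¬ 0# ≈ 1#
    *-inverseʳ        : ∀ x → ¬ x ≈ 0# → x * x ⁻¹ ≈ 1#

    isTotalOrder : IsTotalOrder _≈_ _≤_
    +-monoˡ-≤    : ∀ z {x y} → x ≤ y → x + z ≤ y + z
    *-nonNeg     : ∀ {x y} → 0# ≤ x → 0# ≤ y → 0# ≤ x * y

  UpperBound : (Carrier → Set) → Carrier → Set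
  UpperBound P b = ∀ {x} → P x → x ≤ b

  field
    supremum : (P : Carrier → Set) → ∃ P → ∃ (UpperBound P) →
               ∃ λ s → UpperBound P s × (∀ {b} → UpperBound P b → s ≤ b)

  commutativeRing : CommutativeRing 0ℓ 0ℓ
  commutativeRing = record { isCommutativeRing = isCommutativeRing }

  totalOrder : TotalOrder 0ℓ 0ℓ 0ℓ
  totalOrder = record { isTotalOrder = isTotalOrder }

-- Excluded middle makes the total functions below (floor, logarithm, sum of
-- a series, …) definable by description.
module Analysis (lem : ExcludedMiddle 0ℓ) (R : CompleteOrderedField) where

  open CompleteOrderedField R public renaming (Carrier to ℝ)
  open Strict _≈_ _≤_ public using (_<_)
  open Max totalOrder public using (_⊔_)
  open RawSemiringDefinitions (Semiring.rawSemiring (CommutativeRing.semiring commutativeRing)) public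
    using (_^_; sum) renaming (_×_ to _·_)

  -- Some element satisfying P if there is one, and the default d otherwise.
  choose : {A : Set} → A → (A → Set) → A
  choose d P with lem {∃ P}
  ... | yes (x , _) = x
  ... | no  _       = d

  infixl 6 _-_
  infixl 7 _/_
  _-_ _/_ : ℝ → ℝ → ℝ
  x - y = x + - y
  x / y = x * y ⁻¹

  ∣_∣ : ℝ → ℝ
  ∣ x ∣ = x ⊔ - x

  fromℕ : ℕ → ℝ
  fromℕ n = n · 1#

  fromℤ : ℤ → ℝ
  fromℤ (+ n)    = fromℕ n
  fromℤ -[1+ n ] = - fromℕ (suc n)

  fromℚ : ℚ → ℝ
  fromℚ q = fromℤ (↥ q) / fromℤ (↧ q)

  infixr 8 _^ᶻ_
  _^ᶻ_ : ℝ → ℤ → ℝ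
  x ^ᶻ (+ n)    = x ^ n
  x ^ᶻ -[1+ n ] = (x ⁻¹) ^ suc n

  ⌊_⌋ : ℝ → ℤ
  ⌊ x ⌋ = choose (+ 0) λ k → fromℤ k ≤ x × x < fromℤ k + 1#

  -- The nonnegative square root; 0 for negative arguments.
  √_ : ℝ → ℝ
  √ x = choose 0# λ y → 0# ≤ y × y * y ≈ x

  ConvergesTo : (ℕ → ℝ) → ℝ → Set
  ConvergesTo a l =
    ∀ ε → 0# < ε → ∃ λ N → ∀ n → N ℕ.≤ n → ∣ a n - l ∣ < ε

  TendsToInfinity : (ℕ → ℝ) → Set
  TendsToInfinity a = ∀ M → ∃ λ N → ∀ n → N ℕ.≤ n → M < a n

  -- f(n) = o(g(n)) as n → ∞
  infix 4 _=o_
  _=o_ : (ℕ → ℝ) → (ℕ → ℝ) → Set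
  f =o g = ∀ ε → 0# < ε → ∃ λ N → ∀ n → N ℕ.≤ n → ∣ f n ∣ ≤ ε * ∣ g n ∣

  -- The sum of a(n) over n ≥ m; 0 for a divergent series.
  ∑∞ : ℕ → (ℕ → ℝ) → ℝ
  ∑∞ m a = choose 0# (ConvergesTo λ N → sum {N} λ k → a (m ℕ.+ toℕ k))

  exp : ℝ → ℝ
  exp x = ∑∞ 0 λ k → x ^ k / fromℕ (k !)

  -- The natural logarithm; 0 for arguments ≤ 0.
  log : ℝ → ℝ
  log x = choose 0# λ y → exp y ≈ x

  log⁺ : ℝ → ℝ
  log⁺ x = log (1# ⊔ x)

  -- Real exponents, for bases x ≥ 0. The base 0 gives 0, as it should for
  -- positive exponents: (log 1) ^ʳ (1# + x) is needed below.
  infixr 8 _^ʳ_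
  _^ʳ_ : ℝ → ℝ → ℝ
  x ^ʳ y with lem {x ≈ 0#}
  ... | yes _ = 0#
  ... | no  _ = exp (y * log x)

  record ℂ : Set where
    constructor _+i_
    field
      re im : ℝ
  open ℂ public

  ℂ-rawRing : RawRing 0ℓ 0ℓ
  ℂ-rawRing = record
    { Carrier = ℂ
    ; _≈_     = λ z w → re z ≈ re w × im z ≈ im w
    ; _+_     = λ z w → (re z + re w) +i (im z + im w)
    ; _*_     = λ z w → (re z * re w - im z * im w) +i (re z * im w + im z * re w)
    ; -_      = λ z → (- re z) +i (- im z)
    ; 0#      = 0# +i 0#
    ; 1#      = 1# +i 0#
    }

  open RawRing ℂ-rawRing public using ()
    renaming (_≈_ to _≈ᶜ_; _+_ to _+ᶜ_; _*_ to _*ᶜ_; 0# to 0ᶜ)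
  open RawSemiringDefinitions (RawRing.rawSemiring ℂ-rawRing) public using ()
    renaming (_^_ to _^ᶜ_; sum to sumᶜ)

  fromℝ : ℝ → ℂ
  fromℝ x = x +i 0#

  ∣_∣ᶜ : ℂ → ℝ
  ∣ z ∣ᶜ = √ (re z * re z + im z * im z)

  -- A vector a of length d stands for the monic polynomial
  -- X^d + a_{d-1} X^{d-1} + … + a_0; the function passed first embeds the
  -- coefficients in ℝ.
  evalMonic : ∀ {A : Set} {d} → (A → ℝ) → Vector A d → ℂ → ℂ
  evalMonic {d = d} ι a z =
    (z ^ᶜ d) +ᶜ sumᶜ λ i → fromℝ (ι (a i)) *ᶜ (z ^ᶜ toℕ i)

  AlgebraicInteger : ℂ → Set
  AlgebraicInteger α = ∃₂ λ d (a : Vector ℤ d) → evalMonic fromℤ a α ≈ᶜ 0ᶜ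

  IsMinimalPolynomial : ∀ {d} → Vector ℚ d → ℂ → Set
  IsMinimalPolynomial {d} a α =
    evalMonic fromℚ a α ≈ᶜ 0ᶜ ×
    (∀ {e} (b : Vector ℚ e) → evalMonic fromℚ b α ≈ᶜ 0ᶜ → d ℕ.≤ e)

  -- γ is a conjugate of α (possibly α itself).
  _ConjugateOf_ : ℂ → ℂ → Set
  γ ConjugateOf α =
    ∃₂ λ d (a : Vector ℚ d) → IsMinimalPolynomial a α × evalMonic fromℚ a γ ≈ᶜ 0ᶜ

  _ProperConjugateOf_ : ℂ → ℂ → Set
  γ ProperConjugateOf α = γ ConjugateOf α × ¬ γ ≈ᶜ α

  Pisot : ℝ → Set
  Pisot β =
    AlgebraicInteger (fromℝ β) ×
    1# < β ×
    (∀ γ → γ ProperConjugateOf fromℝ β → ∣ γ ∣ᶜ < 1#)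

  Salem : ℝ → Set
  Salem β =
    AlgebraicInteger (fromℝ β) ×
    1# < β ×
    (∀ γ → γ ProperConjugateOf fromℝ β → ∣ γ ∣ᶜ ≤ 1#) ×
    (∃ λ γ → γ ConjugateOf fromℝ β × ∣ γ ∣ᶜ ≈ 1#)

  -- P i j k is the coefficient of X₁^i X₂^j X₃^k. Every element of
  -- ℤ[X₁,X₂,X₃] has this form for every large enough d.
  Polynomial₃ : ℕ → Set
  Polynomial₃ d = Fin d → Fin d → Fin d → ℤ

  NonzeroPolynomial₃ : ∀ {d} → Polynomial₃ d → Set
  NonzeroPolynomial₃ P = ∃ λ i → ∃ λ j → ∃ λ k → P i j k ≢ + 0

  evalPolynomial₃ : ∀ {d} → Polynomial₃ d → ℂ → ℂ → ℂ → ℂ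
  evalPolynomial₃ P ξ₁ ξ₂ ξ₃ =
    sumᶜ λ i → sumᶜ λ j → sumᶜ λ k →
      fromℝ (fromℤ (P i j k)) *ᶜ ((ξ₁ ^ᶜ toℕ i) *ᶜ ((ξ₂ ^ᶜ toℕ j) *ᶜ (ξ₃ ^ᶜ toℕ k)))

  AlgebraicallyIndependent : ℂ → ℂ → ℂ → Set
  AlgebraicallyIndependent ξ₁ ξ₂ ξ₃ =
    ∀ {d} (P : Polynomial₃ d) → NonzeroPolynomial₃ P →
    ¬ evalPolynomial₃ P ξ₁ ξ₂ ξ₃ ≈ᶜ 0ᶜ

  -- The sum over n ≥ m of u(n) β^{-⌊w(n)⌋}.
  lacunary : ℝ → ℕ → (ℕ → ℕ) → (ℕ → ℝ) → ℂ
  lacunary β m u w = fromℝ (∑∞ m λ n → fromℕ (u n) * β ^ᶻ (ℤ.- ⌊ w n ⌋))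

{-# OPTIONS --safe #-}

-- Suppose that P(ξ₁,ξ₂,ξ₃) = 0 with P ≠ 0, and multiply P by X₁X₃. Let D be the
-- largest degree of P in X₁ and X₂ together, K the largest degree in X₃ of the
-- terms of that degree, and i the largest degree in X₁ among the latter.
-- Truncating the series and expanding P gives a sum of terms c β^(-e), where
-- e = W(n₁) + … + W(n_d) + V(m₁) + … + V(m_k) with d ≤ D. Since u₁/u₂ → ∞, the
-- coefficients with d = D, k ≥ K and all n_j large have the sign of the
-- coefficient of degrees i, D − i and K. As W and V are sparse and V outgrows W,
-- the pigeonhole principle yields sums e of D values of W and K values of V that
-- lie in an interval which contains no exponents of other kinds and is bordered
-- on both sides by long gaps.
--
-- Because β is Pisot or Salem, the coordinates of β^n in the basis 1, β, β², … of
-- ℚ(β) are constant multiples of β^n up to an error of polynomial size: they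
-- satisfy a linear recurrence with one simple dominant root. If a value x of an
-- integer polynomial with small coefficients at β were small but not 0, then the
-- numbers x Σ ε_j β^(kj) with ε_j ∈ {0, 1} would have coordinates in too small a
-- box to be distinct. Hence the part of the sum before either gap vanishes, and
-- so does the part in the interval, whose terms all have the same sign.

module Submission where

open import Algebra.Bundles using (CommutativeRing; Semiring)
open import Axiom.ExcludedMiddle using (ExcludedMiddle)
open import Data.Empty using (⊥; ⊥-elim)
open import Data.Fin.Base as Fin using (Fin; toℕ; fromℕ<; finToFun; funToFin)
open import Data.Fin.Patterns using (0F; 1F; 2F)
import Data.Fin.Properties as FinP
open import Data.Integer.Base as ℤ using (ℤ; +_; -[1+_]; _⊖_)
import Data.Integer.GCD as ℤ
import Data.Integer.Properties as ℤP
open import Data.List.Base using (List; []; _∷_; _++_; map; length; cartesianProduct; lookup; tabulate; applyUpTo)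
open import Data.List.Membership.Propositional using (_∈_)
open import Data.List.Membership.Propositional.Properties using (∈-++⁺ˡ; ∈-++⁺ʳ; ∈-map⁺; ∈-++⁻; ∈-map⁻; ∈-cartesianProduct⁺; ∈-cartesianProduct⁻)
open import Data.List.Properties using (length-map; length-++; length-tabulate; length-applyUpTo)
open import Data.List.Relation.Unary.All as All using (All; []; _∷_)
open import Data.List.Relation.Unary.All.Properties using (¬Any⇒All¬)
open import Data.List.Relation.Unary.Any as Any using (Any; here; there; index)
open import Data.List.Relation.Unary.Any.Properties using (lookup-index)
open import Data.Maybe.Base using (Maybe; just; nothing)
open import Data.Nat.Base as ℕ using (ℕ; zero; suc; _!)
open import Data.Nat.Induction using (<-rec)
import Data.Nat.Properties as ℕP
open import Data.Nat.Tactic.RingSolver using (solve-∀)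
open import Data.Product.Base using (∃; ∃₂; _×_; _,_; proj₁; proj₂)
open import Data.Rational.Base as ℚ using (ℚ; ↥_; ↧_)
import Data.Rational.Properties as ℚP
open import Data.Sum.Base using (_⊎_; inj₁; inj₂; [_,_]′)
open import Data.Unit.Base using (⊤)
open import Data.Vec.Functional using (Vector)
open import Defs
open import Function.Base using (_∘_)
open import Level using (0ℓ)
open import Relation.Binary.Bundles using (TotalOrder)
open import Relation.Binary.Definitions using (tri<; tri≈; tri>; Tri)
open import Relation.Binary.PropositionalEquality as ≡ using (_≡_; _≢_)
open import Relation.Nullary using (yes; no; ¬_; Dec)

-- The shape of the proof is set by a tension between the truncations, H for the W-series and h for
-- the V-series. As u(n) is at most a constant times β^n, the coefficients have size 2^(O(H)), and
-- the relevant exponents stay below 2^H; so the box argument decides vanishing once a gap is longer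
-- than a constant times H, and the errors of size n^k cost no more than that. But the tails must be
-- smaller still: W(H) and V(h) have to exceed 8N, where N bounds the exponents of the interval. As
-- V outgrows W, this makes H at least a large power of h. Then the V-indices hardly count, and the
-- pigeonhole principle has to beat about H^(D - 1) tuples of W-indices, with one index missing or
-- prescribed. The W-indices come from D blocks between powers of t with exponents from q to q + 2D,
-- which gives t^(qD) sums, while H is t^(q + 2D + 4); so a q of order D^2 suffices. That W(H)
-- reaches V(h) for so small an H rests on `flat` and `W-convex`: up to constants, log V grows by a
-- factor of at most 1 + 1/e from the lowest V-block to h, and log W grows by at least that much
-- from t^e to t^(e + 1).

-- The laws as functions: the fields of nested records which they stand for
-- are long chains of projections.
module RingLaws (CR : CommutativeRing 0ℓ 0ℓ) where
  private module CR′ = CommutativeRing CR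
  open CR′ using (Carrier; _≈_; _+_; _*_; -_; 0#; 1#)
  open import Algebra.Definitions.RawSemiring (Semiring.rawSemiring CR′.semiring) using (_^_) renaming (_×_ to _·_)
  import Algebra.Properties.Semiring.Exp CR′.semiring as Exp
  import Algebra.Properties.CommutativeSemiring.Exp CR′.commutativeSemiring as CommutativeExp
  import Algebra.Properties.Semiring.Mult CR′.semiring as Mult

  refl : ∀ {x} → x ≈ x
  refl = CR′.refl

  sym : ∀ {x y} → x ≈ y → y ≈ x
  sym = CR′.sym

  trans : ∀ {x y z} → x ≈ y → y ≈ z → x ≈ z
  trans = CR′.trans

  reflexive : ∀ {x y} → x ≡ y → x ≈ y
  reflexive = CR′.reflexive

  +-cong : ∀ {x y u v} → x ≈ y → u ≈ v → x + u ≈ y + v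
  +-cong = CR′.+-cong

  +-congˡ : ∀ {x y z} → y ≈ z → x + y ≈ x + z
  +-congˡ = CR′.+-congˡ

  +-congʳ : ∀ {x y z} → y ≈ z → y + x ≈ z + x
  +-congʳ = CR′.+-congʳ

  *-cong : ∀ {x y u v} → x ≈ y → u ≈ v → x * u ≈ y * v
  *-cong = CR′.*-cong

  *-congˡ : ∀ {x y z} → y ≈ z → x * y ≈ x * z
  *-congˡ = CR′.*-congˡ

  *-congʳ : ∀ {x y z} → y ≈ z → y * x ≈ z * x
  *-congʳ = CR′.*-congʳ

  -‿cong : ∀ {x y} → x ≈ y → - x ≈ - y
  -‿cong = CR′.-‿cong

  +-comm : ∀ x y → x + y ≈ y + x
  +-comm = CR′.+-comm

  *-comm : ∀ x y → x * y ≈ y * x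
  *-comm = CR′.*-comm

  +-assoc : ∀ x y z → x + y + z ≈ x + (y + z)
  +-assoc = CR′.+-assoc

  *-assoc : ∀ x y z → x * y * z ≈ x * (y * z)
  *-assoc = CR′.*-assoc

  +-identityˡ : ∀ x → 0# + x ≈ x
  +-identityˡ = CR′.+-identityˡ

  +-identityʳ : ∀ x → x + 0# ≈ x
  +-identityʳ = CR′.+-identityʳ

  *-identityˡ : ∀ x → 1# * x ≈ x
  *-identityˡ = CR′.*-identityˡ

  *-identityʳ : ∀ x → x * 1# ≈ x
  *-identityʳ = CR′.*-identityʳ

  zeroˡ : ∀ x → 0# * x ≈ 0#
  zeroˡ = CR′.zeroˡ

  zeroʳ : ∀ x → x * 0# ≈ 0#
  zeroʳ = CR′.zeroʳ

  distribˡ : ∀ x y z → x * (y + z) ≈ x * y + x * z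
  distribˡ = CR′.distribˡ

  distribʳ : ∀ x y z → (y + z) * x ≈ y * x + z * x
  distribʳ = CR′.distribʳ

  -‿inverseˡ : ∀ x → - x + x ≈ 0#
  -‿inverseˡ = CR′.-‿inverseˡ

  -‿inverseʳ : ∀ x → x + - x ≈ 0#
  -‿inverseʳ = CR′.-‿inverseʳ

  ^-congˡ : ∀ n {x y} → x ≈ y → x ^ n ≈ y ^ n
  ^-congˡ = Exp.^-congˡ

  ^-homo-* : ∀ x m n → x ^ (m ℕ.+ n) ≈ x ^ m * x ^ n
  ^-homo-* = Exp.^-homo-*

  ^-assocʳ : ∀ x m n → (x ^ m) ^ n ≈ x ^ (m ℕ.* n)
  ^-assocʳ = Exp.^-assocʳ

  ^-distrib-* : ∀ x y n → (x * y) ^ n ≈ x ^ n * y ^ n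
  ^-distrib-* = CommutativeExp.^-distrib-*

  ×-homo-+ : ∀ x m n → (m ℕ.+ n) · x ≈ m · x + n · x
  ×-homo-+ = Mult.×-homo-+

  ×1-homo-* : ∀ m n → (m ℕ.* n) · 1# ≈ (m · 1#) * (n · 1#)
  ×1-homo-* = Mult.×1-homo-*

-- Ring solver and finite sums over a commutative ring

-- ℤ acts on any commutative ring; taking ℤ as the ring of coefficients makes
-- the ring solver recognise numerals and cancel them.
module RingKit (CR : CommutativeRing 0ℓ 0ℓ) where
  open CommutativeRing CR
  open import Algebra.Properties.Semiring.Mult semiring
    using (×-homo-+; ×1-homo-*) renaming (_×_ to _·_)
  open import Algebra.Properties.Monoid.Mult.TCOptimised +-monoid
    using (×ᵤ≈×) renaming (_×_ to _·′_)
  open import Algebra.Properties.Ring ring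
    using (-‿distribˡ-*; -0#≈0#; -‿involutive; -‿anti-homo-+)
  open import Algebra.Solver.Ring.AlmostCommutativeRing
    using (AlmostCommutativeRing; fromCommutativeRing; _-Raw-AlmostCommutative⟶_)
  import Algebra.Solver.Ring as Solver
  open import Relation.Binary.Reasoning.Setoid setoid

  ι : ℤ → Carrier
  ι (+ n) = n · 1#
  ι -[1+ n ] = - (suc n · 1#)

  private
    -- With the optimised multiplication the numeral 1 evaluates to `1#` itself and not to
    -- `1# + 0#`, so `:1` can stand for `1#` in the identities given to the solver.
    ι′ : ℤ → Carrier
    ι′ (+ n) = n ·′ 1#
    ι′ -[1+ n ] = - (suc n ·′ 1#)

    ι≈ι′ : ∀ k → ι k ≈ ι′ k
    ι≈ι′ (+ n) = ×ᵤ≈× n 1#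
    ι≈ι′ -[1+ n ] = -‿cong (×ᵤ≈× (suc n) 1#)

  ι-⊖ : ∀ m n → ι (m ⊖ n) ≈ m · 1# - n · 1#
  ι-⊖ zero zero = sym (-‿inverseʳ _)
  ι-⊖ zero (suc n) = sym (+-identityˡ _)
  ι-⊖ (suc m) zero = sym (trans (+-congˡ -0#≈0#) (+-identityʳ _))
  ι-⊖ (suc m) (suc n) = begin
    ι (suc m ⊖ suc n) ≡⟨ ≡.cong ι (ℤP.[1+m]⊖[1+n]≡m⊖n m n) ⟩
    ι (m ⊖ n) ≈⟨ ι-⊖ m n ⟩
    m · 1# - n · 1# ≈⟨ +-congʳ (sym (+-identityˡ _)) ⟩
    (0# + m · 1#) - n · 1# ≈⟨ +-congʳ (+-congʳ (sym (-‿inverseʳ 1#))) ⟩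
    ((1# - 1#) + m · 1#) - n · 1# ≈⟨ +-congʳ (+-assoc _ _ _) ⟩
    (1# + (- 1# + m · 1#)) - n · 1# ≈⟨ +-congʳ (+-congˡ (+-comm _ _)) ⟩
    (1# + (m · 1# - 1#)) - n · 1# ≈⟨ +-congʳ (sym (+-assoc _ _ _)) ⟩
    ((1# + m · 1#) - 1#) - n · 1# ≈⟨ +-assoc _ _ _ ⟩
    (1# + m · 1#) + (- 1# - n · 1#) ≈⟨ +-congˡ (+-comm _ _) ⟩
    (1# + m · 1#) + (- (n · 1#) - 1#) ≈⟨ +-congˡ (sym (-‿anti-homo-+ 1# _)) ⟩
    (1# + m · 1#) - (1# + n · 1#) ∎

  ι-+ : ∀ a b → ι (a ℤ.+ b) ≈ ι a + ι b
  ι-+ (+ m) (+ n) = ×-homo-+ 1# m n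
  ι-+ (+ m) -[1+ n ] = ι-⊖ m (suc n)
  ι-+ -[1+ m ] (+ n) = trans (ι-⊖ n (suc m)) (+-comm _ _)
  ι-+ -[1+ m ] -[1+ n ] = begin
    - (suc (suc (m ℕ.+ n)) · 1#) ≡⟨ ≡.cong (λ k → - (k · 1#)) (≡.sym (ℕP.+-suc (suc m) n)) ⟩
    - ((suc m ℕ.+ suc n) · 1#) ≈⟨ -‿cong (×-homo-+ 1# (suc m) (suc n)) ⟩
    - (suc m · 1# + suc n · 1#) ≈⟨ -‿anti-homo-+ _ _ ⟩
    - (suc n · 1#) - suc m · 1# ≈⟨ +-comm _ _ ⟩
    - (suc m · 1#) - suc n · 1# ∎

  ι-neg : ∀ a → ι (ℤ.- a) ≈ - ι a
  ι-neg (+ zero) = sym -0#≈0#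
  ι-neg (+ suc n) = refl
  ι-neg -[1+ n ] = sym (-‿involutive _)

  ι-*⁺ : ∀ m b → ι (+ m ℤ.* b) ≈ ι (+ m) * ι b
  ι-*⁺ zero b = trans (reflexive (≡.cong ι (ℤP.*-zeroˡ b))) (sym (zeroˡ _))
  ι-*⁺ (suc m) b = begin
    ι (+ suc m ℤ.* b) ≡⟨ ≡.cong ι (ℤP.suc-* (+ m) b) ⟩
    ι (b ℤ.+ + m ℤ.* b) ≈⟨ ι-+ b _ ⟩
    ι b + ι (+ m ℤ.* b) ≈⟨ +-cong (sym (*-identityˡ _)) (ι-*⁺ m b) ⟩
    1# * ι b + ι (+ m) * ι b ≈⟨ sym (distribʳ _ _ _) ⟩
    ι (+ suc m) * ι b ∎

  ι-* : ∀ a b → ι (a ℤ.* b) ≈ ι a * ι b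
  ι-* (+ m) b = ι-*⁺ m b
  ι-* -[1+ m ] b = begin
    ι (-[1+ m ] ℤ.* b) ≡⟨ ≡.cong ι (≡.sym (ℤP.neg-distribˡ-* (+ suc m) b)) ⟩
    ι (ℤ.- (+ suc m ℤ.* b)) ≈⟨ ι-neg (+ suc m ℤ.* b) ⟩
    - ι (+ suc m ℤ.* b) ≈⟨ -‿cong (ι-*⁺ (suc m) b) ⟩
    - (ι (+ suc m) * ι b) ≈⟨ -‿distribˡ-* _ _ ⟩
    ι -[1+ m ] * ι b ∎

  private
    target : AlmostCommutativeRing 0ℓ 0ℓ
    target = fromCommutativeRing CR

    morphism : ℤ.+-*-rawRing -Raw-AlmostCommutative⟶ target
    morphism = record
      { ⟦_⟧ = ι′
      ; +-homo = λ a b → trans (sym (ι≈ι′ (a ℤ.+ b))) (trans (ι-+ a b) (+-cong (ι≈ι′ a) (ι≈ι′ b)))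
      ; *-homo = λ a b → trans (sym (ι≈ι′ (a ℤ.* b))) (trans (ι-* a b) (*-cong (ι≈ι′ a) (ι≈ι′ b)))
      ; -‿homo = λ a → trans (sym (ι≈ι′ (ℤ.- a))) (trans (ι-neg a) (-‿cong (ι≈ι′ a)))
      ; 0-homo = refl
      ; 1-homo = refl
      }

    coefficient≟ : ∀ a b → Maybe (ι′ a ≈ ι′ b)
    coefficient≟ a b with a ℤP.≟ b
    ... | yes a≡b = just (reflexive (≡.cong ι′ a≡b))
    ... | no _ = nothing

  open Solver ℤ.+-*-rawRing target morphism coefficient≟ public
    using (solve; _:=_; _:+_; _:*_; _:-_; :-_; con; Polynomial)

  :0 :1 :2 : ∀ {n} → Polynomial n
  :0 = con (+ 0)
  :1 = con (+ 1)
  :2 = con (+ 2)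

  ∑ : ℕ → (ℕ → Carrier) → Carrier
  ∑ zero f = 0#
  ∑ (suc n) f = ∑ n f + f n

  ∑-cong : ∀ n {f g} → (∀ i → i ℕ.< n → f i ≈ g i) → ∑ n f ≈ ∑ n g
  ∑-cong zero e = refl
  ∑-cong (suc n) e = +-cong (∑-cong n (λ i i<n → e i (ℕP.m<n⇒m<1+n i<n))) (e n ℕP.≤-refl)

  ∑-+ : ∀ n f g → ∑ n (λ i → f i + g i) ≈ ∑ n f + ∑ n g
  ∑-+ zero f g = sym (+-identityˡ _)
  ∑-+ (suc n) f g = trans (+-congʳ (∑-+ n f g))
    (solve 4 (λ a b c d → (a :+ b) :+ (c :+ d) := (a :+ c) :+ (b :+ d)) refl _ _ _ _)

  ∑-*ˡ : ∀ n c f → ∑ n (λ i → c * f i) ≈ c * ∑ n f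
  ∑-*ˡ zero c f = sym (zeroʳ c)
  ∑-*ˡ (suc n) c f = trans (+-congʳ (∑-*ˡ n c f)) (sym (distribˡ _ _ _))

  ∑-zero : ∀ n {f} → (∀ i → i ℕ.< n → f i ≈ 0#) → ∑ n f ≈ 0#
  ∑-zero zero e = refl
  ∑-zero (suc n) e = trans (+-cong (∑-zero n (λ i i<n → e i (ℕP.m<n⇒m<1+n i<n))) (e n ℕP.≤-refl)) (+-identityˡ _)

  ∑-split : ∀ m n f → ∑ (m ℕ.+ n) f ≈ ∑ m f + ∑ n (f ∘ (m ℕ.+_))
  ∑-split m zero f = trans (reflexive (≡.cong (λ k → ∑ k f) (ℕP.+-identityʳ m))) (sym (+-identityʳ _))
  ∑-split m (suc n) f = begin
    ∑ (m ℕ.+ suc n) f ≡⟨ ≡.cong (λ k → ∑ k f) (ℕP.+-suc m n) ⟩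
    ∑ (m ℕ.+ n) f + f (m ℕ.+ n) ≈⟨ +-congʳ (∑-split m n f) ⟩
    (∑ m f + ∑ n (f ∘ (m ℕ.+_))) + f (m ℕ.+ n) ≈⟨ +-assoc _ _ _ ⟩
    ∑ m f + ∑ (suc n) (f ∘ (m ℕ.+_)) ∎

  ∑-head : ∀ n f → ∑ (suc n) f ≈ f 0 + ∑ n (f ∘ suc)
  ∑-head n f = trans (∑-split 1 n f) (+-congʳ (+-identityˡ _))

  ∑-swap : ∀ m n (f : ℕ → ℕ → Carrier) → ∑ m (λ i → ∑ n (f i)) ≈ ∑ n (λ j → ∑ m (λ i → f i j))
  ∑-swap zero n f = sym (∑-zero n (λ _ _ → refl))
  ∑-swap (suc m) n f = trans (+-congʳ (∑-swap m n f)) (sym (∑-+ n _ _))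

  -- Both sides sum over the triangle i + j < n, by rows and by antidiagonals. Passing from n to n +
  -- 1 lengthens each row by one term, and these terms form the antidiagonal i + j = n.
  ∑-triangle : ∀ n (f : ℕ → ℕ → Carrier) →
    ∑ n (λ i → ∑ (n ℕ.∸ i) (f i)) ≈ ∑ n (λ k → ∑ (suc k) (λ i → f i (k ℕ.∸ i)))
  ∑-triangle zero f = refl
  ∑-triangle (suc n) f = begin
    ∑ (suc n) (λ i → ∑ (suc n ℕ.∸ i) (f i))
      ≈⟨ ∑-cong (suc n) (λ { i (ℕ.s≤s i≤n) → reflexive (≡.cong (λ k → ∑ k (f i)) (ℕP.+-∸-assoc 1 i≤n)) }) ⟩
    ∑ (suc n) (λ i → ∑ (n ℕ.∸ i) (f i) + f i (n ℕ.∸ i))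
      ≈⟨ ∑-+ (suc n) _ _ ⟩
    ∑ (suc n) (λ i → ∑ (n ℕ.∸ i) (f i)) + ∑ (suc n) (λ i → f i (n ℕ.∸ i))
      ≈⟨ +-congʳ (+-congˡ (reflexive (≡.cong (λ k → ∑ k (f n)) (ℕP.n∸n≡0 n)))) ⟩
    (∑ n (λ i → ∑ (n ℕ.∸ i) (f i)) + 0#) + ∑ (suc n) (λ i → f i (n ℕ.∸ i))
      ≈⟨ +-congʳ (trans (+-identityʳ _) (∑-triangle n f)) ⟩
    ∑ (suc n) (λ k → ∑ (suc k) (λ i → f i (k ℕ.∸ i))) ∎

  ∑ˡ : {A : Set} → List A → (A → Carrier) → Carrier
  ∑ˡ [] f = 0#
  ∑ˡ (x ∷ xs) f = f x + ∑ˡ xs f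

  ∑ˡ-cong : {A : Set} (xs : List A) {f g : A → Carrier} → (∀ x → f x ≈ g x) → ∑ˡ xs f ≈ ∑ˡ xs g
  ∑ˡ-cong [] e = refl
  ∑ˡ-cong (x ∷ xs) e = +-cong (e x) (∑ˡ-cong xs e)

  ∑ˡ-+ : {A : Set} (xs : List A) (f g : A → Carrier) → ∑ˡ xs (λ x → f x + g x) ≈ ∑ˡ xs f + ∑ˡ xs g
  ∑ˡ-+ [] f g = sym (+-identityˡ _)
  ∑ˡ-+ (x ∷ xs) f g = trans (+-congˡ (∑ˡ-+ xs f g))
    (solve 4 (λ a b c d → (a :+ b) :+ (c :+ d) := (a :+ c) :+ (b :+ d)) refl _ _ _ _)

  ∑ˡ-*ˡ : {A : Set} (xs : List A) (c : Carrier) (f : A → Carrier) → ∑ˡ xs (λ x → c * f x) ≈ c * ∑ˡ xs f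
  ∑ˡ-*ˡ [] c f = sym (zeroʳ c)
  ∑ˡ-*ˡ (x ∷ xs) c f = trans (+-congˡ (∑ˡ-*ˡ xs c f)) (sym (distribˡ _ _ _))

  ∑ˡ-++ : {A : Set} (xs ys : List A) (f : A → Carrier) → ∑ˡ (xs ++ ys) f ≈ ∑ˡ xs f + ∑ˡ ys f
  ∑ˡ-++ [] ys f = sym (+-identityˡ _)
  ∑ˡ-++ (x ∷ xs) ys f = trans (+-congˡ (∑ˡ-++ xs ys f)) (sym (+-assoc _ _ _))

  ∑ˡ-∑-swap : {A : Set} (xs : List A) (n : ℕ) (f : A → ℕ → Carrier) →
    ∑ˡ xs (λ x → ∑ n (f x)) ≈ ∑ n (λ i → ∑ˡ xs (λ x → f x i))
  ∑ˡ-∑-swap [] n f = sym (∑-zero n (λ _ _ → refl))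
  ∑ˡ-∑-swap (x ∷ xs) n f = trans (+-congˡ (∑ˡ-∑-swap xs n f)) (sym (∑-+ n _ _))

-- Monic polynomials: Taylor shift, division by X - γ, action on sequences

-- The list c₀ ∷ … ∷ c_{d-1} ∷ [] stands for the monic polynomial X^d + c_{d-1} X^{d-1} + … + c₀.
module MonicPolynomial (CR : CommutativeRing 0ℓ 0ℓ) where
  open CommutativeRing CR
  open RingKit CR
  open import Algebra.Definitions.RawSemiring (Semiring.rawSemiring semiring) using (_^_)

  eval : List Carrier → Carrier → Carrier
  eval [] z = 1#
  eval (c ∷ cs) z = c + z * eval cs z

  eval-cong : ∀ cs {z w} → z ≈ w → eval cs z ≈ eval cs w
  eval-cong [] e = refl
  eval-cong (c ∷ cs) e = +-congˡ (*-cong e (eval-cong cs e))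

  -- The coefficients of c + (a + X) q.
  _+[_+X]*_ : Carrier → Carrier → List Carrier → List Carrier
  c +[ a +X]* [] = (c + a) ∷ []
  c +[ a +X]* (q ∷ qs) = (c + a * q) ∷ (q +[ a +X]* qs)

  eval-+X* : ∀ c a q h → eval (c +[ a +X]* q) h ≈ c + (a + h) * eval q h
  eval-+X* c a [] h = solve 3 (λ c a h → (c :+ a) :+ h :* :1 := c :+ (a :+ h) :* :1) refl c a h
  eval-+X* c a (q ∷ qs) h = trans (+-congˡ (*-congˡ (eval-+X* q a qs h)))
    (solve 5 (λ c a q h e → (c :+ a :* q) :+ h :* (q :+ (a :+ h) :* e) := c :+ (a :+ h) :* (q :+ h :* e)) refl c a q h (eval qs h))

  taylor : Carrier → List Carrier → List Carrier
  taylor a [] = []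
  taylor a (c ∷ cs) = c +[ a +X]* taylor a cs

  eval-taylor : ∀ a cs h → eval (taylor a cs) h ≈ eval cs (a + h)
  eval-taylor a [] h = refl
  eval-taylor a (c ∷ cs) h = trans (eval-+X* c a (taylor a cs) h) (+-congˡ (*-congˡ (eval-taylor a cs h)))

  -- The polynomial acts on sequences, X being the shift.
  op : List Carrier → (ℕ → Carrier) → ℕ → Carrier
  op [] ρ n = ρ n
  op (c ∷ cs) ρ n = c * ρ n + op cs ρ (suc n)

  op-cong : ∀ cs {ρ σ} → (∀ n → ρ n ≈ σ n) → ∀ n → op cs ρ n ≈ op cs σ n
  op-cong [] e n = e n
  op-cong (c ∷ cs) e n = +-cong (*-congˡ (e n)) (op-cong cs e (suc n))

  op-power : ∀ cs z n → op cs (z ^_) n ≈ z ^ n * eval cs z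
  op-power [] z n = sym (*-identityʳ _)
  op-power (c ∷ cs) z n = trans (+-congˡ (op-power cs z (suc n)))
    (solve 4 (λ c p z e → c :* p :+ z :* p :* e := p :* (c :+ z :* e)) refl c (z ^ n) z (eval cs z))

  op-∑ : ∀ cs m (w : ℕ → Carrier) (ρ : ℕ → ℕ → Carrier) n →
    ∑ m (λ j → op cs (λ k → ρ k j) n * w j) ≈ op cs (λ k → ∑ m (λ j → ρ k j * w j)) n
  op-∑ [] m w ρ n = refl
  op-∑ (c ∷ cs) m w ρ n = trans (∑-cong m (λ j _ → trans (distribʳ _ _ _) (+-congʳ (*-assoc _ _ _))))
    (trans (∑-+ m _ _) (+-cong (∑-*ˡ m c _) (op-∑ cs m w ρ (suc n))))

  -- Synthetic division by X - γ: the coefficients of the quotient are the Horner values at γ of the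
  -- successive tails.
  quot : Carrier → List Carrier → List Carrier
  quot γ [] = []
  quot γ (c ∷ []) = []
  quot γ (c ∷ (d ∷ cs)) = eval (d ∷ cs) γ ∷ quot γ (d ∷ cs)

  infix 9 _⊖X_
  -- The action of X - γ on sequences.
  _⊖X_ : Carrier → (ℕ → Carrier) → ℕ → Carrier
  (γ ⊖X ρ) n = ρ (suc n) - γ * ρ n

  -- Division with remainder, p = (X - γ) quot + p(γ), carried over to the action on sequences.
  op-quot : ∀ γ c cs ρ n → op (c ∷ cs) ρ n ≈ op (quot γ (c ∷ cs)) (γ ⊖X ρ) n + eval (c ∷ cs) γ * ρ n
  op-quot γ c [] ρ n = solve 4 (λ γ c r s → c :* r :+ s := (s :- γ :* r) :+ (c :+ γ :* :1) :* r) refl γ c (ρ n) (ρ (suc n))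
  op-quot γ c (d ∷ cs) ρ n = trans (+-congˡ (op-quot γ d cs ρ (suc n)))
    (solve 6 (λ γ c r s q e → c :* r :+ (q :+ e :* s) := (e :* (s :- γ :* r) :+ q) :+ (c :+ γ :* e) :* r)
      refl γ c (ρ n) (ρ (suc n)) (op (quot γ (d ∷ cs)) (γ ⊖X ρ) (suc n)) (eval (d ∷ cs) γ))

  eval-quot : ∀ γ c cs z → eval (c ∷ cs) z ≈ (z - γ) * eval (quot γ (c ∷ cs)) z + eval (c ∷ cs) γ
  eval-quot γ c [] z = solve 3 (λ γ c z → c :+ z :* :1 := (z :- γ) :* :1 :+ (c :+ γ :* :1)) refl γ c z
  eval-quot γ c (d ∷ cs) z = trans (+-congˡ (*-congˡ (eval-quot γ d cs z)))
    (solve 5 (λ γ c z q e → c :+ z :* ((z :- γ) :* q :+ e) := (z :- γ) :* (e :+ z :* q) :+ (c :+ γ :* e))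
      refl γ c z (eval (quot γ (d ∷ cs)) z) (eval (d ∷ cs) γ))

  -- The derivative at z of X^k times the polynomial, divided by z^(k-1).
  weighted : ℕ → List Carrier → Carrier → Carrier
  weighted k [] z = ι (+ k)
  weighted k (c ∷ cs) z = ι (+ k) * c + z * weighted (suc k) cs z

  weighted-suc : ∀ k cs z → weighted (suc k) cs z ≈ weighted k cs z + eval cs z
  weighted-suc k [] z = +-comm _ _
  weighted-suc k (c ∷ cs) z = trans (+-congˡ (*-congˡ (weighted-suc (suc k) cs z)))
    (solve 5 (λ k c z w e → (:1 :+ k) :* c :+ z :* (w :+ e) := (k :* c :+ z :* w) :+ (c :+ z :* e))
      refl (ι (+ k)) c z (weighted (suc k) cs z) (eval cs z))

  -- (p - p(γ)) / (X - γ) takes the value p′(γ) at γ, and `weighted 1 cs` is the derivative of p = c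
  -- + X cs. At a root γ, a nonzero value therefore says that the root is simple.
  eval-quot-self : ∀ γ c cs → eval (quot γ (c ∷ cs)) γ ≈ weighted 1 cs γ
  eval-quot-self γ c [] = sym (+-identityʳ 1#)
  eval-quot-self γ c (d ∷ cs) = trans (+-congˡ (*-congˡ (eval-quot-self γ d cs)))
    (trans (solve 4 (λ γ d e w → (d :+ γ :* e) :+ γ :* w := (:1 :+ :0) :* d :+ γ :* (w :+ e)) refl γ d (eval cs γ) (weighted 1 cs γ))
    (+-congˡ (*-congˡ (sym (weighted-suc 1 cs γ)))))

-- Powers of 2 and the size of the coordinate box

module Naturals where
  open import Data.Nat.Base using (_+_; _*_; _^_; _≤_; _<_; z≤n; s≤s)
  open ℕP.≤-Reasoning

  1≤2^ : ∀ n → 1 ≤ 2 ^ n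
  1≤2^ n = ℕP.m^n>0 2 n

  n<2^n : ∀ n → n < 2 ^ n
  n<2^n zero = s≤s z≤n
  n<2^n (suc n) = ℕP.≤-trans (ℕP.+-mono-≤ (1≤2^ n) (n<2^n n)) (ℕP.≤-reflexive (≡.cong (_+_ (2 ^ n)) (≡.sym (ℕP.+-identityʳ _))))

  n≤2^n : ∀ n → n ≤ 2 ^ n
  n≤2^n n = ℕP.<⇒≤ (n<2^n n)

  *-^ : ∀ m n k → (m * n) ^ k ≡ m ^ k * n ^ k
  *-^ m n zero = ≡.refl
  *-^ m n (suc k) = ≡.trans (≡.cong (m * n *_) (*-^ m n k)) (lemma m n (m ^ k) (n ^ k))
    where
    lemma : ∀ m n p q → m * n * (p * q) ≡ m * p * (n * q)
    lemma = solve-∀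

  -- The left side counts the values of one coordinate in the box argument: A₁L summands, each
  -- combining, with coefficients of total size 2^L, errors of size B G^k, G = 2^L + AL + 1, and
  -- projections of size P. With T = 2^L every factor is at most a constant times a power of T,
  -- altogether T^(k + 2); the constant is at most L ≤ T and costs the last factor T.
  siegel-size : ∀ k A₁ A B P L → suc (2 * (A₁ * (B * (A + 2) ^ k + P))) ≤ L →
    suc (2 * ((A₁ * L) * (2 ^ L * (B * (2 ^ L + suc (A * L)) ^ k + P)))) ≤ 2 ^ ((k + 3) * L)
  siegel-size k A₁ A B P L L₀≤L = begin
    suc (2 * ((A₁ * L) * (T * (B * (T + suc (A * L)) ^ k + P))))
      ≤⟨ s≤s (ℕP.*-monoʳ-≤ 2 (ℕP.*-mono-≤ (ℕP.*-monoʳ-≤ A₁ (n≤2^n L)) (ℕP.*-monoʳ-≤ T (ℕP.+-mono-≤ (ℕP.*-monoʳ-≤ B Gᵏ≤) P≤)))) ⟩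
    suc (2 * ((A₁ * T) * (T * (B * (D * Q) + P * Q))))
      ≤⟨ ℕP.+-monoˡ-≤ _ (ℕP.*-mono-≤ (ℕP.*-mono-≤ 1≤T 1≤T) 1≤Q) ⟩
    T * T * Q + 2 * ((A₁ * T) * (T * (B * (D * Q) + P * Q)))
      ≡⟨ collect T A₁ B D P Q ⟩
    suc (2 * (A₁ * (B * D + P))) * (T * T * Q)
      ≤⟨ ℕP.*-monoˡ-≤ (T * T * Q) (ℕP.≤-trans L₀≤L (n≤2^n L)) ⟩
    T * (T * T * Q)
      ≡⟨ cube T Q ⟩
    Q * T ^ 3
      ≡⟨ ≡.sym (ℕP.^-distribˡ-+-* T k 3) ⟩
    T ^ (k + 3)
      ≡⟨ ≡.trans (ℕP.^-*-assoc 2 L (k + 3)) (≡.cong (2 ^_) (ℕP.*-comm L (k + 3))) ⟩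
    2 ^ ((k + 3) * L) ∎
    where
    T = 2 ^ L
    D = (A + 2) ^ k
    Q = T ^ k
    1≤T = 1≤2^ L
    1≤Q : 1 ≤ Q
    1≤Q = ℕP.≤-trans (ℕP.≤-reflexive (≡.sym (ℕP.^-zeroˡ k))) (ℕP.^-monoˡ-≤ k 1≤T)
    Gᵏ≤ : (T + suc (A * L)) ^ k ≤ D * Q
    Gᵏ≤ = ℕP.≤-trans (ℕP.^-monoˡ-≤ k (ℕP.≤-trans (ℕP.+-monoʳ-≤ T (ℕP.+-mono-≤ 1≤T (ℕP.*-monoʳ-≤ A (n≤2^n L)))) (ℕP.≤-reflexive (factor T A))))
      (ℕP.≤-reflexive (*-^ (A + 2) T k))
      where
      factor : ∀ T A → T + (T + A * T) ≡ (A + 2) * T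
      factor = solve-∀
    P≤ : P ≤ P * Q
    P≤ = ℕP.≤-trans (ℕP.≤-reflexive (≡.sym (ℕP.*-identityʳ P))) (ℕP.*-monoʳ-≤ P 1≤Q)
    collect : ∀ T A₁ B D P Q → T * T * Q + 2 * ((A₁ * T) * (T * (B * (D * Q) + P * Q))) ≡ suc (2 * (A₁ * (B * D + P))) * (T * T * Q)
    collect = solve-∀
    cube : ∀ T Q → T * (T * T * Q) ≡ Q * (T * (T * (T * 1)))
    cube = solve-∀

module Proof (lem : ExcludedMiddle 0ℓ) (ℝ-field : CompleteOrderedField) where

  -- Tuples of indices, the pigeonhole principle and sums of sparse sequences

  module Combinatorics where
    open import Data.Nat.Base using (_+_; _*_; _^_; _∸_; _≤_; _<_; z≤n; s≤s)
    open ℕP.≤-Reasoning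
    open Naturals

    -- Finite lists of indices

    prepend : ℕ → List (List ℕ) → List (List ℕ)
    prepend zero L = []
    prepend (suc n) L = prepend n L ++ map (n ∷_) L

    tuples : ℕ → ℕ → List (List ℕ)
    tuples h zero = [] ∷ []
    tuples h (suc k) = prepend h (tuples h k)

    tuplesUpTo : ℕ → ℕ → List (List ℕ)
    tuplesUpTo h zero = tuples h zero
    tuplesUpTo h (suc k) = tuplesUpTo h k ++ tuples h (suc k)

    length-prepend : ∀ n L → length (prepend n L) ≡ n * length L
    length-prepend zero L = ≡.refl
    length-prepend (suc n) L = ≡.trans (length-++ (prepend n L)) (≡.trans (≡.cong₂ _+_ (length-prepend n L) (length-map (n ∷_) L)) (ℕP.+-comm _ (length L)))

    length-tuples : ∀ h k → length (tuples h k) ≡ h ^ k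
    length-tuples h zero = ≡.refl
    length-tuples h (suc k) = ≡.trans (length-prepend h (tuples h k)) (≡.cong (h *_) (length-tuples h k))

    length-tuplesUpTo : ∀ h k → length (tuplesUpTo h k) ≤ suc h ^ k
    length-tuplesUpTo h zero = s≤s z≤n
    length-tuplesUpTo h (suc k) = begin
      length (tuplesUpTo h k ++ tuples h (suc k)) ≡⟨ length-++ (tuplesUpTo h k) ⟩
      length (tuplesUpTo h k) + length (tuples h (suc k)) ≤⟨ ℕP.+-mono-≤ (length-tuplesUpTo h k) (ℕP.≤-trans (ℕP.≤-reflexive (length-tuples h (suc k)))
                                                                 (ℕP.*-monoʳ-≤ h (ℕP.^-monoˡ-≤ k (ℕP.n≤1+n h)))) ⟩
      suc h ^ suc k ∎

    length-cartesianProduct : {A B : Set} (xs : List A) (ys : List B) → length (cartesianProduct xs ys) ≡ length xs * length ys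
    length-cartesianProduct [] ys = ≡.refl
    length-cartesianProduct (x ∷ xs) ys = ≡.trans (length-++ (map (x ,_) ys)) (≡.cong₂ _+_ (length-map (x ,_) ys) (length-cartesianProduct xs ys))

    ∈-prepend : ∀ {n m ns L} → m < n → ns ∈ L → m ∷ ns ∈ prepend n L
    ∈-prepend {suc n} {m} {ns} {L} m<n p with ℕP.m≤n⇒m<n∨m≡n (ℕP.≤-pred m<n)
    ... | inj₁ q = ∈-++⁺ˡ (∈-prepend q p)
    ... | inj₂ ≡.refl = ∈-++⁺ʳ (prepend n L) (∈-map⁺ (n ∷_) p)

    ∈-tuples : ∀ {h} ns → All (_< h) ns → ns ∈ tuples h (length ns)
    ∈-tuples [] [] = here ≡.refl
    ∈-tuples (n ∷ ns) (p ∷ ps) = ∈-prepend p (∈-tuples ns ps)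

    ∈-tuplesUpTo : ∀ {h k ns} → length ns ≤ k → All (_< h) ns → ns ∈ tuplesUpTo h k
    ∈-tuplesUpTo {h} {zero} {[]} p q = here ≡.refl
    ∈-tuplesUpTo {h} {suc k} {ns} p q with ℕP.m≤n⇒m<n∨m≡n p
    ... | inj₁ r = ∈-++⁺ˡ (∈-tuplesUpTo (ℕP.≤-pred r) q)
    ... | inj₂ r = ∈-++⁺ʳ (tuplesUpTo h k) (≡.subst (λ j → ns ∈ tuples h j) r (∈-tuples ns q))

    weight : (ℕ → ℕ) → List ℕ → ℕ
    weight s [] = 0
    weight s (n ∷ ns) = s n + weight s ns

    -- The codes of bad tuples see the shortened list only through its length, its entries and its
    -- weight, so nothing else about the deletion is recorded.
    data Remove (s : ℕ → ℕ) (P Q : ℕ → Set) (ns : List ℕ) : Set where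
      remove : ∀ n rest → P n → Q n → All Q rest → length ns ≡ suc (length rest) → weight s ns ≡ s n + weight s rest → Remove s P Q ns

    remove-any : ∀ s {P Q : ℕ → Set} {ns} → Any P ns → All Q ns → Remove s P Q ns
    remove-any s {ns = n ∷ ns} (here p) (q ∷ qs) = remove n ns p q qs ≡.refl ≡.refl
    remove-any s {ns = m ∷ ns} (there a) (q ∷ qs) with remove-any s a qs
    ... | remove n rest p q′ qs′ e f = remove n (m ∷ rest) p q′ (q ∷ qs′) (≡.cong suc e)
      (≡.trans (≡.cong (_+_ (s m)) f) (exchange (s m) (s n) (weight s rest)))
      where
      exchange : ∀ a b c → a + (b + c) ≡ b + (a + c)
      exchange = solve-∀

    large-entry : ∀ s Y ns → 0 < length ns → length ns * Y ≤ weight s ns → Any (λ n → Y ≤ s n) ns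
    large-entry s Y (n ∷ ns) _ p with Y ℕP.≤? s n
    ... | yes q = here q
    ... | no q with ns
    ... | [] = ⊥-elim (q (≡.subst₂ _≤_ (ℕP.+-identityʳ Y) (ℕP.+-identityʳ (s n)) p))
    ... | m ∷ ms = there (large-entry s Y (m ∷ ms) (s≤s z≤n) (ℕP.+-cancelˡ-≤ Y _ _ (ℕP.≤-trans p (ℕP.+-monoˡ-≤ _ (ℕP.<⇒≤ (ℕP.≰⇒> q))))))

    -- Pigeonhole principle

    collision : {A : Set} {n : ℕ} (ys : List A) (P : Fin n → A → Set) → length ys < n → (∀ i → ∃ λ y → y ∈ ys × P i y) →
      ∃₂ λ i j → i ≢ j × ∃ λ y → P i y × P j y
    collision ys P small h with FinP.pigeonhole small (λ i → index (proj₁ (proj₂ (h i))))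
    ... | i , j , i<j , e = i , j , (λ i≡j → ℕP.<-irrefl (≡.cong toℕ i≡j) i<j) , proj₁ (h i) , proj₂ (proj₂ (h i)) ,
      ≡.subst (P j) (≡.trans (at j) (≡.trans (≡.cong (lookup ys) (≡.sym e)) (≡.sym (at i)))) (proj₂ (proj₂ (h j)))
      where
      at : ∀ i → proj₁ (h i) ≡ lookup ys (index (proj₁ (proj₂ (h i))))
      at i = lookup-index (proj₁ (proj₂ (h i)))

    -- If every candidate were hit by some y of the list, two candidates would be hit by the same y.
    -- This is how a sum is found that no bad tuple comes close to: each bad tuple rules out at most
    -- one candidate.
    avoid : {A : Set} {n : ℕ} (ys : List A) (P : Fin n → A → Set) → length ys < n → (∀ i j → i ≢ j → ∀ y → P i y → P j y → ⊥) →
      ∃ λ i → ∀ y → y ∈ ys → ¬ P i y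
    avoid ys P small disjoint with lem {∃ λ i → ∀ y → y ∈ ys → ¬ P i y}
    ... | yes h = h
    ... | no n with collision ys P small hit
      where
      hit : ∀ i → ∃ λ y → y ∈ ys × P i y
      hit i with lem {∃ λ y → y ∈ ys × P i y}
      ... | yes h = h
      ... | no m = ⊥-elim (n (i , λ y q p → m (y , q , p)))
    ... | i , j , i≢j , y , p , q = ⊥-elim (disjoint i j i≢j y p q)

    -- Sequences with large gaps

    -- s(n + 1) / s(n) ≥ 1 + 1/(2n), without division.
    Gap : (ℕ → ℕ) → ℕ → Set
    Gap s n₁ = ∀ n → n₁ ≤ n → suc (2 * n) * s n ≤ 2 * n * s (suc n)

    gap-step : ∀ {s n₁} → 0 < n₁ → Gap s n₁ → ∀ {n} → n₁ ≤ n → s n ≤ s (suc n)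
    gap-step {s} 0<n₁ gap {zero} p = ⊥-elim (ℕP.<⇒≱ 0<n₁ p)
    gap-step {s} 0<n₁ gap {suc n} p = ℕP.*-cancelˡ-≤ (2 * suc n) (ℕP.≤-trans (ℕP.m≤n+m _ (s (suc n))) (gap (suc n) p))

    gap-mono : ∀ {s n₁} → 0 < n₁ → Gap s n₁ → ∀ {m n} → n₁ ≤ m → m ≤ n → s m ≤ s n
    gap-mono {s} 0<n₁ gap {m} {n} p q = go n q
      where
      go : ∀ n → m ≤ n → s m ≤ s n
      go n q with ℕP.m≤n⇒m<n∨m≡n q
      ... | inj₂ ≡.refl = ℕP.≤-refl
      go (suc n) q | inj₁ r = ℕP.≤-trans (go n (ℕP.≤-pred r)) (gap-step {s} 0<n₁ gap (ℕP.≤-trans p (ℕP.≤-pred r)))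

    -- One step from m adds at least s(m) / (2m), which is at least s(m) / (2h) and hence at least
    -- X.
    gap-≥ : ∀ {s n₁} → 0 < n₁ → Gap s n₁ → ∀ {m n h X} → n₁ ≤ m → m < n → m ≤ h → 2 * h * X ≤ s m → X + s m ≤ s n
    gap-≥ {s} 0<n₁ gap {zero} p m<n m≤h q = ⊥-elim (ℕP.<⇒≱ 0<n₁ p)
    gap-≥ {s} 0<n₁ gap {suc m} {n} {h} {X} p m<n m≤h q = ℕP.*-cancelˡ-≤ (2 * suc m) (begin
      2 * suc m * (X + s (suc m)) ≡⟨ ℕP.*-distribˡ-+ (2 * suc m) X _ ⟩
      2 * suc m * X + 2 * suc m * s (suc m) ≤⟨ ℕP.+-monoˡ-≤ _ (ℕP.≤-trans (ℕP.*-monoˡ-≤ X (ℕP.*-monoʳ-≤ 2 m≤h)) q) ⟩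
      s (suc m) + 2 * suc m * s (suc m) ≤⟨ gap (suc m) p ⟩
      2 * suc m * s (2 + m) ≤⟨ ℕP.*-monoʳ-≤ (2 * suc m) (gap-mono {s} 0<n₁ gap (ℕP.m≤n⇒m≤1+n p) m<n) ⟩
      2 * suc m * s n ∎)

    -- Well-separated sums with one index from each block [aᵢ, bᵢ)

    Far : ℕ → ℕ → ℕ → Set
    Far σ x y = x + σ ≤ y ⊎ y + σ ≤ x

    record SeparatedFamily (s : ℕ → ℕ) (k lo hi σ : ℕ) : Set where
      field
        count range : ℕ
        choice : Fin count → List ℕ
        length≡ : ∀ i → length (choice i) ≡ k
        entries≥ : ∀ i → All (lo ≤_) (choice i)
        entries< : ∀ i → All (_< hi) (choice i)
        weight≤ : ∀ i → weight s (choice i) ≤ range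
        far : ∀ i j → i ≢ j → Far σ (weight s (choice i)) (weight s (choice j))

    module Blocks (s : ℕ → ℕ) {n₁ : ℕ} (0<n₁ : 0 < n₁) (gap : Gap s n₁) (a b : ℕ → ℕ) (h σ : ℕ) where

      count range : ℕ → ℕ
      count zero = 1
      count (suc k) = (b k ∸ a k) * count k
      range zero = 0
      range (suc k) = s (b k) + range k

      -- Mixed-radix digits: the quotient picks the index in the top block, the remainder those in
      -- the lower blocks.
      choice : ∀ k → Fin (count k) → List ℕ
      choice zero _ = []
      choice (suc k) i = (a k + toℕ (Fin.quotient {b k ∸ a k} (count k) i)) ∷ choice k (Fin.remainder {b k ∸ a k} (count k) i)

      choice-length : ∀ k i → length (choice k i) ≡ k
      choice-length zero i = ≡.refl
      choice-length (suc k) i = ≡.cong suc (choice-length k _)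

      entry< : ∀ k (i : Fin (b k ∸ a k)) → a k + toℕ i < b k
      entry< k i = ℕP.≤-trans (ℕP.+-monoʳ-< (a k) (FinP.toℕ<n i)) (ℕP.≤-reflexive (ℕP.m+[n∸m]≡n {a k} {b k} (ℕP.<⇒≤ (ℕP.m∸n≢0⇒n<m (nonzero i)))))
        where
        nonzero : ∀ {m} → Fin m → m ≢ 0
        nonzero () ≡.refl

      choice-All : ∀ {P : ℕ → Set} k → (∀ i → i < k → ∀ n → a i ≤ n → n < b i → P n) → ∀ i → All P (choice k i)
      choice-All zero h i = []
      choice-All (suc k) h i = h k ℕP.≤-refl _ (ℕP.m≤m+n (a k) _) (entry< k _) ∷ choice-All k (λ i p → h i (ℕP.m<n⇒m<1+n p)) _

      -- By `gap-≥`, a change of the index in block i moves s by at least `range i + σ`, which all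
      -- lower blocks together cannot undo.
      Valid : ℕ → Set
      Valid k = ∀ i → i < k → n₁ ≤ a i × b i ≤ h × 2 * h * (range i + σ) ≤ s (a i)

      valid-pred : ∀ {k} → Valid (suc k) → Valid k
      valid-pred v i p = v i (ℕP.m<n⇒m<1+n p)

      choice-range : ∀ k → Valid k → ∀ i → weight s (choice k i) ≤ range k
      choice-range zero v i = z≤n
      choice-range (suc k) v i = ℕP.+-mono-≤ (gap-mono {s} 0<n₁ gap (ℕP.≤-trans (proj₁ (v k ℕP.≤-refl)) (ℕP.m≤m+n (a k) _)) (ℕP.<⇒≤ (entry< k _)))
        (choice-range k (valid-pred v) _)

      -- Lexicographic comparison with the highest block as leading digit: where the indices in it
      -- differ, `Valid` decides; where they agree, the lower blocks do.
      choice-far : ∀ k → Valid k → ∀ i j → i ≢ j → Far σ (weight s (choice k i)) (weight s (choice k j))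
      choice-far zero v Fin.zero Fin.zero i≢j = ⊥-elim (i≢j ≡.refl)
      choice-far (suc k) v i j i≢j = compare (quo i) (quo j) (rem i) (rem j) λ e f → i≢j (≡.trans
          (≡.sym (FinP.combine-remQuot {b k ∸ a k} (count k) i)) (≡.trans (≡.cong₂ Fin.combine e f) (FinP.combine-remQuot {b k ∸ a k} (count k) j)))
        where
        quo = Fin.quotient {b k ∸ a k} (count k)
        rem = Fin.remainder {b k ∸ a k} (count k)
        less : ∀ (p q : Fin (b k ∸ a k)) (x y : Fin (count k)) → toℕ p < toℕ q →
          s (a k + toℕ p) + weight s (choice k x) + σ ≤ s (a k + toℕ q) + weight s (choice k y)
        less p q x y p<q = begin
          s m + w + σ ≡⟨ rotate (s m) w σ ⟩
          (w + σ) + s m ≤⟨ ℕP.+-monoˡ-≤ (s m) (ℕP.+-monoˡ-≤ σ (choice-range k (valid-pred v) x)) ⟩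
          (range k + σ) + s m ≤⟨ gap-≥ {s} 0<n₁ gap n₁≤m (ℕP.+-monoʳ-< (a k) p<q) (ℕP.≤-trans (ℕP.<⇒≤ (entry< k p)) (proj₁ (proj₂ vk)))
                                           (ℕP.≤-trans (proj₂ (proj₂ vk)) (gap-mono {s} 0<n₁ gap (proj₁ vk) (ℕP.m≤m+n (a k) _))) ⟩
          s (a k + toℕ q) ≤⟨ ℕP.m≤m+n _ _ ⟩
          s (a k + toℕ q) + weight s (choice k y) ∎
          where
          m = a k + toℕ p
          w = weight s (choice k x)
          vk = v k ℕP.≤-refl
          n₁≤m = ℕP.≤-trans (proj₁ vk) (ℕP.m≤m+n (a k) (toℕ p))
          rotate : ∀ x y z → x + y + z ≡ (y + z) + x
          rotate = solve-∀
        compare : ∀ (p q : Fin (b k ∸ a k)) (x y : Fin (count k)) → (p ≡ q → x ≡ y → ⊥) →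
          Far σ (s (a k + toℕ p) + weight s (choice k x)) (s (a k + toℕ q) + weight s (choice k y))
        compare p q x y n with ℕP.<-cmp (toℕ p) (toℕ q)
        ... | tri< p<q _ _ = inj₁ (less p q x y p<q)
        ... | tri> _ _ q<p = inj₂ (less q p y x q<p)
        ... | tri≈ _ e _ with FinP.toℕ-injective e
        ... | ≡.refl with choice-far k (valid-pred v) x y (n ≡.refl)
        ... | inj₁ f = inj₁ (ℕP.≤-trans (ℕP.≤-reflexive (ℕP.+-assoc (s (a k + toℕ p)) _ σ)) (ℕP.+-monoʳ-≤ (s (a k + toℕ p)) f))
        ... | inj₂ f = inj₂ (ℕP.≤-trans (ℕP.≤-reflexive (ℕP.+-assoc (s (a k + toℕ p)) _ σ)) (ℕP.+-monoʳ-≤ (s (a k + toℕ p)) f))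

      family : ∀ k {lo} → Valid k → (∀ i → i < k → lo ≤ a i) → SeparatedFamily s k lo h σ
      family k v lo≤ = record
        { count = count k ; range = range k ; choice = choice k ; length≡ = choice-length k
        ; entries≥ = choice-All k (λ i p m q _ → ℕP.≤-trans (lo≤ i p) q)
        ; entries< = choice-All k (λ i p m _ q → ℕP.<-≤-trans q (proj₁ (proj₂ (v i p))))
        ; weight≤ = choice-range k v ; far = choice-far k v }

    ∈-prepend⁻ : ∀ n {L ns} → ns ∈ prepend n L → ∃₂ λ m ns′ → ns ≡ m ∷ ns′ × m < n × ns′ ∈ L
    ∈-prepend⁻ (suc n) {L} p with ∈-++⁻ (prepend n L) p
    ... | inj₁ q with ∈-prepend⁻ n q
    ... | m , ns′ , e , m<n , r = m , ns′ , e , ℕP.m<n⇒m<1+n m<n , r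
    ∈-prepend⁻ (suc n) {L} p | inj₂ q with ∈-map⁻ (n ∷_) q
    ... | ns′ , r , e = n , ns′ , e , ℕP.≤-refl , r

    ∈-tuples⁻ : ∀ h k {ns} → ns ∈ tuples h k → length ns ≡ k × All (_< h) ns
    ∈-tuples⁻ h zero (here ≡.refl) = ≡.refl , []
    ∈-tuples⁻ h (suc k) p with ∈-prepend⁻ h p
    ... | m , ns′ , ≡.refl , m<h , q with ∈-tuples⁻ h k q
    ... | e , f = ≡.cong suc e , m<h ∷ f

    ∈-tuplesUpTo⁻ : ∀ h k {ns} → ns ∈ tuplesUpTo h k → length ns ≤ k × All (_< h) ns
    ∈-tuplesUpTo⁻ h zero p with ∈-tuples⁻ h zero p
    ... | e , f = ℕP.≤-reflexive e , f
    ∈-tuplesUpTo⁻ h (suc k) p with ∈-++⁻ (tuplesUpTo h k) p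
    ... | inj₁ q = ℕP.m≤n⇒m≤1+n (proj₁ (∈-tuplesUpTo⁻ h k q)) , proj₂ (∈-tuplesUpTo⁻ h k q)
    ... | inj₂ q = ℕP.≤-reflexive (proj₁ (∈-tuples⁻ h (suc k) q)) , proj₂ (∈-tuples⁻ h (suc k) q)

    -- Of `length xs + 1` adjacent windows of length R, open on the left and closed on the right,
    -- one contains no value of e, because each x falls into at most one of them.
    free-window : {A : Set} (xs : List A) (e : A → ℕ) (R base : ℕ) →
      ∃ λ N → base ≤ N × N + R ≤ base + suc (length xs) * R × (∀ x → x ∈ xs → N < e x → e x ≤ N + R → ⊥)
    free-window xs e R base with avoid {n = suc (length xs)} xs (λ j x → left j < e x × e x ≤ left j + R) ℕP.≤-refl disjoint
      where
      left : Fin (suc (length xs)) → ℕ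
      left j = base + toℕ j * R
      ordered : ∀ i j → toℕ i < toℕ j → ∀ x → e x ≤ left i + R → left j < e x → ⊥
      ordered i j i<j x p q = ℕP.<⇒≱ q (ℕP.≤-trans p (ℕP.≤-trans (ℕP.≤-reflexive (≡.trans (ℕP.+-assoc base _ R) (≡.cong (_+_ base) (ℕP.+-comm _ R))))
        (ℕP.+-monoʳ-≤ base (ℕP.*-monoˡ-≤ R i<j))))
      disjoint : ∀ i j → i ≢ j → ∀ x → left i < e x × e x ≤ left i + R → left j < e x × e x ≤ left j + R → ⊥
      disjoint i j i≢j x (p , p′) (q , q′) with ℕP.<-cmp (toℕ i) (toℕ j)
      ... | tri< i<j _ _ = ordered i j i<j x p′ q
      ... | tri≈ _ i≡j _ = i≢j (FinP.toℕ-injective i≡j)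
      ... | tri> _ _ j<i = ordered j i j<i x q′ p
    ... | j , h = base + toℕ j * R , ℕP.m≤m+n base _ ,
      ℕP.≤-trans (ℕP.≤-reflexive (≡.trans (ℕP.+-assoc base _ R) (≡.cong (_+_ base) (ℕP.+-comm _ R)))) (ℕP.+-monoʳ-≤ base (ℕP.*-monoˡ-≤ R (FinP.toℕ<n j))) ,
      λ x p q r → h x p (q , r)

    Index : Set
    Index = List ℕ × List ℕ

    total-exponent : (ℕ → ℕ) → (ℕ → ℕ) → Index → ℕ
    total-exponent W V (ns , ms) = weight W ns + weight V ms

    indices : ℕ → ℕ → ℕ → ℕ → List Index
    indices H h D n = cartesianProduct (tuplesUpTo H D) (tuplesUpTo h n)

    -- The index (ns , ms) lies in a window (lower, upper] that contains only
    -- indices of top degree and is bordered by two gaps of length R.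
    record IsolatedBlock (W V : ℕ → ℕ) (D K n H h n₀ R : ℕ) : Set where
      field
        lower upper : ℕ
        ns ms : List ℕ
        ns-length : length ns ≡ D
        ms-length : length ms ≡ K
        ns-≥ : All (n₀ ≤_) ns
        ms-> : All (0 <_) ms
        ns-< : All (_< H) ns
        ms-< : All (_< h) ms
        lower< : lower < total-exponent W V (ns , ms)
        ≤upper : total-exponent W V (ns , ms) ≤ upper
        lower-gap : ∀ τ → τ ∈ indices H h D n → lower < total-exponent W V τ → total-exponent W V τ ≤ lower + R → ⊥
        upper-gap : ∀ τ → τ ∈ indices H h D n → upper < total-exponent W V τ → total-exponent W V τ ≤ upper + R → ⊥
        top : ∀ τ → τ ∈ indices H h D n → lower < total-exponent W V τ → total-exponent W V τ ≤ upper →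
          length (proj₁ τ) ≡ D × All (n₀ ≤_) (proj₁ τ) × K ≤ length (proj₂ τ)

  -- Isolating a block of exponents of top degree

  module IsolationTheorem where
    open import Data.Nat.Base using (_+_; _*_; _^_; _∸_; _≤_; _<_; z≤n; s≤s)
    open ℕP.≤-Reasoning
    open Naturals
    open Combinatorics

    -- A position V₀ + w is wanted, with V₀ a sum from `FV` and w a sum from `FW`, such that all
    -- exponents within ρ of it have top degree. V₀ is first kept at a distance of more than ρV from
    -- the shorter V-sums, and G + ρ ≤ ρV carries this over to all positions V₀ + w. Then w is
    -- chosen by counting. `window` leaves room for the two gaps of length R.
    module Isolation (W V : ℕ → ℕ) {n₁ : ℕ} (0<n₁ : 0 < n₁) (gapW : Gap W n₁)
      (D′ K′ n H h n₀ R ρ ρV Y : ℕ)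
      (FW : SeparatedFamily W (suc D′) n₀ H (suc (2 * ρ)))
      {lo : ℕ} (0<lo : 0 < lo) (FV : SeparatedFamily V (suc K′) lo h (suc (2 * ρV)))
      (window : suc (length (indices H h (suc D′) n)) * R < ρ)
      (countV : length (tuplesUpTo h K′) < SeparatedFamily.count FV)
      (countW : 3 * (suc n₀ * length (tuplesUpTo H D′)) * length (tuplesUpTo h n) < SeparatedFamily.count FW)
      (G+ρ≤ρV : SeparatedFamily.range FW + ρ ≤ ρV) (small-Y : ∀ m → m < n₁ → W m < Y)
      (gap-Y : 2 * H * suc (SeparatedFamily.range FW + 2 * ρ) ≤ Y) (DY+ρ≤ρV : suc D′ * Y + ρ ≤ ρV)
      (ρ≤V : ∀ i → ρ ≤ weight V (SeparatedFamily.choice FV i)) where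

      module FW = SeparatedFamily FW
      module FV = SeparatedFamily FV
      D = suc D′
      K = suc K′
      G = FW.range

      Near : ℕ → ℕ → ℕ → Set
      Near r x e = x ≤ e + r × e ≤ x + r

      far-not-near : ∀ r v x y e → Far (suc (2 * r)) x y → Near r (v + x) e → Near r (v + y) e → ⊥
      far-not-near r v x y e (inj₁ f) (p , p′) (q , q′) = ℕP.<⇒≱ (begin-strict
        v + y ≤⟨ q ⟩
        e + r ≤⟨ ℕP.+-monoˡ-≤ r p′ ⟩
        (v + x + r) + r <⟨ ℕP.≤-reflexive (regroup v x r) ⟩
        v + (x + suc (2 * r)) ∎) (ℕP.+-monoʳ-≤ v f)
        where
        regroup : ∀ v x r → suc ((v + x + r) + r) ≡ v + (x + suc (2 * r))
        regroup = solve-∀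
      far-not-near r v x y e (inj₂ f) p q = far-not-near r v y x e (inj₁ f) q p

      -- The exponents to be kept away from x: fewer than D indices of W, an index below n₀, or an
      -- index m with W m ≥ Y. The first entry of a code names the kind. In the third kind m is
      -- replaced by 0, since a position close to such an exponent determines m, by `separated`.
      -- Storing m would cost a factor H, and the count of candidates against codes would fail.
      data BadCode (x : ℕ) : Index → Set where
        low : ∀ ns ms → Near ρ x (weight W ns + weight V ms) → BadCode x (0 ∷ 0 ∷ ns , ms)
        small : ∀ m ns ms → Near ρ x (W m + weight W ns + weight V ms) → BadCode x (1 ∷ m ∷ ns , ms)
        large : ∀ m ns ms → n₁ ≤ m → m < H → Y ≤ W m → Near ρ x (W m + weight W ns + weight V ms) → BadCode x (2 ∷ 0 ∷ ns , ms)

      codes : List Index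
      codes = cartesianProduct (prepend 3 (prepend (suc n₀) (tuplesUpTo H D′))) (tuplesUpTo h n)

      codes-length : length codes < FW.count
      codes-length = ℕP.≤-<-trans (ℕP.≤-reflexive (≡.trans (length-cartesianProduct (prepend 3 (prepend (suc n₀) (tuplesUpTo H D′))) (tuplesUpTo h n))
        (≡.cong (_* length (tuplesUpTo h n)) (≡.trans (length-prepend 3 (prepend (suc n₀) (tuplesUpTo H D′))) (≡.cong (3 *_) (length-prepend (suc n₀) (tuplesUpTo H D′))))))) countW

      code-member : ∀ {s m ns ms} → s < 3 → m < suc n₀ → length ns ≤ D′ → All (_< H) ns → length ms ≤ n → All (_< h) ms → (s ∷ m ∷ ns , ms) ∈ codes
      code-member p q r r′ t t′ = ∈-cartesianProduct⁺ (∈-prepend p (∈-prepend q (∈-tuplesUpTo r r′))) (∈-tuplesUpTo t t′)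

      -- A sum of K values of V far from all sums of fewer values.
      V-choice : ∃ λ i → ∀ ms → ms ∈ tuplesUpTo h K′ → ¬ Near ρV (weight V (FV.choice i)) (weight V ms)
      V-choice = avoid (tuplesUpTo h K′) (λ i ms → Near ρV (weight V (FV.choice i)) (weight V ms)) countV
        (λ i j i≢j ms p q → far-not-near ρV 0 (weight V (FV.choice i)) (weight V (FV.choice j)) (weight V ms) (FV.far i j i≢j) p q)

      module Around (ms₀ : List ℕ) (V-isolated : ∀ ms → ms ∈ tuplesUpTo h K′ → ¬ Near ρV (weight V ms₀) (weight V ms)) where

        V₀ = weight V ms₀

        position : Fin FW.count → ℕ
        position i = V₀ + weight W (FW.choice i)

        -- W m and W m′ differ by more than G + 2ρ, while the positions differ among themselves by
        -- at most G. So one code of the third kind cannot be near two positions with different m.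
        separated : ∀ i j m m′ ns ms → m < m′ → n₁ ≤ m → m < H → Y ≤ W m → Near ρ (position i) (W m + weight W ns + weight V ms) →
          Near ρ (position j) (W m′ + weight W ns + weight V ms) → ⊥
        separated i j m m′ ns ms m<m′ n₁≤m m<H Y≤ (p , _) (_ , q) = ℕP.<⇒≱ (begin-strict
          W m′ + c + d ≤⟨ q ⟩
          V₀ + weight W (FW.choice j) + ρ ≤⟨ ℕP.+-monoˡ-≤ ρ (ℕP.+-monoʳ-≤ V₀ (FW.weight≤ j)) ⟩
          V₀ + G + ρ ≤⟨ ℕP.+-monoˡ-≤ ρ (ℕP.+-monoˡ-≤ G (ℕP.≤-trans (ℕP.m≤m+n V₀ _) p)) ⟩
          W m + c + d + ρ + G + ρ <⟨ ℕP.≤-reflexive (regroup (W m) c d ρ G) ⟩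
          suc (G + 2 * ρ) + W m + c + d ∎)
          (ℕP.+-monoˡ-≤ d (ℕP.+-monoˡ-≤ c (gap-≥ {W} 0<n₁ gapW n₁≤m m<m′ (ℕP.<⇒≤ m<H) (ℕP.≤-trans gap-Y Y≤))))
          where
          c = weight W ns
          d = weight V ms
          regroup : ∀ w c d r g → suc (w + c + d + r + g + r) ≡ suc (g + 2 * r) + w + c + d
          regroup = solve-∀

        disjoint : ∀ i j → i ≢ j → ∀ y → BadCode (position i) y → BadCode (position j) y → ⊥
        disjoint i j i≢j _ p q = go p q
          where
          apart : ∀ e → Near ρ (position i) e → Near ρ (position j) e → ⊥
          apart e = far-not-near ρ V₀ (weight W (FW.choice i)) (weight W (FW.choice j)) e (FW.far i j i≢j)
          go : ∀ {y} → BadCode (position i) y → BadCode (position j) y → ⊥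
          go (low ns ms p) (low _ _ q) = apart (weight W ns + weight V ms) p q
          go (small m ns ms p) (small _ _ _ q) = apart (W m + weight W ns + weight V ms) p q
          go (large m ns ms n₁≤m m<H Y≤ p) (large m′ _ _ n₁≤m′ m′<H Y≤′ q) = compare (ℕP.<-cmp m m′)
            where
            compare : Tri (m < m′) (m ≡ m′) (m′ < m) → ⊥
            compare (tri≈ _ ≡.refl _) = apart (W m + weight W ns + weight V ms) p q
            compare (tri< m<m′ _ _) = separated i j m m′ ns ms m<m′ n₁≤m m<H Y≤ p q
            compare (tri> _ _ m′<m) = separated j i m′ m ns ms m′<m n₁≤m′ m′<H Y≤′ q p

        W-choice : ∃ λ i → ∀ y → y ∈ codes → ¬ BadCode (position i) y
        W-choice = avoid codes (λ i → BadCode (position i)) codes-length disjoint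

        module Centre (i₀ : Fin FW.count) (no-code : ∀ y → y ∈ codes → ¬ BadCode (position i₀) y) where

          ns₀ = FW.choice i₀
          x = V₀ + weight W ns₀

          -- Each way of missing the top degree produces a bad code. Only the case of fewer than K
          -- values of V is indirect: V₀ is isolated from such sums, so the W-part has to bridge the
          -- distance.
          good : ∀ τ → τ ∈ indices H h D n → Near ρ x (total-exponent W V τ) → length (proj₁ τ) ≡ D × All (n₀ ≤_) (proj₁ τ) × K ≤ length (proj₂ τ)
          good (ns , ms) τ∈ near = full , large-entries (Any.any? (ℕP._<? n₀) ns) , ℕP.≮⇒≥ (λ p → V-near (V-far p))
            where
            ns∈×ms∈ = ∈-cartesianProduct⁻ (tuplesUpTo H D) (tuplesUpTo h n) τ∈
            ns≤ = proj₁ (∈-tuplesUpTo⁻ H D (proj₁ ns∈×ms∈))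
            ns< = proj₂ (∈-tuplesUpTo⁻ H D (proj₁ ns∈×ms∈))
            ms≤ = proj₁ (∈-tuplesUpTo⁻ h n (proj₂ ns∈×ms∈))
            ms< = proj₂ (∈-tuplesUpTo⁻ h n (proj₂ ns∈×ms∈))
            no-bad : ∀ {s m rest} → s < 3 → m < suc n₀ → length rest ≤ D′ → All (_< H) rest → ¬ BadCode x (s ∷ m ∷ rest , ms)
            no-bad {s} {m} {rest} p q r r′ = no-code (s ∷ m ∷ rest , ms) (code-member p q r r′ ms≤ ms<)
            full : length ns ≡ D
            full = [ (λ p → ⊥-elim (no-bad {rest = ns} (s≤s z≤n) (s≤s z≤n) (ℕP.≤-pred p) ns< (low ns ms near))) , (λ e → e) ]′ (ℕP.m≤n⇒m<n∨m≡n ns≤)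
            rest-length : ∀ {rest : List ℕ} → length ns ≡ suc (length rest) → length rest ≤ D′
            rest-length e = ℕP.≤-reflexive (ℕP.suc-injective (≡.trans (≡.sym e) full))
            no-small : Remove W (_< n₀) (_< H) ns → ⊥
            no-small (remove m rest m<n₀ _ rest< e f) = no-bad (s≤s (s≤s z≤n)) (ℕP.m<n⇒m<1+n m<n₀) (rest-length {rest} e) rest<
              (small m rest ms (≡.subst (λ w → Near ρ x (w + weight V ms)) f near))
            no-large : Remove W (λ m → Y ≤ W m) (_< H) ns → ⊥
            no-large (remove m rest Y≤ m<H rest< e f) = no-bad (s≤s (s≤s (s≤s z≤n))) (s≤s z≤n) (rest-length {rest} e) rest<
              (large m rest ms (ℕP.≮⇒≥ (λ m<n₁ → ℕP.<⇒≱ (small-Y m m<n₁) Y≤)) m<H Y≤ (≡.subst (λ w → Near ρ x (w + weight V ms)) f near))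
            large-entries : Dec (Any (_< n₀) ns) → All (n₀ ≤_) ns
            large-entries (no none) = All.map ℕP.≮⇒≥ (¬Any⇒All¬ ns none)
            large-entries (yes a) = ⊥-elim (no-small (remove-any W a ns<))
            V-far : length ms < K → V₀ + suc ρV ≤ weight V ms ⊎ weight V ms + suc ρV ≤ V₀
            V-far p = go (suc (V₀ + ρV) ℕP.≤? weight V ms) (suc (weight V ms + ρV) ℕP.≤? V₀)
              where
              go : Dec (V₀ + ρV < weight V ms) → Dec (weight V ms + ρV < V₀) → V₀ + suc ρV ≤ weight V ms ⊎ weight V ms + suc ρV ≤ V₀
              go (yes q) _ = inj₁ (ℕP.≤-trans (ℕP.≤-reflexive (ℕP.+-suc V₀ ρV)) q)
              go (no _) (yes q) = inj₂ (ℕP.≤-trans (ℕP.≤-reflexive (ℕP.+-suc _ ρV)) q)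
              go (no q) (no r) = ⊥-elim (V-isolated ms (∈-tuplesUpTo (ℕP.≤-pred p) ms<) (ℕP.≮⇒≥ r , ℕP.≮⇒≥ q))
            V-near : V₀ + suc ρV ≤ weight V ms ⊎ weight V ms + suc ρV ≤ V₀ → ⊥
            V-near (inj₁ q) = ℕP.<⇒≱ (begin-strict
                weight V ms ≤⟨ ℕP.m≤n+m _ (weight W ns) ⟩
                weight W ns + weight V ms ≤⟨ proj₂ near ⟩
                x + ρ ≤⟨ ℕP.+-monoˡ-≤ ρ (ℕP.+-monoʳ-≤ V₀ (FW.weight≤ i₀)) ⟩
                V₀ + G + ρ ≡⟨ ℕP.+-assoc V₀ G ρ ⟩
                V₀ + (G + ρ) ≤⟨ ℕP.+-monoʳ-≤ V₀ G+ρ≤ρV ⟩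
                V₀ + ρV <⟨ ℕP.+-monoʳ-< V₀ ℕP.≤-refl ⟩
                V₀ + suc ρV ∎) q
            -- The V-sum falls short of V₀ by more than ρV ≥ D Y + ρ, so the W-sum is at least D Y
            -- and one of its D values is at least Y.
            V-near (inj₂ q) = no-large (remove-any W (large-entry W Y ns (ℕP.≤-trans (s≤s z≤n) (ℕP.≤-reflexive (≡.sym full)))
                (≡.subst (λ k → k * Y ≤ weight W ns) (≡.sym full) DY≤)) ns<)
              where
              DY≤ : D * Y ≤ weight W ns
              DY≤ = ℕP.+-cancelʳ-≤ (weight V ms + ρ) _ _ (begin
                D * Y + (weight V ms + ρ) ≡⟨ swap (D * Y) (weight V ms) ρ ⟩
                weight V ms + (D * Y + ρ) ≤⟨ ℕP.+-monoʳ-≤ (weight V ms) (ℕP.≤-trans DY+ρ≤ρV (ℕP.n≤1+n ρV)) ⟩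
                weight V ms + suc ρV ≤⟨ q ⟩
                V₀ ≤⟨ ℕP.m≤m+n V₀ _ ⟩
                x ≤⟨ proj₁ near ⟩
                weight W ns + weight V ms + ρ ≡⟨ ℕP.+-assoc (weight W ns) _ ρ ⟩
                weight W ns + (weight V ms + ρ) ∎)
                where
                swap : ∀ a b c → a + (b + c) ≡ b + (a + c)
                swap = solve-∀

          block : All (_< h) ms₀ → All (0 <_) ms₀ → length ms₀ ≡ K → V₀ ≤ FV.range → ρ ≤ V₀ →
            ∃ λ (B : IsolatedBlock W V D K n H h n₀ R) → IsolatedBlock.upper B ≤ FV.range + ρV
          -- The upper gap is sought from x on, the lower one from x - ρ on. `window` keeps both
          -- within distance ρ of x, the lower one strictly below x.
          block ms< ms> ms≡ V₀≤ ρ≤V₀ = build (free-window (indices H h D n) (total-exponent W V) R x) (free-window (indices H h D n) (total-exponent W V) R (x ∸ ρ))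
            where
            Free : ℕ → Set
            Free base = ∃ λ N → base ≤ N × N + R ≤ base + suc (length (indices H h D n)) * R × (∀ τ → τ ∈ indices H h D n → N < total-exponent W V τ → total-exponent W V τ ≤ N + R → ⊥)
            ρ≤x = ℕP.≤-trans ρ≤V₀ (ℕP.m≤m+n V₀ (weight W ns₀))
            x≡ : x ≡ weight W ns₀ + V₀
            x≡ = ℕP.+-comm V₀ (weight W ns₀)
            build : Free x → Free (x ∸ ρ) → ∃ λ (B : IsolatedBlock W V D K n H h n₀ R) → IsolatedBlock.upper B ≤ FV.range + ρV
            build (N₂ , x≤N₂ , N₂≤ , gap₂) (N₁ , ≤N₁ , N₁≤ , gap₁) = record
              { lower = N₁ ; upper = N₂ ; ns = ns₀ ; ms = ms₀
              ; ns-length = FW.length≡ i₀ ; ms-length = ms≡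
              ; ns-≥ = FW.entries≥ i₀
              ; ns-< = FW.entries< i₀
              ; ms-< = ms< ; ms-> = ms>
              ; lower< = ≡.subst (N₁ <_) x≡ N₁<x ; ≤upper = ≡.subst (_≤ N₂) x≡ x≤N₂
              ; lower-gap = gap₁ ; upper-gap = gap₂
              ; top = λ τ τ∈ p q → good τ τ∈ (ℕP.≤-trans (ℕP.≤-reflexive (≡.sym (ℕP.m∸n+n≡m ρ≤x))) (ℕP.+-monoˡ-≤ ρ (ℕP.≤-trans ≤N₁ (ℕP.<⇒≤ p))) ,
                  ℕP.≤-trans q N₂≤x+ρ)
              } , ℕP.≤-trans N₂≤x+ρ (begin
                x + ρ ≤⟨ ℕP.+-monoˡ-≤ ρ (ℕP.+-mono-≤ V₀≤ (FW.weight≤ i₀)) ⟩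
                FV.range + G + ρ ≡⟨ ℕP.+-assoc (FV.range) G ρ ⟩
                FV.range + (G + ρ) ≤⟨ ℕP.+-monoʳ-≤ (FV.range) G+ρ≤ρV ⟩
                FV.range + ρV ∎)
              where
              N₂≤x+ρ : N₂ ≤ x + ρ
              N₂≤x+ρ = ℕP.≤-trans (ℕP.m≤m+n N₂ R) (ℕP.≤-trans N₂≤ (ℕP.+-monoʳ-≤ x (ℕP.<⇒≤ window)))
              N₁<x : N₁ < x
              N₁<x = begin-strict
                N₁ ≤⟨ ℕP.≤-trans (ℕP.m≤m+n N₁ R) N₁≤ ⟩
                (x ∸ ρ) + suc (length (indices H h D n)) * R <⟨ ℕP.+-monoʳ-< (x ∸ ρ) window ⟩
                (x ∸ ρ) + ρ ≡⟨ ℕP.m∸n+n≡m ρ≤x ⟩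
                x ∎

      isolated : ∃ λ (B : IsolatedBlock W V D K n H h n₀ R) → IsolatedBlock.upper B ≤ FV.range + ρV
      isolated = A.Centre.block (proj₁ A.W-choice) (proj₂ A.W-choice)
          (FV.entries< i) (All.map (ℕP.≤-trans 0<lo) (FV.entries≥ i)) (FV.length≡ i) (FV.weight≤ i) (ρ≤V i)
        where
        i = proj₁ V-choice
        module A = Around (FV.choice i) (proj₂ V-choice)

  -- Choice of the scales

  module ParameterChoice where
    open import Data.Nat.Base using (_+_; _*_; _^_; _∸_; _≤_; _<_; z≤n; s≤s)
    open ℕP.≤-Reasoning
    open Naturals
    open Combinatorics
    open IsolationTheorem

    pow-* : ∀ t {x y} a b → x ≤ t ^ a → y ≤ t ^ b → x * y ≤ t ^ (a + b)
    pow-* t a b p q = ℕP.≤-trans (ℕP.*-mono-≤ p q) (ℕP.≤-reflexive (≡.sym (ℕP.^-distribˡ-+-* t a b)))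

    pow-≥1 : ∀ {t} a → 0 < t → 1 ≤ t ^ a
    pow-≥1 {t} a p = ℕP.≤-trans (ℕP.≤-reflexive (≡.sym (ℕP.^-zeroˡ a))) (ℕP.^-monoˡ-≤ a p)

    pow-monoʳ : ∀ {t a b} → 0 < t → a ≤ b → t ^ a ≤ t ^ b
    pow-monoʳ {suc t} _ p = ℕP.^-monoʳ-≤ (suc t) p

    pow-+ : ∀ t {x y} a b → 2 ≤ t → x ≤ t ^ a → y ≤ t ^ b → x + y ≤ t ^ suc (a + b)
    pow-+ t {x} {y} a b 2≤t p q = begin
      x + y ≤⟨ ℕP.+-mono-≤ (ℕP.≤-trans p (pow-monoʳ 0<t (ℕP.m≤m+n a b))) (ℕP.≤-trans q (pow-monoʳ 0<t (ℕP.m≤n+m b a))) ⟩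
      t ^ (a + b) + t ^ (a + b) ≡⟨ ≡.cong (_+_ (t ^ (a + b))) (≡.sym (ℕP.+-identityʳ _)) ⟩
      2 * t ^ (a + b) ≤⟨ ℕP.*-monoˡ-≤ (t ^ (a + b)) 2≤t ⟩
      t ^ suc (a + b) ∎
      where 0<t = ℕP.≤-trans (s≤s z≤n) 2≤t

    pow-suc : ∀ t {x} a → 2 ≤ t → x ≤ t ^ a → suc x ≤ t ^ suc a
    pow-suc t a 2≤t p = pow-+ t 0 a 2≤t ℕP.≤-refl p

    pow-1 : ∀ t {x} → x ≤ t → x ≤ t ^ 1
    pow-1 t p = ℕP.≤-trans p (ℕP.≤-reflexive (≡.sym (ℕP.*-identityʳ t)))

    ^-cancel-≤ : ∀ e {x y} → 0 < e → x ^ e ≤ y ^ e → x ≤ y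
    ^-cancel-≤ (suc e) {x} {y} _ p = ℕP.≮⇒≥ (λ y<x → ℕP.<⇒≱ (ℕP.^-monoˡ-< (suc e) y<x) p)

    ^-cancel-< : ∀ e {x y} → x ^ e < y ^ e → x < y
    ^-cancel-< e {x} {y} p = ℕP.≰⇒> (λ y≤x → ℕP.<⇒≱ p (ℕP.^-monoˡ-≤ e y≤x))

    crossing : ∀ (f : ℕ → ℕ) y t₀ n → f t₀ ≤ y → y < f (t₀ + n) → ∃ λ t → t₀ ≤ t × f t ≤ y × y < f (suc t)
    crossing f y t₀ zero p q = ⊥-elim (ℕP.<⇒≱ q (≡.subst (λ t → f t ≤ y) (≡.sym (ℕP.+-identityʳ t₀)) p))
    crossing f y t₀ (suc n) p q with f (suc t₀) ℕP.≤? y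
    ... | no r = t₀ , ℕP.≤-refl , p , ℕP.≰⇒> r
    ... | yes r with crossing f y (suc t₀) n r (≡.subst (λ t → y < f t) (ℕP.+-suc t₀ n) q)
    ... | t , t₀<t , u , v = t , ℕP.<⇒≤ t₀<t , u , v

    upper-bound : ∀ (f : ℕ → ℕ) n → ∃ λ B → ∀ m → m < n → f m < B
    upper-bound f zero = 0 , λ _ ()
    upper-bound f (suc n) with upper-bound f n
    ... | B , h = suc (f n) + B , λ m p → [ (λ q → ℕP.≤-trans (h m q) (ℕP.m≤n+m B _)) , (λ { ≡.refl → ℕP.m≤m+n _ B }) ]′ (ℕP.m≤n⇒m<n∨m≡n (ℕP.≤-pred p))

    weight-≥ : ∀ {s n₁ lo} → 0 < n₁ → Gap s n₁ → n₁ ≤ lo → ∀ ns → 0 < length ns → All (lo ≤_) ns → s lo ≤ weight s ns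
    weight-≥ {s} 0<n₁ gap p (n ∷ ns) _ (q ∷ _) = ℕP.≤-trans (gap-mono {s} 0<n₁ gap p q) (ℕP.m≤m+n (s n) _)

    Eventually : (ℕ → Set) → Set
    Eventually P = ∃ λ n₀ → ∀ n → n₀ ≤ n → P n

    -- Indices in K blocks [aᵢ, bᵢ) of comparable size, with sums of V separated
    -- and the product of the lengths of the blocks exceeding (h + 1)^(K - 1).
    record SpreadBlocks (V : ℕ → ℕ) (K e s₀ : ℕ) : Set where
      field
        a b : ℕ → ℕ
        h : ℕ
        s₀≤a : s₀ ≤ a 0
        a₀≤a : ∀ i → i < K → a 0 ≤ a i
        a≤b : ∀ i → i < K → a i ≤ b i
        b≤h : ∀ i → i < K → b i ≤ h
        spread : ∀ i → suc i < K → 4 * (h * h) * V (b i) ≤ V (a (suc i))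
        last : ∀ i → suc i ≡ K → 4 * (h * h) * V (b i) ≤ V h
        many : ∀ (c : ℕ → ℕ) → c 0 ≡ 1 → (∀ i → c (suc i) ≡ (b i ∸ a i) * c i) → suc h ^ (K ∸ 1) < c K
        h≤a² : h ≤ a 0 * a 0
        flat : V h ^ e ≤ 2 ^ suc e * V (a 0) ^ suc e

    -- `W-convex` says that W(t^j)^(1/j) increases with j up to a constant: W(t^j)^(1 + 1/j) ≤ 2
    -- W(t^(j + 1)), where rounding costs the 2. `W-steep` says that one step of j outweighs any
    -- fixed power of t.
    record Growth (W V : ℕ → ℕ) : Set where
      field
        n₁ : ℕ
        0<n₁ : 0 < n₁
        gapW : Gap W n₁
        gapV : Gap V n₁
        W-pos : ∀ n → n₁ ≤ n → 0 < W n
        W-steep : ∀ E → Eventually λ t → ∀ j → 0 < j → t ^ E * W (t ^ j) ≤ W (t ^ suc j)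
        W-convex : Eventually λ t → ∀ j → 0 < j → W (t ^ j) ^ suc j ≤ 2 ^ j * W (t ^ suc j) ^ j
        V-faster : ∀ Q → Eventually λ n → W (n ^ Q) ≤ V n
        V-slow : ∃ λ k → Eventually λ n → V n ≤ 2 ^ (k * n)
        V-blocks : ∀ K e s₀ → 0 < K → 0 < e → SpreadBlocks V K e s₀

    -- 8N ≤ W H and 8N ≤ V h make the truncation errors at most β^(-2N), since `WellApproximated`
    -- keeps a quarter of the first omitted exponent. A H + H ≤ N leaves room between β^(-2N) and
    -- β^(-N) for a gap and a constant, and N ≤ 2^H admits the exponents to the box argument.
    record Isolable (W V : ℕ → ℕ) (D K n n₀ A H₀ : ℕ) : Set where
      field
        H h N : ℕ
        H₀≤h : H₀ ≤ h
        h≤H : h ≤ H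
        block : IsolatedBlock W V D K n H h n₀ (A * H)
        upper≤ : IsolatedBlock.upper block ≤ N
        8N≤W : 8 * N ≤ W H
        8N≤V : 8 * N ≤ V h
        ≤N : A * H + H ≤ N
        N≤2^ : N ≤ 2 ^ H

    module Choose {W V : ℕ → ℕ} (growth : Growth W V) (D′ K′ n n₀ A H₀ : ℕ) where
      open Growth growth
      D = suc D′
      K = suc K′
      -- t^(qD) candidates have to outnumber t^(1 + (q′ + 4)D′ + 1) codes. With q′ = q + 2D′ + 3
      -- this is the least such q.
      q = (2 * D + 5) * D′ + 3
      j₂ = q + 2 * D′ + 1
      q′ = 2 + j₂
      -- The exponents e₁, E₀ and E are read off from the uses of `pow-+`, `pow-*` and `pow-suc` in
      -- `ρ≤` and `Z≤`.
      e₁ = suc ((suc ((q′ + 4) * D + 1)) + (1 + (q′ + 3)))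
      E₀ = (1 + (q′ + 3)) + suc (suc (1 + (1 + e₁)))
      E = suc ((1 + suc (E₀ + 1)) + e₁)
      -- One more than q′ absorbs the passage from (t + 1)^q′ to a power of t.
      e = suc q′
      -- a₀^c < t yields (h + 1)^(n + 2) ≤ t, as h + 1 ≤ a₀^3.
      c = 3 * (n + 2)
      Yₘ = proj₁ (upper-bound W n₁)

      t₀ = proj₁ (W-steep E) + (proj₁ W-convex + (n₁ + (8 + (D + (3 * suc n₀ + (suc A + (Yₘ + 2 ^ q′)))))))
      s₀ = t₀ + (proj₁ (V-faster q′) + (proj₁ (V-faster (c * e)) + (proj₁ (proj₂ V-slow) + (n₁ + (2 + (2 * suc K + (proj₁ V-slow + H₀)))))))

      -- t places V(a₀) on the scale of W. Below it the W-sums are at most D w(j₂), two steps of j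
      -- before w(q′) ≤ V(a₀); above it, W(H) = w(q′ + 3) has to reach V(h).
      module Sizes (SB : SpreadBlocks V K e s₀) (t : ℕ) (t₀≤t : t₀ ≤ t)
        (W≤V : W (t ^ q′) ≤ V (SpreadBlocks.a SB 0)) (V<W : V (SpreadBlocks.a SB 0) < W (suc t ^ q′)) where
        open SpreadBlocks SB

        split : ∀ {x y z} → x + y ≤ z → x ≤ z × y ≤ z
        split {x} {y} p = ℕP.≤-trans (ℕP.m≤m+n x y) p , ℕP.≤-trans (ℕP.m≤n+m y x) p

        r₁ = split {proj₁ (W-steep E)} t₀≤t
        r₂ = split {proj₁ W-convex} (proj₂ r₁)
        r₃ = split {n₁} (proj₂ r₂)
        r₄ = split {8} (proj₂ r₃)
        r₅ = split {D} (proj₂ r₄)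
        r₆ = split {3 * suc n₀} (proj₂ r₅)
        r₇ = split {suc A} (proj₂ r₆)
        r₈ = split {Yₘ} (proj₂ r₇)
        n₁≤t = proj₁ r₃
        8≤t = proj₁ r₄
        D≤t = proj₁ r₅
        3n₀≤t = proj₁ r₆
        A≤t = proj₁ r₇
        Yₘ≤t = proj₁ r₈
        2^q′≤t = proj₂ r₈
        2≤t : 2 ≤ t
        2≤t = ℕP.≤-trans (s≤s (s≤s z≤n)) 8≤t
        0<t : 0 < t
        0<t = ℕP.≤-trans (s≤s z≤n) 2≤t

        p₁ = split {t₀} s₀≤a
        p₂ = split {proj₁ (V-faster q′)} (proj₂ p₁)
        p₃ = split {proj₁ (V-faster (c * e))} (proj₂ p₂)
        p₄ = split {proj₁ (proj₂ V-slow)} (proj₂ p₃)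
        p₅ = split {n₁} (proj₂ p₄)
        p₆ = split {2} (proj₂ p₅)
        p₇ = split {2 * suc K} (proj₂ p₆)
        p₈ = split {proj₁ V-slow} (proj₂ p₇)
        n₁≤a₀ = proj₁ p₅
        2≤a₀ = proj₁ p₆
        a₀≤h : a 0 ≤ h
        a₀≤h = ℕP.≤-trans (a≤b 0 (s≤s z≤n)) (b≤h 0 (s≤s z≤n))
        2K≤h = ℕP.≤-trans (proj₁ p₇) a₀≤h
        k≤h = ℕP.≤-trans (proj₁ p₈) a₀≤h
        H₀≤h′ = ℕP.≤-trans (proj₂ p₈) a₀≤h
        1≤h : 1 ≤ h
        1≤h = ℕP.≤-trans (s≤s z≤n) (ℕP.≤-trans 2≤a₀ a₀≤h)

        w : ℕ → ℕ
        w j = W (t ^ j)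

        n₁≤tʲ : ∀ j → 0 < j → n₁ ≤ t ^ j
        n₁≤tʲ (suc j) _ = ℕP.≤-trans n₁≤t (ℕP.≤-trans (ℕP.≤-reflexive (≡.sym (ℕP.*-identityʳ t))) (ℕP.*-monoʳ-≤ t (pow-≥1 j 0<t)))

        w-pos : ∀ j → 0 < j → 1 ≤ w j
        w-pos j p = W-pos (t ^ j) (n₁≤tʲ j p)

        W-mono : ∀ {m n} → n₁ ≤ m → m ≤ n → W m ≤ W n
        W-mono = gap-mono {W} 0<n₁ gapW

        V-mono : ∀ {m n} → n₁ ≤ m → m ≤ n → V m ≤ V n
        V-mono = gap-mono {V} 0<n₁ gapV

        steep : ∀ j → 0 < j → t ^ E * w j ≤ w (suc j)
        steep = proj₂ (W-steep E) t (proj₁ r₁)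

        step : ∀ {x} j → 0 < j → x ≤ t ^ E → x * w j ≤ w (suc j)
        step j p q = ℕP.≤-trans (ℕP.*-monoˡ-≤ (w j) q) (steep j p)

        [1+t]^≤ : suc t ^ q′ ≤ t ^ e
        [1+t]^≤ = begin
          suc t ^ q′ ≤⟨ ℕP.^-monoˡ-≤ q′ (ℕP.≤-trans (ℕP.+-monoˡ-≤ t 0<t) (ℕP.≤-reflexive (≡.cong (_+_ t) (≡.sym (ℕP.+-identityʳ t))))) ⟩
          (2 * t) ^ q′ ≡⟨ *-^ 2 t q′ ⟩
          2 ^ q′ * t ^ q′ ≤⟨ ℕP.*-monoˡ-≤ (t ^ q′) 2^q′≤t ⟩
          t ^ e ∎

        -- V outgrows W: W(a₀^(ce)) ≤ V(a₀) < W((t + 1)^q′), hence a₀^(ce) < (t + 1)^q′ ≤ t^e, and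
        -- e-th roots are taken.
        aᶜ<t : a 0 ^ c < t
        aᶜ<t = ^-cancel-< e (ℕP.<-≤-trans (≡.subst (_< suc t ^ q′) (≡.sym (ℕP.^-*-assoc (a 0) c e)) (ℕP.≰⇒> λ le → ℕP.<⇒≱ V<W (begin
            W (suc t ^ q′) ≤⟨ W-mono (ℕP.≤-trans (n₁≤tʲ q′ (s≤s z≤n)) (ℕP.^-monoˡ-≤ q′ (ℕP.n≤1+n t))) le ⟩
            W (a 0 ^ (c * e)) ≤⟨ proj₂ (V-faster (c * e)) (a 0) (proj₁ p₃) ⟩
            V (a 0) ∎))) [1+t]^≤)

        h^≤t : suc h ^ (n + 2) ≤ t
        h^≤t = begin
          suc h ^ (n + 2) ≤⟨ ℕP.^-monoˡ-≤ (n + 2) 1+h≤ ⟩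
          (a 0 ^ 3) ^ (n + 2) ≡⟨ ℕP.^-*-assoc (a 0) 3 (n + 2) ⟩
          a 0 ^ c ≤⟨ ℕP.<⇒≤ aᶜ<t ⟩
          t ∎
          where
          1+h≤ : suc h ≤ a 0 ^ 3
          1+h≤ = begin
            suc h ≤⟨ ℕP.+-mono-≤ (ℕP.≤-trans (ℕP.*-mono-≤ 1≤a 1≤a) ℕP.≤-refl) h≤a² ⟩
            a 0 * a 0 + a 0 * a 0 ≡⟨ ≡.cong (_+_ (a 0 * a 0)) (≡.sym (ℕP.+-identityʳ _)) ⟩
            2 * (a 0 * a 0) ≤⟨ ℕP.*-monoˡ-≤ (a 0 * a 0) 2≤a₀ ⟩
            a 0 * (a 0 * a 0) ≡⟨ ≡.cong (λ x → a 0 * (a 0 * x)) (≡.sym (ℕP.*-identityʳ (a 0))) ⟩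
            a 0 ^ 3 ∎
            where 1≤a = ℕP.≤-trans (s≤s z≤n) 2≤a₀

        hⁿ≤t : suc h ^ n ≤ t
        hⁿ≤t = ℕP.≤-trans (pow-monoʳ (s≤s z≤n) (ℕP.m≤m+n n 2)) h^≤t

        h²≤t : suc h * suc h ≤ t
        h²≤t = ℕP.≤-trans (ℕP.≤-reflexive (≡.cong (suc h *_) (≡.sym (ℕP.*-identityʳ (suc h))))) (ℕP.≤-trans (pow-monoʳ (s≤s z≤n) (ℕP.m≤n+m 2 n)) h^≤t)

        h≤t : h ≤ t
        h≤t = ℕP.≤-trans (ℕP.≤-trans (ℕP.n≤1+n h) (ℕP.m≤m*n (suc h) (suc h))) h²≤t

        H = t ^ (q′ + 3)
        T = length (indices H h D n)
        R = A * H
        -- `free-window` takes T + 1 windows of length R; the outer `suc` makes the inequality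
        -- strict.
        ρ = suc (suc T * R)
        -- One step of j above the W-sums and one step below w(q′) ≤ V(a₀).
        ρV = w (suc j₂)
        0<j₂ : 0 < j₂
        0<j₂ = ℕP.≤-trans (s≤s z≤n) (ℕP.m≤n+m 1 (q + 2 * D′))

        1+H≤ : suc H ≤ t ^ (q′ + 4)
        1+H≤ = ℕP.≤-trans (pow-suc t (q′ + 3) 2≤t ℕP.≤-refl) (ℕP.≤-reflexive (≡.cong (t ^_) (≡.sym (ℕP.+-suc q′ 3))))

        tuples-H : ∀ k → length (tuplesUpTo H k) ≤ t ^ ((q′ + 4) * k)
        tuples-H k = ℕP.≤-trans (length-tuplesUpTo H k) (ℕP.≤-trans (ℕP.^-monoˡ-≤ k 1+H≤) (ℕP.≤-reflexive (ℕP.^-*-assoc t (q′ + 4) k)))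

        tuples-h : length (tuplesUpTo h n) ≤ t ^ 1
        tuples-h = pow-1 t (ℕP.≤-trans (length-tuplesUpTo h n) hⁿ≤t)

        ρ≤ : ρ ≤ t ^ e₁
        ρ≤ = pow-suc t ((suc ((q′ + 4) * D + 1)) + (1 + (q′ + 3))) 2≤t (pow-* t (suc ((q′ + 4) * D + 1)) (1 + (q′ + 3))
          (pow-suc t ((q′ + 4) * D + 1) 2≤t (ℕP.≤-trans (ℕP.≤-reflexive (length-cartesianProduct (tuplesUpTo H D) (tuplesUpTo h n))) (pow-* t ((q′ + 4) * D) 1 (tuples-H D) tuples-h)))
          (pow-* t 1 (q′ + 3) (pow-1 t (ℕP.≤-trans (ℕP.n≤1+n A) A≤t)) ℕP.≤-refl))

        -- Everything that a single step of j has to absorb, as a multiple of w(j). The inner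
        -- summand D stands for G, which is at most D w(j₂).
        Z = D * (2 * H * suc (D + 2 * ρ) + Yₘ) + ρ

        Z≤ : Z ≤ t ^ E
        Z≤ = pow-+ t (1 + suc (E₀ + 1)) e₁ 2≤t (pow-* t 1 (suc (E₀ + 1)) (pow-1 t D≤t) (pow-+ t E₀ 1 2≤t
          (pow-* t (1 + (q′ + 3)) (suc (suc (1 + (1 + e₁)))) (pow-* t 1 (q′ + 3) (pow-1 t 2≤t) ℕP.≤-refl)
            (pow-suc t (suc (1 + (1 + e₁))) 2≤t (pow-+ t 1 (1 + e₁) 2≤t (pow-1 t D≤t) (pow-* t 1 e₁ (pow-1 t 2≤t) ρ≤)))) (pow-1 t Yₘ≤t))) ρ≤

        1≤H : 1 ≤ H
        1≤H = pow-≥1 (q′ + 3) 0<t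

        HS≤Z : 2 * H * (D + suc (2 * ρ)) ≤ Z
        HS≤Z = begin
          2 * H * (D + suc (2 * ρ)) ≡⟨ ≡.cong (2 * H *_) (ℕP.+-suc D (2 * ρ)) ⟩
          2 * H * suc (D + 2 * ρ) ≤⟨ ℕP.m≤m+n _ Yₘ ⟩
          2 * H * suc (D + 2 * ρ) + Yₘ ≤⟨ ℕP.m≤n*m _ D ⟩
          D * (2 * H * suc (D + 2 * ρ) + Yₘ) ≤⟨ ℕP.m≤m+n _ ρ ⟩
          Z ∎

        D+ρ≤Z : D + ρ ≤ Z
        D+ρ≤Z = ℕP.+-monoˡ-≤ ρ (ℕP.≤-trans (ℕP.≤-reflexive (≡.sym (ℕP.*-identityʳ D))) (ℕP.*-monoʳ-≤ D (ℕP.≤-trans (ℕP.*-mono-≤ (ℕP.*-mono-≤ {1} {2} (s≤s z≤n) 1≤H) (s≤s {0} z≤n)) (ℕP.m≤m+n _ Yₘ))))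

        w-mono : ∀ {i j} → 0 < i → i ≤ j → w i ≤ w j
        w-mono {i} p q = W-mono (n₁≤tʲ i p) (pow-monoʳ 0<t q)

        -- Every second interval between powers of t is skipped, so that one application of `steep`
        -- lies between the end of a block and the start of the next.
        aw bw : ℕ → ℕ
        aw i = t ^ (q + 2 * i)
        bw i = t ^ (q + 2 * i + 1)

        module BW = Blocks W 0<n₁ gapW aw bw H (suc (2 * ρ))

        0<q+ : ∀ x → 0 < q + x
        0<q+ x = ℕP.≤-trans (s≤s z≤n) (ℕP.≤-trans (ℕP.m≤n+m 3 ((2 * D + 5) * D′)) (ℕP.m≤m+n q x))

        rangeW : ∀ i → BW.range (suc i) ≤ suc i * w (q + 2 * i + 1)
        rangeW zero = ℕP.≤-refl
        rangeW (suc i) = ℕP.+-monoʳ-≤ (w (q + 2 * suc i + 1)) (ℕP.≤-trans (rangeW i) (ℕP.*-monoʳ-≤ (suc i)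
          (w-mono (ℕP.≤-trans (0<q+ (2 * i)) (ℕP.m≤m+n _ 1)) (ℕP.+-monoˡ-≤ 1 (ℕP.+-monoʳ-≤ q (ℕP.*-monoʳ-≤ 2 (ℕP.n≤1+n i)))))))

        wide : ∀ i → i < D → 2 * H * (BW.range i + suc (2 * ρ)) ≤ w (q + 2 * i)
        wide zero _ = begin
          2 * H * suc (2 * ρ) ≤⟨ ℕP.*-monoʳ-≤ (2 * H) (ℕP.m≤n+m (suc (2 * ρ)) D) ⟩
          2 * H * (D + suc (2 * ρ)) ≤⟨ ℕP.≤-trans HS≤Z Z≤ ⟩
          t ^ E ≤⟨ ℕP.m≤m*n (t ^ E) (w (x + 2)) {{ℕ.>-nonZero (w-pos (x + 2) (ℕP.≤-trans (s≤s z≤n) (ℕP.m≤n+m 2 x)))}} ⟩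
          t ^ E * w (x + 2) ≤⟨ steep (x + 2) (ℕP.≤-trans (s≤s z≤n) (ℕP.m≤n+m 2 x)) ⟩
          w (suc (x + 2)) ≡⟨ ≡.cong w (shift x) ⟩
          w (q + 2 * 0) ∎
          where
          x = (2 * D + 5) * D′
          shift : ∀ x → suc (x + 2) ≡ x + 3 + 0
          shift = solve-∀
        wide (suc i) i<D = begin
          2 * H * (BW.range (suc i) + suc (2 * ρ)) ≤⟨ ℕP.*-monoʳ-≤ (2 * H) (ℕP.+-mono-≤ (ℕP.≤-trans (rangeW i) (ℕP.*-monoˡ-≤ (w j) (ℕP.<⇒≤ i<D))) (ℕP.m≤m*n (suc (2 * ρ)) (w j) {{ℕ.>-nonZero (w-pos j 0<j)}})) ⟩
          2 * H * (D * w j + suc (2 * ρ) * w j) ≡⟨ factor (2 * H) D (suc (2 * ρ)) (w j) ⟩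
          2 * H * (D + suc (2 * ρ)) * w j ≤⟨ step j 0<j (ℕP.≤-trans HS≤Z Z≤) ⟩
          w (suc j) ≡⟨ ≡.cong w (shift q i) ⟩
          w (q + 2 * suc i) ∎
          where
          j = q + 2 * i + 1
          0<j : 0 < j
          0<j = ℕP.≤-trans (0<q+ (2 * i)) (ℕP.m≤m+n _ 1)
          factor : ∀ h d r w → h * (d * w + r * w) ≡ h * (d + r) * w
          factor = solve-∀
          shift : ∀ q i → suc (q + 2 * i + 1) ≡ q + 2 * suc i
          shift = solve-∀

        validW : BW.Valid D
        validW i i<D = n₁≤tʲ (q + 2 * i) (0<q+ (2 * i)) , pow-monoʳ 0<t (ℕP.≤-trans (ℕP.+-monoˡ-≤ 1 (ℕP.+-monoʳ-≤ q (ℕP.*-monoʳ-≤ 2 (ℕP.≤-pred i<D))))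
          (ℕP.≤-trans (ℕP.m≤n+m j₂ 2) (ℕP.m≤m+n q′ 3))) , wide i i<D

        n₀≤aw : ∀ i → i < D → n₀ ≤ aw i
        n₀≤aw i _ = ℕP.≤-trans (ℕP.≤-trans (ℕP.n≤1+n n₀) (ℕP.≤-trans (ℕP.m≤n*m (suc n₀) 3) 3n₀≤t)) (ℕP.≤-trans (pow-1 t ℕP.≤-refl) (pow-monoʳ 0<t (0<q+ (2 * i))))

        FW = BW.family D validW n₀≤aw

        G = BW.range D
        G≤ : G ≤ D * w j₂
        G≤ = rangeW D′

        block-size : ∀ k → t ^ q ≤ bw k ∸ aw k
        block-size k = ℕP.≤-trans (pow-monoʳ 0<t (ℕP.m≤m+n q (2 * k))) (ℕP.m+n≤o⇒m≤o∸n (t ^ m) (begin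
          t ^ m + t ^ m ≡⟨ ≡.cong (_+_ (t ^ m)) (≡.sym (ℕP.+-identityʳ _)) ⟩
          2 * t ^ m ≤⟨ ℕP.*-monoˡ-≤ (t ^ m) 2≤t ⟩
          t ^ suc m ≡⟨ ≡.cong (t ^_) (ℕP.+-comm 1 m) ⟩
          t ^ (m + 1) ∎))
          where m = q + 2 * k

        countW-≥ : ∀ k → t ^ (q * k) ≤ BW.count k
        countW-≥ zero = ℕP.≤-reflexive (≡.cong (t ^_) (ℕP.*-zeroʳ q))
        countW-≥ (suc k) = ℕP.≤-trans (ℕP.≤-reflexive (≡.trans (≡.cong (t ^_) (ℕP.*-suc q k)) (ℕP.^-distribˡ-+-* t q (q * k)))) (ℕP.*-mono-≤ (block-size k) (countW-≥ k))

        countW : 3 * (suc n₀ * length (tuplesUpTo H D′)) * length (tuplesUpTo h n) < BW.count D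
        countW = begin-strict
          3 * (suc n₀ * length (tuplesUpTo H D′)) * length (tuplesUpTo h n) ≡⟨ ≡.cong (_* length (tuplesUpTo h n)) (≡.sym (ℕP.*-assoc 3 (suc n₀) (length (tuplesUpTo H D′)))) ⟩
          3 * suc n₀ * length (tuplesUpTo H D′) * length (tuplesUpTo h n) ≤⟨ pow-* t (1 + (q′ + 4) * D′) 1 (pow-* t 1 ((q′ + 4) * D′) (pow-1 t 3n₀≤t) (tuples-H D′)) tuples-h ⟩
          t ^ (1 + (q′ + 4) * D′ + 1) <⟨ ℕP.^-monoʳ-< t 2≤t (ℕP.≤-reflexive (degrees D′)) ⟩
          t ^ (q * D) ≤⟨ countW-≥ D ⟩
          BW.count D ∎
          where
          degrees : ∀ d → suc (1 + (2 + ((2 * suc d + 5) * d + 3 + 2 * d + 1) + 4) * d + 1) ≡ ((2 * suc d + 5) * d + 3) * suc d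
          degrees = solve-∀

        1≤w₂ = w-pos j₂ 0<j₂

        Y = 2 * H * suc (G + 2 * ρ) + Yₘ

        DY+ρ≤ρV : D * Y + ρ ≤ ρV
        DY+ρ≤ρV = begin
          D * (2 * H * suc (G + 2 * ρ) + Yₘ) + ρ
            ≤⟨ ℕP.+-mono-≤ (ℕP.*-monoʳ-≤ D (ℕP.+-mono-≤ (ℕP.*-monoʳ-≤ (2 * H) (ℕP.+-mono-≤ 1≤w₂ (ℕP.+-mono-≤ G≤ (up (2 * ρ))))) (up Yₘ))) (up ρ) ⟩
          D * (2 * H * (w j₂ + (D * w j₂ + 2 * ρ * w j₂)) + Yₘ * w j₂) + ρ * w j₂
            ≡⟨ factor D (2 * H) (w j₂) (2 * ρ) Yₘ ρ ⟩
          Z * w j₂ ≤⟨ step j₂ 0<j₂ Z≤ ⟩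
          ρV ∎
          where
          up : ∀ x → x ≤ x * w j₂
          up x = ℕP.m≤m*n x (w j₂) {{ℕ.>-nonZero 1≤w₂}}
          factor : ∀ d h w r y s → d * (h * (w + (d * w + r * w)) + y * w) + s * w ≡ (d * (h * suc (d + r) + y) + s) * w
          factor = solve-∀

        G+ρ≤ρV : G + ρ ≤ ρV
        G+ρ≤ρV = ℕP.≤-trans (ℕP.+-monoˡ-≤ ρ (ℕP.≤-trans (ℕP.≤-trans (ℕP.n≤1+n G) (ℕP.≤-trans (ℕP.m≤m+n (suc G) (2 * ρ)) (ℕP.m≤n*m _ (2 * H) {{ℕ.>-nonZero (ℕP.*-mono-≤ {1} {2} (s≤s z≤n) 1≤H)}})))
          (ℕP.≤-trans (ℕP.m≤m+n _ Yₘ) (ℕP.m≤n*m Y D)))) DY+ρ≤ρV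

        W≤ : w q′ ≤ V (a 0)
        W≤ = W≤V

        2≤E : 2 ≤ E
        2≤E = s≤s (s≤s z≤n)

        6h≤ : 6 * h ≤ t ^ E
        6h≤ = ℕP.≤-trans (ℕP.*-mono-≤ (ℕP.≤-trans (ℕP.m≤n+m 6 2) 8≤t) h≤t) (ℕP.≤-trans (ℕP.≤-reflexive (≡.cong (t *_) (≡.sym (ℕP.*-identityʳ t)))) (pow-monoʳ 0<t 2≤E))

        1≤ρV = w-pos (suc j₂) (s≤s z≤n)

        2hσ≤ : 2 * h * suc (2 * ρV) ≤ V (a 0)
        2hσ≤ = begin
          2 * h * suc (2 * ρV) ≤⟨ ℕP.*-monoʳ-≤ (2 * h) (ℕP.+-monoˡ-≤ (2 * ρV) 1≤ρV) ⟩
          2 * h * (ρV + 2 * ρV) ≡⟨ collect h ρV ⟩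
          6 * h * ρV ≤⟨ step (suc j₂) (s≤s z≤n) 6h≤ ⟩
          w q′ ≤⟨ W≤ ⟩
          V (a 0) ∎
          where
          collect : ∀ h r → 2 * h * (r + 2 * r) ≡ 6 * h * r
          collect = solve-∀

        σ≤ : suc (2 * ρV) ≤ V (a 0)
        σ≤ = ℕP.≤-trans (ℕP.m≤n*m (suc (2 * ρV)) (2 * h) {{ℕ.>-nonZero (ℕP.*-mono-≤ {1} {2} (s≤s z≤n) 1≤h)}}) 2hσ≤

        module BV = Blocks V 0<n₁ gapV a b h (suc (2 * ρV))

        Va₀≤Vb : ∀ i → i < K → V (a 0) ≤ V (b i)
        Va₀≤Vb i p = V-mono n₁≤a₀ (ℕP.≤-trans (a₀≤a i p) (a≤b i p))

        Vb-mono : ∀ i → suc i < K → V (b i) ≤ V (b (suc i))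
        Vb-mono i p = ℕP.≤-trans (ℕP.m≤n*m (V (b i)) (4 * (h * h)) {{ℕ.>-nonZero (ℕP.*-mono-≤ {1} {4} (s≤s z≤n) (ℕP.*-mono-≤ 1≤h 1≤h))}})
          (ℕP.≤-trans (spread i p) (V-mono (ℕP.≤-trans n₁≤a₀ (a₀≤a (suc i) p)) (a≤b (suc i) p)))

        rangeV : ∀ i → i < K → BV.range (suc i) ≤ suc i * V (b i)
        rangeV zero _ = ℕP.≤-refl
        rangeV (suc i) p = ℕP.+-monoʳ-≤ (V (b (suc i))) (ℕP.≤-trans (rangeV i (ℕP.<⇒≤ p)) (ℕP.*-monoʳ-≤ (suc i) (Vb-mono i p)))

        validV : BV.Valid K
        validV i i<K = ℕP.≤-trans n₁≤a₀ (a₀≤a i i<K) , b≤h i i<K , wideV i i<K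
          where
          wideV : ∀ i → i < K → 2 * h * (BV.range i + suc (2 * ρV)) ≤ V (a i)
          wideV zero _ = 2hσ≤
          wideV (suc i) p = begin
            2 * h * (BV.range (suc i) + suc (2 * ρV)) ≤⟨ ℕP.*-monoʳ-≤ (2 * h) (ℕP.+-mono-≤ (rangeV i (ℕP.<⇒≤ p)) (ℕP.≤-trans σ≤ (Va₀≤Vb i (ℕP.<⇒≤ p)))) ⟩
            2 * h * (suc i * V (b i) + V (b i)) ≡⟨ ≡.cong (2 * h *_) (ℕP.+-comm (suc i * V (b i)) (V (b i))) ⟩
            2 * h * (suc (suc i) * V (b i)) ≤⟨ ℕP.*-monoʳ-≤ (2 * h) (ℕP.*-monoˡ-≤ (V (b i)) (ℕP.≤-trans p (ℕP.≤-trans (ℕP.n≤1+n K) (ℕP.≤-trans (ℕP.m≤n*m (suc K) 2) (ℕP.≤-trans 2K≤h (ℕP.m≤n*m h 2)))))) ⟩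
            2 * h * (2 * h * V (b i)) ≡⟨ square h (V (b i)) ⟩
            4 * (h * h) * V (b i) ≤⟨ spread i p ⟩
            V (a (suc i)) ∎
            where
            square : ∀ h v → 2 * h * (2 * h * v) ≡ 4 * (h * h) * v
            square = solve-∀

        FV = BV.family K validV a₀≤a

        countV : length (tuplesUpTo h K′) < BV.count K
        countV = ℕP.≤-<-trans (length-tuplesUpTo h K′) (many BV.count ≡.refl (λ _ → ≡.refl))

        t^E≤Va₀ : t ^ E ≤ V (a 0)
        t^E≤Va₀ = ℕP.≤-trans (ℕP.m≤m*n (t ^ E) ρV {{ℕ.>-nonZero 1≤ρV}}) (ℕP.≤-trans (steep (suc j₂) (s≤s z≤n)) W≤)

        ρ≤V : ∀ i → ρ ≤ weight V (BV.choice K i)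
        ρ≤V i = ℕP.≤-trans (ℕP.≤-trans (ℕP.m≤n+m ρ D) (ℕP.≤-trans D+ρ≤Z (ℕP.≤-trans Z≤ t^E≤Va₀)))
          (weight-≥ {V} 0<n₁ gapV n₁≤a₀ (BV.choice K i) (ℕP.≤-trans (s≤s z≤n) (ℕP.≤-reflexive (≡.sym (BV.choice-length K i)))) (SeparatedFamily.entries≥ FV i))

        isolated-block : ∃ λ (B : IsolatedBlock W V D K n H h n₀ R) → IsolatedBlock.upper B ≤ BV.range K + ρV
        isolated-block = Isolation.isolated W V 0<n₁ gapW D′ K′ n H h n₀ R ρ ρV Y FW (ℕP.≤-trans 0<n₁ n₁≤a₀) FV ℕP.≤-refl countV countW G+ρ≤ρV
          (λ m p → ℕP.≤-trans (proj₂ (upper-bound W n₁) m p) (ℕP.m≤n+m Yₘ _)) (ℕP.m≤m+n _ Yₘ) DY+ρ≤ρV ρ≤V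

        Vb = V (b K′)
        N = suc K * Vb
        Va₀≤ : V (a 0) ≤ Vb
        Va₀≤ = Va₀≤Vb K′ ℕP.≤-refl

        upper-N : BV.range K + ρV ≤ N
        upper-N = ℕP.≤-trans (ℕP.+-mono-≤ (rangeV K′ ℕP.≤-refl) (ℕP.≤-trans (ℕP.≤-trans (ℕP.m≤m+n ρV _) (ℕP.n≤1+n _)) (ℕP.≤-trans σ≤ Va₀≤))) (ℕP.≤-reflexive (ℕP.+-comm (K * Vb) Vb))

        8N≤Vh : 8 * N ≤ V h
        8N≤Vh = begin
          8 * (suc K * Vb) ≡⟨ regroup (suc K) Vb ⟩
          4 * (2 * suc K) * Vb ≤⟨ ℕP.*-monoˡ-≤ Vb (ℕP.*-monoʳ-≤ 4 (ℕP.≤-trans 2K≤h (ℕP.m≤m*n h h {{ℕ.>-nonZero 1≤h}}))) ⟩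
          4 * (h * h) * Vb ≤⟨ last K′ ≡.refl ⟩
          V h ∎
          where
          regroup : ∀ k v → 8 * (k * v) ≡ 4 * (2 * k) * v
          regroup = solve-∀

        -- By `flat`, V(h) is up to a constant at most V(a₀)^(1 + 1/e) ≤ w(e)^(1 + 1/e), which
        -- `W-convex` bounds by w(e + 1), again up to a constant. The constants together are at most
        -- 8, and `steep` absorbs them: 8 w(e + 1) ≤ w(e + 2) = W(H).
        Vh≤WH : V h ≤ W H
        Vh≤WH = ℕP.≤-trans (^-cancel-≤ e (s≤s z≤n) root) (ℕP.≤-trans (step (suc e) (s≤s z≤n) (ℕP.≤-trans 8≤t (ℕP.≤-trans (pow-1 t ℕP.≤-refl) (pow-monoʳ 0<t (ℕP.<⇒≤ 2≤E)))))
            (ℕP.≤-reflexive (≡.cong w (ℕP.+-comm 3 q′))))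
          where
          Va₀≤we : V (a 0) ≤ w e
          Va₀≤we = ℕP.≤-trans (ℕP.<⇒≤ V<W) (W-mono (ℕP.≤-trans (n₁≤tʲ q′ (s≤s z≤n)) (ℕP.^-monoˡ-≤ q′ (ℕP.n≤1+n t))) [1+t]^≤)
          root : V h ^ e ≤ (8 * w (suc e)) ^ e
          root = begin
            V h ^ e ≤⟨ flat ⟩
            2 ^ suc e * V (a 0) ^ suc e ≤⟨ ℕP.*-monoʳ-≤ (2 ^ suc e) (ℕP.^-monoˡ-≤ (suc e) Va₀≤we) ⟩
            2 ^ suc e * w e ^ suc e ≤⟨ ℕP.*-monoʳ-≤ (2 ^ suc e) (proj₂ W-convex t (proj₁ r₂) e (s≤s z≤n)) ⟩
            2 ^ suc e * (2 ^ e * w (suc e) ^ e) ≡⟨ ≡.trans (≡.sym (ℕP.*-assoc (2 ^ suc e) (2 ^ e) _)) (≡.cong (_* w (suc e) ^ e) (≡.sym (ℕP.^-distribˡ-+-* 2 (suc e) e))) ⟩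
            2 ^ (suc e + e) * w (suc e) ^ e ≤⟨ ℕP.*-monoˡ-≤ (w (suc e) ^ e) (pow-monoʳ (s≤s z≤n) 2e+1≤3e) ⟩
            2 ^ (3 * e) * w (suc e) ^ e ≡⟨ ≡.cong (_* w (suc e) ^ e) (≡.sym (ℕP.^-*-assoc 2 3 e)) ⟩
            8 ^ e * w (suc e) ^ e ≡⟨ ≡.sym (*-^ 8 (w (suc e)) e) ⟩
            (8 * w (suc e)) ^ e ∎
            where
            2e+1≤3e : suc e + e ≤ 3 * e
            2e+1≤3e = ℕP.≤-trans (ℕP.+-monoˡ-≤ (e + e) {1} {e} (s≤s z≤n)) (ℕP.≤-reflexive (≡.cong (λ x → e + (e + x)) (≡.sym (ℕP.+-identityʳ e))))

        t≤H : t ≤ H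
        t≤H = ℕP.≤-trans (pow-1 t ℕP.≤-refl) (pow-monoʳ 0<t (ℕP.≤-trans (s≤s z≤n) (ℕP.m≤n+m 3 q′)))

        8N : N ≤ 8 * N
        8N = ℕP.m≤n*m N 8

        result : Isolable W V D K n n₀ A H₀
        result = record
          { H = H ; h = h ; N = N ; H₀≤h = H₀≤h′ ; h≤H = ℕP.≤-trans h≤t t≤H
          ; block = proj₁ isolated-block
          ; upper≤ = ℕP.≤-trans (proj₂ isolated-block) upper-N
          ; 8N≤W = ℕP.≤-trans 8N≤Vh Vh≤WH ; 8N≤V = 8N≤Vh
          ; ≤N = begin
              A * H + H ≡⟨ ℕP.+-comm (A * H) H ⟩
              suc A * H ≤⟨ pow-* t 1 (q′ + 3) (pow-1 t A≤t) ℕP.≤-refl ⟩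
              t ^ (1 + (q′ + 3)) ≤⟨ pow-monoʳ 0<t (ℕP.≤-trans (ℕP.m≤n+m (1 + (q′ + 3)) (suc ((q′ + 4) * D + 1))) (ℕP.≤-trans (ℕP.n≤1+n _) (ℕP.≤-trans (ℕP.m≤n+m e₁ (1 + suc (E₀ + 1))) (ℕP.n≤1+n _)))) ⟩
              t ^ E ≤⟨ t^E≤Va₀ ⟩
              V (a 0) ≤⟨ Va₀≤ ⟩
              Vb ≤⟨ ℕP.m≤n*m Vb (suc K) ⟩
              N ∎
          ; N≤2^ = begin
              N ≤⟨ ℕP.≤-trans 8N 8N≤Vh ⟩
              V h ≤⟨ proj₂ (proj₂ V-slow) h (ℕP.≤-trans (proj₁ p₄) a₀≤h) ⟩
              2 ^ (proj₁ V-slow * h) ≤⟨ pow-monoʳ (s≤s z≤n) (ℕP.≤-trans (ℕP.*-monoˡ-≤ h k≤h) (ℕP.≤-trans (ℕP.*-mono-≤ (ℕP.n≤1+n h) (ℕP.n≤1+n h)) (ℕP.≤-trans h²≤t t≤H))) ⟩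
              2 ^ H ∎
          }

      -- The V-blocks come first, for K, e and a threshold; t is then found by locating V(a₀) among
      -- the values W(t^q′).
      isolate : Isolable W V D K n n₀ A H₀
      isolate = Sizes.result SB (proj₁ cross) (proj₁ (proj₂ cross)) (proj₁ (proj₂ (proj₂ cross))) (proj₂ (proj₂ (proj₂ cross)))
        where
        SB = V-blocks K e s₀ (s≤s z≤n) (s≤s z≤n)
        open SpreadBlocks SB using (a; s₀≤a)
        y = V (a 0)
        n₁≤t₀ : n₁ ≤ t₀
        n₁≤t₀ = ℕP.≤-trans (ℕP.≤-trans (ℕP.m≤m+n n₁ _) (ℕP.m≤n+m _ (proj₁ W-convex))) (ℕP.m≤n+m _ (proj₁ (W-steep E)))
        n₁≤^ : ∀ {t} j → t₀ ≤ t → n₁ ≤ t ^ suc j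
        n₁≤^ {t} j p = ℕP.≤-trans (ℕP.≤-trans n₁≤t₀ p) (ℕP.m≤m*n t (t ^ j) {{ℕ.>-nonZero (pow-≥1 j (ℕP.≤-trans 0<n₁ (ℕP.≤-trans n₁≤t₀ p)))}})
        t₀≤a : t₀ ≤ a 0
        t₀≤a = ℕP.≤-trans (ℕP.m≤m+n t₀ _) s₀≤a
        below : W (t₀ ^ q′) ≤ y
        below = ℕP.≤-trans (gap-mono {W} 0<n₁ gapW (n₁≤^ (suc j₂) ℕP.≤-refl) (ℕP.^-monoˡ-≤ q′ t₀≤a))
          (proj₂ (V-faster q′) (a 0) (ℕP.≤-trans (ℕP.≤-trans (ℕP.m≤m+n _ _) (ℕP.m≤n+m _ t₀)) s₀≤a))
        above : ∀ t → t₀ ≤ t → t ≤ W (t ^ q′)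
        above t p = ℕP.≤-trans (ℕP.≤-trans (ℕP.m≤m*n t (t ^ ((1 + suc (E₀ + 1)) + e₁)) {{ℕ.>-nonZero (pow-≥1 ((1 + suc (E₀ + 1)) + e₁) 0<t)}}) (ℕP.m≤m*n (t ^ E) (W (t ^ suc j₂)) {{ℕ.>-nonZero (W-pos (t ^ suc j₂) (n₁≤^ j₂ p))}}))
          (proj₂ (W-steep E) t (ℕP.≤-trans (ℕP.m≤m+n _ _) p) (suc j₂) (s≤s z≤n))
          where 0<t = ℕP.≤-trans 0<n₁ (ℕP.≤-trans n₁≤t₀ p)
        cross : ∃ λ t → t₀ ≤ t × W (t ^ q′) ≤ y × y < W (suc t ^ q′)
        cross = crossing (λ t → W (t ^ q′)) y t₀ (suc y) below (ℕP.≤-trans (ℕP.m≤n+m (suc y) t₀) (above (t₀ + suc y) (ℕP.m≤m+n t₀ _)))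

  -- Rounding estimates and grids of indices for V

  module Grids where
    open import Data.Nat.Base using (_+_; _*_; _^_; _∸_; _≤_; _<_; z≤n; s≤s)
    open ℕP.≤-Reasoning
    open Naturals
    open ParameterChoice

    -- The hypothesis is a growth by (1 + 1/n)² as it survives rounding. Since (n + 1)² > n(n + 2),
    -- it yields the factor 1 + 2/n. The conclusion asks for 1 + 1/(2n) only, and by n ≤ w the rest
    -- pays for the rounding.
    gap-arithmetic : ∀ n w w′ → 0 < n → n ≤ w → suc n * suc n * w ≤ n * n * suc w′ → suc (2 * n) * w ≤ 2 * n * w′
    gap-arithmetic n@(suc _) w w′ _ n≤w h = ℕP.+-cancelˡ-≤ (2 * n) _ _ (begin
      2 * n + suc (2 * n) * w ≤⟨ ℕP.+-monoˡ-≤ _ (ℕP.*-monoʳ-≤ 2 n≤w) ⟩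
      2 * w + suc (2 * n) * w ≤⟨ ℕP.m≤m+n _ w ⟩
      2 * w + suc (2 * n) * w + w ≡⟨ double n w ⟩
      2 * ((n + 2) * w) ≤⟨ ℕP.*-monoʳ-≤ 2 (ℕP.*-cancelˡ-≤ n (ℕP.≤-trans (ℕP.≤-trans (ℕP.m≤m+n _ w) (ℕP.≤-reflexive (square n w)))
                                            (ℕP.≤-trans h (ℕP.≤-reflexive (ℕP.*-assoc n n (suc w′)))))) ⟩
      2 * (n * suc w′) ≡⟨ expand n w′ ⟩
      2 * n + 2 * n * w′ ∎)
      where
      double : ∀ n w → 2 * w + suc (2 * n) * w + w ≡ 2 * ((n + 2) * w)
      double = solve-∀
      square : ∀ n w → n * ((n + 2) * w) + w ≡ suc n * suc n * w
      square = solve-∀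
      expand : ∀ n w → 2 * (n * suc w) ≡ 2 * n + 2 * n * w
      expand = solve-∀

    -- One half of w pays for M, the other for c + 2n. There one n is used up by u(n) ≤ β^n, the
    -- other makes the tail a geometric series, and c pays for its sum.
    tail-exponent : ∀ M c n w → 4 + 2 * c ≤ n → 4 * M ≤ w → n * n ≤ w → M + c + 2 * n ≤ w
    tail-exponent M c n w n-large 4M≤w n²≤w = ℕP.*-cancelˡ-≤ 2 (begin
      2 * (M + c + 2 * n) ≡⟨ split M c n ⟩
      2 * M + (4 * n + 2 * c * 1) ≤⟨ ℕP.+-mono-≤ (ℕP.*-monoˡ-≤ M {2} {4} (s≤s (s≤s z≤n))) (ℕP.+-monoʳ-≤ (4 * n) (ℕP.*-monoʳ-≤ (2 * c) (ℕP.≤-trans (s≤s z≤n) n-large))) ⟩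
      4 * M + (4 * n + 2 * c * n) ≡⟨ ≡.cong (_+_ (4 * M)) (≡.sym (ℕP.*-distribʳ-+ n 4 (2 * c))) ⟩
      4 * M + (4 + 2 * c) * n ≤⟨ ℕP.+-mono-≤ 4M≤w (ℕP.≤-trans (ℕP.*-monoˡ-≤ n n-large) n²≤w) ⟩
      w + w ≡⟨ ≡.cong (_+_ w) (≡.sym (ℕP.+-identityʳ w)) ⟩
      2 * w ∎)
      where
      split : ∀ M c n → 2 * (M + c + 2 * n) ≡ 2 * M + (4 * n + 2 * c * 1)
      split = solve-∀

    4q²s² : ∀ q s → 4 * ((q * s) * (q * s)) ≡ 4 * (q * q) * (s * s)
    4q²s² = solve-∀

    -- (p + D) e = p (e + 1) for p = D e.
    flat-product : ∀ D e s → (D * e + D) * s * e ≡ D * e * s * suc e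
    flat-product = solve-∀

    -- p + 2i, by recursion, so that the grid point where block i + 1 starts is by computation the
    -- successor of the one where block i ends.
    raise : ℕ → ℕ → ℕ
    raise p zero = p
    raise p (suc i) = suc (suc (raise p i))

    raise-≡ : ∀ p i → raise p i ≡ p + 2 * i
    raise-≡ p zero = ≡.sym (ℕP.+-identityʳ p)
    raise-≡ p (suc i) = ≡.trans (≡.cong (λ k → suc (suc k)) (raise-≡ p i)) (lemma p i)
      where
      lemma : ∀ p i → suc (suc (p + 2 * i)) ≡ p + 2 * suc i
      lemma = solve-∀

    raise-mono : ∀ p {i j} → i ≤ j → raise p i ≤ raise p j
    raise-mono p {i} {j} q = begin
      raise p i ≡⟨ raise-≡ p i ⟩
      p + 2 * i ≤⟨ ℕP.+-monoʳ-≤ p (ℕP.*-monoʳ-≤ 2 q) ⟩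
      p + 2 * j ≡⟨ ≡.sym (raise-≡ p j) ⟩
      raise p j ∎

    -- Blocks [x_{p+2i}, x_{p+2i+1}) cut out by an increasing sequence x.
    grid-blocks : ∀ (V x : ℕ → ℕ) K p m e s₀ → let h = x (raise p K) in
      s₀ ≤ x p → (∀ j → p ≤ j → m + x j ≤ x (suc j)) →
      (∀ j → p ≤ j → 4 * (h * h) * V (x j) ≤ V (x (suc j))) →
      suc h ^ (K ∸ 1) < m ^ K → h ≤ x p * x p → V h ^ e ≤ 2 ^ suc e * V (x p) ^ suc e →
      SpreadBlocks V K e s₀
    grid-blocks V x K p m e s₀ s₀≤ wide steep many′ h≤ flat′ = record
      { a = λ i → x (raise p i) ; b = λ i → x (suc (raise p i)) ; h = x (raise p K)
      ; s₀≤a = s₀≤ ; a₀≤a = λ i _ → mono (p≤raise 0) (p≤raise i)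
      ; a≤b = λ i _ → step (p≤raise i) ; b≤h = λ i i<K → mono (ℕP.m≤n⇒m≤1+n (p≤raise i)) (ℕP.≤-trans (ℕP.n≤1+n _) (raise-mono p i<K))
      ; spread = λ i _ → steep _ (ℕP.m≤n⇒m≤1+n (p≤raise i))
      ; last = λ { i ≡.refl → steep _ (ℕP.m≤n⇒m≤1+n (p≤raise i)) }
      ; many = λ c c₀ c₊ → ℕP.<-≤-trans many′ (product c c₀ c₊ K)
      ; h≤a² = h≤ ; flat = flat′ }
      where
      p≤raise : ∀ i → p ≤ raise p i
      p≤raise i = raise-mono p {0} {i} z≤n
      step : ∀ {j} → p ≤ j → x j ≤ x (suc j)
      step {j} q = ℕP.≤-trans (ℕP.m≤n+m (x j) m) (wide j q)
      mono : ∀ {i j} → p ≤ i → i ≤ j → x i ≤ x j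
      mono {i} {j} q r = ≡.subst (λ k → x i ≤ x k) (ℕP.m+[n∸m]≡n r) (go (j ∸ i))
        where
        go : ∀ k → x i ≤ x (i + k)
        go zero = ℕP.≤-reflexive (≡.cong x (≡.sym (ℕP.+-identityʳ i)))
        go (suc k) = ℕP.≤-trans (go k) (ℕP.≤-trans (step (ℕP.≤-trans q (ℕP.m≤m+n i k))) (ℕP.≤-reflexive (≡.cong x (≡.sym (ℕP.+-suc i k)))))
      product : ∀ (c : ℕ → ℕ) → c 0 ≡ 1 → (∀ i → c (suc i) ≡ (x (suc (raise p i)) ∸ x (raise p i)) * c i) → ∀ i → m ^ i ≤ c i
      product c c₀ c₊ zero = ℕP.≤-reflexive (≡.sym c₀)
      product c c₀ c₊ (suc i) = ℕP.≤-trans (ℕP.*-mono-≤ (ℕP.m+n≤o⇒m≤o∸n m (wide _ (p≤raise i))) (product c c₀ c₊ i)) (ℕP.≤-reflexive (≡.sym (c₊ i)))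

    -- In the grids of powers and of multiples of s, p is large compared with K,
    -- and s large compared with p.
    geometric-blocks : ∀ V k p s e s₀ → let q = raise p (suc k) in
      s₀ ≤ s → 2 ≤ s → 2 * (k * k) + 3 * k + 2 ≤ p →
      (∀ j → 0 < j → s ^ (2 + (q + q)) * V (s ^ j) ≤ V (s ^ suc j)) →
      V (s ^ q) ^ e ≤ 2 ^ suc e * V (s ^ p) ^ suc e →
      SpreadBlocks V (suc k) e s₀
    geometric-blocks V k p s e s₀ s₀≤s 2≤s p-large steep = grid-blocks V (s ^_) (suc k) p (s ^ p) e s₀
      (ℕP.≤-trans s₀≤s (ℕP.≤-trans (pow-1 s ℕP.≤-refl) (pow-monoʳ 0<s 1≤p)))
      (λ j p≤j → begin
        s ^ p + s ^ j ≤⟨ ℕP.+-mono-≤ (pow-monoʳ 0<s p≤j) (ℕP.≤-reflexive (≡.sym (ℕP.+-identityʳ _))) ⟩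
        2 * s ^ j ≤⟨ ℕP.*-monoˡ-≤ (s ^ j) 2≤s ⟩
        s ^ suc j ∎)
      (λ j p≤j → ℕP.≤-trans (ℕP.*-monoˡ-≤ (V (s ^ j)) (pow-* s 2 (q + q) (ℕP.*-mono-≤ 2≤s (ℕP.≤-trans 2≤s (pow-1 s ℕP.≤-refl))) (pow-* s q q ℕP.≤-refl ℕP.≤-refl)))
        (steep j (ℕP.≤-trans 1≤p p≤j)))
      (begin-strict
        suc (s ^ q) ^ k ≤⟨ ℕP.^-monoˡ-≤ k (pow-suc s q 2≤s ℕP.≤-refl) ⟩
        (s ^ suc q) ^ k ≡⟨ ℕP.^-*-assoc s (suc q) k ⟩
        s ^ (suc q * k) <⟨ ℕP.^-monoʳ-< s 2≤s exponents ⟩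
        s ^ (p * suc k) ≡⟨ ≡.sym (ℕP.^-*-assoc s p (suc k)) ⟩
        (s ^ p) ^ suc k ∎)
      (ℕP.≤-trans (pow-monoʳ 0<s q≤2p) (ℕP.≤-reflexive (ℕP.^-distribˡ-+-* s p p)))
      where
      q = raise p (suc k)
      0<s = ℕP.≤-trans (s≤s z≤n) 2≤s
      1≤p : 1 ≤ p
      1≤p = ℕP.≤-trans (ℕP.≤-trans (s≤s z≤n) (ℕP.m≤n+m 2 (2 * (k * k) + 3 * k))) p-large
      2k+2≤p : 2 * suc k ≤ p
      2k+2≤p = ℕP.≤-trans (ℕP.≤-trans (ℕP.m≤m+n _ (2 * (k * k) + k)) (ℕP.≤-reflexive (lemma k))) p-large
        where
        lemma : ∀ k → 2 * suc k + (2 * (k * k) + k) ≡ 2 * (k * k) + 3 * k + 2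
        lemma = solve-∀
      q≤2p : q ≤ p + p
      q≤2p = ℕP.≤-trans (ℕP.≤-reflexive (raise-≡ p (suc k))) (ℕP.+-monoʳ-≤ p 2k+2≤p)
      -- (q + 1)k = pk + 2k² + 3k, whence the lower bound for p.
      exponents : suc q * k < p * suc k
      exponents = begin-strict
        suc q * k ≡⟨ ≡.cong (λ q → suc q * k) (raise-≡ p (suc k)) ⟩
        suc (p + 2 * suc k) * k ≡⟨ lemma p k ⟩
        p * k + (2 * (k * k) + 3 * k) <⟨ ℕP.+-monoʳ-< (p * k) (ℕP.<-≤-trans (ℕP.m<m+n _ (s≤s z≤n)) p-large) ⟩
        p * k + p ≡⟨ ≡.trans (ℕP.+-comm (p * k) p) (≡.sym (ℕP.*-suc p k)) ⟩
        p * suc k ∎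
        where
        lemma : ∀ p k → suc (p + 2 * suc k) * k ≡ p * k + (2 * (k * k) + 3 * k)
        lemma = solve-∀

    -- For V(n) near r^n. Over a grid of powers of s, log V would grow by the factor s^(q - p) from
    -- a₀ to h, and `flat` would fail; over multiples of s it grows by the factor q/p only.
    arithmetic-blocks : ∀ V k p s e s₀ → let q = raise p (suc k) in
      s₀ ≤ s → 2 ≤ s → 2 * suc k ≤ p → suc q ^ k < s →
      (∀ j → 0 < j → 4 * ((q * s) * (q * s)) * V (j * s) ≤ V (suc j * s)) →
      V (q * s) ^ e ≤ 2 ^ suc e * V (p * s) ^ suc e →
      SpreadBlocks V (suc k) e s₀
    arithmetic-blocks V k p s e s₀ s₀≤s 2≤s 2K≤p s-large steep = grid-blocks V (_* s) (suc k) p s e s₀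
      (ℕP.≤-trans s₀≤s (ℕP.≤-trans (ℕP.≤-reflexive (≡.sym (ℕP.*-identityˡ s))) (ℕP.*-monoˡ-≤ s 1≤p)))
      (λ j _ → ℕP.≤-refl)
      (λ j p≤j → steep j (ℕP.≤-trans 1≤p p≤j))
      (begin-strict
        suc (q * s) ^ k ≤⟨ ℕP.^-monoˡ-≤ k (ℕP.+-monoˡ-≤ (q * s) 0<s) ⟩
        (suc q * s) ^ k ≡⟨ *-^ (suc q) s k ⟩
        suc q ^ k * s ^ k <⟨ ℕP.*-monoˡ-< (s ^ k) {{ℕ.>-nonZero (pow-≥1 k 0<s)}} s-large ⟩
        s * s ^ k ∎)
      (begin
        q * s ≤⟨ ℕP.*-monoˡ-≤ s q≤2p ⟩
        2 * p * s ≤⟨ ℕP.*-mono-≤ (ℕP.*-mono-≤ 2≤s (ℕP.≤-refl {p})) (ℕP.≤-trans (ℕP.≤-reflexive (≡.sym (ℕP.*-identityˡ s))) (ℕP.*-monoˡ-≤ s 1≤p)) ⟩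
        s * p * (p * s) ≡⟨ ≡.cong (_* (p * s)) (ℕP.*-comm s p) ⟩
        p * s * (p * s) ∎)
      where
      q = raise p (suc k)
      0<s = ℕP.≤-trans (s≤s z≤n) 2≤s
      1≤p = ℕP.≤-trans (s≤s z≤n) 2K≤p
      q≤2p : q ≤ 2 * p
      q≤2p = ℕP.≤-trans (ℕP.≤-reflexive (raise-≡ p (suc k))) (ℕP.≤-trans (ℕP.+-monoʳ-≤ p 2K≤p) (ℕP.≤-reflexive (≡.cong (_+_ p) (≡.sym (ℕP.+-identityʳ p)))))

  open Analysis lem ℝ-field
  open Naturals
  open Combinatorics using (Index; weight; total-exponent; indices; prepend; tuples; tuplesUpTo; length-tuplesUpTo; length-cartesianProduct; ∈-tuples⁻; ∈-tuplesUpTo⁻; IsolatedBlock; ∈-tuplesUpTo; module IsolatedBlock; Gap; gap-mono)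
  open ParameterChoice using (Growth; Isolable; module Choose; module Isolable; upper-bound; Eventually; SpreadBlocks; pow-≥1; pow-monoʳ; pow-1)
  open Grids using (gap-arithmetic; tail-exponent; 4q²s²; flat-product; raise; raise-≡; raise-mono; geometric-blocks; arithmetic-blocks)

  open RingKit commutativeRing public
  open RingLaws commutativeRing public
    renaming (refl to ≈-refl; sym to ≈-sym; trans to ≈-trans; reflexive to ≈-reflexive)
  open import Algebra.Construct.NaturalChoice.Max totalOrder public
    using (⊔-lub; x≤x⊔y; x≤y⊔x; ⊔-cong; ⊔-sel)

  -- Order and chains of inequalities in the real numbers

  ≤-refl : ∀ {x} → x ≤ x
  ≤-refl = TotalOrder.refl totalOrder

  ≈⇒≤ : ∀ {x y} → x ≈ y → x ≤ y
  ≈⇒≤ = TotalOrder.reflexive totalOrder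

  ≤-trans : ∀ {x y z} → x ≤ y → y ≤ z → x ≤ z
  ≤-trans = TotalOrder.trans totalOrder

  antisym : ∀ {x y} → x ≤ y → y ≤ x → x ≈ y
  antisym = TotalOrder.antisym totalOrder

  total : ∀ x y → x ≤ y ⊎ y ≤ x
  total = TotalOrder.total totalOrder

  ≤-respˡ-≈ : ∀ {x y z} → x ≈ y → x ≤ z → y ≤ z
  ≤-respˡ-≈ e p = ≤-trans (≈⇒≤ (≈-sym e)) p

  ≤-respʳ-≈ : ∀ {x y z} → x ≈ y → z ≤ x → z ≤ y
  ≤-respʳ-≈ e p = ≤-trans p (≈⇒≤ e)

  <⇒≤ : ∀ {x y} → x < y → x ≤ y
  <⇒≤ = proj₁

  <-≤-trans : ∀ {x y z} → x < y → y ≤ z → x < z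
  <-≤-trans (x≤y , x≉y) y≤z = ≤-trans x≤y y≤z , λ x≈z → x≉y (antisym x≤y (≤-trans y≤z (≈⇒≤ (≈-sym x≈z))))

  ≤-<-trans : ∀ {x y z} → x ≤ y → y < z → x < z
  ≤-<-trans x≤y (y≤z , y≉z) = ≤-trans x≤y y≤z , λ x≈z → y≉z (antisym y≤z (≤-trans (≈⇒≤ (≈-sym x≈z)) x≤y))

  infix 1 begin_ begin-strict_ begin-equality_
  infixr 2 step-≈ step-≡ step-≤ step-<
  infix 3 _∎
  infix 4 _⊴_

  data _⊴_ (x y : ℝ) : Set where
    equally : x ≈ y → x ⊴ y
    weakly : x ≤ y → x ⊴ y
    strictly : x < y → x ⊴ y

  Equality Strictness : ∀ {x y} → x ⊴ y → Set
  Equality (equally _) = ⊤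
  Equality _ = ⊥
  Strictness (strictly _) = ⊤
  Strictness _ = ⊥

  begin_ : ∀ {x y} → x ⊴ y → x ≤ y
  begin equally e = ≈⇒≤ e
  begin weakly p = p
  begin strictly p = <⇒≤ p

  begin-equality_ : ∀ {x y} (r : x ⊴ y) → {Equality r} → x ≈ y
  begin-equality equally e = e

  begin-strict_ : ∀ {x y} (r : x ⊴ y) → {Strictness r} → x < y
  begin-strict strictly p = p

  step-≈ : ∀ x {y z} → y ⊴ z → x ≈ y → x ⊴ z
  step-≈ x (equally q) p = equally (≈-trans p q)
  step-≈ x (weakly q) p = weakly (≤-trans (≈⇒≤ p) q)
  step-≈ x (strictly q) p = strictly (≤-<-trans (≈⇒≤ p) q)

  step-≡ : ∀ x {y z} → y ⊴ z → x ≡ y → x ⊴ z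
  step-≡ x r p = step-≈ x r (≈-reflexive p)

  step-≤ : ∀ x {y z} → y ⊴ z → x ≤ y → x ⊴ z
  step-≤ x (equally q) p = weakly (≤-trans p (≈⇒≤ q))
  step-≤ x (weakly q) p = weakly (≤-trans p q)
  step-≤ x (strictly q) p = strictly (≤-<-trans p q)

  step-< : ∀ x {y z} → y ⊴ z → x < y → x ⊴ z
  step-< x (equally q) p = strictly (<-≤-trans p (≈⇒≤ q))
  step-< x (weakly q) p = strictly (<-≤-trans p q)
  step-< x (strictly q) p = strictly (<-≤-trans p (<⇒≤ q))

  syntax step-≈ x r p = x ≈⟨ p ⟩ r
  syntax step-≡ x r p = x ≡⟨ p ⟩ r
  syntax step-≤ x r p = x ≤⟨ p ⟩ r
  syntax step-< x r p = x <⟨ p ⟩ r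

  _∎ : ∀ x → x ⊴ x
  x ∎ = equally ≈-refl

  <-trans : ∀ {x y z} → x < y → y < z → x < z
  <-trans p q = <-≤-trans p (<⇒≤ q)

  <⇒≱ : ∀ {x y} → x < y → ¬ y ≤ x
  <⇒≱ (x≤y , x≉y) y≤x = x≉y (antisym x≤y y≤x)

  <-irrefl : ∀ {x} → ¬ x < x
  <-irrefl p = <⇒≱ p ≤-refl

  ≰⇒> : ∀ {x y} → ¬ x ≤ y → y < x
  ≰⇒> {x} {y} x≰y with total x y
  ... | inj₁ x≤y = ⊥-elim (x≰y x≤y)
  ... | inj₂ y≤x = y≤x , λ y≈x → x≰y (≈⇒≤ (≈-sym y≈x))

  ≤-or-> : ∀ x y → x ≤ y ⊎ y < x
  ≤-or-> x y with lem {x ≤ y}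
  ... | yes p = inj₁ p
  ... | no p = inj₂ (≰⇒> p)

  ≮⇒≥ : ∀ {x y} → ¬ x < y → y ≤ x
  ≮⇒≥ {x} {y} x≮y with ≤-or-> y x
  ... | inj₁ p = p
  ... | inj₂ p = ⊥-elim (x≮y p)

  <-respˡ : ∀ {x y z} → x ≈ y → x < z → y < z
  <-respˡ e p = ≤-<-trans (≈⇒≤ (≈-sym e)) p

  <-respʳ : ∀ {x y z} → x ≈ y → z < x → z < y
  <-respʳ e p = <-≤-trans p (≈⇒≤ e)

  +-monoʳ-≤ : ∀ z {x y} → x ≤ y → z + x ≤ z + y
  +-monoʳ-≤ z {x} {y} p = begin z + x ≈⟨ +-comm z x ⟩ x + z ≤⟨ +-monoˡ-≤ z p ⟩ y + z ≈⟨ +-comm y z ⟩ z + y ∎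

  +-mono-≤ : ∀ {x y u v} → x ≤ y → u ≤ v → x + u ≤ y + v
  +-mono-≤ p q = ≤-trans (+-monoˡ-≤ _ p) (+-monoʳ-≤ _ q)

  ≤⇒0≤- : ∀ {x y} → x ≤ y → 0# ≤ y - x
  ≤⇒0≤- {x} {y} p = ≤-respˡ-≈ (-‿inverseʳ x) (+-monoˡ-≤ (- x) p)

  -- The standard way to prove an inequality below: the ring solver identifies the difference of the
  -- sides with an expression known to be nonnegative.
  by≤ : ∀ {x y c} → 0# ≤ c → y - x ≈ c → x ≤ y
  by≤ {x} {y} {c} p e = begin
    x ≈⟨ ≈-sym (+-identityˡ x) ⟩
    0# + x ≤⟨ +-monoˡ-≤ x p ⟩
    c + x ≈⟨ +-congʳ (≈-sym e) ⟩
    (y - x) + x ≈⟨ solve 2 (λ x y → (y :- x) :+ x := y) ≈-refl x y ⟩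
    y ∎

  0≤-⇒≤ : ∀ {x y} → 0# ≤ y - x → x ≤ y
  0≤-⇒≤ p = by≤ p ≈-refl

  x-y≈0⇒x≈y : ∀ {x y} → x - y ≈ 0# → x ≈ y
  x-y≈0⇒x≈y {x} {y} e = ≈-trans (solve 2 (λ x y → x := (x :- y) :+ y) ≈-refl x y) (≈-trans (+-congʳ e) (+-identityˡ y))

  x≈y⇒x-y≈0 : ∀ {x y} → x ≈ y → x - y ≈ 0#
  x≈y⇒x-y≈0 e = ≈-trans (+-congʳ e) (-‿inverseʳ _)

  <⇒0<- : ∀ {x y} → x < y → 0# < y - x
  <⇒0<- {x} {y} (p , n) = ≤⇒0≤- p , λ e → n (≈-sym (x-y≈0⇒x≈y (≈-sym e)))

  by< : ∀ {x y c} → 0# < c → y - x ≈ c → x < y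
  by< p e = by≤ (<⇒≤ p) e , λ x≈y → proj₂ p (≈-trans (≈-sym (x≈y⇒x-y≈0 (≈-sym x≈y))) e)

  +-mono-<-≤ : ∀ {x y u v} → x < y → u ≤ v → x + u < y + v
  +-mono-<-≤ {x} {y} {u} {v} p q = <-≤-trans
    (by< (<⇒0<- p) (solve 3 (λ x y u → (y :+ u) :- (x :+ u) := y :- x) ≈-refl x y u))
    (+-monoʳ-≤ y q)

  +-mono-≤-< : ∀ {x y u v} → x ≤ y → u < v → x + u < y + v
  +-mono-≤-< {x} {y} {u} {v} p q = <-respˡ (+-comm u x) (<-respʳ (+-comm v y) (+-mono-<-≤ q p))

  +-nonneg : ∀ {x y} → 0# ≤ x → 0# ≤ y → 0# ≤ x + y
  +-nonneg p q = ≤-respˡ-≈ (+-identityˡ 0#) (+-mono-≤ p q)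

  +-pos : ∀ {x y} → 0# < x → 0# ≤ y → 0# < x + y
  +-pos p q = <-respˡ (+-identityˡ 0#) (+-mono-<-≤ p q)

  neg-mono-≤ : ∀ {x y} → x ≤ y → - y ≤ - x
  neg-mono-≤ {x} {y} p = by≤ (≤⇒0≤- p) (solve 2 (λ x y → (:- x) :- (:- y) := y :- x) ≈-refl x y)

  neg-mono-< : ∀ {x y} → x < y → - y < - x
  neg-mono-< {x} {y} p = by< (<⇒0<- p) (solve 2 (λ x y → (:- x) :- (:- y) := y :- x) ≈-refl x y)

  neg-involutive : ∀ x → - (- x) ≈ x
  neg-involutive = solve 1 (λ x → :- (:- x) := x) ≈-refl

  neg-0 : - 0# ≈ 0#
  neg-0 = solve 0 (:- :0 := :0) ≈-refl

  ≤0⇒0≤neg : ∀ {x} → x ≤ 0# → 0# ≤ - x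
  ≤0⇒0≤neg p = ≤-respˡ-≈ neg-0 (neg-mono-≤ p)

  <0⇒0<neg : ∀ {x} → x < 0# → 0# < - x
  <0⇒0<neg p = <-respˡ neg-0 (neg-mono-< p)

  square-nonneg : ∀ x → 0# ≤ x * x
  square-nonneg x with total 0# x
  ... | inj₁ p = *-nonNeg p p
  ... | inj₂ p = ≤-respʳ-≈ (solve 1 (λ x → (:- x) :* (:- x) := x :* x) ≈-refl x) (*-nonNeg (≤0⇒0≤neg p) (≤0⇒0≤neg p))

  0<1 : 0# < 1#
  0<1 = ≤-respʳ-≈ (*-identityˡ 1#) (square-nonneg 1#) , 0≉1

  0≤1 : 0# ≤ 1#
  0≤1 = <⇒≤ 0<1

  2# : ℝ
  2# = 1# + 1#

  0<2 : 0# < 2#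
  0<2 = +-pos 0<1 0≤1

  *-monoˡ-≤ : ∀ {z x y} → 0# ≤ z → x ≤ y → z * x ≤ z * y
  *-monoˡ-≤ {z} {x} {y} q p = by≤ (*-nonNeg q (≤⇒0≤- p)) (solve 3 (λ x y z → z :* y :- z :* x := z :* (y :- x)) ≈-refl x y z)

  *-monoʳ-≤ : ∀ {z x y} → 0# ≤ z → x ≤ y → x * z ≤ y * z
  *-monoʳ-≤ {z} {x} {y} q p = ≤-respˡ-≈ (*-comm z x) (≤-respʳ-≈ (*-comm z y) (*-monoˡ-≤ q p))

  *-mono-≤ : ∀ {x y u v} → 0# ≤ x → 0# ≤ v → x ≤ y → u ≤ v → x * u ≤ y * v
  *-mono-≤ 0≤x 0≤v p q = ≤-trans (*-monoˡ-≤ 0≤x q) (*-monoʳ-≤ 0≤v p)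

  ≉-by-inverse : ∀ {x y} → x * y ≈ 1# → ¬ x ≈ 0#
  ≉-by-inverse {x} {y} e x≈0 = 0≉1 (≈-trans (≈-sym (≈-trans (*-congʳ x≈0) (zeroˡ y))) e)

  >⇒≉ : ∀ {x} → 0# < x → ¬ x ≈ 0#
  >⇒≉ p e = proj₂ p (≈-sym e)

  *-cancel-0 : ∀ {x y} → ¬ x ≈ 0# → x * y ≈ 0# → y ≈ 0#
  *-cancel-0 {x} {y} x≉0 e = begin-equality
    y ≈⟨ ≈-sym (*-identityˡ y) ⟩
    1# * y ≈⟨ *-congʳ (≈-sym (*-inverseʳ x x≉0)) ⟩
    x * x ⁻¹ * y ≈⟨ solve 3 (λ x i y → x :* i :* y := i :* (x :* y)) ≈-refl x (x ⁻¹) y ⟩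
    x ⁻¹ * (x * y) ≈⟨ *-congˡ e ⟩
    x ⁻¹ * 0# ≈⟨ zeroʳ _ ⟩
    0# ∎

  *-pos : ∀ {x y} → 0# < x → 0# < y → 0# < x * y
  *-pos p q = *-nonNeg (<⇒≤ p) (<⇒≤ q) , λ e → >⇒≉ q (*-cancel-0 (>⇒≉ p) (≈-sym e))

  *-monoˡ-< : ∀ {z x y} → 0# < z → x < y → z * x < z * y
  *-monoˡ-< {z} {x} {y} q p = by< (*-pos q (<⇒0<- p)) (solve 3 (λ x y z → z :* y :- z :* x := z :* (y :- x)) ≈-refl x y z)

  *-monoʳ-< : ∀ {z x y} → 0# < z → x < y → x * z < y * z
  *-monoʳ-< {z} {x} {y} q p = <-respˡ (*-comm z x) (<-respʳ (*-comm z y) (*-monoˡ-< q p))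

  *-cancelˡ-≤ : ∀ {z x y} → 0# < z → z * x ≤ z * y → x ≤ y
  *-cancelˡ-≤ {z} {x} {y} q p with ≤-or-> x y
  ... | inj₁ r = r
  ... | inj₂ r = ⊥-elim (<⇒≱ (*-monoˡ-< q r) p)

  *-cancelˡ-< : ∀ {z x y} → 0# ≤ z → z * x < z * y → x < y
  *-cancelˡ-< q p = ≰⇒> (λ y≤x → <⇒≱ p (*-monoˡ-≤ q y≤x))

  *-cancelˡ : ∀ {z x y} → ¬ z ≈ 0# → z * x ≈ z * y → x ≈ y
  *-cancelˡ {z} {x} {y} n e = x-y≈0⇒x≈y (*-cancel-0 n (≈-trans
    (solve 3 (λ x y z → z :* (x :- y) := z :* x :- z :* y) ≈-refl x y z) (x≈y⇒x-y≈0 e)))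

  ⁻¹-inverse : ∀ {x} → 0# < x → x * x ⁻¹ ≈ 1#
  ⁻¹-inverse p = *-inverseʳ _ (>⇒≉ p)

  ⁻¹-pos : ∀ {x} → 0# < x → 0# < x ⁻¹
  ⁻¹-pos {x} p = *-cancelˡ-< (<⇒≤ p) (<-respˡ (≈-sym (zeroʳ x)) (<-respʳ (≈-sym (⁻¹-inverse p)) 0<1))

  inverse-unique : ∀ {x y} → x * y ≈ 1# → y ≈ x ⁻¹
  inverse-unique {x} {y} e = *-cancelˡ (≉-by-inverse e) (≈-trans e (≈-sym (*-inverseʳ x (≉-by-inverse e))))

  ⁻¹-antitone : ∀ {x y} → 0# < x → x ≤ y → y ⁻¹ ≤ x ⁻¹
  ⁻¹-antitone {x} {y} 0<x p = *-cancelˡ-≤ 0<x (begin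
    x * y ⁻¹ ≤⟨ *-monoʳ-≤ (<⇒≤ (⁻¹-pos 0<y)) p ⟩
    y * y ⁻¹ ≈⟨ ⁻¹-inverse 0<y ⟩
    1# ≈⟨ ≈-sym (⁻¹-inverse 0<x) ⟩
    x * x ⁻¹ ∎)
    where 0<y = <-≤-trans 0<x p

  half : ℝ → ℝ
  half x = x * 2# ⁻¹

  half+half : ∀ x → half x + half x ≈ x
  half+half x = begin-equality
    x * 2# ⁻¹ + x * 2# ⁻¹ ≈⟨ solve 2 (λ x i → x :* i :+ x :* i := x :* ((:1 :+ :1) :* i)) ≈-refl x (2# ⁻¹) ⟩
    x * (2# * 2# ⁻¹) ≈⟨ *-congˡ (⁻¹-inverse 0<2) ⟩
    x * 1# ≈⟨ *-identityʳ x ⟩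
    x ∎

  half-pos : ∀ {x} → 0# < x → 0# < half x
  half-pos p = *-pos p (⁻¹-pos 0<2)

  half<self : ∀ {x} → 0# < x → half x < x
  half<self {x} p = by< (half-pos p) (≈-trans (+-congʳ (≈-sym (half+half x)))
    (solve 1 (λ h → (h :+ h) :- h := h) ≈-refl (half x)))

  -- Absolute value

  ∣∣-cong : ∀ {x y} → x ≈ y → ∣ x ∣ ≈ ∣ y ∣
  ∣∣-cong e = ⊔-cong e (-‿cong e)

  x≤∣x∣ : ∀ x → x ≤ ∣ x ∣
  x≤∣x∣ x = x≤x⊔y x (- x)

  -x≤∣x∣ : ∀ x → - x ≤ ∣ x ∣
  -x≤∣x∣ x = x≤y⊔x x (- x)

  ∣∣-lub : ∀ {x c} → x ≤ c → - x ≤ c → ∣ x ∣ ≤ c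
  ∣∣-lub = ⊔-lub

  ∣∣-lub-< : ∀ {x c} → x < c → - x < c → ∣ x ∣ < c
  ∣∣-lub-< {x} p q with ⊔-sel x (- x)
  ... | inj₁ e = <-respˡ (≈-sym e) p
  ... | inj₂ e = <-respˡ (≈-sym e) q

  ∣∣-of-nonneg : ∀ {x} → 0# ≤ x → ∣ x ∣ ≈ x
  ∣∣-of-nonneg {x} p = antisym (∣∣-lub ≤-refl (≤-trans (≤-trans (neg-mono-≤ p) (≈⇒≤ neg-0)) p)) (x≤∣x∣ x)

  ∣∣-neg : ∀ x → ∣ - x ∣ ≈ ∣ x ∣
  ∣∣-neg x = antisym (∣∣-lub (-x≤∣x∣ x) (≤-trans (≈⇒≤ (neg-involutive x)) (x≤∣x∣ x)))
                     (∣∣-lub (≤-trans (≈⇒≤ (≈-sym (neg-involutive x))) (-x≤∣x∣ (- x))) (x≤∣x∣ (- x)))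

  ∣∣-nonneg : ∀ x → 0# ≤ ∣ x ∣
  ∣∣-nonneg x with total 0# x
  ... | inj₁ p = ≤-trans p (x≤∣x∣ x)
  ... | inj₂ p = ≤-trans (≤0⇒0≤neg p) (-x≤∣x∣ x)

  ∣∣-+ : ∀ x y → ∣ x + y ∣ ≤ ∣ x ∣ + ∣ y ∣
  ∣∣-+ x y = ∣∣-lub (+-mono-≤ (x≤∣x∣ x) (x≤∣x∣ y))
    (≤-trans (≈⇒≤ (solve 2 (λ x y → :- (x :+ y) := (:- x) :+ (:- y)) ≈-refl x y)) (+-mono-≤ (-x≤∣x∣ x) (-x≤∣x∣ y)))

  ∣∣-* : ∀ x y → ∣ x * y ∣ ≈ ∣ x ∣ * ∣ y ∣
  ∣∣-* x y = go (total 0# x) (total 0# y)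
    where
    ∣neg∣ : ∀ {x} → x ≤ 0# → ∣ x ∣ ≈ - x
    ∣neg∣ {x} p = ≈-trans (≈-sym (∣∣-neg x)) (∣∣-of-nonneg (≤0⇒0≤neg p))
    go : 0# ≤ x ⊎ x ≤ 0# → 0# ≤ y ⊎ y ≤ 0# → ∣ x * y ∣ ≈ ∣ x ∣ * ∣ y ∣
    go (inj₁ p) (inj₁ q) = ≈-trans (∣∣-of-nonneg (*-nonNeg p q)) (≈-sym (*-cong (∣∣-of-nonneg p) (∣∣-of-nonneg q)))
    go (inj₁ p) (inj₂ q) = begin-equality
      ∣ x * y ∣ ≈⟨ ≈-sym (∣∣-neg (x * y)) ⟩
      ∣ - (x * y) ∣ ≈⟨ ∣∣-cong (solve 2 (λ x y → :- (x :* y) := x :* (:- y)) ≈-refl x y) ⟩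
      ∣ x * - y ∣ ≈⟨ ∣∣-of-nonneg (*-nonNeg p (≤0⇒0≤neg q)) ⟩
      x * - y ≈⟨ ≈-sym (*-cong (∣∣-of-nonneg p) (∣neg∣ q)) ⟩
      ∣ x ∣ * ∣ y ∣ ∎
    go (inj₂ p) (inj₁ q) = begin-equality
      ∣ x * y ∣ ≈⟨ ≈-sym (∣∣-neg (x * y)) ⟩
      ∣ - (x * y) ∣ ≈⟨ ∣∣-cong (solve 2 (λ x y → :- (x :* y) := (:- x) :* y) ≈-refl x y) ⟩
      ∣ - x * y ∣ ≈⟨ ∣∣-of-nonneg (*-nonNeg (≤0⇒0≤neg p) q) ⟩
      - x * y ≈⟨ ≈-sym (*-cong (∣neg∣ p) (∣∣-of-nonneg q)) ⟩
      ∣ x ∣ * ∣ y ∣ ∎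
    go (inj₂ p) (inj₂ q) = begin-equality
      ∣ x * y ∣ ≈⟨ ∣∣-cong (solve 2 (λ x y → x :* y := (:- x) :* (:- y)) ≈-refl x y) ⟩
      ∣ - x * - y ∣ ≈⟨ ∣∣-of-nonneg (*-nonNeg (≤0⇒0≤neg p) (≤0⇒0≤neg q)) ⟩
      - x * - y ≈⟨ ≈-sym (*-cong (∣neg∣ p) (∣neg∣ q)) ⟩
      ∣ x ∣ * ∣ y ∣ ∎

  ∣-∣-comm : ∀ x y → ∣ x - y ∣ ≈ ∣ y - x ∣
  ∣-∣-comm x y = ≈-trans (≈-sym (∣∣-neg _)) (∣∣-cong (solve 2 (λ x y → :- (x :- y) := y :- x) ≈-refl x y))

  ∣-∣-bounds : ∀ {x y c} → ∣ x - y ∣ ≤ c → y - c ≤ x × x ≤ y + c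
  ∣-∣-bounds {x} {y} {c} p =
    by≤ (≤⇒0≤- (≤-trans (-x≤∣x∣ (x - y)) p)) (solve 3 (λ x y c → x :- (y :- c) := c :- (:- (x :- y))) ≈-refl x y c) ,
    by≤ (≤⇒0≤- (≤-trans (x≤∣x∣ (x - y)) p)) (solve 3 (λ x y c → (y :+ c) :- x := c :- (x :- y)) ≈-refl x y c)

  ≤-of-all-ε : ∀ {x y} → (∀ ε → 0# < ε → x ≤ y + ε) → x ≤ y
  ≤-of-all-ε {x} {y} h with ≤-or-> x y
  ... | inj₁ p = p
  ... | inj₂ p = ⊥-elim (<⇒≱ (half<self (<⇒0<- p)) (by≤ (≤⇒0≤- (h _ (half-pos (<⇒0<- p))))
        (solve 3 (λ x y h → h :- (x :- y) := (y :+ h) :- x) ≈-refl x y (half (x - y)))))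

  -- Natural numbers and powers

  fromℤ≈ι : ∀ k → fromℤ k ≈ ι k
  fromℤ≈ι (+ n) = ≈-refl
  fromℤ≈ι -[1+ n ] = ≈-refl

  fromℤ-+ : ∀ a b → fromℤ (a ℤ.+ b) ≈ fromℤ a + fromℤ b
  fromℤ-+ a b = ≈-trans (fromℤ≈ι (a ℤ.+ b)) (≈-trans (ι-+ a b) (≈-sym (+-cong (fromℤ≈ι a) (fromℤ≈ι b))))

  fromℤ-* : ∀ a b → fromℤ (a ℤ.* b) ≈ fromℤ a * fromℤ b
  fromℤ-* a b = ≈-trans (fromℤ≈ι (a ℤ.* b)) (≈-trans (ι-* a b) (≈-sym (*-cong (fromℤ≈ι a) (fromℤ≈ι b))))

  fromℤ-neg : ∀ a → fromℤ (ℤ.- a) ≈ - fromℤ a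
  fromℤ-neg a = ≈-trans (fromℤ≈ι (ℤ.- a)) (≈-trans (ι-neg a) (≈-sym (-‿cong (fromℤ≈ι a))))

  fromℕ-+ : ∀ m n → fromℕ (m ℕ.+ n) ≈ fromℕ m + fromℕ n
  fromℕ-+ m n = ×-homo-+ 1# m n

  fromℕ-* : ∀ m n → fromℕ (m ℕ.* n) ≈ fromℕ m * fromℕ n
  fromℕ-* m n = ×1-homo-* m n

  fromℕ-1 : fromℕ 1 ≈ 1#
  fromℕ-1 = +-identityʳ 1#

  fromℕ-nonneg : ∀ n → 0# ≤ fromℕ n
  fromℕ-nonneg zero = ≤-refl
  fromℕ-nonneg (suc n) = +-nonneg 0≤1 (fromℕ-nonneg n)

  fromℕ-mono : ∀ {m n} → m ℕ.≤ n → fromℕ m ≤ fromℕ n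
  fromℕ-mono {n = n} ℕ.z≤n = fromℕ-nonneg n
  fromℕ-mono (ℕ.s≤s p) = +-monoʳ-≤ 1# (fromℕ-mono p)

  fromℕ-pos : ∀ {n} → 0 ℕ.< n → 0# < fromℕ n
  fromℕ-pos {suc n} _ = +-pos 0<1 (fromℕ-nonneg n)

  fromℕ-mono-< : ∀ {m n} → m ℕ.< n → fromℕ m < fromℕ n
  fromℕ-mono-< {m} {n} p = <-≤-trans (by< 0<1 (solve 1 (λ x → (:1 :+ x) :- x := :1) ≈-refl (fromℕ m))) (fromℕ-mono p)

  fromℕ-cancel-≤ : ∀ {m n} → fromℕ m ≤ fromℕ n → m ℕ.≤ n
  fromℕ-cancel-≤ {m} {n} p with m ℕP.≤? n
  ... | yes q = q
  ... | no q = ⊥-elim (<⇒≱ (fromℕ-mono-< (ℕP.≰⇒> q)) p)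

  fromℕ-cancel-< : ∀ {m n} → fromℕ m < fromℕ n → m ℕ.< n
  fromℕ-cancel-< {m} {n} p with suc m ℕP.≤? n
  ... | yes q = q
  ... | no q = ⊥-elim (<⇒≱ p (fromℕ-mono (ℕP.≮⇒≥ q)))

  fromℕ-^ : ∀ m n → fromℕ (m ℕ.^ n) ≈ fromℕ m ^ n
  fromℕ-^ m zero = fromℕ-1
  fromℕ-^ m (suc n) = ≈-trans (fromℕ-* m (m ℕ.^ n)) (*-congˡ (fromℕ-^ m n))

  ^-nonneg : ∀ {x} n → 0# ≤ x → 0# ≤ x ^ n
  ^-nonneg zero p = 0≤1
  ^-nonneg (suc n) p = *-nonNeg p (^-nonneg n p)

  ^-pos : ∀ {x} n → 0# < x → 0# < x ^ n
  ^-pos zero p = 0<1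
  ^-pos (suc n) p = *-pos p (^-pos n p)

  ^-monoˡ-≤ : ∀ n {x y} → 0# ≤ x → x ≤ y → x ^ n ≤ y ^ n
  ^-monoˡ-≤ zero p q = ≤-refl
  ^-monoˡ-≤ (suc n) p q = *-mono-≤ p (^-nonneg n (≤-trans p q)) q (^-monoˡ-≤ n p q)

  1≤^ : ∀ n {x} → 1# ≤ x → 1# ≤ x ^ n
  1≤^ zero p = ≤-refl
  1≤^ (suc n) {x} p = begin
    1# ≈⟨ ≈-sym (*-identityˡ 1#) ⟩
    1# * 1# ≤⟨ *-mono-≤ 0≤1 (^-nonneg n (≤-trans 0≤1 p)) p (1≤^ n p) ⟩
    x * x ^ n ∎

  ^-≤1 : ∀ n {x} → 0# ≤ x → x ≤ 1# → x ^ n ≤ 1#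
  ^-≤1 zero p q = ≤-refl
  ^-≤1 (suc n) {x} p q = begin
    x * x ^ n ≤⟨ *-mono-≤ p 0≤1 q (^-≤1 n p q) ⟩
    1# * 1# ≈⟨ *-identityˡ 1# ⟩
    1# ∎

  ^-split : ∀ x {m n} → m ℕ.≤ n → x ^ n ≈ x ^ m * x ^ (n ℕ.∸ m)
  ^-split x {m} {n} p = ≈-trans (≈-reflexive (≡.cong (x ^_) (≡.sym (ℕP.m+[n∸m]≡n p)))) (^-homo-* x m _)

  ^-monoʳ-≤ : ∀ {x m n} → 1# ≤ x → m ℕ.≤ n → x ^ m ≤ x ^ n
  ^-monoʳ-≤ {x} {m} {n} p q = begin
    x ^ m ≈⟨ ≈-sym (*-identityʳ _) ⟩
    x ^ m * 1# ≤⟨ *-monoˡ-≤ (^-nonneg m (≤-trans 0≤1 p)) (1≤^ (n ℕ.∸ m) p) ⟩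
    x ^ m * x ^ (n ℕ.∸ m) ≈⟨ ≈-sym (^-split x q) ⟩
    x ^ n ∎

  ^-antitone : ∀ {x m n} → 0# ≤ x → x ≤ 1# → m ℕ.≤ n → x ^ n ≤ x ^ m
  ^-antitone {x} {m} {n} p p′ q = begin
    x ^ n ≈⟨ ^-split x q ⟩
    x ^ m * x ^ (n ℕ.∸ m) ≤⟨ *-monoˡ-≤ (^-nonneg m p) (^-≤1 (n ℕ.∸ m) p p′) ⟩
    x ^ m * 1# ≈⟨ *-identityʳ _ ⟩
    x ^ m ∎

  1^ : ∀ n → 1# ^ n ≈ 1#
  1^ zero = ≈-refl
  1^ (suc n) = ≈-trans (*-identityˡ _) (1^ n)

  ^-inverse : ∀ {x y} n → x * y ≈ 1# → x ^ n * y ^ n ≈ 1#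
  ^-inverse {x} {y} n e = ≈-trans (≈-sym (^-distrib-* x y n)) (≈-trans (^-congˡ n e) (1^ n))

  bernoulli : ∀ n {x} → 0# ≤ x → 1# + fromℕ n * x ≤ (1# + x) ^ n
  bernoulli zero {x} p = ≈⇒≤ (solve 1 (λ x → :1 :+ :0 :* x := :1) ≈-refl x)
  bernoulli (suc n) {x} p = begin
    1# + fromℕ (suc n) * x ≤⟨ by≤ (*-nonNeg (fromℕ-nonneg n) (square-nonneg x))
      (solve 2 (λ n x → (:1 :+ x) :* (:1 :+ n :* x) :- (:1 :+ (:1 :+ n) :* x) := n :* (x :* x)) ≈-refl (fromℕ n) x) ⟩
    (1# + x) * (1# + fromℕ n * x) ≤⟨ *-monoˡ-≤ (+-nonneg 0≤1 p) (bernoulli n p) ⟩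
    (1# + x) * (1# + x) ^ n ∎

  -- A supremum s of the natural numbers would leave s - 1 as a smaller upper bound.
  archimedean : ∀ x → ∃ λ n → x < fromℕ n
  archimedean x with lem {∃ λ n → x < fromℕ n}
  ... | yes h = h
  ... | no h = ⊥-elim contra
    where
    P : ℝ → Set
    P y = ∃ λ n → y ≈ fromℕ n
    sup = supremum P (0# , 0 , ≈-refl) (x , λ { (n , e) → ≤-trans (≈⇒≤ e) (≮⇒≥ (λ p → h (n , p))) })
    s = proj₁ sup
    contra : ⊥
    contra = <⇒≱ (by< {s - 1#} {s} 0<1 (solve 1 (λ s → s :- (s :- :1) := :1) ≈-refl s))
      (proj₂ (proj₂ sup) (λ { {y} (n , e) → by≤ (≤⇒0≤- (proj₁ (proj₂ sup) {fromℕ (suc n)} (suc n , ≈-refl)))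
        (≈-trans (+-congˡ (-‿cong e)) (solve 2 (λ s y → (s :- :1) :- y := s :- (:1 :+ y)) ≈-refl s (fromℕ n))) }))

  ^-unbounded : ∀ {b} → 1# < b → ∀ x → ∃ λ n → x < b ^ n
  ^-unbounded {b} 1<b x = n , (begin-strict
    x ≈⟨ ≈-sym (*-identityʳ _) ⟩
    x * 1# ≈⟨ *-congˡ (≈-sym (⁻¹-inverse 0<h)) ⟩
    x * (h * h ⁻¹) ≈⟨ solve 3 (λ n h i → n :* (h :* i) := h :* (n :* i)) ≈-refl x h (h ⁻¹) ⟩
    h * (x * h ⁻¹) <⟨ *-monoˡ-< 0<h (proj₂ arch) ⟩
    h * fromℕ n ≤⟨ by≤ 0≤1 (solve 2 (λ n h → (:1 :+ n :* h) :- h :* n := :1) ≈-refl (fromℕ n) h) ⟩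
    1# + fromℕ n * h ≤⟨ bernoulli n (<⇒≤ 0<h) ⟩
    (1# + h) ^ n ≈⟨ ^-congˡ n (solve 1 (λ b → :1 :+ (b :- :1) := b) ≈-refl b) ⟩
    b ^ n ∎)
    where
    h = b - 1#
    0<h = <⇒0<- 1<b
    arch = archimedean (x * h ⁻¹)
    n = proj₁ arch

  choose-spec : {A : Set} (d : A) (P : A → Set) → ∃ P → P (choose d P)
  choose-spec d P h with lem {∃ P}
  ... | yes (x , p) = p
  ... | no n = ⊥-elim (n h)

  -- Limits

  conv-cong : ∀ {a b l} → (∀ n → a n ≈ b n) → ConvergesTo a l → ConvergesTo b l
  conv-cong e c ε 0<ε = proj₁ (c ε 0<ε) , λ n p →
    ≤-<-trans (≈⇒≤ (∣∣-cong (+-congʳ (≈-sym (e n))))) (proj₂ (c ε 0<ε) n p)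

  conv-unique : ∀ {a l m} → ConvergesTo a l → ConvergesTo a m → l ≈ m
  conv-unique {a} {l} {m} c d = antisym (go c d) (go d c)
    where
    go : ∀ {l m} → ConvergesTo a l → ConvergesTo a m → l ≤ m
    go {l} {m} c d = ≤-of-all-ε λ ε 0<ε →
      let N₁ , h₁ = c _ (half-pos 0<ε)
          N₂ , h₂ = d _ (half-pos 0<ε)
          n = N₁ ℕ.+ N₂
          p₁ = proj₁ (∣-∣-bounds (<⇒≤ (h₁ n (ℕP.m≤m+n N₁ N₂))))
          p₂ = proj₂ (∣-∣-bounds (<⇒≤ (h₂ n (ℕP.m≤n+m N₂ N₁))))
      in begin
        l ≈⟨ solve 2 (λ l h → l := (l :- h) :+ h) ≈-refl l (half ε) ⟩
        (l - half ε) + half ε ≤⟨ +-monoˡ-≤ _ p₁ ⟩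
        a n + half ε ≤⟨ +-monoˡ-≤ _ p₂ ⟩
        (m + half ε) + half ε ≈⟨ +-assoc _ _ _ ⟩
        m + (half ε + half ε) ≈⟨ +-congˡ (half+half ε) ⟩
        m + ε ∎

  -- Lets an estimate be stated for ε ≤ 1 and with a constant factor, as the limit of a product
  -- requires.
  conv-scale : ∀ {a l} K → 0# < K → (∀ ε → 0# < ε → ε ≤ 1# → ∃ λ N → ∀ n → N ℕ.≤ n → ∣ a n - l ∣ ≤ K * ε) →
    ConvergesTo a l
  conv-scale {a} {l} K 0<K h ε 0<ε = proj₁ q , λ n p → ≤-<-trans (proj₂ q n p) (begin-strict
      K * δ ≤⟨ *-monoˡ-≤ (<⇒≤ 0<K) δ≤ ⟩
      K * (half ε * K ⁻¹) ≈⟨ solve 3 (λ k h i → k :* (h :* i) := h :* (k :* i)) ≈-refl K (half ε) (K ⁻¹) ⟩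
      half ε * (K * K ⁻¹) ≈⟨ *-congˡ (⁻¹-inverse 0<K) ⟩
      half ε * 1# ≈⟨ *-identityʳ _ ⟩
      half ε <⟨ half<self 0<ε ⟩
      ε ∎)
    where
    min : ∃ λ δ → 0# < δ × δ ≤ 1# × δ ≤ half ε * K ⁻¹
    min with total 1# (half ε * K ⁻¹)
    ... | inj₁ p = 1# , 0<1 , ≤-refl , p
    ... | inj₂ p = half ε * K ⁻¹ , *-pos (half-pos 0<ε) (⁻¹-pos 0<K) , p , ≤-refl
    δ = proj₁ min
    δ≤ = proj₂ (proj₂ (proj₂ min))
    q = h δ (proj₁ (proj₂ min)) (proj₁ (proj₂ (proj₂ min)))

  conv-- : ∀ {a b l m} → ConvergesTo a l → ConvergesTo b m → ConvergesTo (λ n → a n - b n) (l - m)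
  conv-- {a} {b} {l} {m} c d = conv-scale 2# 0<2 λ ε 0<ε _ →
    let N₁ , h₁ = c ε 0<ε
        N₂ , h₂ = d ε 0<ε
    in N₁ ℕ.+ N₂ , λ n p → begin
      ∣ (a n - b n) - (l - m) ∣ ≈⟨ ∣∣-cong (solve 4 (λ a b l m → (a :- b) :- (l :- m) := (a :- l) :+ (m :- b)) ≈-refl (a n) (b n) l m) ⟩
      ∣ (a n - l) + (m - b n) ∣ ≤⟨ ∣∣-+ _ _ ⟩
      ∣ a n - l ∣ + ∣ m - b n ∣ ≈⟨ +-congˡ (∣-∣-comm m (b n)) ⟩
      ∣ a n - l ∣ + ∣ b n - m ∣ ≤⟨ +-mono-≤ (<⇒≤ (h₁ n (ℕP.≤-trans (ℕP.m≤m+n N₁ N₂) p))) (<⇒≤ (h₂ n (ℕP.≤-trans (ℕP.m≤n+m N₂ N₁) p))) ⟩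
      ε + ε ≈⟨ solve 1 (λ e → e :+ e := (:1 :+ :1) :* e) ≈-refl ε ⟩
      2# * ε ∎

  conv-* : ∀ {a b l m} → ConvergesTo a l → ConvergesTo b m → ConvergesTo (λ n → a n * b n) (l * m)
  conv-* {a} {b} {l} {m} c d = conv-scale K 0<K λ ε 0<ε ε≤1 →
    let N₁ , h₁ = c ε 0<ε
        N₂ , h₂ = d ε 0<ε
    in N₁ ℕ.+ N₂ , λ n p →
      let q₁ = <⇒≤ (h₁ n (ℕP.≤-trans (ℕP.m≤m+n N₁ N₂) p))
          q₂ = <⇒≤ (h₂ n (ℕP.≤-trans (ℕP.m≤n+m N₂ N₁) p))
          b≤ : ∣ b n ∣ ≤ 1# + ∣ m ∣
          b≤ = begin
            ∣ b n ∣ ≈⟨ ∣∣-cong (solve 2 (λ b m → b := (b :- m) :+ m) ≈-refl (b n) m) ⟩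
            ∣ (b n - m) + m ∣ ≤⟨ ∣∣-+ _ _ ⟩
            ∣ b n - m ∣ + ∣ m ∣ ≤⟨ +-monoˡ-≤ _ (≤-trans q₂ ε≤1) ⟩
            1# + ∣ m ∣ ∎
      in begin
      ∣ a n * b n - l * m ∣ ≈⟨ ∣∣-cong (solve 4 (λ a b l m → a :* b :- l :* m := (a :- l) :* b :+ l :* (b :- m)) ≈-refl (a n) (b n) l m) ⟩
      ∣ (a n - l) * b n + l * (b n - m) ∣ ≤⟨ ∣∣-+ _ _ ⟩
      ∣ (a n - l) * b n ∣ + ∣ l * (b n - m) ∣ ≈⟨ +-cong (∣∣-* _ _) (∣∣-* _ _) ⟩
      ∣ a n - l ∣ * ∣ b n ∣ + ∣ l ∣ * ∣ b n - m ∣ ≤⟨ +-mono-≤ (*-mono-≤ (∣∣-nonneg _) (+-nonneg 0≤1 (∣∣-nonneg m)) q₁ b≤) (*-monoˡ-≤ (∣∣-nonneg l) q₂) ⟩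
      ε * (1# + ∣ m ∣) + ∣ l ∣ * ε ≈⟨ solve 3 (λ e l m → e :* (:1 :+ m) :+ l :* e := (:1 :+ (m :+ l)) :* e) ≈-refl ε ∣ l ∣ ∣ m ∣ ⟩
      K * ε ∎
    where
    K = 1# + (∣ m ∣ + ∣ l ∣)
    0<K = +-pos 0<1 (+-nonneg (∣∣-nonneg m) (∣∣-nonneg l))

  lim-≤ : ∀ {a l c} N → ConvergesTo a l → (∀ n → N ℕ.≤ n → a n ≤ c) → l ≤ c
  lim-≤ {a} {l} {c} N conv h = ≤-of-all-ε λ ε 0<ε →
    let N₁ , h₁ = conv ε 0<ε
        n = N ℕ.+ N₁
        p = proj₁ (∣-∣-bounds (<⇒≤ (h₁ n (ℕP.m≤n+m N₁ N))))
    in begin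
      l ≈⟨ solve 2 (λ l h → l := (l :- h) :+ h) ≈-refl l ε ⟩
      (l - ε) + ε ≤⟨ +-monoˡ-≤ ε (≤-trans p (h n (ℕP.m≤m+n N N₁))) ⟩
      c + ε ∎

  lim-≥ : ∀ {a l c} N → ConvergesTo a l → (∀ n → N ℕ.≤ n → c ≤ a n) → c ≤ l
  lim-≥ {a} {l} {c} N conv h = ≤-of-all-ε λ ε 0<ε →
    let N₁ , h₁ = conv ε 0<ε
        n = N ℕ.+ N₁
    in ≤-trans (h n (ℕP.m≤m+n N N₁)) (proj₂ (∣-∣-bounds (<⇒≤ (h₁ n (ℕP.m≤n+m N₁ N)))))

  monotone-converges : ∀ {s B} → (∀ m n → m ℕ.≤ n → s m ≤ s n) → (∀ n → s n ≤ B) →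
    ∃ λ l → ConvergesTo s l × (∀ n → s n ≤ l)
  monotone-converges {s} {B} mono bound = l , conv , s≤l
    where
    P : ℝ → Set
    P y = ∃ λ n → y ≈ s n
    sup = supremum P (s 0 , 0 , ≈-refl) (B , λ { (n , e) → ≤-trans (≈⇒≤ e) (bound n) })
    l = proj₁ sup
    s≤l : ∀ n → s n ≤ l
    s≤l n = proj₁ (proj₂ sup) (n , ≈-refl)
    conv : ConvergesTo s l
    conv ε 0<ε with lem {∃ λ N → l - ε < s N}
    ... | yes (N , p) = N , λ n q → ∣∣-lub-<
            (<-respˡ (≈-refl) (≤-<-trans (by≤ (≤⇒0≤- (s≤l n)) (solve 2 (λ s l → :0 :- (s :- l) := l :- s) ≈-refl (s n) l)) 0<ε))
            (by< (<⇒0<- (<-≤-trans p (mono N n q))) (solve 3 (λ s l e → e :- (:- (s :- l)) := s :- (l :- e)) ≈-refl (s n) l ε))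
    ... | no h = ⊥-elim (<⇒≱ (by< {l - ε} {l} 0<ε (solve 2 (λ l e → l :- (l :- e) := e) ≈-refl l ε))
            (proj₂ (proj₂ sup) (λ { (n , e) → ≤-trans (≈⇒≤ e) (≮⇒≥ (λ p → h (n , p))) })))

  -- Series

  ∑-mono : ∀ n {f g} → (∀ i → i ℕ.< n → f i ≤ g i) → ∑ n f ≤ ∑ n g
  ∑-mono zero h = ≤-refl
  ∑-mono (suc n) h = +-mono-≤ (∑-mono n (λ i p → h i (ℕP.m<n⇒m<1+n p))) (h n ℕP.≤-refl)

  ∑-nonneg : ∀ n {f} → (∀ i → 0# ≤ f i) → 0# ≤ ∑ n f
  ∑-nonneg zero h = ≤-refl
  ∑-nonneg (suc n) h = +-nonneg (∑-nonneg n h) (h n)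

  ∑-monoˡ : ∀ {m n f} → (∀ i → 0# ≤ f i) → m ℕ.≤ n → ∑ m f ≤ ∑ n f
  ∑-monoˡ {m} {n} {f} h p = begin
    ∑ m f ≈⟨ ≈-sym (+-identityʳ _) ⟩
    ∑ m f + 0# ≤⟨ +-monoʳ-≤ _ (∑-nonneg (n ℕ.∸ m) (λ i → h (m ℕ.+ i))) ⟩
    ∑ m f + ∑ (n ℕ.∸ m) (f ∘ (m ℕ.+_)) ≈⟨ ≈-sym (∑-split m (n ℕ.∸ m) f) ⟩
    ∑ (m ℕ.+ (n ℕ.∸ m)) f ≡⟨ ≡.cong (λ k → ∑ k f) (ℕP.m+[n∸m]≡n p) ⟩
    ∑ n f ∎

  ∣∑∣ : ∀ n f → ∣ ∑ n f ∣ ≤ ∑ n (λ i → ∣ f i ∣)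
  ∣∑∣ zero f = ≈⇒≤ (∣∣-of-nonneg ≤-refl)
  ∣∑∣ (suc n) f = ≤-trans (∣∣-+ _ _) (+-monoˡ-≤ _ (∣∑∣ n f))

  -- a = (a + b) - b, and both a + b and b are series of nonnegative terms with bounded partial
  -- sums.
  series-converges : ∀ {a b B} → (∀ k → ∣ a k ∣ ≤ b k) → (∀ n → ∑ n b ≤ B) → ∃ λ l → ConvergesTo (λ n → ∑ n a) l
  series-converges {a} {b} {B} h bound = l₁ - l₂ , conv-cong (λ n → ≈-trans (+-congʳ (∑-+ n a b))
      (solve 2 (λ x y → (x :+ y) :- y := x) ≈-refl (∑ n a) (∑ n b))) (conv-- (proj₁ (proj₂ c₁)) (proj₁ (proj₂ c₂)))
    where
    b≥0 : ∀ k → 0# ≤ b k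
    b≥0 k = ≤-trans (∣∣-nonneg _) (h k)
    a+b≥0 : ∀ k → 0# ≤ a k + b k
    a+b≥0 k = by≤ (≤⇒0≤- (≤-trans (-x≤∣x∣ (a k)) (h k))) (solve 2 (λ x y → (x :+ y) :- :0 := y :- (:- x)) ≈-refl (a k) (b k))
    c₁ = monotone-converges {λ n → ∑ n (λ k → a k + b k)} {B + B} (λ m n → ∑-monoˡ a+b≥0) (λ n → begin
      ∑ n (λ k → a k + b k) ≤⟨ ∑-mono n (λ k _ → +-monoˡ-≤ (b k) (≤-trans (x≤∣x∣ (a k)) (h k))) ⟩
      ∑ n (λ k → b k + b k) ≈⟨ ∑-+ n b b ⟩
      ∑ n b + ∑ n b ≤⟨ +-mono-≤ (bound n) (bound n) ⟩
      B + B ∎)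
    l₁ = proj₁ c₁
    c₂ = monotone-converges {λ n → ∑ n b} {B} (λ m n → ∑-monoˡ b≥0) bound
    l₂ = proj₁ c₂

  sum≈∑ : ∀ n f → sum {n} (f ∘ toℕ) ≈ ∑ n f
  sum≈∑ zero f = ≈-refl
  sum≈∑ (suc n) f = ≈-trans (+-congˡ (sum≈∑ n (f ∘ suc))) (≈-sym (∑-head n f))

  ∑∞-≈ : ∀ {m a l} → ConvergesTo (λ n → ∑ n (λ k → a (m ℕ.+ k))) l → ∑∞ m a ≈ l
  ∑∞-≈ {m} {a} {l} c = conv-unique (choose-spec 0# (ConvergesTo λ N → sum {N} λ k → a (m ℕ.+ toℕ k)) (l , c′)) c′
    where c′ = conv-cong (λ n → ≈-sym (sum≈∑ n (λ k → a (m ℕ.+ k)))) c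

  geometric : ∀ n x → ∑ n (x ^_) * (1# - x) ≈ 1# - x ^ n
  geometric zero x = solve 1 (λ x → :0 :* (:1 :- x) := :1 :- :1) ≈-refl x
  geometric (suc n) x = begin-equality
    (∑ n (x ^_) + x ^ n) * (1# - x) ≈⟨ distribʳ _ _ _ ⟩
    ∑ n (x ^_) * (1# - x) + x ^ n * (1# - x) ≈⟨ +-congʳ (geometric n x) ⟩
    (1# - x ^ n) + x ^ n * (1# - x) ≈⟨ solve 2 (λ x p → (:1 :- p) :+ p :* (:1 :- x) := :1 :- x :* p) ≈-refl x (x ^ n) ⟩
    1# - x ^ suc n ∎

  geometric-≤ : ∀ n {x} → 0# ≤ x → ∑ n (x ^_) * (1# - x) ≤ 1#
  geometric-≤ n {x} p = ≤-trans (≈⇒≤ (geometric n x))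
    (by≤ (^-nonneg n p) (solve 1 (λ y → :1 :- (:1 :- y) := y) ≈-refl (x ^ n)))

  -- Exponential function

  term : ℝ → ℕ → ℝ
  term x k = x ^ k / fromℕ (k !)

  0<! : ∀ k → 0# < fromℕ (k !)
  0<! k = fromℕ-pos (ℕP.n≢0⇒n>0 (ℕ.≢-nonZero⁻¹ (k !) {{k ℕP.!≢0}}))

  term-0 : ∀ x → term x 0 ≈ 1#
  term-0 x = ≈-trans (*-identityˡ _) (≈-sym (inverse-unique (≈-trans (*-identityʳ _) fromℕ-1)))

  term-suc : ∀ x k → fromℕ (suc k) * term x (suc k) ≈ x * term x k
  term-suc x k = begin-equality
    c * (x * x ^ k * fromℕ (suc k !) ⁻¹) ≈⟨ solve 4 (λ c x p i → c :* (x :* p :* i) := x :* (p :* (c :* i))) ≈-refl c x (x ^ k) (fromℕ (suc k !) ⁻¹) ⟩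
    x * (x ^ k * (c * fromℕ (suc k !) ⁻¹)) ≈⟨ *-congˡ (*-congˡ (inverse-unique (≈-trans
      (solve 3 (λ f c i → f :* (c :* i) := c :* f :* i) ≈-refl (fromℕ (k !)) c (fromℕ (suc k !) ⁻¹))
      (≈-trans (*-congʳ (≈-sym (fromℕ-* (suc k) (k !)))) (⁻¹-inverse (0<! (suc k))))))) ⟩
    x * term x k ∎
    where c = fromℕ (suc k)

  term-nonneg : ∀ {x} k → 0# ≤ x → 0# ≤ term x k
  term-nonneg k p = *-nonNeg (^-nonneg k p) (<⇒≤ (⁻¹-pos (0<! k)))

  ∣^∣ : ∀ x k → ∣ x ^ k ∣ ≈ ∣ x ∣ ^ k
  ∣^∣ x zero = ∣∣-of-nonneg 0≤1
  ∣^∣ x (suc k) = ≈-trans (∣∣-* _ _) (*-congˡ (∣^∣ x k))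

  ∣term∣ : ∀ x k → ∣ term x k ∣ ≈ term ∣ x ∣ k
  ∣term∣ x k = ≈-trans (∣∣-* _ _) (*-cong (∣^∣ x k) (∣∣-of-nonneg (<⇒≤ (⁻¹-pos (0<! k)))))

  -- From an index N > 2x on, each term is at most half of the preceding one.
  term-bound : ∀ x → 0# ≤ x → ∃ λ B → ∀ n → ∑ n (term x) ≤ B
  term-bound x 0≤x = ∑ N (term x) + 2# * term x N , λ n → begin
      ∑ n (term x) ≤⟨ ∑-monoˡ (λ k → term-nonneg k 0≤x) (ℕP.m≤n+m n N) ⟩
      ∑ (N ℕ.+ n) (term x) ≈⟨ ∑-split N n (term x) ⟩
      ∑ N (term x) + ∑ n (λ j → term x (N ℕ.+ j)) ≤⟨ +-monoʳ-≤ _ (∑-mono n (λ j _ → decay j)) ⟩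
      ∑ N (term x) + ∑ n (λ j → term x N * h ^ j) ≈⟨ +-congˡ (∑-*ˡ n (term x N) (h ^_)) ⟩
      ∑ N (term x) + term x N * ∑ n (h ^_) ≤⟨ +-monoʳ-≤ _ (*-monoˡ-≤ (term-nonneg N 0≤x) (geo n)) ⟩
      ∑ N (term x) + term x N * 2# ≈⟨ +-congˡ (*-comm _ _) ⟩
      ∑ N (term x) + 2# * term x N ∎
    where
    arch = archimedean (2# * x)
    N = proj₁ arch
    h = 2# ⁻¹
    0≤h = <⇒≤ (⁻¹-pos 0<2)
    2h = ⁻¹-inverse 0<2
    geo : ∀ n → ∑ n (h ^_) ≤ 2#
    geo n = begin
      ∑ n (h ^_) ≈⟨ ≈-sym (*-identityʳ _) ⟩
      ∑ n (h ^_) * 1# ≈⟨ *-congˡ (≈-sym (≈-trans (solve 1 (λ h → (:1 :+ :1) :* (:1 :- h) := (:1 :+ :1) :- (:1 :+ :1) :* h) ≈-refl h)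
                                         (≈-trans (+-congˡ (-‿cong 2h)) (solve 0 ((:1 :+ :1) :- :1 := :1) ≈-refl)))) ⟩
      ∑ n (h ^_) * (2# * (1# - h)) ≈⟨ solve 3 (λ s t u → s :* (t :* u) := t :* (s :* u)) ≈-refl (∑ n (h ^_)) 2# (1# - h) ⟩
      2# * (∑ n (h ^_) * (1# - h)) ≤⟨ *-monoˡ-≤ (<⇒≤ 0<2) (geometric-≤ n 0≤h) ⟩
      2# * 1# ≈⟨ *-identityʳ _ ⟩
      2# ∎
    decay : ∀ j → term x (N ℕ.+ j) ≤ term x N * h ^ j
    decay zero = ≈⇒≤ (≈-trans (≈-reflexive (≡.cong (term x) (ℕP.+-identityʳ N))) (≈-sym (*-identityʳ _)))
    decay (suc j) = *-cancelˡ-≤ (fromℕ-pos {suc (N ℕ.+ j)} (ℕ.s≤s ℕ.z≤n)) (begin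
      c * term x (N ℕ.+ suc j) ≡⟨ ≡.cong (λ k → c * term x k) (ℕP.+-suc N j) ⟩
      c * term x (suc (N ℕ.+ j)) ≈⟨ term-suc x (N ℕ.+ j) ⟩
      x * term x (N ℕ.+ j) ≤⟨ *-monoˡ-≤ 0≤x (decay j) ⟩
      x * (term x N * h ^ j) ≈⟨ ≈-sym (*-identityˡ _) ⟩
      1# * (x * (term x N * h ^ j)) ≈⟨ *-congʳ (≈-sym 2h) ⟩
      2# * h * (x * (term x N * h ^ j)) ≈⟨ solve 5 (λ t h x a p → t :* h :* (x :* (a :* p)) := t :* x :* (a :* (h :* p))) ≈-refl 2# h x (term x N) (h ^ j) ⟩
      2# * x * (term x N * h ^ suc j) ≤⟨ *-monoʳ-≤ (*-nonNeg (term-nonneg N 0≤x) (^-nonneg (suc j) 0≤h))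
                                            (≤-trans (<⇒≤ (proj₂ arch)) (fromℕ-mono (ℕP.m≤n⇒m≤1+n (ℕP.m≤m+n N j)))) ⟩
      c * (term x N * h ^ suc j) ∎)
      where c = fromℕ (suc (N ℕ.+ j))

  exp-converges : ∀ x → ConvergesTo (λ n → ∑ n (term x)) (exp x)
  exp-converges x = conv
    where
    c = series-converges {term x} (λ k → ≈⇒≤ (∣term∣ x k)) (proj₂ (term-bound ∣ x ∣ (∣∣-nonneg x)))
    conv : ConvergesTo (λ n → ∑ n (term x)) (exp x)
    conv ε 0<ε = proj₁ (proj₂ c ε 0<ε) , λ n p → ≤-<-trans
      (≈⇒≤ (∣∣-cong (+-congˡ (-‿cong (∑∞-≈ {0} {term x} (proj₂ c)))))) (proj₂ (proj₂ c ε 0<ε) n p)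

  term-cong : ∀ {x y} k → x ≈ y → term x k ≈ term y k
  term-cong k e = *-congʳ (^-congˡ k e)

  exp-cong : ∀ {x y} → x ≈ y → exp x ≈ exp y
  exp-cong {x} {y} e = conv-unique (conv-cong (λ n → ∑-cong n (λ k _ → term-cong k e)) (exp-converges x)) (exp-converges y)

  exp-≥ : ∀ n {x} → 0# ≤ x → ∑ n (term x) ≤ exp x
  exp-≥ n {x} p = lim-≥ n (exp-converges x) (λ m q → ∑-monoˡ (λ k → term-nonneg k p) q)

  -- Multiplied by k + 1 = i + (k + 1 - i), the i-th product splits in two. In each part `term-suc`
  -- trades the integer factor for x or for y and lowers the degree, so no binomial coefficients
  -- occur.
  binomial : ∀ x y k → ∑ (suc k) (λ i → term x i * term y (k ℕ.∸ i)) ≈ term (x + y) k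
  binomial x y zero = begin-equality
    0# + term x 0 * term y 0 ≈⟨ +-identityˡ _ ⟩
    term x 0 * term y 0 ≈⟨ *-cong (term-0 x) (term-0 y) ⟩
    1# * 1# ≈⟨ *-identityˡ _ ⟩
    1# ≈⟨ ≈-sym (term-0 (x + y)) ⟩
    term (x + y) 0 ∎
  binomial x y (suc k) = *-cancelˡ (>⇒≉ (fromℕ-pos {suc k} (ℕ.s≤s ℕ.z≤n))) (begin-equality
    c * ∑ (2 ℕ.+ k) f ≈⟨ ≈-sym (∑-*ˡ (2 ℕ.+ k) c f) ⟩
    ∑ (2 ℕ.+ k) (λ i → c * f i) ≈⟨ ∑-cong (2 ℕ.+ k) (λ i p → split i (ℕP.≤-pred p)) ⟩
    ∑ (2 ℕ.+ k) (λ i → fromℕ i * f i + fromℕ (suc k ℕ.∸ i) * f i) ≈⟨ ∑-+ (2 ℕ.+ k) _ _ ⟩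
    ∑ (2 ℕ.+ k) (λ i → fromℕ i * f i) + ∑ (2 ℕ.+ k) (λ i → fromℕ (suc k ℕ.∸ i) * f i) ≈⟨ +-cong left right ⟩
    x * S + y * S ≈⟨ ≈-sym (distribʳ _ _ _) ⟩
    (x + y) * S ≈⟨ *-congˡ (binomial x y k) ⟩
    (x + y) * term (x + y) k ≈⟨ ≈-sym (term-suc (x + y) k) ⟩
    c * term (x + y) (suc k) ∎)
    where
    c = fromℕ (suc k)
    f : ℕ → ℝ
    f i = term x i * term y (suc k ℕ.∸ i)
    g : ℕ → ℝ
    g i = term x i * term y (k ℕ.∸ i)
    S = ∑ (suc k) g
    split : ∀ i → i ℕ.≤ suc k → c * f i ≈ fromℕ i * f i + fromℕ (suc k ℕ.∸ i) * f i
    split i p = ≈-trans (*-congʳ (≈-trans (≈-reflexive (≡.cong fromℕ (≡.sym (ℕP.m+[n∸m]≡n p)))) (fromℕ-+ i _))) (distribʳ _ _ _)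
    left : ∑ (2 ℕ.+ k) (λ i → fromℕ i * f i) ≈ x * S
    left = begin-equality
      ∑ (2 ℕ.+ k) (λ i → fromℕ i * f i) ≈⟨ ∑-head (suc k) _ ⟩
      0# * f 0 + ∑ (suc k) (λ i → fromℕ (suc i) * f (suc i)) ≈⟨ ≈-trans (+-congʳ (zeroˡ _)) (+-identityˡ _) ⟩
      ∑ (suc k) (λ i → fromℕ (suc i) * f (suc i)) ≈⟨ ∑-cong (suc k) (λ i _ → ≈-trans (≈-sym (*-assoc _ _ _))
                                                                   (≈-trans (*-congʳ (term-suc x i)) (*-assoc _ _ _))) ⟩
      ∑ (suc k) (λ i → x * g i) ≈⟨ ∑-*ˡ (suc k) x g ⟩
      x * S ∎
    right : ∑ (2 ℕ.+ k) (λ i → fromℕ (suc k ℕ.∸ i) * f i) ≈ y * S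
    right = begin-equality
      ∑ (suc k) (λ i → fromℕ (suc k ℕ.∸ i) * f i) + fromℕ (suc k ℕ.∸ suc k) * f (suc k)
        ≈⟨ ≈-trans (+-congˡ (≈-trans (*-congʳ (≈-reflexive (≡.cong fromℕ (ℕP.n∸n≡0 k)))) (zeroˡ _))) (+-identityʳ _) ⟩
      ∑ (suc k) (λ i → fromℕ (suc k ℕ.∸ i) * f i)
        ≈⟨ ∑-cong (suc k) (λ i p → one i (ℕP.≤-pred p)) ⟩
      ∑ (suc k) (λ i → y * g i) ≈⟨ ∑-*ˡ (suc k) y g ⟩
      y * S ∎
      where
      one : ∀ i → i ℕ.≤ k → fromℕ (suc k ℕ.∸ i) * f i ≈ y * g i
      one i p rewrite ℕP.+-∸-assoc 1 p = begin-equality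
        fromℕ (suc (k ℕ.∸ i)) * (term x i * term y (suc (k ℕ.∸ i))) ≈⟨ solve 3 (λ a b c → a :* (b :* c) := b :* (a :* c)) ≈-refl (fromℕ (suc (k ℕ.∸ i))) (term x i) _ ⟩
        term x i * (fromℕ (suc (k ℕ.∸ i)) * term y (suc (k ℕ.∸ i))) ≈⟨ *-congˡ (term-suc y (k ℕ.∸ i)) ⟩
        term x i * (y * term y (k ℕ.∸ i)) ≈⟨ solve 3 (λ a b c → a :* (b :* c) := b :* (a :* c)) ≈-refl (term x i) y _ ⟩
        y * g i ∎

  -- The product of two partial sums exceeds the partial sum of the Cauchy product
  -- by the terms i, j < n with n ≤ i + j.
  corner : ℝ → ℝ → ℕ → ℝ
  corner x y n = ∑ n λ i → ∑ i λ j → term x i * term y ((n ℕ.∸ i) ℕ.+ j)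

  product-of-sums : ∀ x y n → ∑ n (term x) * ∑ n (term y) ≈ ∑ n (λ i → ∑ n (λ j → term x i * term y j))
  product-of-sums x y n = begin-equality
    ∑ n (term x) * ∑ n (term y) ≈⟨ *-comm _ _ ⟩
    ∑ n (term y) * ∑ n (term x) ≈⟨ ≈-sym (∑-*ˡ n _ (term x)) ⟩
    ∑ n (λ i → ∑ n (term y) * term x i) ≈⟨ ∑-cong n (λ i _ → ≈-trans (*-comm _ _) (≈-sym (∑-*ˡ n (term x i) (term y)))) ⟩
    ∑ n (λ i → ∑ n (λ j → term x i * term y j)) ∎

  triangle-sum : ∀ x y n → ∑ n (λ i → ∑ (n ℕ.∸ i) (λ j → term x i * term y j)) ≈ ∑ n (term (x + y))
  triangle-sum x y n = ≈-trans (∑-triangle n _) (∑-cong n (λ k _ → binomial x y k))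

  corner-≈ : ∀ x y n → corner x y n ≈ ∑ n (term x) * ∑ n (term y) - ∑ n (term (x + y))
  corner-≈ x y n = ≈-sym (begin-equality
    ∑ n (term x) * ∑ n (term y) - ∑ n (term (x + y))
      ≈⟨ +-cong (≈-trans (product-of-sums x y n) (≈-trans (∑-cong n split) (∑-+ n _ _))) (-‿cong (≈-sym (triangle-sum x y n))) ⟩
    (T + corner x y n) - T ≈⟨ solve 2 (λ t c → (t :+ c) :- t := c) ≈-refl T (corner x y n) ⟩
    corner x y n ∎)
    where
    T = ∑ n (λ i → ∑ (n ℕ.∸ i) (λ j → term x i * term y j))
    split : ∀ i → i ℕ.< n → ∑ n (λ j → term x i * term y j) ≈
      ∑ (n ℕ.∸ i) (λ j → term x i * term y j) + ∑ i (λ j → term x i * term y ((n ℕ.∸ i) ℕ.+ j))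
    split i p = ≈-trans (≈-reflexive (≡.cong (λ k → ∑ k (λ j → term x i * term y j)) (≡.sym (ℕP.m∸n+n≡m (ℕP.<⇒≤ p)))))
      (∑-split (n ℕ.∸ i) i _)

  corner-abs : ∀ x y n → ∣ corner x y n ∣ ≤ corner ∣ x ∣ ∣ y ∣ n
  corner-abs x y n = ≤-trans (∣∑∣ n _) (∑-mono n (λ i _ → ≤-trans (∣∑∣ i _) (∑-mono i (λ j _ →
    ≈⇒≤ (≈-trans (∣∣-* _ _) (*-cong (∣term∣ x i) (∣term∣ y ((n ℕ.∸ i) ℕ.+ j))))))))

  product-≤-double : ∀ {x y} n → 0# ≤ x → 0# ≤ y → ∑ n (term x) * ∑ n (term y) ≤ ∑ (n ℕ.+ n) (term (x + y))
  product-≤-double {x} {y} n p q = begin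
    ∑ n (term x) * ∑ n (term y) ≈⟨ product-of-sums x y n ⟩
    ∑ n (λ i → ∑ n (f i)) ≤⟨ ∑-mono n (λ i i<n → ∑-monoˡ (f≥0 i)
      (ℕP.≤-trans (ℕP.m≤m+n n (n ℕ.∸ i)) (ℕP.≤-reflexive (≡.sym (ℕP.+-∸-assoc n (ℕP.<⇒≤ i<n)))))) ⟩
    ∑ n (λ i → ∑ (n ℕ.+ n ℕ.∸ i) (f i)) ≤⟨ ∑-monoˡ (λ i → ∑-nonneg (n ℕ.+ n ℕ.∸ i) (f≥0 i)) (ℕP.m≤m+n n n) ⟩
    ∑ (n ℕ.+ n) (λ i → ∑ (n ℕ.+ n ℕ.∸ i) (f i)) ≈⟨ triangle-sum x y (n ℕ.+ n) ⟩
    ∑ (n ℕ.+ n) (term (x + y)) ∎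
    where
    f : ℕ → ℕ → ℝ
    f i j = term x i * term y j
    f≥0 : ∀ i j → 0# ≤ f i j
    f≥0 i j = *-nonNeg (term-nonneg i p) (term-nonneg j q)

  -- The error is the corner, which is at most the corner for |x| and |y| in absolute value. That
  -- one is bounded by the terms of exp(|x| + |y|) from the n-th to the 2n-th, so it tends to 0.
  exp-+ : ∀ x y → exp (x + y) ≈ exp x * exp y
  exp-+ x y = ≈-sym (x-y≈0⇒x≈y (conv-unique
    (conv-- (conv-* (exp-converges x) (exp-converges y)) (exp-converges (x + y)))
    (λ ε 0<ε → proj₁ (exp-converges z ε 0<ε) , λ n p → begin-strict
      ∣ ∑ n (term x) * ∑ n (term y) - ∑ n (term (x + y)) - 0# ∣
        ≈⟨ ∣∣-cong (≈-trans (solve 1 (λ a → a :- :0 := a) ≈-refl _) (≈-sym (corner-≈ x y n))) ⟩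
      ∣ corner x y n ∣ ≤⟨ corner-abs x y n ⟩
      corner ∣ x ∣ ∣ y ∣ n ≈⟨ corner-≈ ∣ x ∣ ∣ y ∣ n ⟩
      ∑ n (term ∣ x ∣) * ∑ n (term ∣ y ∣) - ∑ n (term z) ≤⟨ +-monoˡ-≤ _ (product-≤-double n (∣∣-nonneg x) (∣∣-nonneg y)) ⟩
      ∑ (n ℕ.+ n) (term z) - ∑ n (term z) ≤⟨ +-monoˡ-≤ _ (exp-≥ (n ℕ.+ n) 0≤z) ⟩
      exp z - ∑ n (term z) ≤⟨ x≤∣x∣ _ ⟩
      ∣ exp z - ∑ n (term z) ∣ ≈⟨ ∣-∣-comm _ _ ⟩
      ∣ ∑ n (term z) - exp z ∣ <⟨ proj₂ (exp-converges z ε 0<ε) n p ⟩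
      ε ∎)))
    where
    z = ∣ x ∣ + ∣ y ∣
    0≤z = +-nonneg (∣∣-nonneg x) (∣∣-nonneg y)

  exp-0 : exp 0# ≈ 1#
  exp-0 = conv-unique (exp-converges 0#) (λ ε 0<ε → 1 , λ { (suc n) _ → ≤-<-trans (≈⇒≤ (≈-trans
    (∣∣-cong (≈-trans (+-congʳ (≈-trans (∑-head n (term 0#)) (+-cong (term-0 0#) (∑-zero n (λ i _ → ≈-trans (*-congʳ (zeroˡ _)) (zeroˡ _))))))
      (solve 0 ((:1 :+ :0) :- :1 := :0) ≈-refl))) (∣∣-of-nonneg ≤-refl))) 0<ε })

  exp-inverse : ∀ x → exp x * exp (- x) ≈ 1#
  exp-inverse x = ≈-trans (≈-sym (exp-+ x (- x))) (≈-trans (exp-cong (-‿inverseʳ x)) exp-0)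

  exp-pos : ∀ x → 0# < exp x
  exp-pos x = (≤-respʳ-≈ (≈-sym sq) (square-nonneg (exp (half x)))) , λ e → ≉-by-inverse (exp-inverse x) (≈-sym e)
    where sq = ≈-trans (exp-cong (≈-sym (half+half x))) (exp-+ (half x) (half x))

  exp-≥1+-nonneg : ∀ {x} → 0# ≤ x → 1# + x ≤ exp x
  exp-≥1+-nonneg {x} p = ≤-trans (≈⇒≤ (≈-sym (≈-trans (+-cong (≈-trans (+-identityˡ _) (term-0 x)) t1) ≈-refl))) (exp-≥ 2 p)
    where
    t1 : term x 1 ≈ x
    t1 = begin-equality
      term x 1 ≈⟨ ≈-sym (*-identityˡ _) ⟩
      1# * term x 1 ≈⟨ *-congʳ (≈-sym fromℕ-1) ⟩
      fromℕ 1 * term x 1 ≈⟨ term-suc x 0 ⟩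
      x * term x 0 ≈⟨ *-congˡ (term-0 x) ⟩
      x * 1# ≈⟨ *-identityʳ x ⟩
      x ∎

  term-≤-^ : ∀ {x} k → 0# ≤ x → term x k ≤ x ^ k
  term-≤-^ {x} k p = begin
    x ^ k * fromℕ (k !) ⁻¹ ≤⟨ *-monoˡ-≤ (^-nonneg k p) (≤-trans (⁻¹-antitone {1#} 0<1 (≤-trans (≈⇒≤ (≈-sym fromℕ-1))
         (fromℕ-mono (ℕP.n≢0⇒n>0 (ℕ.≢-nonZero⁻¹ (k !) {{k ℕP.!≢0}})))))
         (≈⇒≤ (≈-sym (inverse-unique (*-identityˡ 1#))))) ⟩
    x ^ k * 1# ≈⟨ *-identityʳ _ ⟩
    x ^ k ∎

  -- Since x^k / k! ≤ x^k, the partial sums are at most those of the geometric series for 1/(1 - x).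
  exp-*-1- : ∀ {x} → 0# ≤ x → x ≤ 1# → exp x * (1# - x) ≤ 1#
  exp-*-1- {x} p q = ≤-trans (≈⇒≤ (*-comm _ _)) (lim-≤ 0 (conv-* (λ ε 0<ε → 0 , λ n _ → ≤-<-trans (≈⇒≤ (≈-trans (∣∣-cong (-‿inverseʳ (1# - x))) (∣∣-of-nonneg ≤-refl))) 0<ε) (exp-converges x)) (λ n _ → begin
    (1# - x) * ∑ n (term x) ≤⟨ *-monoˡ-≤ (≤⇒0≤- q) (∑-mono n (λ k _ → term-≤-^ k p)) ⟩
    (1# - x) * ∑ n (x ^_) ≈⟨ *-comm _ _ ⟩
    ∑ n (x ^_) * (1# - x) ≤⟨ geometric-≤ n p ⟩
    1# ∎))

  exp-≥1+ : ∀ x → 1# + x ≤ exp x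
  exp-≥1+ x with total 0# x
  ... | inj₁ p = exp-≥1+-nonneg p
  ... | inj₂ p with total (- x) 1#
  ... | inj₂ q = ≤-trans (by≤ (≤⇒0≤- q) (solve 1 (λ x → :0 :- (:1 :+ x) := (:- x) :- :1) ≈-refl x)) (<⇒≤ (exp-pos x))
  ... | inj₁ q = *-cancelˡ-≤ (exp-pos (- x)) (begin
    exp (- x) * (1# + x) ≈⟨ *-congˡ (solve 1 (λ x → :1 :+ x := :1 :- (:- x)) ≈-refl x) ⟩
    exp (- x) * (1# - (- x)) ≤⟨ exp-*-1- (≤0⇒0≤neg p) q ⟩
    1# ≈⟨ ≈-sym (exp-inverse x) ⟩
    exp x * exp (- x) ≈⟨ *-comm _ _ ⟩
    exp (- x) * exp x ∎)

  exp-mono-< : ∀ {x y} → x < y → exp x < exp y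
  exp-mono-< {x} {y} p = begin-strict
    exp x ≈⟨ ≈-sym (*-identityʳ _) ⟩
    exp x * 1# <⟨ *-monoˡ-< (exp-pos x) (<-≤-trans (by< (<⇒0<- p) (solve 1 (λ d → (:1 :+ d) :- :1 := d) ≈-refl (y - x))) (exp-≥1+ (y - x))) ⟩
    exp x * exp (y - x) ≈⟨ ≈-sym (exp-+ x (y - x)) ⟩
    exp (x + (y - x)) ≈⟨ exp-cong (solve 2 (λ x y → x :+ (y :- x) := y) ≈-refl x y) ⟩
    exp y ∎

  exp-mono-≤ : ∀ {x y} → x ≤ y → exp x ≤ exp y
  exp-mono-≤ {x} {y} p with lem {x ≈ y}
  ... | yes e = ≈⇒≤ (exp-cong e)
  ... | no n = <⇒≤ (exp-mono-< (p , n))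

  exp-cancel-≤ : ∀ {x y} → exp x ≤ exp y → x ≤ y
  exp-cancel-≤ p = ≮⇒≥ (λ q → <⇒≱ (exp-mono-< q) p)

  exp-injective : ∀ {x y} → exp x ≈ exp y → x ≈ y
  exp-injective e = antisym (exp-cancel-≤ (≈⇒≤ e)) (exp-cancel-≤ (≈⇒≤ (≈-sym e)))

  -- The supremum s of all y with exp y ≤ x is the solution. In place of continuity the proof uses 1
  -- - h ≤ exp(-h) and exp h ≤ 1/(1 - h): if exp s and x differed, h would be the relative
  -- difference, and s could be moved by h without crossing x.
  exp-surjective : ∀ {x} → 0# < x → ∃ λ y → exp y ≈ x
  exp-surjective {x} 0<x = s , antisym upper lower
    where
    P : ℝ → Set
    P y = exp y ≤ x
    self≤exp : ∀ y → y ≤ exp y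
    self≤exp y = ≤-trans (by≤ 0≤1 (solve 1 (λ y → (:1 :+ y) :- y := :1) ≈-refl y)) (exp-≥1+ y)
    -- exp(1/x) ≥ 1/x, and inversion gives an element of P.
    nonempty : P (- x ⁻¹)
    nonempty = *-cancelˡ-≤ (exp-pos (x ⁻¹)) (begin
      exp (x ⁻¹) * exp (- x ⁻¹) ≈⟨ exp-inverse _ ⟩
      1# ≈⟨ ≈-trans (≈-sym (⁻¹-inverse 0<x)) (*-comm _ _) ⟩
      x ⁻¹ * x ≤⟨ *-monoʳ-≤ (<⇒≤ 0<x) (self≤exp (x ⁻¹)) ⟩
      exp (x ⁻¹) * x ∎)
    sup = supremum P (- x ⁻¹ , nonempty) (x , λ {y} p → ≤-trans (self≤exp y) p)
    s = proj₁ sup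
    upper : exp s ≤ x
    upper = ≮⇒≥ λ x<exp →
      let h = 1# - x * exp s ⁻¹
          0<e = exp-pos s
          e*h : exp s * (1# - h) ≈ x
          e*h = begin-equality
            exp s * (1# - h) ≈⟨ solve 3 (λ e x i → e :* (:1 :- (:1 :- x :* i)) := x :* (e :* i)) ≈-refl (exp s) x (exp s ⁻¹) ⟩
            x * (exp s * exp s ⁻¹) ≈⟨ *-congˡ (⁻¹-inverse 0<e) ⟩
            x * 1# ≈⟨ *-identityʳ x ⟩
            x ∎
          0<h : 0# < h
          0<h = *-cancelˡ-< (<⇒≤ 0<e) (<-respˡ (≈-sym (zeroʳ _)) (<-respʳ
            (≈-trans (+-congˡ (-‿cong (≈-sym e*h))) (solve 2 (λ e h → e :- e :* (:1 :- h) := e :* h) ≈-refl (exp s) h)) (<⇒0<- x<exp)))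
          bound : x ≤ exp (s - h)
          bound = begin
            x ≈⟨ ≈-sym e*h ⟩
            exp s * (1# - h) ≤⟨ *-monoˡ-≤ (<⇒≤ 0<e) (exp-≥1+ (- h)) ⟩
            exp s * exp (- h) ≈⟨ ≈-sym (exp-+ s (- h)) ⟩
            exp (s - h) ∎
      in <⇒≱ (by< {s - h} {s} 0<h (solve 2 (λ s h → s :- (s :- h) := h) ≈-refl s h))
             (proj₂ (proj₂ sup) (λ {y} p → exp-cancel-≤ (≤-trans p bound)))
    lower : x ≤ exp s
    lower = ≮⇒≥ λ exp<x →
      let h = 1# - exp s * x ⁻¹
          x*h : x * (1# - h) ≈ exp s
          x*h = begin-equality
            x * (1# - h) ≈⟨ solve 3 (λ e x i → x :* (:1 :- (:1 :- e :* i)) := e :* (x :* i)) ≈-refl (exp s) x (x ⁻¹) ⟩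
            exp s * (x * x ⁻¹) ≈⟨ *-congˡ (⁻¹-inverse 0<x) ⟩
            exp s * 1# ≈⟨ *-identityʳ _ ⟩
            exp s ∎
          0<h : 0# < h
          0<h = *-cancelˡ-< (<⇒≤ 0<x) (<-respˡ (≈-sym (zeroʳ _)) (<-respʳ
            (≈-trans (+-congˡ (-‿cong (≈-sym x*h))) (solve 2 (λ e h → e :- e :* (:1 :- h) := e :* h) ≈-refl x h)) (<⇒0<- exp<x)))
          h<1 : 0# < 1# - h
          h<1 = <-respʳ (solve 1 (λ y → y := :1 :- (:1 :- y)) ≈-refl _) (*-pos (exp-pos s) (⁻¹-pos 0<x))
          bound : exp (s + h) ≤ x
          bound = *-cancelˡ-≤ h<1 (begin
            (1# - h) * exp (s + h) ≈⟨ *-congˡ (exp-+ s h) ⟩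
            (1# - h) * (exp s * exp h) ≈⟨ solve 3 (λ a b c → a :* (b :* c) := b :* (c :* a)) ≈-refl (1# - h) (exp s) (exp h) ⟩
            exp s * (exp h * (1# - h)) ≤⟨ *-monoˡ-≤ (<⇒≤ (exp-pos s)) (exp-*-1- (<⇒≤ 0<h) (0≤-⇒≤ (<⇒≤ h<1))) ⟩
            exp s * 1# ≈⟨ ≈-trans (*-identityʳ _) (≈-sym x*h) ⟩
            x * (1# - h) ≈⟨ *-comm _ _ ⟩
            (1# - h) * x ∎)
      in <⇒≱ (by< {s} {s + h} 0<h (solve 2 (λ s h → (s :+ h) :- s := h) ≈-refl s h))
             (proj₁ (proj₂ sup) bound)

  exp-log : ∀ {x} → 0# < x → exp (log x) ≈ x
  exp-log p = choose-spec 0# _ (exp-surjective p)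

  log-exp : ∀ y → log (exp y) ≈ y
  log-exp y = exp-injective (exp-log (exp-pos y))

  log-mono-≤ : ∀ {x y} → 0# < x → x ≤ y → log x ≤ log y
  log-mono-≤ p q = exp-cancel-≤ (≤-respˡ-≈ (≈-sym (exp-log p)) (≤-respʳ-≈ (≈-sym (exp-log (<-≤-trans p q))) q))

  log-cong : ∀ {x y} → 0# < x → x ≈ y → log x ≈ log y
  log-cong p e = antisym (log-mono-≤ p (≈⇒≤ e)) (log-mono-≤ (<-respʳ e p) (≈⇒≤ (≈-sym e)))

  log-* : ∀ {x y} → 0# < x → 0# < y → log (x * y) ≈ log x + log y
  log-* p q = exp-injective (≈-trans (exp-log (*-pos p q)) (≈-trans (*-cong (≈-sym (exp-log p)) (≈-sym (exp-log q))) (≈-sym (exp-+ _ _))))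

  log-1 : log 1# ≈ 0#
  log-1 = exp-injective (≈-trans (exp-log 0<1) (≈-sym exp-0))

  exp-fromℕ* : ∀ n x → exp (fromℕ n * x) ≈ exp x ^ n
  exp-fromℕ* zero x = ≈-trans (exp-cong (zeroˡ x)) exp-0
  exp-fromℕ* (suc n) x = ≈-trans (exp-cong (solve 2 (λ n x → (:1 :+ n) :* x := x :+ n :* x) ≈-refl (fromℕ n) x))
    (≈-trans (exp-+ _ _) (*-congˡ (exp-fromℕ* n x)))

  log-^ : ∀ n {x} → 0# < x → log (x ^ n) ≈ fromℕ n * log x
  log-^ n {x} p = exp-injective (≈-trans (exp-log (^-pos n p)) (≈-sym (≈-trans (exp-fromℕ* n _) (^-congˡ n (exp-log p)))))

  ^ʳ-pos-base : ∀ {x} y → 0# < x → x ^ʳ y ≡ exp (y * log x)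
  ^ʳ-pos-base {x} y p with lem {x ≈ 0#}
  ... | yes e = ⊥-elim (>⇒≉ p e)
  ... | no _ = ≡.refl

  sqrt-exists : ∀ {x} → 0# ≤ x → ∃ λ y → 0# ≤ y × y * y ≈ x
  sqrt-exists {x} p with lem {0# ≈ x}
  ... | yes e = 0# , ≤-refl , ≈-trans (zeroˡ 0#) e
  ... | no n = exp (half (log x)) , <⇒≤ (exp-pos _) , ≈-trans (≈-sym (exp-+ _ _)) (≈-trans (exp-cong (half+half _)) (exp-log (p , n)))

  √-nonneg : ∀ {x} → 0# ≤ x → 0# ≤ √ x
  √-nonneg p = proj₁ (choose-spec 0# _ (sqrt-exists p))

  √-square : ∀ {x} → 0# ≤ x → √ x * √ x ≈ x
  √-square p = proj₂ (choose-spec 0# _ (sqrt-exists p))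

  floor-exists : ∀ {x} → 0# ≤ x → ∃ λ k → fromℕ k ≤ x × x < fromℕ k + 1#
  floor-exists {x} p = go (proj₁ (archimedean x)) (proj₂ (archimedean x))
    where
    go : ∀ n → x < fromℕ n → ∃ λ k → fromℕ k ≤ x × x < fromℕ k + 1#
    go zero q = ⊥-elim (<⇒≱ q p)
    go (suc n) q with ≤-or-> (fromℕ n) x
    ... | inj₁ r = n , r , <-respʳ (+-comm _ _) q
    ... | inj₂ r = go n r

  floor-nonneg : ∀ {x} → 0# ≤ x → ∃ λ k → ⌊ x ⌋ ≡ + k × fromℕ k ≤ x × x < fromℕ k + 1#
  floor-nonneg {x} p with ⌊ x ⌋ | choose-spec (+ 0) (λ k → fromℤ k ≤ x × x < fromℤ k + 1#) (let k , h = floor-exists p in + k , h)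
  ... | + k | h = k , ≡.refl , h
  ... | -[1+ n ] | _ , q = ⊥-elim (<⇒≱ q (≤-trans (by≤ (fromℕ-nonneg n) (solve 1 (λ n → :0 :- ((:- (:1 :+ n)) :+ :1) := n) ≈-refl (fromℕ n))) p))

  -- Complex numbers

  infix 8 -ᶜ_
  -ᶜ_ : ℂ → ℂ
  -ᶜ z = (- re z) +i (- im z)

  1ᶜ : ℂ
  1ᶜ = 1# +i 0#

  ℂ-commutativeRing : CommutativeRing 0ℓ 0ℓ
  ℂ-commutativeRing = record
    { Carrier = ℂ ; _≈_ = _≈ᶜ_ ; _+_ = _+ᶜ_ ; _*_ = _*ᶜ_ ; -_ = -ᶜ_ ; 0# = 0ᶜ ; 1# = 1ᶜ
    ; isCommutativeRing = record
      { isRing = record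
        { +-isAbelianGroup = record
          { isGroup = record
            { isMonoid = record
              { isSemigroup = record
                { isMagma = record
                  { isEquivalence = record
                    { refl = ≈-refl , ≈-refl
                    ; sym = λ (p , q) → ≈-sym p , ≈-sym q
                    ; trans = λ (p , q) (r , s) → ≈-trans p r , ≈-trans q s }
                  ; ∙-cong = λ (p , q) (r , s) → +-cong p r , +-cong q s }
                ; assoc = λ _ _ _ → +-assoc _ _ _ , +-assoc _ _ _ }
              ; identity = (λ _ → +-identityˡ _ , +-identityˡ _) , (λ _ → +-identityʳ _ , +-identityʳ _) }
            ; inverse = (λ _ → -‿inverseˡ _ , -‿inverseˡ _) , (λ _ → -‿inverseʳ _ , -‿inverseʳ _)
            ; ⁻¹-cong = λ (p , q) → -‿cong p , -‿cong q }
          ; comm = λ _ _ → +-comm _ _ , +-comm _ _ }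
        ; *-cong = λ (p , q) (r , s) → +-cong (*-cong p r) (-‿cong (*-cong q s)) , +-cong (*-cong p s) (*-cong q r)
        ; *-assoc = λ x y z →
            solve 6 (λ a b c d e f → (a :* c :- b :* d) :* e :- (a :* d :+ b :* c) :* f := a :* (c :* e :- d :* f) :- b :* (c :* f :+ d :* e)) ≈-refl (re x) (im x) (re y) (im y) (re z) (im z) ,
            solve 6 (λ a b c d e f → (a :* c :- b :* d) :* f :+ (a :* d :+ b :* c) :* e := a :* (c :* f :+ d :* e) :+ b :* (c :* e :- d :* f)) ≈-refl (re x) (im x) (re y) (im y) (re z) (im z)
        ; *-identity =
            (λ x → solve 2 (λ a b → :1 :* a :- :0 :* b := a) ≈-refl (re x) (im x) , solve 2 (λ a b → :1 :* b :+ :0 :* a := b) ≈-refl (re x) (im x)) ,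
            (λ x → solve 2 (λ a b → a :* :1 :- b :* :0 := a) ≈-refl (re x) (im x) , solve 2 (λ a b → a :* :0 :+ b :* :1 := b) ≈-refl (re x) (im x))
        ; distrib =
            (λ x y z → solve 6 (λ a b c d e f → a :* (c :+ e) :- b :* (d :+ f) := (a :* c :- b :* d) :+ (a :* e :- b :* f)) ≈-refl (re x) (im x) (re y) (im y) (re z) (im z) ,
                       solve 6 (λ a b c d e f → a :* (d :+ f) :+ b :* (c :+ e) := (a :* d :+ b :* c) :+ (a :* f :+ b :* e)) ≈-refl (re x) (im x) (re y) (im y) (re z) (im z)) ,
            (λ x y z → solve 6 (λ a b c d e f → (c :+ e) :* a :- (d :+ f) :* b := (c :* a :- d :* b) :+ (e :* a :- f :* b)) ≈-refl (re x) (im x) (re y) (im y) (re z) (im z) ,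
                       solve 6 (λ a b c d e f → (c :+ e) :* b :+ (d :+ f) :* a := (c :* b :+ d :* a) :+ (e :* b :+ f :* a)) ≈-refl (re x) (im x) (re y) (im y) (re z) (im z))
        }
      ; *-comm = λ x y →
          solve 4 (λ a b c d → a :* c :- b :* d := c :* a :- d :* b) ≈-refl (re x) (im x) (re y) (im y) ,
          solve 4 (λ a b c d → a :* d :+ b :* c := c :* b :+ d :* a) ≈-refl (re x) (im x) (re y) (im y)
      }
    }

  open RingKit ℂ-commutativeRing public using ()
    renaming (solve to solveᶜ; _:=_ to _:=ᶜ_; _:+_ to _:+ᶜ_; _:*_ to _:*ᶜ_; _:-_ to _:-ᶜ_; :-_ to :-ᶜ_; :0 to :0ᶜ; :1 to :1ᶜ)
  open RingLaws ℂ-commutativeRing public using ()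
    renaming (refl to ≈ᶜ-refl; sym to ≈ᶜ-sym; trans to ≈ᶜ-trans; +-cong to +ᶜ-cong; *-cong to *ᶜ-cong;
              +-congˡ to +ᶜ-congˡ; *-congˡ to *ᶜ-congˡ; *-congʳ to *ᶜ-congʳ;
              *-identityˡ to *ᶜ-identityˡ; *-identityʳ to *ᶜ-identityʳ; zeroˡ to zeroᶜˡ; zeroʳ to zeroᶜʳ;
              +-identityˡ to +ᶜ-identityˡ; +-identityʳ to +ᶜ-identityʳ; *-assoc to *ᶜ-assoc; reflexive to ≈ᶜ-reflexive;
              ^-congˡ to ^ᶜ-congˡ; ^-homo-* to ^ᶜ-homo-*; ^-distrib-* to ^ᶜ-distrib-*)

  fromℝ-cong : ∀ {x y} → x ≈ y → fromℝ x ≈ᶜ fromℝ y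
  fromℝ-cong e = e , ≈-refl

  fromℝ-+ : ∀ x y → fromℝ (x + y) ≈ᶜ fromℝ x +ᶜ fromℝ y
  fromℝ-+ x y = ≈-refl , ≈-sym (+-identityˡ 0#)

  fromℝ-* : ∀ x y → fromℝ (x * y) ≈ᶜ fromℝ x *ᶜ fromℝ y
  fromℝ-* x y = solve 2 (λ x y → x :* y := x :* y :- :0 :* :0) ≈-refl x y , solve 2 (λ x y → :0 := x :* :0 :+ :0 :* y) ≈-refl x y

  fromℝ-^ : ∀ x n → fromℝ (x ^ n) ≈ᶜ fromℝ x ^ᶜ n
  fromℝ-^ x zero = ≈ᶜ-refl
  fromℝ-^ x (suc n) = ≈ᶜ-trans (fromℝ-* x (x ^ n)) (*ᶜ-congˡ (fromℝ-^ x n))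

  -- Modulus

  normSq : ℂ → ℝ
  normSq z = re z * re z + im z * im z

  normSq-nonneg : ∀ z → 0# ≤ normSq z
  normSq-nonneg z = +-nonneg (square-nonneg _) (square-nonneg _)

  square-cancel-≤ : ∀ {x y} → 0# ≤ y → x * x ≤ y * y → x ≤ y
  square-cancel-≤ {x} {y} p q with ≤-or-> x y
  ... | inj₁ r = r
  ... | inj₂ r = ⊥-elim (<⇒≱ (begin-strict
    y * y ≤⟨ *-monoˡ-≤ p (<⇒≤ r) ⟩
    y * x <⟨ *-monoʳ-< (≤-<-trans p r) r ⟩
    x * x ∎) q)

  square-injective : ∀ {x y} → 0# ≤ x → 0# ≤ y → x * x ≈ y * y → x ≈ y
  square-injective p q e = antisym (square-cancel-≤ q (≈⇒≤ e)) (square-cancel-≤ p (≈⇒≤ (≈-sym e)))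

  ∣∣ᶜ-nonneg : ∀ z → 0# ≤ ∣ z ∣ᶜ
  ∣∣ᶜ-nonneg z = √-nonneg (normSq-nonneg z)

  ∣∣ᶜ-square : ∀ z → ∣ z ∣ᶜ * ∣ z ∣ᶜ ≈ normSq z
  ∣∣ᶜ-square z = √-square (normSq-nonneg z)

  normSq-cong : ∀ {z w} → z ≈ᶜ w → normSq z ≈ normSq w
  normSq-cong (p , q) = +-cong (*-cong p p) (*-cong q q)

  ∣∣ᶜ-cong : ∀ {z w} → z ≈ᶜ w → ∣ z ∣ᶜ ≈ ∣ w ∣ᶜ
  ∣∣ᶜ-cong {z} {w} e = square-injective (∣∣ᶜ-nonneg z) (∣∣ᶜ-nonneg w) (≈-trans (∣∣ᶜ-square z) (≈-trans (normSq-cong e) (≈-sym (∣∣ᶜ-square w))))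

  ∣∣ᶜ-≤-by-squares : ∀ {z c} → 0# ≤ c → normSq z ≤ c * c → ∣ z ∣ᶜ ≤ c
  ∣∣ᶜ-≤-by-squares {z} p q = square-cancel-≤ p (≤-respˡ-≈ (≈-sym (∣∣ᶜ-square z)) q)

  ∣∣ᶜ-* : ∀ z w → ∣ z *ᶜ w ∣ᶜ ≈ ∣ z ∣ᶜ * ∣ w ∣ᶜ
  ∣∣ᶜ-* z w = square-injective (∣∣ᶜ-nonneg _) (*-nonNeg (∣∣ᶜ-nonneg z) (∣∣ᶜ-nonneg w)) (begin-equality
    ∣ z *ᶜ w ∣ᶜ * ∣ z *ᶜ w ∣ᶜ ≈⟨ ∣∣ᶜ-square _ ⟩
    normSq (z *ᶜ w) ≈⟨ solve 4 (λ a b c d → (a :* c :- b :* d) :* (a :* c :- b :* d) :+ (a :* d :+ b :* c) :* (a :* d :+ b :* c)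
                                                     := (a :* a :+ b :* b) :* (c :* c :+ d :* d)) ≈-refl (re z) (im z) (re w) (im w) ⟩
    normSq z * normSq w ≈⟨ ≈-sym (*-cong (∣∣ᶜ-square z) (∣∣ᶜ-square w)) ⟩
    (∣ z ∣ᶜ * ∣ z ∣ᶜ) * (∣ w ∣ᶜ * ∣ w ∣ᶜ) ≈⟨ solve 2 (λ a b → a :* a :* (b :* b) := a :* b :* (a :* b)) ≈-refl ∣ z ∣ᶜ ∣ w ∣ᶜ ⟩
    ∣ z ∣ᶜ * ∣ w ∣ᶜ * (∣ z ∣ᶜ * ∣ w ∣ᶜ) ∎)

  ∣∣ᶜ-+ : ∀ z w → ∣ z +ᶜ w ∣ᶜ ≤ ∣ z ∣ᶜ + ∣ w ∣ᶜ
  ∣∣ᶜ-+ z w = ∣∣ᶜ-≤-by-squares (+-nonneg (∣∣ᶜ-nonneg z) (∣∣ᶜ-nonneg w)) (begin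
    normSq (z +ᶜ w) ≈⟨ solve 4 (λ a b c d → (a :+ c) :* (a :+ c) :+ (b :+ d) :* (b :+ d)
                                                            := (a :* a :+ b :* b) :+ (c :* c :+ d :* d) :+ ((:1 :+ :1) :* (a :* c :+ b :* d))) ≈-refl (re z) (im z) (re w) (im w) ⟩
    normSq z + normSq w + 2# * (re z * re w + im z * im w) ≤⟨ +-monoʳ-≤ _ (*-monoˡ-≤ (<⇒≤ 0<2) cauchy) ⟩
    normSq z + normSq w + 2# * (∣ z ∣ᶜ * ∣ w ∣ᶜ) ≈⟨ +-congʳ (+-cong (≈-sym (∣∣ᶜ-square z)) (≈-sym (∣∣ᶜ-square w))) ⟩
    ∣ z ∣ᶜ * ∣ z ∣ᶜ + ∣ w ∣ᶜ * ∣ w ∣ᶜ + 2# * (∣ z ∣ᶜ * ∣ w ∣ᶜ) ≈⟨ solve 2 (λ a b → a :* a :+ b :* b :+ (:1 :+ :1) :* (a :* b) := (a :+ b) :* (a :+ b)) ≈-refl ∣ z ∣ᶜ ∣ w ∣ᶜ ⟩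
    (∣ z ∣ᶜ + ∣ w ∣ᶜ) * (∣ z ∣ᶜ + ∣ w ∣ᶜ) ∎)
    where
    cauchy : re z * re w + im z * im w ≤ ∣ z ∣ᶜ * ∣ w ∣ᶜ
    cauchy = square-cancel-≤ (*-nonNeg (∣∣ᶜ-nonneg z) (∣∣ᶜ-nonneg w)) (≤-respʳ-≈
      (≈-trans (≈-sym (*-cong (∣∣ᶜ-square z) (∣∣ᶜ-square w))) (solve 2 (λ a b → a :* a :* (b :* b) := a :* b :* (a :* b)) ≈-refl ∣ z ∣ᶜ ∣ w ∣ᶜ))
      (by≤ (square-nonneg (re z * im w - im z * re w))
        (solve 4 (λ a b c d → (a :* a :+ b :* b) :* (c :* c :+ d :* d) :- (a :* c :+ b :* d) :* (a :* c :+ b :* d)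
          := (a :* d :- b :* c) :* (a :* d :- b :* c)) ≈-refl (re z) (im z) (re w) (im w))))

  ∣∣ᶜ-neg : ∀ z → ∣ -ᶜ z ∣ᶜ ≈ ∣ z ∣ᶜ
  ∣∣ᶜ-neg z = square-injective (∣∣ᶜ-nonneg (-ᶜ z)) (∣∣ᶜ-nonneg z) (≈-trans (∣∣ᶜ-square (-ᶜ z)) (≈-trans
    (solve 2 (λ a b → (:- a) :* (:- a) :+ (:- b) :* (:- b) := a :* a :+ b :* b) ≈-refl (re z) (im z)) (≈-sym (∣∣ᶜ-square z))))

  ∣∣ᶜ-+-≥ : ∀ z w → ∣ z ∣ᶜ - ∣ w ∣ᶜ ≤ ∣ z +ᶜ w ∣ᶜ
  ∣∣ᶜ-+-≥ z w = by≤ (≤⇒0≤- (begin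
    ∣ z ∣ᶜ ≈⟨ ∣∣ᶜ-cong (solveᶜ 2 (λ z w → z :=ᶜ (z :+ᶜ w) :+ᶜ (:-ᶜ w)) ≈ᶜ-refl z w) ⟩
    ∣ (z +ᶜ w) +ᶜ -ᶜ w ∣ᶜ ≤⟨ ∣∣ᶜ-+ _ _ ⟩
    ∣ z +ᶜ w ∣ᶜ + ∣ -ᶜ w ∣ᶜ ≈⟨ +-congˡ (∣∣ᶜ-neg w) ⟩
    ∣ z +ᶜ w ∣ᶜ + ∣ w ∣ᶜ ∎)) (solve 3 (λ a b c → c :- (a :- b) := (c :+ b) :- a) ≈-refl ∣ z ∣ᶜ ∣ w ∣ᶜ ∣ z +ᶜ w ∣ᶜ)

  ∣∣-square : ∀ x → ∣ x ∣ * ∣ x ∣ ≈ x * x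
  ∣∣-square x = ≈-trans (≈-sym (∣∣-* x x)) (∣∣-of-nonneg (square-nonneg x))

  ∣fromℝ∣ᶜ : ∀ x → ∣ fromℝ x ∣ᶜ ≈ ∣ x ∣
  ∣fromℝ∣ᶜ x = square-injective (∣∣ᶜ-nonneg _) (∣∣-nonneg x) (≈-trans (∣∣ᶜ-square _)
    (≈-trans (solve 1 (λ x → x :* x :+ :0 :* :0 := x :* x) ≈-refl x) (≈-sym (∣∣-square x))))

  ∣0∣ᶜ : ∣ 0ᶜ ∣ᶜ ≈ 0#
  ∣0∣ᶜ = ≈-trans (∣fromℝ∣ᶜ 0#) (∣∣-of-nonneg ≤-refl)

  ∣1∣ᶜ : ∣ 1ᶜ ∣ᶜ ≈ 1#
  ∣1∣ᶜ = ≈-trans (∣fromℝ∣ᶜ 1#) (∣∣-of-nonneg 0≤1)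

  ∣re∣≤ : ∀ z → ∣ re z ∣ ≤ ∣ z ∣ᶜ
  ∣re∣≤ z = square-cancel-≤ (∣∣ᶜ-nonneg z) (≤-respʳ-≈ (≈-sym (∣∣ᶜ-square z)) (≤-respˡ-≈ (≈-sym (∣∣-square _))
    (by≤ (square-nonneg (im z)) (solve 2 (λ a b → (a :+ b) :- a := b) ≈-refl (re z * re z) (im z * im z)))))

  ∣im∣≤ : ∀ z → ∣ im z ∣ ≤ ∣ z ∣ᶜ
  ∣im∣≤ z = square-cancel-≤ (∣∣ᶜ-nonneg z) (≤-respʳ-≈ (≈-sym (∣∣ᶜ-square z)) (≤-respˡ-≈ (≈-sym (∣∣-square _))
    (by≤ (square-nonneg (re z)) (solve 2 (λ a b → (a :+ b) :- b := a) ≈-refl (re z * re z) (im z * im z)))))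

  ∣∣ᶜ≤∣re∣+∣im∣ : ∀ z → ∣ z ∣ᶜ ≤ ∣ re z ∣ + ∣ im z ∣
  ∣∣ᶜ≤∣re∣+∣im∣ z = ∣∣ᶜ-≤-by-squares (+-nonneg (∣∣-nonneg _) (∣∣-nonneg _))
    (≤-respˡ-≈ (+-cong (∣∣-square (re z)) (∣∣-square (im z)))
      (by≤ (*-nonNeg (<⇒≤ 0<2) (*-nonNeg (∣∣-nonneg (re z)) (∣∣-nonneg (im z))))
        (solve 2 (λ a b → (a :+ b) :* (a :+ b) :- (a :* a :+ b :* b) := (:1 :+ :1) :* (a :* b)) ≈-refl ∣ re z ∣ ∣ im z ∣)))

  square≈0 : ∀ {x} → x * x ≤ 0# → x ≈ 0#
  square≈0 {x} p with lem {x ≈ 0#}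
  ... | yes e = e
  ... | no n = *-cancel-0 n (antisym p (square-nonneg x))

  normSq-pos : ∀ {z} → ¬ z ≈ᶜ 0ᶜ → 0# < normSq z
  normSq-pos {z} n = normSq-nonneg z , λ e → n
    ( square≈0 (≤-trans (by≤ (square-nonneg (im z)) (solve 2 (λ a b → (a :+ b) :- a := b) ≈-refl (re z * re z) (im z * im z))) (≈⇒≤ (≈-sym e)))
    , square≈0 (≤-trans (by≤ (square-nonneg (re z)) (solve 2 (λ a b → (a :+ b) :- b := a) ≈-refl (re z * re z) (im z * im z))) (≈⇒≤ (≈-sym e))))

  ∣∣ᶜ-pos : ∀ {z} → ¬ z ≈ᶜ 0ᶜ → 0# < ∣ z ∣ᶜ
  ∣∣ᶜ-pos {z} n = ∣∣ᶜ-nonneg z , λ e → proj₂ (normSq-pos n) (≈-trans (≈-sym (zeroˡ 0#)) (≈-trans (*-cong e e) (∣∣ᶜ-square z)))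

  invᶜ : ℂ → ℂ
  invᶜ z = (re z * normSq z ⁻¹) +i (- im z * normSq z ⁻¹)

  invᶜ-inverse : ∀ {z} → ¬ z ≈ᶜ 0ᶜ → z *ᶜ invᶜ z ≈ᶜ 1ᶜ
  invᶜ-inverse {z} n =
    ≈-trans (solve 3 (λ a b i → a :* (a :* i) :- b :* ((:- b) :* i) := (a :* a :+ b :* b) :* i) ≈-refl (re z) (im z) (normSq z ⁻¹)) (⁻¹-inverse (normSq-pos n)) ,
    solve 3 (λ a b i → a :* ((:- b) :* i) :+ b :* (a :* i) := :0) ≈-refl (re z) (im z) (normSq z ⁻¹)

  -- The half-angle formulas: the parts of w are the square roots of (|z| + re z)/2 and (|z| - re
  -- z)/2, both taken nonnegative because im z ≥ 0.
  sqrtᶜ⁺ : ∀ z → 0# ≤ im z → ∃ λ w → w *ᶜ w ≈ᶜ z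
  sqrtᶜ⁺ z p = (a +i b) , diff , ≈-trans (solve 2 (λ a b → a :* b :+ b :* a := (:1 :+ :1) :* (a :* b)) ≈-refl a b) (≈-trans prod (∣∣-of-nonneg p))
    where
    u = half (∣ z ∣ᶜ + re z)
    v = half (∣ z ∣ᶜ - re z)
    half-nonneg : ∀ {x} → 0# ≤ x → 0# ≤ half x
    half-nonneg p = *-nonNeg p (<⇒≤ (⁻¹-pos 0<2))
    0≤u : 0# ≤ u
    0≤u = half-nonneg (by≤ (≤⇒0≤- (≤-trans (-x≤∣x∣ (re z)) (∣re∣≤ z))) (solve 2 (λ a b → (a :+ b) :- :0 := a :- (:- b)) ≈-refl ∣ z ∣ᶜ (re z)))
    0≤v : 0# ≤ v
    0≤v = half-nonneg (≤⇒0≤- (≤-trans (x≤∣x∣ (re z)) (∣re∣≤ z)))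
    a = √ u
    b = √ v
    diff : a * a - b * b ≈ re z
    diff = begin-equality
      a * a - b * b ≈⟨ +-cong (√-square 0≤u) (-‿cong (√-square 0≤v)) ⟩
      u - v ≈⟨ solve 3 (λ m x h → (m :+ x) :* h :- (m :- x) :* h := x :* h :+ x :* h) ≈-refl ∣ z ∣ᶜ (re z) (2# ⁻¹) ⟩
      half (re z) + half (re z) ≈⟨ half+half _ ⟩
      re z ∎
    prod : 2# * (a * b) ≈ ∣ im z ∣
    prod = square-injective (*-nonNeg (<⇒≤ 0<2) (*-nonNeg (√-nonneg 0≤u) (√-nonneg 0≤v))) (∣∣-nonneg _) (begin-equality
      2# * (a * b) * (2# * (a * b)) ≈⟨ solve 3 (λ t a b → t :* (a :* b) :* (t :* (a :* b)) := t :* (a :* a) :* (t :* (b :* b))) ≈-refl 2# a b ⟩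
      2# * (a * a) * (2# * (b * b)) ≈⟨ *-cong (*-congˡ (√-square 0≤u)) (*-congˡ (√-square 0≤v)) ⟩
      2# * u * (2# * v) ≈⟨ *-cong (double (∣ z ∣ᶜ + re z)) (double (∣ z ∣ᶜ - re z)) ⟩
      (∣ z ∣ᶜ + re z) * (∣ z ∣ᶜ - re z) ≈⟨ solve 2 (λ m x → (m :+ x) :* (m :- x) := m :* m :- x :* x) ≈-refl ∣ z ∣ᶜ (re z) ⟩
      ∣ z ∣ᶜ * ∣ z ∣ᶜ - re z * re z ≈⟨ +-congʳ (∣∣ᶜ-square z) ⟩
      normSq z - re z * re z ≈⟨ solve 2 (λ x y → (x :+ y) :- x := y) ≈-refl (re z * re z) (im z * im z) ⟩
      im z * im z ≈⟨ ≈-sym (∣∣-square _) ⟩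
      ∣ im z ∣ * ∣ im z ∣ ∎)
      where
      double : ∀ x → 2# * half x ≈ x
      double x = ≈-trans (solve 1 (λ h → (:1 :+ :1) :* h := h :+ h) ≈-refl (half x)) (half+half x)

  sqrtᶜ : ∀ z → ∃ λ w → w *ᶜ w ≈ᶜ z
  sqrtᶜ z with total 0# (im z)
  ... | inj₁ p = sqrtᶜ⁺ z p
  ... | inj₂ p = let w , e₁ , e₂ = sqrtᶜ⁺ (re z +i (- im z)) (≤0⇒0≤neg p) in (re w +i (- im w)) ,
        ≈-trans (solve 2 (λ a b → a :* a :- (:- b) :* (:- b) := a :* a :- b :* b) ≈-refl (re w) (im w)) e₁ ,
        ≈-trans (solve 2 (λ a b → a :* (:- b) :+ (:- b) :* a := :- (a :* b :+ b :* a)) ≈-refl (re w) (im w)) (≈-trans (-‿cong e₂) (neg-involutive _))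

  -- Fundamental theorem of algebra

  open MonicPolynomial ℂ-commutativeRing public

  taylor-nonconstant : ∀ a c cs → ∃ λ c′ → ∃ λ cs′ → taylor a (c ∷ cs) ≡ c′ ∷ cs′
  taylor-nonconstant a c cs with taylor a cs
  ... | [] = _ , _ , ≡.refl
  ... | _ ∷ _ = _ , _ , ≡.refl

  eval-bound : ∀ cs → ∃ λ B → 0# ≤ B × (∀ h → ∣ h ∣ᶜ ≤ 1# → ∣ eval cs h ∣ᶜ ≤ B)
  eval-bound [] = 1# , 0≤1 , λ h _ → ≈⇒≤ ∣1∣ᶜ
  eval-bound (c ∷ cs) = let B , 0≤B , b = eval-bound cs in ∣ c ∣ᶜ + B , +-nonneg (∣∣ᶜ-nonneg c) 0≤B , λ h p → begin
    ∣ c +ᶜ h *ᶜ eval cs h ∣ᶜ ≤⟨ ∣∣ᶜ-+ _ _ ⟩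
    ∣ c ∣ᶜ + ∣ h *ᶜ eval cs h ∣ᶜ ≈⟨ +-congˡ (∣∣ᶜ-* _ _) ⟩
    ∣ c ∣ᶜ + ∣ h ∣ᶜ * ∣ eval cs h ∣ᶜ ≤⟨ +-monoʳ-≤ _ (*-monoʳ-≤ (∣∣ᶜ-nonneg _) p) ⟩
    ∣ c ∣ᶜ + 1# * ∣ eval cs h ∣ᶜ ≈⟨ +-congˡ (*-identityˡ _) ⟩
    ∣ c ∣ᶜ + ∣ eval cs h ∣ᶜ ≤⟨ +-monoʳ-≤ _ (b h p) ⟩
    ∣ c ∣ᶜ + B ∎

  -- Splits off the power of h in front of the first nonzero coefficient c. The rest g enters later
  -- only through its bound on the unit disc.
  leading-term : ∀ cs → ∃ λ k → ∃ λ c → ∃ λ (g : ℂ → ℂ) → ∃ λ B → ¬ c ≈ᶜ 0ᶜ × 0# ≤ B ×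
    (∀ h → ∣ h ∣ᶜ ≤ 1# → ∣ g h ∣ᶜ ≤ B) × (∀ h → eval cs h ≈ᶜ (h ^ᶜ k) *ᶜ (c +ᶜ h *ᶜ g h))
  leading-term [] = 0 , 1ᶜ , (λ _ → 0ᶜ) , 0# , (λ (e , _) → 0≉1 (≈-sym e)) , ≤-refl , (λ _ _ → ≈⇒≤ ∣0∣ᶜ) ,
    λ h → solveᶜ 1 (λ h → :1ᶜ :=ᶜ :1ᶜ :*ᶜ (:1ᶜ :+ᶜ h :*ᶜ :0ᶜ)) ≈ᶜ-refl h
  leading-term (c ∷ cs) with lem {c ≈ᶜ 0ᶜ}
  ... | no n = let B , 0≤B , b = eval-bound cs in 0 , c , eval cs , B , n , 0≤B , b , λ h → ≈ᶜ-sym (*ᶜ-identityˡ _)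
  ... | yes e = let k , c′ , g , B , n , 0≤B , b , eq = leading-term cs in suc k , c′ , g , B , n , 0≤B , b , λ h →
    ≈ᶜ-trans (+ᶜ-cong e (*ᶜ-congˡ (eq h))) (≈ᶜ-trans (+ᶜ-identityˡ _) (≈ᶜ-sym (*ᶜ-assoc _ _ _)))

  -- A tail may be the constant 1, which does not grow. So the induction keeps the lower bound 1 for
  -- the tail, and the factor z supplies the growth.
  eval-grows : ∀ cs → ∃ λ B → 1# ≤ B × (∀ z → B ≤ ∣ z ∣ᶜ → 1# ≤ ∣ eval cs z ∣ᶜ)
  eval-grows⁺ : ∀ c cs M → 0# ≤ M → ∃ λ B → 1# ≤ B × (∀ z → B ≤ ∣ z ∣ᶜ → M ≤ ∣ eval (c ∷ cs) z ∣ᶜ)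
  eval-grows [] = 1# , ≤-refl , λ z _ → ≈⇒≤ (≈-sym ∣1∣ᶜ)
  eval-grows (c ∷ cs) = eval-grows⁺ c cs 1# 0≤1
  eval-grows⁺ c cs M 0≤M = B + (M + ∣ c ∣ᶜ) , ≤-trans 1≤B (B≤ (+-nonneg 0≤M (∣∣ᶜ-nonneg c))) , λ z p →
    let p₁ = ≤-trans (B≤ (+-nonneg 0≤M (∣∣ᶜ-nonneg c))) p
        p₂ = ≤-trans (by≤ (≤-trans 0≤1 1≤B) (solve 2 (λ b m → (b :+ m) :- m := b) ≈-refl B (M + ∣ c ∣ᶜ))) p
    in begin
      M ≈⟨ solve 2 (λ m c → m := (m :+ c) :- c) ≈-refl M ∣ c ∣ᶜ ⟩
      (M + ∣ c ∣ᶜ) - ∣ c ∣ᶜ ≤⟨ +-monoˡ-≤ _ p₂ ⟩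
      ∣ z ∣ᶜ - ∣ c ∣ᶜ ≈⟨ +-congʳ (≈-sym (*-identityʳ _)) ⟩
      ∣ z ∣ᶜ * 1# - ∣ c ∣ᶜ ≤⟨ +-monoˡ-≤ _ (*-monoˡ-≤ (∣∣ᶜ-nonneg z) (grow z p₁)) ⟩
      ∣ z ∣ᶜ * ∣ eval cs z ∣ᶜ - ∣ c ∣ᶜ ≈⟨ +-congʳ (≈-sym (∣∣ᶜ-* z _)) ⟩
      ∣ z *ᶜ eval cs z ∣ᶜ - ∣ c ∣ᶜ ≤⟨ ∣∣ᶜ-+-≥ _ _ ⟩
      ∣ z *ᶜ eval cs z +ᶜ c ∣ᶜ ≈⟨ ∣∣ᶜ-cong (solveᶜ 2 (λ c w → w :+ᶜ c :=ᶜ c :+ᶜ w) ≈ᶜ-refl c (z *ᶜ eval cs z)) ⟩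
      ∣ c +ᶜ z *ᶜ eval cs z ∣ᶜ ∎
    where
    ih = eval-grows cs
    B = proj₁ ih
    1≤B = proj₁ (proj₂ ih)
    grow = proj₂ (proj₂ ih)
    B≤ : ∀ {x} → 0# ≤ x → B ≤ B + x
    B≤ {x} p = by≤ p (solve 2 (λ b x → (b :+ x) :- b := x) ≈-refl B x)

  parity : ∀ k → ∃ λ j → k ≡ j ℕ.+ j ⊎ k ≡ suc (j ℕ.+ j)
  parity zero = 0 , inj₁ ≡.refl
  parity (suc k) with parity k
  ... | j , inj₁ e = j , inj₂ (≡.cong suc e)
  ... | j , inj₂ e = suc j , inj₁ (≡.trans (≡.cong suc e) (≡.cong suc (≡.sym (ℕP.+-suc j j))))

  -- An odd power of i is i or -i; the square of the imaginary part covers both signs.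
  i^odd : ∀ j → re ((0# +i 1#) ^ᶜ suc (j ℕ.+ j)) ≈ 0# × im ((0# +i 1#) ^ᶜ suc (j ℕ.+ j)) * im ((0# +i 1#) ^ᶜ suc (j ℕ.+ j)) ≈ 1#
  i^odd zero = solve 0 (:0 :* :1 :- :1 :* :0 := :0) ≈-refl , solve 0 ((:0 :* :0 :+ :1 :* :1) :* (:0 :* :0 :+ :1 :* :1) := :1) ≈-refl
  i^odd (suc j) rewrite ℕP.+-suc j j = let r , i = i^odd j; w = (0# +i 1#) ^ᶜ suc (j ℕ.+ j) in
    ≈-trans (solve 2 (λ a b → :0 :* (:0 :* a :- :1 :* b) :- :1 :* (:0 :* b :+ :1 :* a) := :- a) ≈-refl (re w) (im w)) (≈-trans (-‿cong r) neg-0) ,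
    ≈-trans (solve 2 (λ a b → (:0 :* (:0 :* b :+ :1 :* a) :+ :1 :* (:0 :* a :- :1 :* b)) :* (:0 :* (:0 :* b :+ :1 :* a) :+ :1 :* (:0 :* a :- :1 :* b)) := b :* b) ≈-refl (re w) (im w)) i

  neg^odd : ∀ z j → (-ᶜ z) ^ᶜ suc (j ℕ.+ j) ≈ᶜ -ᶜ (z ^ᶜ suc (j ℕ.+ j))
  neg^odd z zero = solveᶜ 1 (λ z → (:-ᶜ z) :*ᶜ :1ᶜ :=ᶜ :-ᶜ (z :*ᶜ :1ᶜ)) ≈ᶜ-refl z
  neg^odd z (suc j) rewrite ℕP.+-suc j j = ≈ᶜ-trans (*ᶜ-congˡ (*ᶜ-congˡ (neg^odd z j)))
    (solveᶜ 2 (λ z w → (:-ᶜ z) :*ᶜ ((:-ᶜ z) :*ᶜ (:-ᶜ w)) :=ᶜ :-ᶜ (z :*ᶜ (z :*ᶜ w))) ≈ᶜ-refl z (z ^ᶜ suc (j ℕ.+ j)))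

  -- For odd k one of ±1, ±i will do; for even k take a square root of a direction for k/2.
  descent-direction : ∀ k → 0 ℕ.< k → ∀ c → ¬ c ≈ᶜ 0ᶜ → ∃ λ h → re (c *ᶜ (h ^ᶜ k)) < 0#
  descent-direction = <-rec _ λ k rec 0<k c c≉0 → go k rec 0<k c c≉0 (parity k)
    where
    odd : ∀ j c → ¬ c ≈ᶜ 0ᶜ → ∀ z → ¬ re (c *ᶜ (z ^ᶜ suc (j ℕ.+ j))) ≈ 0# → ∃ λ h → re (c *ᶜ (h ^ᶜ suc (j ℕ.+ j))) < 0#
    odd j c c≉0 z n with total (re (c *ᶜ (z ^ᶜ suc (j ℕ.+ j)))) 0#
    ... | inj₁ p = z , p , n
    ... | inj₂ p = -ᶜ z , <-respˡ (≈-sym (≈-trans (proj₁ (*ᶜ-congˡ {c} (neg^odd z j)))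
            (proj₁ (solveᶜ 2 (λ c w → c :*ᶜ (:-ᶜ w) :=ᶜ :-ᶜ (c :*ᶜ w)) ≈ᶜ-refl c (z ^ᶜ suc (j ℕ.+ j)))))) (<-respʳ neg-0 (neg-mono-< (p , λ e → n (≈-sym e))))
    1^ᶜ : ∀ n → 1ᶜ ^ᶜ n ≈ᶜ 1ᶜ
    1^ᶜ zero = ≈ᶜ-refl
    1^ᶜ (suc n) = ≈ᶜ-trans (*ᶜ-identityˡ _) (1^ᶜ n)
    go : ∀ k → (∀ {j} → j ℕ.< k → 0 ℕ.< j → ∀ c → ¬ c ≈ᶜ 0ᶜ → ∃ λ h → re (c *ᶜ (h ^ᶜ j)) < 0#) →
      0 ℕ.< k → ∀ c → ¬ c ≈ᶜ 0ᶜ → (∃ λ j → k ≡ j ℕ.+ j ⊎ k ≡ suc (j ℕ.+ j)) → ∃ λ h → re (c *ᶜ (h ^ᶜ k)) < 0#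
    go _ rec () c c≉0 (zero , inj₁ ≡.refl)
    go _ rec 0<k c c≉0 (suc j , inj₁ ≡.refl) =
      let h , p = rec {suc j} (ℕP.m<m+n (suc j) (ℕ.s≤s ℕ.z≤n)) (ℕ.s≤s ℕ.z≤n) c c≉0
          g , e = sqrtᶜ h
      in g , <-respˡ (≈-sym (proj₁ (*ᶜ-congˡ {c} (≈ᶜ-trans (^ᶜ-homo-* g (suc j) (suc j))
           (≈ᶜ-trans (≈ᶜ-sym (^ᶜ-distrib-* g g (suc j))) (^ᶜ-congˡ (suc j) e)))))) p
    go _ rec 0<k c c≉0 (j , inj₂ ≡.refl) with lem {re c ≈ 0#}
    ... | no n = odd j c c≉0 1ᶜ λ e → n (≈-trans (≈-sym (proj₁ (≈ᶜ-trans (*ᶜ-congˡ (1^ᶜ (suc (j ℕ.+ j)))) (*ᶜ-identityʳ c)))) e)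
    ... | yes e = odd j c c≉0 (0# +i 1#) λ e′ →
      let w = (0# +i 1#) ^ᶜ suc (j ℕ.+ j)
          r , i = i^odd j
      in c≉0 (e , (begin-equality
        im c ≈⟨ ≈-sym (*-identityʳ _) ⟩
        im c * 1# ≈⟨ *-congˡ (≈-sym i) ⟩
        im c * (im w * im w) ≈⟨ solve 4 (λ a b c d → b :* (d :* d) := (:- d) :* (a :* c :- b :* d) :+ a :* c :* d) ≈-refl (re c) (im c) (re w) (im w) ⟩
        - im w * (re c * re w - im c * im w) + re c * re w * im w ≈⟨ +-cong (*-congˡ e′) (*-congʳ (*-congʳ e)) ⟩
        - im w * 0# + 0# * re w * im w ≈⟨ solve 2 (λ a b → (:- b) :* :0 :+ :0 :* a :* b := :0) ≈-refl (re w) (im w) ⟩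
        0# ∎))

  by-contradiction : {A : Set} → ¬ ¬ A → A
  by-contradiction {A} n with lem {A}
  ... | yes a = a
  ... | no m = ⊥-elim (n m)

  -- Proved for an abstract ring, where the solver meets atoms instead of pairs of real numbers. In
  -- the application the product of c₀ and i is 1.
  descent-identity : (CR : CommutativeRing 0ℓ 0ℓ) → let module C = CommutativeRing CR in
    ∀ c₀ i η ζᵏ ζ c ε g → c₀ C.+ (c₀ C.* i) C.* ((η C.* ζᵏ) C.* (c C.+ (ε C.* ζ) C.* g))
      C.≈ c₀ C.* ((C.1# C.+ η C.* ((c C.* i) C.* ζᵏ)) C.+ η C.* (ε C.* ((ζᵏ C.* ζ) C.* g C.* i)))
  descent-identity CR = K.solve 8 (λ c₀ i η ζᵏ ζ c ε g → c₀ K.:+ (c₀ K.:* i) K.:* ((η K.:* ζᵏ) K.:* (c K.:+ (ε K.:* ζ) K.:* g))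
      K.:= c₀ K.:* ((K.:1 K.:+ η K.:* ((c K.:* i) K.:* ζᵏ)) K.:+ η K.:* (ε K.:* ((ζᵏ K.:* ζ) K.:* g K.:* i)))) (CommutativeRing.refl CR)
    where module K = RingKit CR

  small : ∀ X → 0# ≤ X → ∃ λ ε → 0# < ε × ε ≤ 1# × (∀ {x} → 0# ≤ x → x ≤ X → ε * x ≤ 1#)
  small X 0≤X = (1# + X) ⁻¹ , ⁻¹-pos 0<1+X ,
    ≤-trans (⁻¹-antitone 0<1 (by≤ 0≤X (solve 1 (λ x → (:1 :+ x) :- :1 := x) ≈-refl X))) (≈⇒≤ (≈-sym (inverse-unique (*-identityˡ 1#)))) ,
    λ {x} p q → begin
      (1# + X) ⁻¹ * x ≤⟨ *-monoˡ-≤ (<⇒≤ (⁻¹-pos 0<1+X)) (≤-trans q (by≤ 0≤1 (solve 1 (λ x → (:1 :+ x) :- x := :1) ≈-refl X))) ⟩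
      (1# + X) ⁻¹ * (1# + X) ≈⟨ ≈-trans (*-comm _ _) (⁻¹-inverse 0<1+X) ⟩
      1# ∎
    where 0<1+X = +-pos 0<1 0≤X

  -- The argument of d'Alembert and Argand. With h = εζ and η = ε^(k + 1), f(z₀ + h) = c₀(1 + ηα +
  -- ηεβ), where ζ is chosen so that re α = -2δ < 0. For small ε, |1 + ηα| ≤ 1 - ηδ and ε|β| < δ, so
  -- the second factor has modulus below 1.
  modulus-decreases : ∀ c cs z₀ → ¬ eval (c ∷ cs) z₀ ≈ᶜ 0ᶜ → ∃ λ z → ∣ eval (c ∷ cs) z ∣ᶜ < ∣ eval (c ∷ cs) z₀ ∣ᶜ
  modulus-decreases c₁ cs z₀ f≉0 with taylor-nonconstant z₀ c₁ cs
  ... | c₀ , ds , eq with leading-term ds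
  ... | k , c , g , B , c≉0 , 0≤B , g≤B , expand = z₀ +ᶜ h , (begin-strict
      ∣ f (z₀ +ᶜ h) ∣ᶜ ≈⟨ ∣∣ᶜ-cong value ⟩
      ∣ c₀ *ᶜ ((1ᶜ +ᶜ fromℝ η *ᶜ α) +ᶜ fromℝ η *ᶜ (fromℝ ε *ᶜ β)) ∣ᶜ ≈⟨ ∣∣ᶜ-* _ _ ⟩
      ∣ c₀ ∣ᶜ * ∣ (1ᶜ +ᶜ fromℝ η *ᶜ α) +ᶜ fromℝ η *ᶜ (fromℝ ε *ᶜ β) ∣ᶜ <⟨ *-monoˡ-< (∣∣ᶜ-pos c₀≉0) less ⟩
      ∣ c₀ ∣ᶜ * 1# ≈⟨ *-identityʳ _ ⟩
      ∣ c₀ ∣ᶜ ≈⟨ ∣∣ᶜ-cong (≈ᶜ-sym f≈c₀) ⟩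
      ∣ f z₀ ∣ᶜ ∎)
    where
    f = eval (c₁ ∷ cs)
    f-expand : ∀ h → f (z₀ +ᶜ h) ≈ᶜ c₀ +ᶜ h *ᶜ eval ds h
    f-expand h = ≈ᶜ-trans (≈ᶜ-sym (eval-taylor z₀ (c₁ ∷ cs) h)) (≈ᶜ-reflexive (≡.cong (λ p → eval p h) eq))
    f≈c₀ : f z₀ ≈ᶜ c₀
    f≈c₀ = ≈ᶜ-trans (eval-cong (c₁ ∷ cs) (solveᶜ 1 (λ z → z :=ᶜ z :+ᶜ :0ᶜ) ≈ᶜ-refl z₀)) (≈ᶜ-trans (f-expand 0ᶜ)
      (solveᶜ 2 (λ c e → c :+ᶜ :0ᶜ :*ᶜ e :=ᶜ c) ≈ᶜ-refl c₀ (eval ds 0ᶜ)))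
    c₀≉0 : ¬ c₀ ≈ᶜ 0ᶜ
    c₀≉0 e = f≉0 (≈ᶜ-trans f≈c₀ e)
    i = invᶜ c₀
    a = c *ᶜ i
    a≉0 : ¬ a ≈ᶜ 0ᶜ
    a≉0 e = c≉0 (≈ᶜ-trans (≈ᶜ-trans (≈ᶜ-sym (*ᶜ-identityʳ c)) (*ᶜ-congˡ (≈ᶜ-sym (invᶜ-inverse c₀≉0))))
      (≈ᶜ-trans (solveᶜ 3 (λ c c₀ i → c :*ᶜ (c₀ :*ᶜ i) :=ᶜ (c :*ᶜ i) :*ᶜ c₀) ≈ᶜ-refl c c₀ i) (≈ᶜ-trans (*ᶜ-congʳ e) (zeroᶜˡ c₀))))
    dir = descent-direction (suc k) (ℕ.s≤s ℕ.z≤n) a a≉0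
    ζ = proj₁ dir
    ζᵏ = ζ ^ᶜ suc k
    α = a *ᶜ ζᵏ
    δ = half (- re α)
    0<δ : 0# < δ
    0<δ = half-pos (<0⇒0<neg (proj₂ dir))
    reα : re α ≈ - (δ + δ)
    reα = ≈-trans (≈-sym (neg-involutive _)) (-‿cong (≈-sym (half+half (- re α))))
    B′ = ∣ ζᵏ *ᶜ ζ ∣ᶜ * B * ∣ i ∣ᶜ
    0≤B′ : 0# ≤ B′
    0≤B′ = *-nonNeg (*-nonNeg (∣∣ᶜ-nonneg _) 0≤B) (∣∣ᶜ-nonneg i)
    -- ε has to satisfy ε|ζ| ≤ 1, ε|α|² ≤ 2δ, εδ ≤ 1 and ε(B′ + 1) ≤ δ. `small`, applied to the sum
    -- of the four bounds on 1/ε, serves all of them.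
    X₁ = ∣ ζ ∣ᶜ
    X₂ = normSq α * (δ + δ) ⁻¹
    X₄ = (B′ + 1#) * δ ⁻¹
    0≤X₁ = ∣∣ᶜ-nonneg ζ
    0<δ+δ = +-pos 0<δ (<⇒≤ 0<δ)
    0≤X₂ : 0# ≤ X₂
    0≤X₂ = *-nonNeg (normSq-nonneg α) (<⇒≤ (⁻¹-pos 0<δ+δ))
    0≤X₄ : 0# ≤ X₄
    0≤X₄ = *-nonNeg (+-nonneg 0≤B′ 0≤1) (<⇒≤ (⁻¹-pos 0<δ))
    sm = small (((X₁ + X₂) + δ) + X₄) (+-nonneg (+-nonneg (+-nonneg 0≤X₁ 0≤X₂) (<⇒≤ 0<δ)) 0≤X₄)
    ε = proj₁ sm
    0<ε = proj₁ (proj₂ sm)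
    ε≤1 = proj₁ (proj₂ (proj₂ sm))
    ε*_≤1 = proj₂ (proj₂ (proj₂ sm))
    ε-X₁ : ε * X₁ ≤ 1#
    ε-X₁ = ε* 0≤X₁ ≤1 (by≤ (+-nonneg (+-nonneg 0≤X₂ (<⇒≤ 0<δ)) 0≤X₄) (solve 4 (λ a b c d → (((a :+ b) :+ c) :+ d) :- a := (b :+ c) :+ d) ≈-refl X₁ X₂ δ X₄))
    ε-X₂ : ε * X₂ ≤ 1#
    ε-X₂ = ε* 0≤X₂ ≤1 (by≤ (+-nonneg (+-nonneg 0≤X₁ (<⇒≤ 0<δ)) 0≤X₄) (solve 4 (λ a b c d → (((a :+ b) :+ c) :+ d) :- b := (a :+ c) :+ d) ≈-refl X₁ X₂ δ X₄))
    ε-δ : ε * δ ≤ 1#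
    ε-δ = ε* (<⇒≤ 0<δ) ≤1 (by≤ (+-nonneg (+-nonneg 0≤X₁ 0≤X₂) 0≤X₄) (solve 4 (λ a b c d → (((a :+ b) :+ c) :+ d) :- c := (a :+ b) :+ d) ≈-refl X₁ X₂ δ X₄))
    ε-X₄ : ε * X₄ ≤ 1#
    ε-X₄ = ε* 0≤X₄ ≤1 (by≤ (+-nonneg (+-nonneg 0≤X₁ 0≤X₂) (<⇒≤ 0<δ)) (solve 4 (λ a b c d → (((a :+ b) :+ c) :+ d) :- d := (a :+ b) :+ c) ≈-refl X₁ X₂ δ X₄))
    unscale : ∀ {y d} → 0# < d → ε * (y * d ⁻¹) ≤ 1# → ε * y ≤ d
    unscale {y} {d} 0<d p = begin
      ε * y ≈⟨ ≈-trans (≈-sym (*-identityʳ _)) (*-congˡ (≈-sym (⁻¹-inverse 0<d))) ⟩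
      ε * y * (d * d ⁻¹) ≈⟨ solve 4 (λ e y d i → e :* y :* (d :* i) := d :* (e :* (y :* i))) ≈-refl ε y d (d ⁻¹) ⟩
      d * (ε * (y * d ⁻¹)) ≤⟨ *-monoˡ-≤ (<⇒≤ 0<d) p ⟩
      d * 1# ≈⟨ *-identityʳ d ⟩
      d ∎
    η = ε ^ suc k
    0<η : 0# < η
    0<η = ^-pos (suc k) 0<ε
    η≤ε : η ≤ ε
    η≤ε = ≤-trans (*-monoˡ-≤ (<⇒≤ 0<ε) (^-≤1 k (<⇒≤ 0<ε) ε≤1)) (≈⇒≤ (*-identityʳ ε))
    h = fromℝ ε *ᶜ ζ
    ∣h∣≤1 : ∣ h ∣ᶜ ≤ 1#
    ∣h∣≤1 = ≤-trans (≈⇒≤ (≈-trans (∣∣ᶜ-* (fromℝ ε) ζ) (*-congʳ (≈-trans (∣fromℝ∣ᶜ ε) (∣∣-of-nonneg (<⇒≤ 0<ε)))))) ε-X₁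
    β = (ζᵏ *ᶜ ζ) *ᶜ g h *ᶜ i
    ∣β∣≤ : ∣ β ∣ᶜ ≤ B′
    ∣β∣≤ = ≤-trans (≈⇒≤ (≈-trans (∣∣ᶜ-* _ i) (*-congʳ (∣∣ᶜ-* _ (g h))))) (*-monoʳ-≤ (∣∣ᶜ-nonneg i) (*-monoˡ-≤ (∣∣ᶜ-nonneg (ζᵏ *ᶜ ζ)) (g≤B h ∣h∣≤1)))
    hᵏ : h ^ᶜ suc k ≈ᶜ fromℝ η *ᶜ ζᵏ
    hᵏ = ≈ᶜ-trans (^ᶜ-distrib-* (fromℝ ε) ζ (suc k)) (*ᶜ-congʳ (≈ᶜ-sym (fromℝ-^ ε (suc k))))
    value : f (z₀ +ᶜ h) ≈ᶜ c₀ *ᶜ ((1ᶜ +ᶜ fromℝ η *ᶜ α) +ᶜ fromℝ η *ᶜ (fromℝ ε *ᶜ β))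
    value =
      ≈ᶜ-trans (f-expand h) (≈ᶜ-trans (+ᶜ-congˡ (≈ᶜ-trans (*ᶜ-congˡ (expand h)) (≈ᶜ-trans (≈ᶜ-sym (*ᶜ-assoc _ _ _)) (*ᶜ-congʳ hᵏ))))
      (≈ᶜ-trans (≈ᶜ-trans (+ᶜ-congˡ (≈ᶜ-sym (≈ᶜ-trans (*ᶜ-congʳ (invᶜ-inverse c₀≉0)) (*ᶜ-identityˡ _))))
        (descent-identity ℂ-commutativeRing c₀ i (fromℝ η) ζᵏ ζ c (fromℝ ε) (g h))) ≈ᶜ-refl))
    main≤ : ∣ 1ᶜ +ᶜ fromℝ η *ᶜ α ∣ᶜ ≤ 1# - η * δ
    main≤ = ∣∣ᶜ-≤-by-squares (≤⇒0≤- (≤-trans (*-monoʳ-≤ (<⇒≤ 0<δ) η≤ε) ε-δ)) (begin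
      normSq (1ᶜ +ᶜ fromℝ η *ᶜ α) ≈⟨ solve 3 (λ η a b → (:1 :+ (η :* a :- :0 :* b)) :* (:1 :+ (η :* a :- :0 :* b)) :+ (:0 :+ (η :* b :+ :0 :* a)) :* (:0 :+ (η :* b :+ :0 :* a))
                                                               := :1 :+ ((η :* a :+ η :* a) :+ η :* (η :* (a :* a :+ b :* b)))) ≈-refl η (re α) (im α) ⟩
      1# + ((η * re α + η * re α) + η * (η * normSq α)) ≤⟨ +-monoʳ-≤ 1# (+-mono-≤ (≈⇒≤ (+-cong (*-congˡ reα) (*-congˡ reα)))
                                                              (*-monoˡ-≤ (<⇒≤ 0<η) (≤-trans (*-monoʳ-≤ (normSq-nonneg α) η≤ε) (unscale 0<δ+δ ε-X₂)))) ⟩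
      1# + ((η * - (δ + δ) + η * - (δ + δ)) + η * (δ + δ)) ≤⟨ by≤ (square-nonneg (η * δ)) (solve 2 (λ η d → (:1 :- η :* d) :* (:1 :- η :* d) :- (:1 :+ ((η :* (:- (d :+ d)) :+ η :* (:- (d :+ d))) :+ η :* (d :+ d)))
                                                                := (η :* d) :* (η :* d)) ≈-refl η δ) ⟩
      (1# - η * δ) * (1# - η * δ) ∎)
    ε-B′ : ε * B′ < δ
    ε-B′ = <-≤-trans (by< 0<ε (solve 2 (λ e b → e :* (b :+ :1) :- e :* b := e) ≈-refl ε B′)) (unscale 0<δ ε-X₄)
    less : ∣ (1ᶜ +ᶜ fromℝ η *ᶜ α) +ᶜ fromℝ η *ᶜ (fromℝ ε *ᶜ β) ∣ᶜ < 1#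
    less = begin-strict
      ∣ (1ᶜ +ᶜ fromℝ η *ᶜ α) +ᶜ fromℝ η *ᶜ (fromℝ ε *ᶜ β) ∣ᶜ ≤⟨ ∣∣ᶜ-+ _ _ ⟩
      ∣ 1ᶜ +ᶜ fromℝ η *ᶜ α ∣ᶜ + ∣ fromℝ η *ᶜ (fromℝ ε *ᶜ β) ∣ᶜ ≤⟨ +-mono-≤ main≤ (≈⇒≤ (≈-trans (∣∣ᶜ-* _ _) (*-cong (∣pos∣ 0<η) (≈-trans (∣∣ᶜ-* _ _) (*-congʳ (∣pos∣ 0<ε)))))) ⟩
      (1# - η * δ) + η * (ε * ∣ β ∣ᶜ) ≤⟨ +-monoʳ-≤ _ (*-monoˡ-≤ (<⇒≤ 0<η) (*-monoˡ-≤ (<⇒≤ 0<ε) ∣β∣≤)) ⟩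
      (1# - η * δ) + η * (ε * B′) <⟨ by< (*-pos 0<η (<⇒0<- ε-B′)) (solve 3 (λ η d b → :1 :- ((:1 :- η :* d) :+ η :* b) := η :* (d :- b)) ≈-refl η δ (ε * B′)) ⟩
      1# ∎
      where
      ∣pos∣ : ∀ {x} → 0# < x → ∣ fromℝ x ∣ᶜ ≈ x
      ∣pos∣ p = ≈-trans (∣fromℝ∣ᶜ _) (∣∣-of-nonneg (<⇒≤ p))

  modulus-lower-continuous : ∀ cs z₀ {t} → t < ∣ eval cs z₀ ∣ᶜ →
    ∃ λ δ → 0# < δ × (∀ z → ∣ re z - re z₀ ∣ ≤ δ → ∣ im z - im z₀ ∣ ≤ δ → t < ∣ eval cs z ∣ᶜ)
  modulus-lower-continuous [] z₀ p = 1# , 0<1 , λ _ _ _ → p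
  modulus-lower-continuous (c ∷ cs) z₀ {t} p with taylor-nonconstant z₀ c cs
  ... | c₀ , ds , eq = δ , half-pos 0<ε , λ z p₁ p₂ →
    let h = z +ᶜ (-ᶜ z₀)
        ∣h∣≤ε : ∣ h ∣ᶜ ≤ ε
        ∣h∣≤ε = ≤-trans (∣∣ᶜ≤∣re∣+∣im∣ h) (≤-trans (+-mono-≤ p₁ p₂) (≈⇒≤ (half+half ε)))
    in begin-strict
      t ≈⟨ solve 2 (λ t m → t := m :- (m :- t)) ≈-refl t ∣ c₀ ∣ᶜ ⟩
      ∣ c₀ ∣ᶜ - g <⟨ +-mono-≤-< ≤-refl (neg-mono-< (<-respˡ (*-comm _ _) εB<g)) ⟩
      ∣ c₀ ∣ᶜ - B * ε ≤⟨ +-monoʳ-≤ _ (neg-mono-≤ (begin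
          ∣ h *ᶜ eval ds h ∣ᶜ ≈⟨ ≈-trans (∣∣ᶜ-* _ _) (*-comm _ _) ⟩
          ∣ eval ds h ∣ᶜ * ∣ h ∣ᶜ ≤⟨ *-mono-≤ (∣∣ᶜ-nonneg _) (<⇒≤ 0<ε) (bound h (≤-trans ∣h∣≤ε ε≤1)) ∣h∣≤ε ⟩
          B * ε ∎)) ⟩
      ∣ c₀ ∣ᶜ - ∣ h *ᶜ eval ds h ∣ᶜ ≤⟨ ∣∣ᶜ-+-≥ _ _ ⟩
      ∣ c₀ +ᶜ h *ᶜ eval ds h ∣ᶜ ≈⟨ ∣∣ᶜ-cong (≈ᶜ-sym (f-expand h)) ⟩
      ∣ eval (c ∷ cs) (z₀ +ᶜ h) ∣ᶜ ≈⟨ ∣∣ᶜ-cong (eval-cong (c ∷ cs) (solveᶜ 2 (λ z₀ z → z₀ :+ᶜ (z :+ᶜ (:-ᶜ z₀)) :=ᶜ z) ≈ᶜ-refl z₀ z)) ⟩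
      ∣ eval (c ∷ cs) z ∣ᶜ ∎
    where
    f-expand : ∀ h → eval (c ∷ cs) (z₀ +ᶜ h) ≈ᶜ c₀ +ᶜ h *ᶜ eval ds h
    f-expand h = ≈ᶜ-trans (≈ᶜ-sym (eval-taylor z₀ (c ∷ cs) h)) (≈ᶜ-reflexive (≡.cong (λ p → eval p h) eq))
    f≈c₀ : eval (c ∷ cs) z₀ ≈ᶜ c₀
    f≈c₀ = ≈ᶜ-trans (eval-cong (c ∷ cs) (solveᶜ 1 (λ z → z :=ᶜ z :+ᶜ :0ᶜ) ≈ᶜ-refl z₀)) (≈ᶜ-trans (f-expand 0ᶜ)
      (solveᶜ 2 (λ c e → c :+ᶜ :0ᶜ :*ᶜ e :=ᶜ c) ≈ᶜ-refl c₀ (eval ds 0ᶜ)))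
    g = ∣ c₀ ∣ᶜ - t
    0<g : 0# < g
    0<g = <⇒0<- (<-respʳ (∣∣ᶜ-cong f≈c₀) p)
    bd = eval-bound ds
    B = proj₁ bd
    0≤B = proj₁ (proj₂ bd)
    bound = proj₂ (proj₂ bd)
    0≤X : 0# ≤ (B + 1#) * g ⁻¹
    0≤X = *-nonNeg (+-nonneg 0≤B 0≤1) (<⇒≤ (⁻¹-pos 0<g))
    sm = small ((B + 1#) * g ⁻¹) 0≤X
    ε = proj₁ sm
    0<ε = proj₁ (proj₂ sm)
    ε≤1 = proj₁ (proj₂ (proj₂ sm))
    δ = half ε
    εB<g : ε * B < g
    εB<g = begin-strict
      ε * B <⟨ by< 0<ε (solve 2 (λ e b → e :* (b :+ :1) :- e :* b := e) ≈-refl ε B) ⟩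
      ε * (B + 1#) ≈⟨ ≈-trans (≈-sym (*-identityʳ _)) (*-congˡ (≈-sym (⁻¹-inverse 0<g))) ⟩
      ε * (B + 1#) * (g * g ⁻¹) ≈⟨ solve 4 (λ e y d i → e :* y :* (d :* i) := d :* (e :* (y :* i))) ≈-refl ε (B + 1#) g (g ⁻¹) ⟩
      g * (ε * ((B + 1#) * g ⁻¹)) ≤⟨ *-monoˡ-≤ (<⇒≤ 0<g) (proj₂ (proj₂ (proj₂ sm)) 0≤X ≤-refl) ⟩
      g * 1# ≈⟨ *-identityʳ g ⟩
      g ∎

  -- A form of the Heine–Borel theorem.
  cousin : (P : ℝ → ℝ → Set) →
    (∀ {a b c} → a ≤ b → b ≤ c → P a b → P b c → P a c) →
    (∀ x → ∃ λ δ → 0# < δ × (∀ a b → x - δ ≤ a → a ≤ b → b ≤ x + δ → P a b)) →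
    ∀ a b → a ≤ b → P a b
  cousin P glue local a b a≤b = result
    where
    In : ℝ → Set
    In x = a ≤ x × x ≤ b × P a x
    below : ∀ x {δ} → 0# < δ → x - δ ≤ x
    below x {δ} p = by≤ (<⇒≤ p) (solve 2 (λ x d → x :- (x :- d) := d) ≈-refl x δ)
    above : ∀ x {δ} → 0# < δ → x ≤ x + δ
    above x {δ} p = by≤ (<⇒≤ p) (solve 2 (λ x d → (x :+ d) :- x := d) ≈-refl x δ)
    base : In a
    base = ≤-refl , a≤b , proj₂ (proj₂ (local a)) a a (below a (proj₁ (proj₂ (local a)))) ≤-refl (above a (proj₁ (proj₂ (local a))))
    conclude : (∃ λ s → UpperBound In s × (∀ {c} → UpperBound In c → s ≤ c)) → P a b
    conclude (s , upper , least) with local s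
    ... | δ , 0<δ , P-near = extend near (≤-or-> b (s + δ))
      where
      near : ∃ λ x → In x × s - δ ≤ x
      near = by-contradiction λ n → <⇒≱ (by< {s - δ} {s} 0<δ (solve 2 (λ x d → x :- (x :- d) := d) ≈-refl s δ))
        (least (λ {x} h → <⇒≤ (≰⇒> λ q → n (x , h , q))))
      extend : (∃ λ x → In x × s - δ ≤ x) → b ≤ s + δ ⊎ s + δ < b → P a b
      extend (x , (a≤x , x≤b , Pax) , p) (inj₁ b≤) = glue a≤x x≤b Pax (P-near x b p x≤b b≤)
      extend (x , (a≤x , x≤b , Pax) , p) (inj₂ b>) = ⊥-elim (<⇒≱ (by< {s} {s + δ} 0<δ (solve 2 (λ x d → (x :+ d) :- x := d) ≈-refl s δ))
            (upper (≤-trans a≤x x≤s+δ , <⇒≤ b> , glue a≤x x≤s+δ Pax (P-near x (s + δ) p x≤s+δ ≤-refl))))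
        where x≤s+δ = ≤-trans (upper (a≤x , x≤b , Pax)) (above s 0<δ)
    result : P a b
    result = conclude (supremum In (a , base) (b , λ (_ , q , _) → q))

  -- A coercive lower semicontinuous function has a minimum, in negative form. Near each point a
  -- single w satisfies g w < g throughout. `cousin`, applied along each vertical segment and then
  -- across the segments, glues these neighbourhoods until one w beats a whole square. Such a w lies
  -- neither in the square nor, by coercivity, outside.
  no-coercive-descent : (g : ℂ → ℝ) → (∀ z → ∃ λ w → g w < g z) →
    (∀ z₀ t → t < g z₀ → ∃ λ δ → 0# < δ × (∀ z → ∣ re z - re z₀ ∣ ≤ δ → ∣ im z - im z₀ ∣ ≤ δ → t < g z)) →
    ∀ B → 0# ≤ B → (∀ z → B ≤ ∣ z ∣ᶜ → g 0ᶜ ≤ g z) → ⊥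
  no-coercive-descent g decreases lower-continuous B 0≤B coercive = impossible
    where
    -B≤B : - B ≤ B
    -B≤B = ≤-trans (≤-respʳ-≈ neg-0 (neg-mono-≤ 0≤B)) 0≤B
    Between : ℝ → ℝ → ℝ → Set
    Between a b x = a ≤ x × x ≤ b
    -- A single point beats a rectangle.
    data Beaten (X Y : ℝ → Set) : Set where
      _beats_ : ∀ w → (∀ x y → X x → Y y → g w < g (x +i y)) → Beaten X Y
    glue : ∀ {X X₁ X₂ Y Y₁ Y₂ : ℝ → Set} → Beaten X₁ Y₁ → Beaten X₂ Y₂ → (∀ x y → X x → Y y → (X₁ x × Y₁ y) ⊎ (X₂ x × Y₂ y)) → Beaten X Y
    glue {X} {X₁} {X₂} {Y} {Y₁} {Y₂} (w₁ beats h₁) (w₂ beats h₂) cover with total (g w₁) (g w₂)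
    ... | inj₁ p = w₁ beats λ x y i j → go x y (cover x y i j)
      where
      go : ∀ x y → (X₁ x × Y₁ y) ⊎ (X₂ x × Y₂ y) → g w₁ < g (x +i y)
      go x y (inj₁ (i , j)) = h₁ x y i j
      go x y (inj₂ (i , j)) = ≤-<-trans p (h₂ x y i j)
    ... | inj₂ p = w₂ beats λ x y i j → go x y (cover x y i j)
      where
      go : ∀ x y → (X₁ x × Y₁ y) ⊎ (X₂ x × Y₂ y) → g w₂ < g (x +i y)
      go x y (inj₁ (i , j)) = ≤-<-trans p (h₁ x y i j)
      go x y (inj₂ (i , j)) = h₂ x y i j

    within : ∀ {x x₀ δ} → x₀ - δ ≤ x → x ≤ x₀ + δ → ∣ x - x₀ ∣ ≤ δ
    within {x} {x₀} {δ} p q = ∣∣-lub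
      (by≤ (≤⇒0≤- q) (solve 3 (λ x y d → d :- (x :- y) := (y :+ d) :- x) ≈-refl x x₀ δ))
      (by≤ (≤⇒0≤- p) (solve 3 (λ x y d → d :- (:- (x :- y)) := x :- (y :- d)) ≈-refl x x₀ δ))
    Column : ℝ → ℝ → ℝ → Set
    Column x₀ a b = ∃ λ δ → 0# < δ × Beaten (Between (x₀ - δ) (x₀ + δ)) (Between a b)
    column : ∀ x₀ → Column x₀ (- B) B
    column x₀ = cousin (Column x₀) glue′ local (- B) B -B≤B
      where
      Strip : ℝ → ℝ → Set
      Strip δ = Between (x₀ - δ) (x₀ + δ)
      glue′ : ∀ {a b c} → a ≤ b → b ≤ c → Column x₀ a b → Column x₀ b c → Column x₀ a c
      glue′ {a} {b} {c} _ _ (δ₁ , p₁ , h₁) (δ₂ , p₂ , h₂) with total δ₁ δ₂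
      ... | inj₁ δ₁≤δ₂ = δ₁ , p₁ , glue h₁ h₂ (λ x y (i , i′) (j , j′) → cover x y i i′ j j′ (total y b))
        where
        cover : ∀ x y → x₀ - δ₁ ≤ x → x ≤ x₀ + δ₁ → a ≤ y → y ≤ c → y ≤ b ⊎ b ≤ y →
          (Strip δ₁ x × Between a b y) ⊎ (Strip δ₂ x × Between b c y)
        cover x y i i′ j j′ (inj₁ q) = inj₁ ((i , i′) , j , q)
        cover x y i i′ j j′ (inj₂ q) = inj₂ ((≤-trans (+-monoʳ-≤ x₀ (neg-mono-≤ δ₁≤δ₂)) i , ≤-trans i′ (+-monoʳ-≤ x₀ δ₁≤δ₂)) , q , j′)
      ... | inj₂ δ₂≤δ₁ = δ₂ , p₂ , glue h₁ h₂ (λ x y (i , i′) (j , j′) → cover x y i i′ j j′ (total y b))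
        where
        cover : ∀ x y → x₀ - δ₂ ≤ x → x ≤ x₀ + δ₂ → a ≤ y → y ≤ c → y ≤ b ⊎ b ≤ y →
          (Strip δ₁ x × Between a b y) ⊎ (Strip δ₂ x × Between b c y)
        cover x y i i′ j j′ (inj₂ q) = inj₂ ((i , i′) , q , j′)
        cover x y i i′ j j′ (inj₁ q) = inj₁ ((≤-trans (+-monoʳ-≤ x₀ (neg-mono-≤ δ₂≤δ₁)) i , ≤-trans i′ (+-monoʳ-≤ x₀ δ₂≤δ₁)) , j , q)
      local : ∀ y₀ → ∃ λ δ → 0# < δ × (∀ a b → y₀ - δ ≤ a → a ≤ b → b ≤ y₀ + δ → Column x₀ a b)
      local y₀ =
        let w , w< = decreases (x₀ +i y₀)
            δ , 0<δ , h = lower-continuous (x₀ +i y₀) (g w) w<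
        in δ , 0<δ , λ a b p _ q → δ , 0<δ , w beats λ x y (i , i′) (j , j′) →
             h (x +i y) (within i i′) (within (≤-trans p j) (≤-trans j′ q))
    square : Beaten (Between (- B) B) (Between (- B) B)
    square = cousin (λ a b → Beaten (Between a b) (Between (- B) B)) glue′ local (- B) B -B≤B
      where
      glue′ : ∀ {a b c} → a ≤ b → b ≤ c → Beaten (Between a b) (Between (- B) B) → Beaten (Between b c) (Between (- B) B) → Beaten (Between a c) (Between (- B) B)
      glue′ {a} {b} {c} _ _ = λ h₁ h₂ → glue h₁ h₂ (λ x y (i , i′) j → cover x y i i′ j (total x b))
        where
        cover : ∀ x y → a ≤ x → x ≤ c → Between (- B) B y → x ≤ b ⊎ b ≤ x →
          (Between a b x × Between (- B) B y) ⊎ (Between b c x × Between (- B) B y)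
        cover x y i i′ j (inj₁ q) = inj₁ ((i , q) , j)
        cover x y i i′ j (inj₂ q) = inj₂ ((q , i′) , j)
      local : ∀ x₀ → ∃ λ δ → 0# < δ × (∀ a b → x₀ - δ ≤ a → a ≤ b → b ≤ x₀ + δ → Beaten (Between a b) (Between (- B) B))
      local x₀ = from (column x₀)
        where
        from : Column x₀ (- B) B → ∃ λ δ → 0# < δ × (∀ a b → x₀ - δ ≤ a → a ≤ b → b ≤ x₀ + δ → Beaten (Between a b) (Between (- B) B))
        from (δ , 0<δ , (w beats h)) = δ , 0<δ , λ a b p _ q → w beats λ x y (i , i′) j → h x y (≤-trans p i , ≤-trans i′ q) j
    bounds : ∀ {y x} → y ≤ B → ∣ x ∣ ≤ y → Between (- B) B x
    bounds {y} {x} p q = ≤-respʳ-≈ (neg-involutive x) (neg-mono-≤ (≤-trans (-x≤∣x∣ x) (≤-trans q p))) , ≤-trans (x≤∣x∣ x) (≤-trans q p)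
    0-between : Between (- B) B 0#
    0-between = ≤-respʳ-≈ neg-0 (neg-mono-≤ 0≤B) , 0≤B
    refute : Beaten (Between (- B) B) (Between (- B) B) → ⊥
    refute (w beats h) = go (≤-or-> ∣ w ∣ᶜ B)
      where
      go : ∣ w ∣ᶜ ≤ B ⊎ B < ∣ w ∣ᶜ → ⊥
      go (inj₁ p) = <-irrefl (h (re w) (im w) (bounds p (∣re∣≤ w)) (bounds p (∣im∣≤ w)))
      go (inj₂ p) = <⇒≱ (h 0# 0# 0-between 0-between) (coercive w (<⇒≤ p))
    impossible : ⊥
    impossible = refute square

  fundamental-theorem-of-algebra : ∀ c cs → ∃ λ z → eval (c ∷ cs) z ≈ᶜ 0ᶜ
  fundamental-theorem-of-algebra c cs with lem {∃ λ z → eval (c ∷ cs) z ≈ᶜ 0ᶜ}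
  ... | yes h = h
  ... | no n = ⊥-elim (no-coercive-descent (λ z → ∣ eval (c ∷ cs) z ∣ᶜ)
      (λ z → modulus-decreases c cs z (λ e → n (z , e)))
      (λ z₀ t → modulus-lower-continuous (c ∷ cs) z₀ {t})
      (proj₁ growth) (≤-trans 0≤1 (proj₁ (proj₂ growth))) (proj₂ (proj₂ growth)))
    where growth = eval-grows⁺ c cs ∣ eval (c ∷ cs) 0ᶜ ∣ᶜ (∣∣ᶜ-nonneg _)

  -- Linear recurrences whose characteristic polynomial has its roots in the unit disc

  data PolynomiallyBounded (σ : ℕ → ℂ) (k : ℕ) : Set where
    bounded : ∀ A → 0# ≤ A → (∀ n → ∣ σ n ∣ᶜ ≤ A * fromℕ (suc n) ^ k) → PolynomiallyBounded σ k

  1≤fromℕ-suc : ∀ n → 1# ≤ fromℕ (suc n)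
  1≤fromℕ-suc n = by≤ (fromℕ-nonneg n) (solve 1 (λ n → (:1 :+ n) :- :1 := n) ≈-refl (fromℕ n))

  -- As |γ| ≤ 1, |σ(n + 1)| exceeds |σ(n)| by at most the bound for (X - γ)σ, and summation over n
  -- costs one power of n.
  summation-bound : ∀ {γ σ k} → ∣ γ ∣ᶜ ≤ 1# → PolynomiallyBounded (γ ⊖X σ) k → PolynomiallyBounded σ (suc k)
  summation-bound {γ} {σ} {k} γ≤1 (bounded A 0≤A h) = bounded A′ 0≤A′ bound
    where
    A′ = ∣ σ 0 ∣ᶜ + A
    0≤A′ = +-nonneg (∣∣ᶜ-nonneg _) 0≤A
    step : ∀ n → ∣ σ (suc n) ∣ᶜ ≤ ∣ σ n ∣ᶜ + A * fromℕ (suc n) ^ k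
    step n = begin
      ∣ σ (suc n) ∣ᶜ ≈⟨ ∣∣ᶜ-cong (solveᶜ 2 (λ s t → s :=ᶜ t :+ᶜ (s :-ᶜ t)) ≈ᶜ-refl (σ (suc n)) (γ *ᶜ σ n)) ⟩
      ∣ γ *ᶜ σ n +ᶜ (γ ⊖X σ) n ∣ᶜ ≤⟨ ∣∣ᶜ-+ (γ *ᶜ σ n) ((γ ⊖X σ) n) ⟩
      ∣ γ *ᶜ σ n ∣ᶜ + ∣ (γ ⊖X σ) n ∣ᶜ ≤⟨ +-mono-≤ (≤-trans (≈⇒≤ (∣∣ᶜ-* γ (σ n))) (≤-trans (*-monoʳ-≤ (∣∣ᶜ-nonneg _) γ≤1) (≈⇒≤ (*-identityˡ _)))) (h n) ⟩
      ∣ σ n ∣ᶜ + A * fromℕ (suc n) ^ k ∎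
    bound : ∀ n → ∣ σ n ∣ᶜ ≤ A′ * fromℕ (suc n) ^ suc k
    bound zero = begin
      ∣ σ 0 ∣ᶜ ≈⟨ ≈-sym (*-identityʳ _) ⟩
      ∣ σ 0 ∣ᶜ * 1# ≤⟨ *-mono-≤ (∣∣ᶜ-nonneg _) (^-nonneg (suc k) (fromℕ-nonneg 1)) (by≤ 0≤A (solve 2 (λ s a → (s :+ a) :- s := a) ≈-refl ∣ σ 0 ∣ᶜ A)) (1≤^ (suc k) (1≤fromℕ-suc 0)) ⟩
      A′ * fromℕ 1 ^ suc k ∎
    bound (suc n) = begin
      ∣ σ (suc n) ∣ᶜ ≤⟨ step n ⟩
      ∣ σ n ∣ᶜ + A * fromℕ (suc n) ^ k ≤⟨ +-mono-≤ (bound n) (*-monoʳ-≤ (^-nonneg k (fromℕ-nonneg (suc n))) A≤A′) ⟩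
      A′ * (N * N ^ k) + A′ * N ^ k ≈⟨ solve 3 (λ a n p → a :* (n :* p) :+ a :* p := a :* ((:1 :+ n) :* p)) ≈-refl A′ N (N ^ k) ⟩
      A′ * ((1# + N) * N ^ k) ≤⟨ *-monoˡ-≤ 0≤A′ (*-monoˡ-≤ (fromℕ-nonneg (2 ℕ.+ n)) (^-monoˡ-≤ k (fromℕ-nonneg (suc n)) (fromℕ-mono (ℕP.n≤1+n (suc n))))) ⟩
      A′ * fromℕ (2 ℕ.+ n) ^ suc k ∎
      where
      N = fromℕ (suc n)
      A≤A′ : A ≤ A′
      A≤A′ = by≤ (∣∣ᶜ-nonneg _) (solve 2 (λ s a → (s :+ a) :- a := s) ≈-refl ∣ σ 0 ∣ᶜ A)

  bounded-raise : ∀ {σ k} → PolynomiallyBounded σ k → PolynomiallyBounded σ (suc k)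
  bounded-raise {σ} {k} (bounded A 0≤A h) = bounded A 0≤A λ n → ≤-trans (h n) (*-monoˡ-≤ 0≤A (^-monoʳ-≤ (1≤fromℕ-suc n) (ℕP.n≤1+n k)))

  bounded-combine : ∀ {σ τ k} c → PolynomiallyBounded σ k → PolynomiallyBounded τ k → PolynomiallyBounded (λ n → c *ᶜ (σ n +ᶜ -ᶜ τ n)) k
  bounded-combine {σ} {τ} {k} c (bounded A 0≤A h) (bounded B 0≤B g) = bounded (∣ c ∣ᶜ * (A + B)) (*-nonNeg (∣∣ᶜ-nonneg c) (+-nonneg 0≤A 0≤B)) λ n → begin
    ∣ c *ᶜ (σ n +ᶜ -ᶜ τ n) ∣ᶜ ≈⟨ ∣∣ᶜ-* c _ ⟩
    ∣ c ∣ᶜ * ∣ σ n +ᶜ -ᶜ τ n ∣ᶜ ≤⟨ *-monoˡ-≤ (∣∣ᶜ-nonneg c) (≤-trans (∣∣ᶜ-+ _ _) (+-mono-≤ (h n) (≤-trans (≈⇒≤ (∣∣ᶜ-neg (τ n))) (g n)))) ⟩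
    ∣ c ∣ᶜ * (A * fromℕ (suc n) ^ k + B * fromℕ (suc n) ^ k) ≈⟨ solve 4 (λ c a b p → c :* (a :* p :+ b :* p) := c :* (a :+ b) :* p) ≈-refl ∣ c ∣ᶜ A B (fromℕ (suc n) ^ k) ⟩
    ∣ c ∣ᶜ * (A + B) * fromℕ (suc n) ^ k ∎

  bounded-0 : ∀ {σ} → (∀ n → σ n ≈ᶜ 0ᶜ) → PolynomiallyBounded σ 0
  bounded-0 e = bounded 0# ≤-refl λ n → ≈⇒≤ (≈-trans (∣∣ᶜ-cong (e n)) (≈-trans ∣0∣ᶜ (≈-sym (zeroˡ _))))

  quot-length : ∀ γ c cs → length (quot γ (c ∷ cs)) ≡ length cs
  quot-length γ c [] = ≡.refl
  quot-length γ c (d ∷ cs) = ≡.cong suc (quot-length γ d cs)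

  root-of-quot : ∀ {γ c cs z} → eval (c ∷ cs) γ ≈ᶜ 0ᶜ → eval (quot γ (c ∷ cs)) z ≈ᶜ 0ᶜ → eval (c ∷ cs) z ≈ᶜ 0ᶜ
  root-of-quot {γ} {c} {cs} {z} e f = ≈ᶜ-trans (eval-quot γ c cs z) (≈ᶜ-trans (+ᶜ-cong (≈ᶜ-trans (*ᶜ-congˡ f) (zeroᶜʳ _)) e) (+ᶜ-identityˡ _))

  op-quot-root : ∀ {γ c cs} → eval (c ∷ cs) γ ≈ᶜ 0ᶜ → ∀ ρ n → op (c ∷ cs) ρ n ≈ᶜ op (quot γ (c ∷ cs)) (γ ⊖X ρ) n
  op-quot-root {γ} {c} {cs} e ρ n = ≈ᶜ-trans (op-quot γ c cs ρ n) (≈ᶜ-trans (+ᶜ-congˡ (≈ᶜ-trans (*ᶜ-congʳ e) (zeroᶜˡ _))) (+ᶜ-identityʳ _))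

  RootsIn : (ℂ → Set) → List ℂ → Set
  RootsIn P p = ∀ γ → eval p γ ≈ᶜ 0ᶜ → P γ

  -- If (X − γ)σ = τ and (X − b)t = τ, then (X − b) maps (σ − t)/(γ − b) to σ.
  shifted-solution : (CR : CommutativeRing 0ℓ 0ℓ) → let module C = CommutativeRing CR in
    ∀ {γ b i s₀ s₁ t₀ t₁} → (γ C.- b) C.* i C.≈ C.1# → t₁ C.- b C.* t₀ C.≈ s₁ C.- γ C.* s₀ →
    i C.* (s₁ C.- t₁) C.- b C.* (i C.* (s₀ C.- t₀)) C.≈ s₀
  shifted-solution CR {γ} {b} {i} {s₀} {s₁} {t₀} {t₁} inv e = C.trans
    (K.solve 7 (λ γ b i s₀ s₁ t₀ t₁ → i K.:* (s₁ K.:- t₁) K.:- b K.:* (i K.:* (s₀ K.:- t₀))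
       K.:= (γ K.:- b) K.:* i K.:* s₀ K.:- i K.:* ((t₁ K.:- b K.:* t₀) K.:- (s₁ K.:- γ K.:* s₀))) C.refl γ b i s₀ s₁ t₀ t₁)
    (C.trans (C.+-cong (C.*-congʳ inv) (C.-‿cong (C.*-congˡ (C.trans (C.+-congʳ e) (C.-‿inverseʳ _)))))
    (K.solve 2 (λ s i → K.:1 K.:* s K.:- i K.:* K.:0 K.:= s) C.refl s₀ i))
    where
    module C = CommutativeRing CR
    module K = RingKit CR

  -- Induction over the roots γ of p: (X - γ)σ satisfies a shorter recurrence, `summation-bound`
  -- returns to σ, and `shifted-solution` builds s. The size of s matters because `dominant-root`
  -- subtracts it to leave a multiple of b^n.
  resonance-free : ∀ b p → RootsIn (λ γ → ∣ γ ∣ᶜ ≤ 1# × ¬ γ ≈ᶜ b) p → ∀ σ → (∀ n → op p σ n ≈ᶜ 0ᶜ) →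
    PolynomiallyBounded σ (length p) × ∃ λ s → PolynomiallyBounded s (length p) × (∀ n → (b ⊖X s) n ≈ᶜ σ n)
  resonance-free b p = go (length p) p ≡.refl
    where
    go : ∀ k p → length p ≡ k → RootsIn (λ γ → ∣ γ ∣ᶜ ≤ 1# × ¬ γ ≈ᶜ b) p → ∀ σ → (∀ n → op p σ n ≈ᶜ 0ᶜ) →
      PolynomiallyBounded σ k × ∃ λ s → PolynomiallyBounded s k × (∀ n → (b ⊖X s) n ≈ᶜ σ n)
    go zero [] _ roots σ h = bounded-0 h , (λ _ → 0ᶜ) , bounded-0 (λ _ → ≈ᶜ-refl) ,
      λ n → ≈ᶜ-trans (solveᶜ 1 (λ b → :0ᶜ :-ᶜ b :*ᶜ :0ᶜ :=ᶜ :0ᶜ) ≈ᶜ-refl b) (≈ᶜ-sym (h n))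
    go (suc k) (c ∷ cs) len roots σ h = step (fundamental-theorem-of-algebra c cs)
      where
      step : (∃ λ γ → eval (c ∷ cs) γ ≈ᶜ 0ᶜ) → _
      step (γ , e) = conclude (go k (quot γ (c ∷ cs)) (≡.trans (quot-length γ c cs) (ℕP.suc-injective len))
          (λ z f → roots z (root-of-quot {γ} {c} {cs} e f)) (γ ⊖X σ) (λ n → ≈ᶜ-trans (≈ᶜ-sym (op-quot-root {γ} {c} {cs} e σ n)) (h n)))
        where
        i = invᶜ (γ +ᶜ -ᶜ b)
        γ-b≉0 : ¬ (γ +ᶜ -ᶜ b) ≈ᶜ 0ᶜ
        γ-b≉0 (e₁ , e₂) = proj₂ (roots γ e) (x-y≈0⇒x≈y e₁ , x-y≈0⇒x≈y e₂)
        conclude : PolynomiallyBounded (γ ⊖X σ) k × (∃ λ s → PolynomiallyBounded s k × (∀ n → (b ⊖X s) n ≈ᶜ (γ ⊖X σ) n)) →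
          PolynomiallyBounded σ (suc k) × ∃ λ s → PolynomiallyBounded s (suc k) × (∀ n → (b ⊖X s) n ≈ᶜ σ n)
        conclude (bd , t , bt , et) = bσ , (λ n → i *ᶜ (σ n +ᶜ -ᶜ t n)) , bounded-combine i bσ (bounded-raise bt) ,
            λ n → shifted-solution ℂ-commutativeRing (invᶜ-inverse γ-b≉0) (et n)
          where bσ = summation-bound (proj₁ (roots γ e)) bd

  recurrence-step : (CR : CommutativeRing 0ℓ 0ℓ) → let module C = CommutativeRing CR in
    ∀ {b s₀ s₁ r₀ r₁ p q} → s₁ C.- b C.* s₀ C.≈ r₁ C.- b C.* r₀ → s₀ C.≈ r₀ C.- p C.* q → s₁ C.≈ r₁ C.- (b C.* p) C.* q
  recurrence-step CR {b} {s₀} {s₁} {r₀} {r₁} {p} {q} e f = C.trans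
    (K.solve 3 (λ s₁ b s₀ → s₁ K.:= (s₁ K.:- b K.:* s₀) K.:+ b K.:* s₀) C.refl s₁ b s₀)
    (C.trans (C.+-cong e (C.*-congˡ f))
    (K.solve 5 (λ r₁ b r₀ p q → (r₁ K.:- b K.:* r₀) K.:+ b K.:* (r₀ K.:- p K.:* q) K.:= r₁ K.:- (b K.:* p) K.:* q) C.refl r₁ b r₀ p q))
    where
    module C = CommutativeRing CR
    module K = RingKit CR

  -- (X - b)ρ satisfies the recurrence without the root b, so there is an s of polynomial size with
  -- (X - b)s = (X - b)ρ. Then X - b annihilates ρ - s, which is therefore geometric with ratio b.
  dominant-root : ∀ b c cs → eval (c ∷ cs) b ≈ᶜ 0ᶜ → ¬ eval (quot b (c ∷ cs)) b ≈ᶜ 0ᶜ →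
    RootsIn (λ γ → γ ≈ᶜ b ⊎ ∣ γ ∣ᶜ ≤ 1#) (c ∷ cs) → ∀ ρ → (∀ n → op (c ∷ cs) ρ n ≈ᶜ 0ᶜ) →
    ∃ λ p → PolynomiallyBounded (λ n → ρ n +ᶜ -ᶜ ((b ^ᶜ n) *ᶜ p)) (length cs)
  dominant-root b c cs root simple roots ρ h = conclude (resonance-free b (quot b (c ∷ cs)) roots′ (b ⊖X ρ)
      (λ n → ≈ᶜ-trans (≈ᶜ-sym (op-quot-root {b} {c} {cs} root ρ n)) (h n)))
    where
    roots′ : RootsIn (λ γ → ∣ γ ∣ᶜ ≤ 1# × ¬ γ ≈ᶜ b) (quot b (c ∷ cs))
    roots′ γ e = case (roots γ (root-of-quot {b} {c} {cs} root e)) , ≉b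
      where
      ≉b : ¬ γ ≈ᶜ b
      ≉b f = simple (≈ᶜ-trans (eval-cong (quot b (c ∷ cs)) (≈ᶜ-sym f)) e)
      case : γ ≈ᶜ b ⊎ ∣ γ ∣ᶜ ≤ 1# → ∣ γ ∣ᶜ ≤ 1#
      case (inj₁ f) = ⊥-elim (≉b f)
      case (inj₂ p) = p
    conclude : (PolynomiallyBounded (b ⊖X ρ) (length (quot b (c ∷ cs))) × ∃ λ s → PolynomiallyBounded s (length (quot b (c ∷ cs))) × (∀ n → (b ⊖X s) n ≈ᶜ (b ⊖X ρ) n)) → _
    conclude (_ , s , (bounded A 0≤A bound) , e) = ρ 0 +ᶜ -ᶜ s 0 , bounded A 0≤A λ n →
      ≤-trans (≈⇒≤ (∣∣ᶜ-cong (≈ᶜ-sym (difference n)))) (≤-trans (bound n) (≈⇒≤ (*-congˡ (≈-reflexive (≡.cong (fromℕ (suc n) ^_) (quot-length b c cs))))))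
      where
      difference : ∀ n → s n ≈ᶜ ρ n +ᶜ -ᶜ ((b ^ᶜ n) *ᶜ (ρ 0 +ᶜ -ᶜ s 0))
      difference zero = solveᶜ 2 (λ r s → s :=ᶜ r :-ᶜ :1ᶜ :*ᶜ (r :-ᶜ s)) ≈ᶜ-refl (ρ 0) (s 0)
      difference (suc n) = recurrence-step ℂ-commutativeRing (e n) (difference n)

  module ℝP = MonicPolynomial commutativeRing

  -- Integers and rationals among the reals

  data IsInteger (x : ℝ) : Set where
    integer : ∀ k → x ≈ fromℤ k → IsInteger x

  data IsRational (x : ℝ) : Set where
    rational : ∀ n → 0 ℕ.< n → IsInteger (fromℕ n * x) → IsRational x

  integer-cong : ∀ {x y} → x ≈ y → IsInteger x → IsInteger y
  integer-cong e (integer k f) = integer k (≈-trans (≈-sym e) f)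

  integer-+ : ∀ {x y} → IsInteger x → IsInteger y → IsInteger (x + y)
  integer-+ (integer k e) (integer l f) = integer (k ℤ.+ l) (≈-trans (+-cong e f) (≈-sym (fromℤ-+ k l)))

  integer-* : ∀ {x y} → IsInteger x → IsInteger y → IsInteger (x * y)
  integer-* (integer k e) (integer l f) = integer (k ℤ.* l) (≈-trans (*-cong e f) (≈-sym (fromℤ-* k l)))

  integer-neg : ∀ {x} → IsInteger x → IsInteger (- x)
  integer-neg (integer k e) = integer (ℤ.- k) (≈-trans (-‿cong e) (≈-sym (fromℤ-neg k)))

  integer-ℕ : ∀ n → IsInteger (fromℕ n)
  integer-ℕ n = integer (+ n) ≈-refl

  integer⇒rational : ∀ {x} → IsInteger x → IsRational x
  integer⇒rational i = rational 1 (ℕ.s≤s ℕ.z≤n) (integer-* (integer-ℕ 1) i)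

  0<-* : ∀ {m n} → 0 ℕ.< m → 0 ℕ.< n → 0 ℕ.< m ℕ.* n
  0<-* p q = ℕP.*-mono-≤ p q

  rational-+ : ∀ {x y} → IsRational x → IsRational y → IsRational (x + y)
  rational-+ {x} {y} (rational m p i) (rational n q j) = rational (m ℕ.* n) (0<-* p q) (integer-cong
    (≈-trans (solve 4 (λ m n x y → n :* (m :* x) :+ m :* (n :* y) := m :* n :* (x :+ y)) ≈-refl (fromℕ m) (fromℕ n) x y) (*-congʳ (≈-sym (fromℕ-* m n))))
    (integer-+ (integer-* (integer-ℕ n) i) (integer-* (integer-ℕ m) j)))

  rational-* : ∀ {x y} → IsRational x → IsRational y → IsRational (x * y)
  rational-* {x} {y} (rational m p i) (rational n q j) = rational (m ℕ.* n) (0<-* p q) (integer-cong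
    (≈-trans (solve 4 (λ m n x y → m :* x :* (n :* y) := m :* n :* (x :* y)) ≈-refl (fromℕ m) (fromℕ n) x y) (*-congʳ (≈-sym (fromℕ-* m n))))
    (integer-* i j))

  rational-neg : ∀ {x} → IsRational x → IsRational (- x)
  rational-neg {x} (rational n p i) = rational n p (integer-cong (solve 2 (λ n x → :- (n :* x) := n :* (:- x)) ≈-refl (fromℕ n) x) (integer-neg i))

  rational-inverse : ∀ {x y} → x * y ≈ 1# → IsRational x → IsRational y
  rational-inverse {x} {y} e (rational n p (integer (+ zero) f)) =
    ⊥-elim (≉-by-inverse e (*-cancel-0 (>⇒≉ (fromℕ-pos p)) f))
  rational-inverse {x} {y} e (rational n p (integer (+ suc k) f)) = rational (suc k) (ℕ.s≤s ℕ.z≤n) (integer-cong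
    (≈-trans (≈-sym (*-identityʳ _)) (≈-trans (*-congˡ (≈-sym e)) (≈-trans (≈-sym (*-assoc _ _ _)) (*-congʳ f)))) (integer-ℕ n))
  rational-inverse {x} {y} e (rational n p (integer -[1+ k ] f)) = rational (suc k) (ℕ.s≤s ℕ.z≤n) (integer-cong
    (≈-trans (-‿cong (≈-trans (≈-sym (*-identityʳ _)) (≈-trans (*-congˡ (≈-sym e)) (≈-trans (≈-sym (*-assoc _ _ _)) (*-congʳ f)))))
      (solve 2 (λ k y → :- ((:- k) :* y) := k :* y) ≈-refl (fromℕ (suc k)) y)) (integer-neg (integer-ℕ n)))

  fromℚ-rational : ∀ q → IsRational (fromℚ q)
  fromℚ-rational q = rational-* (integer⇒rational (integer (↥ q) ≈-refl))
    (rational-inverse (⁻¹-inverse (fromℕ-pos {ℚ.denominatorℕ q} (ℕ.s≤s ℕ.z≤n))) (integer⇒rational (integer (↧ q) ≈-refl)))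

  rational⇒ℚ : ∀ {x} → IsRational x → ∃ λ q → fromℚ q ≈ x
  rational⇒ℚ {x} (rational n@(suc _) p (integer k e)) = q , *-cancelˡ D≉0 (begin-equality
    D * (N * D ⁻¹) ≈⟨ solve 3 (λ d n i → d :* (n :* i) := n :* (d :* i)) ≈-refl D N (D ⁻¹) ⟩
    N * (D * D ⁻¹) ≈⟨ ≈-trans (*-congˡ (*-inverseʳ D D≉0)) (*-identityʳ N) ⟩
    N ≈⟨ *-cancelˡ g≉0 (begin-equality
      g * N ≈⟨ *-comm g N ⟩
      N * g ≈⟨ ≈-sym (fromℤ-* (↥ q) (ℤ.gcd k (+ n))) ⟩
      fromℤ (↥ q ℤ.* ℤ.gcd k (+ n)) ≡⟨ ≡.cong fromℤ (ℚP.↥-/ k n) ⟩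
      fromℤ k ≈⟨ ≈-sym e ⟩
      fromℕ n * x ≈⟨ *-congʳ (≈-sym Dg) ⟩
      D * g * x ≈⟨ solve 3 (λ d g x → d :* g :* x := g :* (d :* x)) ≈-refl D g x ⟩
      g * (D * x) ∎) ⟩
    D * x ∎)
    where
    q = k ℚ./ n
    N = fromℤ (↥ q)
    D = fromℤ (↧ q)
    g = fromℤ (ℤ.gcd k (+ n))
    Dg : D * g ≈ fromℕ n
    Dg = ≈-trans (≈-sym (fromℤ-* (↧ q) (ℤ.gcd k (+ n)))) (≈-reflexive (≡.cong fromℤ (ℚP.↧-/ k n)))
    D≉0 : ¬ D ≈ 0#
    D≉0 f = >⇒≉ (fromℕ-pos p) (≈-trans (≈-sym Dg) (≈-trans (*-congʳ f) (zeroˡ g)))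
    g≉0 : ¬ g ≈ 0#
    g≉0 f = >⇒≉ (fromℕ-pos p) (≈-trans (≈-sym Dg) (≈-trans (*-congˡ f) (zeroʳ D)))

  -- Real polynomials as complex polynomials

  eval-fromℝ : ∀ cs x → eval (map fromℝ cs) (fromℝ x) ≈ᶜ fromℝ (ℝP.eval cs x)
  eval-fromℝ [] x = ≈ᶜ-refl
  eval-fromℝ (c ∷ cs) x = ≈ᶜ-trans (+ᶜ-congˡ (≈ᶜ-trans (*ᶜ-congˡ (eval-fromℝ cs x)) (≈ᶜ-sym (fromℝ-* x _)))) (≈ᶜ-sym (fromℝ-+ c _))

  op-fromℝ : ∀ cs ρ n → op (map fromℝ cs) (fromℝ ∘ ρ) n ≈ᶜ fromℝ (ℝP.op cs ρ n)
  op-fromℝ [] ρ n = ≈ᶜ-refl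
  op-fromℝ (c ∷ cs) ρ n = ≈ᶜ-trans (+ᶜ-cong (≈ᶜ-sym (fromℝ-* c _)) (op-fromℝ cs ρ (suc n))) (≈ᶜ-sym (fromℝ-+ (c * ρ n) _))

  module ℂK = RingKit ℂ-commutativeRing

  ι-fromℝ : ∀ n → ℂK.ι (+ n) ≈ᶜ fromℝ (fromℕ n)
  ι-fromℝ zero = ≈ᶜ-refl
  ι-fromℝ (suc n) = ≈ᶜ-trans (+ᶜ-congˡ (ι-fromℝ n)) (≈ᶜ-sym (fromℝ-+ 1# _))

  weighted-fromℝ : ∀ k cs x → weighted k (map fromℝ cs) (fromℝ x) ≈ᶜ fromℝ (ℝP.weighted k cs x)
  weighted-fromℝ k [] x = ι-fromℝ k
  weighted-fromℝ k (c ∷ cs) x = ≈ᶜ-trans (+ᶜ-cong (≈ᶜ-trans (*ᶜ-congʳ (ι-fromℝ k)) (≈ᶜ-sym (fromℝ-* (fromℕ k) c)))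
    (≈ᶜ-trans (*ᶜ-congˡ (weighted-fromℝ (suc k) cs x)) (≈ᶜ-sym (fromℝ-* x _)))) (≈ᶜ-sym (fromℝ-+ (fromℕ k * c) _))

  sumᶜ-*ˡ : ∀ d z (f : Fin d → ℂ) → sumᶜ (λ i → z *ᶜ f i) ≈ᶜ z *ᶜ sumᶜ f
  sumᶜ-*ˡ zero z f = ≈ᶜ-sym (zeroᶜʳ z)
  sumᶜ-*ˡ (suc d) z f = ≈ᶜ-trans (+ᶜ-congˡ (sumᶜ-*ˡ d z (f ∘ Fin.suc)))
    (solveᶜ 3 (λ z a b → z :*ᶜ a :+ᶜ z :*ᶜ b :=ᶜ z :*ᶜ (a :+ᶜ b)) ≈ᶜ-refl z (f Fin.zero) (sumᶜ (f ∘ Fin.suc)))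

  sumᶜ-cong : ∀ d {f g : Fin d → ℂ} → (∀ i → f i ≈ᶜ g i) → sumᶜ f ≈ᶜ sumᶜ g
  sumᶜ-cong zero e = ≈ᶜ-refl
  sumᶜ-cong (suc d) e = +ᶜ-cong (e Fin.zero) (sumᶜ-cong d (e ∘ Fin.suc))

  evalMonic≈eval : ∀ {A : Set} d (ι : A → ℝ) (a : Vector A d) z → evalMonic ι a z ≈ᶜ eval (map fromℝ (tabulate (ι ∘ a))) z
  evalMonic≈eval zero ι a z = +ᶜ-identityʳ 1ᶜ
  evalMonic≈eval (suc d) ι a z = ≈ᶜ-trans
    (+ᶜ-congˡ (+ᶜ-congˡ (≈ᶜ-trans (sumᶜ-cong d (λ i → swap (fromℝ (ι (a (Fin.suc i)))) z (z ^ᶜ toℕ i))) (sumᶜ-*ˡ d z _))))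
    (≈ᶜ-trans (regroup z (z ^ᶜ d) (fromℝ (ι (a Fin.zero))) _) (+ᶜ-congˡ (*ᶜ-congˡ (evalMonic≈eval d ι (a ∘ Fin.suc) z))))
    where
    swap : ∀ a z p → a *ᶜ (z *ᶜ p) ≈ᶜ z *ᶜ (a *ᶜ p)
    swap = solveᶜ 3 (λ a z p → a :*ᶜ (z :*ᶜ p) :=ᶜ z :*ᶜ (a :*ᶜ p)) ≈ᶜ-refl
    regroup : ∀ z p a s → z *ᶜ p +ᶜ (a *ᶜ 1ᶜ +ᶜ z *ᶜ s) ≈ᶜ a +ᶜ z *ᶜ (p +ᶜ s)
    regroup = solveᶜ 4 (λ z p a s → z :*ᶜ p :+ᶜ (a :*ᶜ :1ᶜ :+ᶜ z :*ᶜ s) :=ᶜ a :+ᶜ z :*ᶜ (p :+ᶜ s)) ≈ᶜ-refl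

  eval-∑ : ∀ n w x → ℝP.eval (applyUpTo w n) x ≈ ∑ n (λ j → w j * x ^ j) + x ^ n
  eval-∑ zero w x = ≈-sym (+-identityˡ 1#)
  eval-∑ (suc n) w x = ≈-trans (+-congˡ (*-congˡ (eval-∑ n (w ∘ suc) x))) (≈-trans (+-congˡ (≈-trans (distribˡ x _ _) (+-congʳ
    (≈-trans (≈-sym (∑-*ˡ n x _)) (∑-cong n (λ i _ → solve 3 (λ a x p → x :* (a :* p) := a :* (x :* p)) ≈-refl (w (suc i)) x (x ^ i)))))))
    (≈-trans (≈-sym (+-assoc _ _ _)) (+-congʳ (≈-sym (≈-trans (∑-head n _) (+-congʳ (*-identityʳ _)))))))

  -- Minimal polynomials

  RationalRoot : ℝ → ℕ → Set
  RationalRoot β n = ∃ λ cs → length cs ≡ n × All IsRational cs × ℝP.eval cs β ≈ 0#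

  DegreeAtLeast : ℝ → ℕ → Set
  DegreeAtLeast β d = ∀ n → RationalRoot β n → d ℕ.≤ n

  rational-vector : ∀ cs → All IsRational cs → ∃ λ (b : Vector ℚ (length cs)) → ∀ z → evalMonic fromℚ b z ≈ᶜ eval (map fromℝ cs) z
  rational-vector cs rs = b cs rs , λ z → ≈ᶜ-trans (evalMonic≈eval (length cs) fromℚ (b cs rs) z) (same cs rs z)
    where
    b : ∀ cs → All IsRational cs → Vector ℚ (length cs)
    b (c ∷ cs) (r ∷ rs) Fin.zero = proj₁ (rational⇒ℚ r)
    b (c ∷ cs) (r ∷ rs) (Fin.suc i) = b cs rs i
    same : ∀ cs rs z → eval (map fromℝ (tabulate (fromℚ ∘ b cs rs))) z ≈ᶜ eval (map fromℝ cs) z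
    same [] [] z = ≈ᶜ-refl
    same (c ∷ cs) (r ∷ rs) z = +ᶜ-cong (fromℝ-cong (proj₂ (rational⇒ℚ r))) (*ᶜ-congˡ (same cs rs z))

  least : (P : ℕ → Set) → ∃ P → ∃ λ n → P n × (∀ m → P m → n ℕ.≤ m)
  least P (n , p) = <-rec (λ n → P n → ∃ λ n → P n × (∀ m → P m → n ℕ.≤ m)) step n p
    where
    step : ∀ n → (∀ {m} → m ℕ.< n → P m → ∃ λ n → P n × (∀ m → P m → n ℕ.≤ m)) → P n → ∃ λ n → P n × (∀ m → P m → n ℕ.≤ m)
    step n rec p with lem {∃ λ m → m ℕ.< n × P m}
    ... | yes (m , m<n , q) = rec m<n q
    ... | no none = n , p , λ m q → ℕP.≮⇒≥ (λ m<n → none (m , m<n , q))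

  All-tabulate : ∀ {d} {f : Fin d → ℝ} {P : ℝ → Set} → (∀ i → P (f i)) → All P (tabulate f)
  All-tabulate {zero} h = []
  All-tabulate {suc d} h = h Fin.zero ∷ All-tabulate (h ∘ Fin.suc)

  All-applyUpTo : ∀ {w : ℕ → ℝ} {P : ℝ → Set} n → (∀ i → i ℕ.< n → P (w i)) → All P (applyUpTo w n)
  All-applyUpTo zero h = []
  All-applyUpTo (suc n) h = h 0 (ℕ.s≤s ℕ.z≤n) ∷ All-applyUpTo n (λ i p → h (suc i) (ℕ.s≤s p))

  -- The derivative of a minimal polynomial, made monic, has smaller degree.
  minimal-root-simple : ∀ β c cs → All IsRational (c ∷ cs) → DegreeAtLeast β (suc (length cs)) →
    ¬ eval (quot (fromℝ β) (map fromℝ (c ∷ cs))) (fromℝ β) ≈ᶜ 0ᶜ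
  minimal-root-simple β c cs (_ ∷ rs) minimal e = ℕP.<-irrefl ≡.refl (minimal (length cs)
      (derivative 1 cs , derivative-length 1 cs , derivative-rational 1 cs rs ,
       *-cancel-0 (>⇒≉ (fromℕ-pos 0<M)) (≈-trans (derivative-eval 1 cs ≡.refl) weighted≈0)))
    where
    M = suc (length cs)
    0<M : 0 ℕ.< M
    0<M = ℕ.s≤s ℕ.z≤n
    i = fromℕ M ⁻¹
    derivative : ℕ → List ℝ → List ℝ
    derivative k [] = []
    derivative k (c ∷ cs) = (fromℕ k * c * i) ∷ derivative (suc k) cs
    derivative-length : ∀ k cs → length (derivative k cs) ≡ length cs
    derivative-length k [] = ≡.refl
    derivative-length k (c ∷ cs) = ≡.cong suc (derivative-length (suc k) cs)
    derivative-rational : ∀ k cs → All IsRational cs → All IsRational (derivative k cs)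
    derivative-rational k [] [] = []
    derivative-rational k (c ∷ cs) (r ∷ rs) = rational-* (rational-* (integer⇒rational (integer-ℕ k)) r)
      (rational-inverse (⁻¹-inverse (fromℕ-pos 0<M)) (integer⇒rational (integer-ℕ M))) ∷ derivative-rational (suc k) cs rs
    derivative-eval : ∀ k cs → k ℕ.+ length cs ≡ M → fromℕ M * ℝP.eval (derivative k cs) β ≈ ℝP.weighted k cs β
    derivative-eval k [] eq = ≈-trans (*-identityʳ _) (≈-reflexive (≡.cong fromℕ (≡.trans (≡.sym eq) (ℕP.+-identityʳ k))))
    derivative-eval k (c ∷ cs) eq = ≈-trans (solve 6 (λ m k c i b e → m :* (k :* c :* i :+ b :* e) := (m :* i) :* (k :* c) :+ b :* (m :* e))
        ≈-refl (fromℕ M) (fromℕ k) c i β (ℝP.eval (derivative (suc k) cs) β))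
      (+-cong (≈-trans (*-congʳ (⁻¹-inverse (fromℕ-pos 0<M))) (*-identityˡ _)) (*-congˡ (derivative-eval (suc k) cs (≡.trans (≡.sym (ℕP.+-suc k _)) eq))))
    weighted≈0 : ℝP.weighted 1 cs β ≈ 0#
    weighted≈0 = proj₁ (≈ᶜ-trans (≈ᶜ-sym (weighted-fromℝ 1 cs β)) (≈ᶜ-trans (≈ᶜ-sym (eval-quot-self (fromℝ β) (fromℝ c) (map fromℝ cs))) e))

  -- Divided by its last nonzero coefficient v(t), a relation would become a monic rational
  -- polynomial of degree t < d with root β.
  minimal-independent : ∀ {β d} → DegreeAtLeast β d → (v : ℕ → ℝ) → (∀ j → j ℕ.< d → IsRational (v j)) → ∑ d (λ j → v j * β ^ j) ≈ 0# →
    ∀ j → j ℕ.< d → v j ≈ 0#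
  minimal-independent {β} {d} minimal v rat = go d ℕP.≤-refl
    where
    go : ∀ t → t ℕ.≤ d → ∑ t (λ j → v j * β ^ j) ≈ 0# → ∀ j → j ℕ.< t → v j ≈ 0#
    go (suc t) t<d e j j≤t with lem {v t ≈ 0#}
    ... | no n = ⊥-elim (ℕP.<⇒≱ t<d (minimal t (applyUpTo (λ j → v t ⁻¹ * v j) t , length-applyUpTo _ t ,
        All-applyUpTo t (λ i p → rational-* (rational-inverse (*-inverseʳ _ n) (rat t t<d)) (rat i (ℕP.<-trans p t<d))) , (begin-equality
      ℝP.eval (applyUpTo (λ j → v t ⁻¹ * v j) t) β ≈⟨ eval-∑ t _ β ⟩
      ∑ t (λ j → v t ⁻¹ * v j * β ^ j) + β ^ t ≈⟨ +-cong (≈-trans (∑-cong t (λ _ _ → *-assoc _ _ _)) (∑-*ˡ t (v t ⁻¹) _))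
                                                             (≈-sym (≈-trans (≈-sym (*-assoc _ _ _)) (≈-trans (*-congʳ (≈-trans (*-comm _ _) (*-inverseʳ _ n))) (*-identityˡ _)))) ⟩
      v t ⁻¹ * ∑ t (λ j → v j * β ^ j) + v t ⁻¹ * (v t * β ^ t) ≈⟨ ≈-sym (distribˡ _ _ _) ⟩
      v t ⁻¹ * ∑ (suc t) (λ j → v j * β ^ j) ≈⟨ ≈-trans (*-congˡ e) (zeroʳ _) ⟩
      0# ∎))))
    ... | yes z with ℕP.m≤n⇒m<n∨m≡n (ℕP.≤-pred j≤t)
    ... | inj₂ ≡.refl = z
    ... | inj₁ j<t = go t (ℕP.<⇒≤ t<d) (≈-trans (≈-sym (≈-trans (+-congˡ (≈-trans (*-congʳ z) (zeroˡ _))) (+-identityʳ _))) e) j j<t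

  -- Coordinates of the powers of an algebraic integer

  common-multiple : (Q : ℕ → ℕ → Set) → (∀ i m n → Q i n → Q i (m ℕ.* n)) → ∀ d → (∀ i → i ℕ.< d → ∃ λ n → 0 ℕ.< n × Q i n) →
    ∃ λ n → 0 ℕ.< n × (∀ i → i ℕ.< d → Q i n)
  common-multiple Q closed zero h = 1 , ℕ.s≤s ℕ.z≤n , λ _ ()
  common-multiple Q closed (suc d) h with common-multiple Q closed d (λ i p → h i (ℕP.m<n⇒m<1+n p)) | h d ℕP.≤-refl
  ... | m , 0<m , all | n , 0<n , q = m ℕ.* n , 0<-* 0<m 0<n , λ i p → go i (ℕP.m≤n⇒m<n∨m≡n (ℕP.≤-pred p))
    where
    go : ∀ i → i ℕ.< d ⊎ i ≡ d → Q i (m ℕ.* n)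
    go i (inj₁ p) = ≡.subst (Q i) (ℕP.*-comm n m) (closed i n m (all i p))
    go i (inj₂ ≡.refl) = closed i m n q

  common-bound : (Q : ℕ → ℝ → Set) → (∀ i {x y} → x ≤ y → Q i x → Q i y) → ∀ d → (∀ i → i ℕ.< d → ∃ λ B → 0# ≤ B × Q i B) →
    ∃ λ B → 0# ≤ B × (∀ i → i ℕ.< d → Q i B)
  common-bound Q mono zero h = 0# , ≤-refl , λ _ ()
  common-bound Q mono (suc d) h with common-bound Q mono d (λ i p → h i (ℕP.m<n⇒m<1+n p)) | h d ℕP.≤-refl
  ... | B , 0≤B , all | C , 0≤C , q = B + C , +-nonneg 0≤B 0≤C , λ i p → go i (ℕP.m≤n⇒m<n∨m≡n (ℕP.≤-pred p))
    where
    go : ∀ i → i ℕ.< d ⊎ i ≡ d → Q i (B + C)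
    go i (inj₁ p) = mono i (by≤ 0≤C (solve 2 (λ b c → (b :+ c) :- b := c) ≈-refl B C)) (all i p)
    go i (inj₂ ≡.refl) = mono i (by≤ 0≤B (solve 2 (λ b c → (b :+ c) :- c := b) ≈-refl B C)) q

  recurrence-integer : ∀ q ρ n → All IsInteger q → IsInteger (ℝP.op q ρ n) → (∀ i → i ℕ.< length q → IsInteger (ρ (n ℕ.+ i))) →
    IsInteger (ρ (n ℕ.+ length q))
  recurrence-integer [] ρ n _ h _ = ≡.subst (IsInteger ∘ ρ) (≡.sym (ℕP.+-identityʳ n)) h
  recurrence-integer (c ∷ cs) ρ n (i ∷ is) h g = ≡.subst (IsInteger ∘ ρ) (≡.sym (ℕP.+-suc n (length cs))) (recurrence-integer cs ρ (suc n) is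
    (integer-cong (solve 2 (λ x y → (x :+ y) :+ (:- x) := y) ≈-refl (c * ρ n) _) (integer-+ h (integer-neg (integer-* i (≡.subst (IsInteger ∘ ρ) (ℕP.+-identityʳ n) (g 0 (ℕ.s≤s ℕ.z≤n)))))))
    (λ k p → ≡.subst (IsInteger ∘ ρ) (ℕP.+-suc n k) (g (suc k) (ℕ.s≤s p))))

  at : List ℝ → ℕ → ℝ
  at [] _ = 0#
  at (c ∷ cs) zero = c
  at (c ∷ cs) (suc i) = at cs i

  applyUpTo-at : ∀ cs → applyUpTo (at cs) (length cs) ≡ cs
  applyUpTo-at [] = ≡.refl
  applyUpTo-at (c ∷ cs) = ≡.cong (c ∷_) (applyUpTo-at cs)

  at-rational : ∀ {cs} → All IsRational cs → ∀ j → IsRational (at cs j)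
  at-rational [] j = integer⇒rational (integer-ℕ 0)
  at-rational (r ∷ rs) zero = r
  at-rational (r ∷ rs) (suc j) = at-rational rs j

  module Coordinates (β : ℝ) (c : ℝ) (cs : List ℝ) (rs : All IsRational (c ∷ cs)) (root : ℝP.eval (c ∷ cs) β ≈ 0#)
    (minimal : DegreeAtLeast β (suc (length cs))) where

    m = length cs
    d = suc m
    a = at (c ∷ cs)

    value : (ℕ → ℝ) → ℝ
    value v = ∑ d (λ j → v j * β ^ j)

    -- Multiplication by β in the basis 1, β, ..., β^(d - 1), that is, the companion matrix.
    next : (ℕ → ℝ) → ℕ → ℝ
    next v zero = - (a 0 * v m)
    next v (suc j) = v j - a (suc j) * v m

    relation : ∑ d (λ j → a j * β ^ j) + β ^ d ≈ 0#
    relation = ≈-trans (≈-sym (eval-∑ d a β)) (≈-trans (≈-reflexive (≡.cong (λ p → ℝP.eval p β) (applyUpTo-at (c ∷ cs)))) root)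

    value-next : ∀ v → value (next v) ≈ β * value v
    value-next v = begin-equality
      value (next v) ≈⟨ ∑-head m _ ⟩
      - (a 0 * v m) * 1# + ∑ m (λ j → (v j - a (suc j) * v m) * β ^ suc j)
        ≈⟨ +-congˡ (≈-trans (∑-cong m (λ j _ → solve 5 (λ x y z b p → (x :- y :* z) :* (b :* p) := b :* (x :* p) :+ (:- z) :* (y :* (b :* p))) ≈-refl (v j) (a (suc j)) (v m) β (β ^ j)))
             (≈-trans (∑-+ m _ _) (+-cong (∑-*ˡ m β _) (∑-*ˡ m (- v m) _)))) ⟩
      - (a 0 * v m) * 1# + (β * S + - v m * T) ≈⟨ solve 5 (λ a₀ w b s t → (:- (a₀ :* w)) :* :1 :+ (b :* s :+ (:- w) :* t) := b :* s :- w :* (a₀ :* :1 :+ t)) ≈-refl (a 0) (v m) β S T ⟩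
      β * S - v m * (a 0 * 1# + T) ≈⟨ +-congˡ (-‿cong (*-congˡ (≈-sym (∑-head m _)))) ⟩
      β * S - v m * U ≈⟨ solve 5 (λ b s w u p → b :* s :- w :* u := b :* (s :+ w :* p) :- w :* (u :+ b :* p)) ≈-refl β S (v m) U (β ^ m) ⟩
      β * value v - v m * (U + β ^ d) ≈⟨ +-congˡ (-‿cong (≈-trans (*-congˡ relation) (zeroʳ _))) ⟩
      β * value v - 0# ≈⟨ solve 1 (λ x → x :- :0 := x) ≈-refl (β * value v) ⟩
      β * value v ∎
      where
      S = ∑ m (λ j → v j * β ^ j)
      T = ∑ m (λ j → a (suc j) * β ^ suc j)
      U = ∑ d (λ j → a j * β ^ j)

    coordinate : ℕ → ℕ → ℝ
    coordinate zero zero = 1#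
    coordinate zero (suc j) = 0#
    coordinate (suc n) j = next (coordinate n) j

    value-coordinate : ∀ n → value (coordinate n) ≈ β ^ n
    value-coordinate zero = ≈-trans (∑-head m _) (≈-trans (+-cong (*-identityˡ 1#) (∑-zero m (λ j _ → zeroˡ _))) (+-identityʳ 1#))
    value-coordinate (suc n) = ≈-trans (value-next (coordinate n)) (*-congˡ (value-coordinate n))

    coordinate-rational : ∀ n j → IsRational (coordinate n j)
    coordinate-rational zero zero = integer⇒rational (integer-cong fromℕ-1 (integer-ℕ 1))
    coordinate-rational zero (suc j) = integer⇒rational (integer-ℕ 0)
    coordinate-rational (suc n) zero = rational-neg (rational-* (at-rational rs 0) (coordinate-rational n m))
    coordinate-rational (suc n) (suc j) = rational-+ (coordinate-rational n j) (rational-neg (rational-* (at-rational rs (suc j)) (coordinate-rational n m)))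

    op-rational : ∀ q ρ n → All IsRational q → (∀ k → IsRational (ρ k)) → IsRational (ℝP.op q ρ n)
    op-rational [] ρ n _ h = h n
    op-rational (_ ∷ q) ρ n (r ∷ rs) h = rational-+ (rational-* r (h n)) (op-rational q ρ (suc n) rs h)

    -- The coordinates inherit the relation β^n q(β) = 0, because coordinates are unique. It is
    -- applied to the minimal polynomial, for the growth, and to an integer polynomial, for the
    -- denominators.
    coordinate-recurrence : ∀ q → All IsRational q → ℝP.eval q β ≈ 0# → ∀ n j → j ℕ.< d → ℝP.op q (λ k → coordinate k j) n ≈ 0#
    coordinate-recurrence q rq e n = minimal-independent minimal (λ j → ℝP.op q (λ k → coordinate k j) n)
      (λ j _ → op-rational q (λ k → coordinate k j) n rq (λ k → coordinate-rational k j))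
      (≈-trans (ℝP.op-∑ q d (β ^_) coordinate n) (≈-trans (ℝP.op-cong q value-coordinate n)
        (≈-trans (ℝP.op-power q β n) (≈-trans (*-congˡ e) (zeroʳ _)))))

    -- q is monic with integer coefficients, so a common denominator of the first `length q`
    -- coordinate vectors is one for all n. This takes the place of Gauss's lemma, as the minimal
    -- polynomial is only known to be rational.
    denominator : ∀ q → All IsInteger q → ℝP.eval q β ≈ 0# →
      ∃ λ Δ → 0 ℕ.< Δ × (∀ n j → j ℕ.< d → IsInteger (fromℕ Δ * coordinate n j))
    denominator q iq e = conclude (common-multiple (λ n Δ → ∀ j → j ℕ.< d → IsInteger (fromℕ Δ * coordinate n j))
        (λ n m k h j p → multiple n j m k (h j p)) (length q)
        (λ n _ → common-multiple (λ j Δ → IsInteger (fromℕ Δ * coordinate n j)) (multiple n) d (λ j _ → single (coordinate-rational n j))))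
      where
      multiple : ∀ n j m k → IsInteger (fromℕ k * coordinate n j) → IsInteger (fromℕ (m ℕ.* k) * coordinate n j)
      multiple n j m k h = integer-cong (≈-trans (≈-sym (*-assoc _ _ _)) (*-congʳ (≈-sym (fromℕ-* m k)))) (integer-* (integer-ℕ m) h)
      single : ∀ {x} → IsRational x → ∃ λ n → 0 ℕ.< n × IsInteger (fromℕ n * x)
      single (rational n p i) = n , p , i
      rational-q : ∀ {q} → All IsInteger q → All IsRational q
      rational-q [] = []
      rational-q (i ∷ is) = integer⇒rational i ∷ rational-q is
      conclude : (∃ λ Δ → 0 ℕ.< Δ × (∀ n → n ℕ.< length q → ∀ j → j ℕ.< d → IsInteger (fromℕ Δ * coordinate n j))) →
        ∃ λ Δ → 0 ℕ.< Δ × (∀ n j → j ℕ.< d → IsInteger (fromℕ Δ * coordinate n j))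
      conclude (Δ , 0<Δ , initial) = Δ , 0<Δ , λ n j p → all j p (suc n) n ℕP.≤-refl
        where
        op-scale : ∀ q c ρ n → ℝP.op q (λ k → c * ρ k) n ≈ c * ℝP.op q ρ n
        op-scale [] c ρ n = ≈-refl
        op-scale (a ∷ q) c ρ n = ≈-trans (+-congˡ (op-scale q c ρ (suc n)))
          (solve 4 (λ a c r o → a :* (c :* r) :+ c :* o := c :* (a :* r :+ o)) ≈-refl a c (ρ n) (ℝP.op q ρ (suc n)))
        all : ∀ j → j ℕ.< d → ∀ b n → n ℕ.< b → IsInteger (fromℕ Δ * coordinate n j)
        all j p (suc b) n (ℕ.s≤s n≤b) with length q ℕP.≤? n
        ... | no n<e = initial n (ℕP.≰⇒> n<e) j p
        ... | yes e≤n = ≡.subst (λ k → IsInteger (fromℕ Δ * coordinate k j)) (ℕP.m∸n+n≡m e≤n)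
          (recurrence-integer q (λ k → fromℕ Δ * coordinate k j) (n ℕ.∸ length q) iq
            (integer-cong (≈-sym (≈-trans (op-scale q (fromℕ Δ) (λ k → coordinate k j) _) (≈-trans (*-congˡ (coordinate-recurrence q (rational-q iq) e _ j p)) (zeroʳ _)))) (integer-ℕ 0))
            (λ i i<e → all j p b (n ℕ.∸ length q ℕ.+ i) (ℕP.<-≤-trans (ℕP.+-monoʳ-< (n ℕ.∸ length q) i<e) (ℕP.≤-trans (ℕP.≤-reflexive (ℕP.m∸n+n≡m e≤n)) n≤b))))

  -- Δ β^n in coordinates with respect to 1, β, ..., where each coordinate is a multiple of β^n up
  -- to an error of size (n + 1)^k. In this form, together with β > 1, the arithmetic of β enters
  -- the rest of the proof.
  record PowerExpansion (β : ℝ) : Set where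
    constructor expansion
    field
      degree denominator exponent : ℕ
      coefficient : ℕ → ℕ → ℤ
      bound : ℝ
      denominator-pos : 0 ℕ.< denominator
      bound-nonneg : 0# ≤ bound
      expand : ∀ n → ∑ degree (λ j → fromℤ (coefficient n j) * β ^ j) ≈ fromℕ denominator * β ^ n
      dominated : ∀ j → j ℕ.< degree → ∃ λ p → ∀ n → ∣ fromℤ (coefficient n j) - β ^ n * p ∣ ≤ bound * fromℕ (suc n) ^ exponent

  power-expansion : ∀ β → AlgebraicInteger (fromℝ β) → (∀ γ → γ ConjugateOf fromℝ β → γ ≈ᶜ fromℝ β ⊎ ∣ γ ∣ᶜ ≤ 1#) → PowerExpansion β
  power-expansion β (e , a , a-root) conjugates = start (least (RationalRoot β) (e , q , length-tabulate _ , All-tabulate (λ i → integer⇒rational (integer (a i) ≈-refl)) , q-root))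
    where
    q = tabulate (fromℤ ∘ a)
    q-root : ℝP.eval q β ≈ 0#
    q-root = proj₁ (≈ᶜ-trans (≈ᶜ-sym (eval-fromℝ q β)) (≈ᶜ-trans (≈ᶜ-sym (evalMonic≈eval e fromℤ a (fromℝ β))) a-root))
    iq : All IsInteger q
    iq = All-tabulate (λ i → integer (a i) ≈-refl)
    core : ∀ c cs → All IsRational (c ∷ cs) → ℝP.eval (c ∷ cs) β ≈ 0# → DegreeAtLeast β (suc (length cs)) → PowerExpansion β
    core c cs rs root minimal = build (denominator q iq q-root)
      where
      open Coordinates β c cs rs root minimal
      p = map fromℝ (c ∷ cs)
      b = rational-vector (c ∷ cs) rs
      complex-root : eval p (fromℝ β) ≈ᶜ 0ᶜ
      complex-root = ≈ᶜ-trans (eval-fromℝ (c ∷ cs) β) (fromℝ-cong root)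
      minimal-polynomial : IsMinimalPolynomial (proj₁ b) (fromℝ β)
      minimal-polynomial = ≈ᶜ-trans (proj₂ b (fromℝ β)) complex-root , λ {e} b′ h → minimal e
        (tabulate (fromℚ ∘ b′) , length-tabulate _ , All-tabulate (λ i → fromℚ-rational (b′ i)) ,
         proj₁ (≈ᶜ-trans (≈ᶜ-sym (eval-fromℝ (tabulate (fromℚ ∘ b′)) β)) (≈ᶜ-trans (≈ᶜ-sym (evalMonic≈eval e fromℚ b′ (fromℝ β))) h)))
      -- Conjugates are defined through vectors of rationals; `rational-vector` carries the minimal
      -- polynomial, found among lists of reals, over to that form.
      roots : RootsIn (λ γ → γ ≈ᶜ fromℝ β ⊎ ∣ γ ∣ᶜ ≤ 1#) p
      roots γ h = conjugates γ (suc (length cs) , proj₁ b , minimal-polynomial , ≈ᶜ-trans (proj₂ b γ) h)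
      growth : ∀ j → j ℕ.< d → ∃ λ p → PolynomiallyBounded (λ n → fromℝ (coordinate n j) +ᶜ -ᶜ ((fromℝ β ^ᶜ n) *ᶜ p)) (length (map fromℝ cs))
      growth j j<d = dominant-root (fromℝ β) (fromℝ c) (map fromℝ cs) complex-root
        (minimal-root-simple β c cs rs minimal) roots (λ n → fromℝ (coordinate n j))
        (λ n → ≈ᶜ-trans (op-fromℝ (c ∷ cs) (λ k → coordinate k j) n) (fromℝ-cong (coordinate-recurrence (c ∷ cs) rs root n j j<d)))
      build : (∃ λ Δ → 0 ℕ.< Δ × (∀ n j → j ℕ.< d → IsInteger (fromℕ Δ * coordinate n j))) → PowerExpansion β
      build (Δ , 0<Δ , int) = finish (common-bound Q mono d single)
        where
        z : ℕ → ℕ → ℤ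
        z n j = choose (+ 0) (λ k → fromℕ Δ * coordinate n j ≈ fromℤ k)
        witness : ∀ {x} → IsInteger x → ∃ λ k → x ≈ fromℤ k
        witness (integer k e) = k , e
        z-spec : ∀ n j → j ℕ.< d → fromℕ Δ * coordinate n j ≈ fromℤ (z n j)
        z-spec n j j<d = choose-spec (+ 0) (λ k → fromℕ Δ * coordinate n j ≈ fromℤ k) (witness (int n j j<d))
        k = length (map fromℝ cs)
        Q : ℕ → ℝ → Set
        Q j B = ∃ λ p → ∀ n → ∣ fromℤ (z n j) - β ^ n * p ∣ ≤ B * fromℕ (suc n) ^ k
        mono : ∀ j {x y} → x ≤ y → Q j x → Q j y
        mono j x≤y (p , h) = p , λ n → ≤-trans (h n) (*-monoʳ-≤ (^-nonneg k (fromℕ-nonneg (suc n))) x≤y)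
        single : ∀ j → j ℕ.< d → ∃ λ B → 0# ≤ B × Q j B
        single j j<d = go (growth j j<d)
          where
          go : (∃ λ p → PolynomiallyBounded (λ n → fromℝ (coordinate n j) +ᶜ -ᶜ ((fromℝ β ^ᶜ n) *ᶜ p)) k) → ∃ λ B → 0# ≤ B × Q j B
          go (p , bounded A 0≤A h) = fromℕ Δ * A , *-nonNeg (fromℕ-nonneg Δ) 0≤A , fromℕ Δ * re p , λ n → begin
            ∣ fromℤ (z n j) - β ^ n * (fromℕ Δ * re p) ∣ ≈⟨ ∣∣-cong (≈-trans (+-congʳ (≈-sym (z-spec n j j<d)))
              (solve 4 (λ D x y p → D :* x :- y :* (D :* p) := D :* (x :- y :* p)) ≈-refl (fromℕ Δ) (coordinate n j) (β ^ n) (re p))) ⟩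
            ∣ fromℕ Δ * (coordinate n j - β ^ n * re p) ∣ ≈⟨ ≈-trans (∣∣-* _ _) (*-congʳ (∣∣-of-nonneg (fromℕ-nonneg Δ))) ⟩
            fromℕ Δ * ∣ coordinate n j - β ^ n * re p ∣ ≈⟨ *-congˡ (∣∣-cong (real-part n)) ⟩
            fromℕ Δ * ∣ re (w n) ∣ ≤⟨ *-monoˡ-≤ (fromℕ-nonneg Δ) (≤-trans (∣re∣≤ (w n)) (h n)) ⟩
            fromℕ Δ * (A * fromℕ (suc n) ^ k) ≈⟨ ≈-sym (*-assoc _ _ _) ⟩
            fromℕ Δ * A * fromℕ (suc n) ^ k ∎
            where
            w : ℕ → ℂ
            w n = fromℝ (coordinate n j) +ᶜ -ᶜ ((fromℝ β ^ᶜ n) *ᶜ p)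
            real-part : ∀ n → coordinate n j - β ^ n * re p ≈ re (w n)
            real-part n = +-congˡ (-‿cong (≈-trans (solve 3 (λ x y z → x :* y := x :* y :- :0 :* z) ≈-refl (β ^ n) (re p) (im p))
              (proj₁ (*ᶜ-congʳ {p} (fromℝ-^ β n)))))
        finish : (∃ λ B → 0# ≤ B × (∀ j → j ℕ.< d → Q j B)) → PowerExpansion β
        finish (B , 0≤B , h) = expansion d Δ k z B 0<Δ 0≤B (λ n → ≈-trans (∑-cong d (λ j p → ≈-trans (*-congʳ (≈-sym (z-spec n j p))) (*-assoc _ _ _)))
          (≈-trans (∑-*ˡ d (fromℕ Δ) _) (*-congˡ (value-coordinate n)))) h
    start : (∃ λ n → RationalRoot β n × (∀ m → RationalRoot β m → n ℕ.≤ m)) → PowerExpansion β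
    start (n , ([] , _ , _ , root) , _) = ⊥-elim (0≉1 (≈-sym root))
    start (_ , (c ∷ cs , ≡.refl , rs , root) , minimal) = core c cs rs root minimal

  -- Small values of integer polynomials at a Pisot or Salem number

  ∑ˡ-mono : {A : Set} (xs : List A) {f g : A → ℝ} → (∀ x → f x ≤ g x) → ∑ˡ xs f ≤ ∑ˡ xs g
  ∑ˡ-mono [] h = ≤-refl
  ∑ˡ-mono (x ∷ xs) h = +-mono-≤ (h x) (∑ˡ-mono xs h)

  ∣∑ˡ∣ : {A : Set} (xs : List A) (f : A → ℝ) → ∣ ∑ˡ xs f ∣ ≤ ∑ˡ xs (λ x → ∣ f x ∣)
  ∣∑ˡ∣ [] f = ≈⇒≤ (∣∣-of-nonneg ≤-refl)
  ∣∑ˡ∣ (x ∷ xs) f = ≤-trans (∣∣-+ _ _) (+-monoʳ-≤ _ (∣∑ˡ∣ xs f))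

  integer-∑ : ∀ n {f} → (∀ i → IsInteger (f i)) → IsInteger (∑ n f)
  integer-∑ zero h = integer-ℕ 0
  integer-∑ (suc n) h = integer-+ (integer-∑ n h) (h n)

  integer-∑ˡ : {A : Set} (xs : List A) {f : A → ℝ} → (∀ x → IsInteger (f x)) → IsInteger (∑ˡ xs f)
  integer-∑ˡ [] h = integer-ℕ 0
  integer-∑ˡ (x ∷ xs) h = integer-+ (h x) (integer-∑ˡ xs h)

  ∑-const : ∀ n c → ∑ n (λ _ → c) ≈ fromℕ n * c
  ∑-const zero c = ≈-sym (zeroˡ c)
  ∑-const (suc n) c = ≈-trans (+-congʳ (∑-const n c)) (solve 2 (λ n c → n :* c :+ c := (:1 :+ n) :* c) ≈-refl (fromℕ n) c)

  Sign : ℝ → Set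
  Sign ε = ε ≈ 0# ⊎ ∣ ε ∣ ≈ 1#

  -- For b ≥ 2 the top term b^n exceeds the sum of the lower ones. It is applied to b = β^κ, so that
  -- different subsets of the powers β^(κi) have different sums.
  no-short-relation : ∀ {b} → 2# ≤ b → ∀ n (ε : ℕ → ℝ) → (∀ i → Sign (ε i)) → ∑ n (λ i → ε i * b ^ i) ≈ 0# → ∀ i → i ℕ.< n → ε i ≈ 0#
  no-short-relation {b} 2≤b = go
    where
    1≤b-1 : 1# ≤ b - 1#
    1≤b-1 = by≤ (≤⇒0≤- 2≤b) (solve 1 (λ b → (b :- :1) :- :1 := b :- (:1 :+ :1)) ≈-refl b)
    0<b = <-≤-trans 0<2 2≤b
    sign≤1 : ∀ {ε} → Sign ε → ∣ ε ∣ ≤ 1#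
    sign≤1 (inj₁ e) = ≤-trans (≈⇒≤ (≈-trans (∣∣-cong e) (∣∣-of-nonneg ≤-refl))) 0≤1
    sign≤1 (inj₂ e) = ≈⇒≤ e
    lower : ∀ n (ε : ℕ → ℝ) → (∀ i → Sign (ε i)) → ∣ ∑ n (λ i → ε i * b ^ i) ∣ < b ^ n
    lower n ε s = begin-strict
      ∣ ∑ n (λ i → ε i * b ^ i) ∣ ≤⟨ ∣∑∣ n _ ⟩
      ∑ n (λ i → ∣ ε i * b ^ i ∣) ≤⟨ ∑-mono n (λ i _ → ≤-trans (≈⇒≤ (≈-trans (∣∣-* _ _) (*-congˡ (∣∣-of-nonneg (^-nonneg i (<⇒≤ 0<b))))))
                                             (≤-trans (*-monoʳ-≤ (^-nonneg i (<⇒≤ 0<b)) (sign≤1 (s i))) (≈⇒≤ (*-identityˡ _)))) ⟩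
      ∑ n (b ^_) ≈⟨ ≈-sym (*-identityʳ _) ⟩
      ∑ n (b ^_) * 1# ≤⟨ *-monoˡ-≤ (∑-nonneg n (λ i → ^-nonneg i (<⇒≤ 0<b))) 1≤b-1 ⟩
      ∑ n (b ^_) * (b - 1#) ≈⟨ solve 2 (λ s b → s :* (b :- :1) := :- (s :* (:1 :- b))) ≈-refl (∑ n (b ^_)) b ⟩
      - (∑ n (b ^_) * (1# - b)) ≈⟨ -‿cong (geometric n b) ⟩
      - (1# - b ^ n) <⟨ by< 0<1 (solve 1 (λ p → p :- (:- (:1 :- p)) := :1) ≈-refl (b ^ n)) ⟩
      b ^ n ∎
    go : ∀ n (ε : ℕ → ℝ) → (∀ i → Sign (ε i)) → ∑ n (λ i → ε i * b ^ i) ≈ 0# → ∀ i → i ℕ.< n → ε i ≈ 0#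
    go (suc n) ε s e i i≤n = cases (s n) (ℕP.m≤n⇒m<n∨m≡n (ℕP.≤-pred i≤n))
      where
      cases : Sign (ε n) → i ℕ.< n ⊎ i ≡ n → ε i ≈ 0#
      cases (inj₁ z) (inj₂ ≡.refl) = z
      cases (inj₁ z) (inj₁ i<n) = go n ε s (≈-trans (≈-sym (≈-trans (+-congˡ (≈-trans (*-congʳ z) (zeroˡ _))) (+-identityʳ _))) e) i i<n
      cases (inj₂ o) _ = ⊥-elim (<⇒≱ (lower n ε s) (begin
        b ^ n ≈⟨ ≈-sym (≈-trans (∣∣-* _ _) (≈-trans (*-cong o (∣∣-of-nonneg (^-nonneg n (<⇒≤ 0<b)))) (*-identityˡ _))) ⟩
        ∣ ε n * b ^ n ∣ ≈⟨ ∣∣-cong (≈-trans (solve 2 (λ s t → t := (s :+ t) :- s) ≈-refl (∑ n (λ i → ε i * b ^ i)) _) (≈-trans (+-congʳ e) (+-identityˡ _))) ⟩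
        ∣ - ∑ n (λ i → ε i * b ^ i) ∣ ≈⟨ ∣∣-neg _ ⟩
        ∣ ∑ n (λ i → ε i * b ^ i) ∣ ∎))

  encode : ∀ {y} N → IsInteger y → ∣ y ∣ ≤ fromℕ N → ∃ λ (i : Fin (suc (2 ℕ.* N))) → fromℕ (toℕ i) ≈ y + fromℕ N
  encode {y} N i p = go (integer-+ i (integer-ℕ N))
    where
    go : IsInteger (y + fromℕ N) → ∃ λ (i : Fin (suc (2 ℕ.* N))) → fromℕ (toℕ i) ≈ y + fromℕ N
    go (integer (+ n) e) = fromℕ< n< , ≈-trans (≈-reflexive (≡.cong fromℕ (FinP.toℕ-fromℕ< n<))) (≈-sym e)
      where
      n< : n ℕ.< suc (2 ℕ.* N)
      n< = ℕ.s≤s (fromℕ-cancel-≤ {n} {2 ℕ.* N} (begin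
        fromℕ n ≈⟨ ≈-sym e ⟩
        y + fromℕ N ≤⟨ +-monoˡ-≤ _ (≤-trans (x≤∣x∣ y) p) ⟩
        fromℕ N + fromℕ N ≈⟨ ≈-sym (≈-trans (fromℕ-+ N (N ℕ.+ 0)) (+-congˡ (≈-trans (fromℕ-+ N 0) (+-identityʳ _)))) ⟩
        fromℕ (2 ℕ.* N) ∎))
    go (integer -[1+ n ] e) = ⊥-elim (<⇒≱ (<-respʳ neg-0 (neg-mono-< (fromℕ-pos {suc n} (ℕ.s≤s ℕ.z≤n))))
      (≤-respʳ-≈ e (by≤ (≤⇒0≤- (≤-trans (-x≤∣x∣ y) p)) (solve 2 (λ y n → (y :+ n) :- :0 := n :- (:- y)) ≈-refl y (fromℕ N)))))

  module LowerBound {β : ℝ} (1<β : 1# < β) (ex : PowerExpansion β) where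
    open PowerExpansion ex renaming (degree to d; denominator to Δ; exponent to k; coefficient to z; bound to B)

    0≤β = ≤-trans 0≤1 (<⇒≤ 1<β)
    κ = proj₁ (^-unbounded 1<β 2#)
    -- 2^J sums with J = A₁L have to outnumber the box, which has at most 2^((k + 3)dL) points.
    A₁ = suc ((k ℕ.+ 3) ℕ.* d)
    -- The shifts κi with i < J do not exceed AL, the range of l in which β^l x₀ is at most 2^L.
    A = κ ℕ.* A₁
    projections : ∃ λ P → 0# ≤ P × (∀ j → j ℕ.< d → ∃ λ p → ∣ p ∣ ≤ P × ∀ n → ∣ fromℤ (z n j) - β ^ n * p ∣ ≤ B * fromℕ (suc n) ^ k)
    projections = common-bound (λ j P → ∃ λ p → ∣ p ∣ ≤ P × ∀ n → ∣ fromℤ (z n j) - β ^ n * p ∣ ≤ B * fromℕ (suc n) ^ k)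
      (λ j x≤y (p , q , h) → p , ≤-trans q x≤y , h) d (λ j j<d → let p , h = dominated j j<d in ∣ p ∣ , ∣∣-nonneg p , p , ≤-refl , h)
    P′ = proj₁ (archimedean (proj₁ projections))
    B′ = proj₁ (archimedean B)
    C = B′ ℕ.* (A ℕ.+ 2) ℕ.^ k ℕ.+ P′
    L₀ = suc (2 ℕ.* (A₁ ℕ.* C))

    module _ (L : ℕ) (L₀≤L : L₀ ℕ.≤ L) {X : Set} (xs : List X) (c : X → ℤ) (f : X → ℕ)
      (c-bound : ∑ˡ xs (λ x → ∣ fromℤ (c x) ∣) ≤ fromℕ (2 ℕ.^ L)) (f-bound : ∀ x → f x ℕ.≤ 2 ℕ.^ L)
      (small-value : ∣ ∑ˡ xs (λ x → fromℤ (c x) * β ^ f x) ∣ * β ^ (A ℕ.* L) ≤ fromℕ (2 ℕ.^ L)) where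

      x₀ = ∑ˡ xs (λ x → fromℤ (c x) * β ^ f x)
      J = A₁ ℕ.* L
      G = 2 ℕ.^ L ℕ.+ suc (A ℕ.* L)
      bound-y = 2 ℕ.^ L ℕ.* (B′ ℕ.* G ℕ.^ k ℕ.+ P′)

      -- The coordinates of Δ β^l x₀.
      y : ℕ → ℕ → ℝ
      y l j = ∑ˡ xs (λ x → fromℤ (c x) * fromℤ (z (f x ℕ.+ l) j))

      shift-β : ∀ l → ∑ˡ xs (λ x → fromℤ (c x) * β ^ (f x ℕ.+ l)) ≈ β ^ l * x₀
      shift-β l = ≈-trans (∑ˡ-cong xs (λ x → ≈-trans (*-congˡ (^-homo-* β (f x) l)) (solve 3 (λ c p q → c :* (p :* q) := q :* (c :* p)) ≈-refl (fromℤ (c x)) (β ^ f x) (β ^ l))))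
        (∑ˡ-*ˡ xs (β ^ l) _)

      y-integer : ∀ l j → IsInteger (y l j)
      y-integer l j = integer-∑ˡ xs (λ x → integer-* (integer (c x) ≈-refl) (integer (z (f x ℕ.+ l) j) ≈-refl))

      y-value : ∀ l → ∑ d (λ j → y l j * β ^ j) ≈ fromℕ Δ * (β ^ l * x₀)
      y-value l = begin-equality
        ∑ d (λ j → y l j * β ^ j)
          ≈⟨ ∑-cong d (λ j _ → ≈-trans (*-comm _ _) (≈-trans (≈-sym (∑ˡ-*ˡ xs (β ^ j) _)) (∑ˡ-cong xs (λ x → solve 3 (λ b c z → b :* (c :* z) := c :* (z :* b)) ≈-refl (β ^ j) (fromℤ (c x)) (fromℤ (z (f x ℕ.+ l) j)))))) ⟩
        ∑ d (λ j → ∑ˡ xs (λ x → fromℤ (c x) * (fromℤ (z (f x ℕ.+ l) j) * β ^ j)))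
          ≈⟨ ≈-sym (∑ˡ-∑-swap xs d _) ⟩
        ∑ˡ xs (λ x → ∑ d (λ j → fromℤ (c x) * (fromℤ (z (f x ℕ.+ l) j) * β ^ j)))
          ≈⟨ ∑ˡ-cong xs (λ x → ≈-trans (∑-*ˡ d (fromℤ (c x)) _) (≈-trans (*-congˡ (expand (f x ℕ.+ l))) (solve 3 (λ c D p → c :* (D :* p) := D :* (c :* p)) ≈-refl (fromℤ (c x)) (fromℕ Δ) (β ^ (f x ℕ.+ l))))) ⟩
        ∑ˡ xs (λ x → fromℕ Δ * (fromℤ (c x) * β ^ (f x ℕ.+ l)))
          ≈⟨ ≈-trans (∑ˡ-*ˡ xs (fromℕ Δ) _) (*-congˡ (shift-β l)) ⟩
        fromℕ Δ * (β ^ l * x₀) ∎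

      -- Writing each coordinate of Δ β^m as (z - β^m p) + β^m p splits y into the errors, of total
      -- size 2^L B′G^k, and p β^l x₀, which is small by the assumption on x₀.
      y-bound : ∀ l j → l ℕ.≤ A ℕ.* L → j ℕ.< d → ∣ y l j ∣ ≤ fromℕ bound-y
      y-bound l j l≤ j<d = go (proj₂ (proj₂ projections) j j<d)
        where
        two = fromℕ (2 ℕ.^ L)
        go : (∃ λ p → ∣ p ∣ ≤ proj₁ projections × ∀ n → ∣ fromℤ (z n j) - β ^ n * p ∣ ≤ B * fromℕ (suc n) ^ k) → ∣ y l j ∣ ≤ fromℕ bound-y
        go (p , p≤ , h) = begin
          ∣ y l j ∣ ≈⟨ ∣∣-cong (≈-trans (∑ˡ-cong xs (λ x → solve 4 (λ c z b p → c :* z := c :* (z :- b :* p) :+ p :* (c :* b)) ≈-refl (fromℤ (c x)) (fromℤ (z (f x ℕ.+ l) j)) (β ^ (f x ℕ.+ l)) p))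
                         (≈-trans (∑ˡ-+ xs _ _) (+-congˡ (≈-trans (∑ˡ-*ˡ xs p _) (*-congˡ (shift-β l)))))) ⟩
          ∣ ∑ˡ xs (λ x → fromℤ (c x) * e x) + p * (β ^ l * x₀) ∣ ≤⟨ ≤-trans (∣∣-+ _ _) (+-mono-≤ (∣∑ˡ∣ xs _) (≈⇒≤ (∣∣-* p _))) ⟩
          ∑ˡ xs (λ x → ∣ fromℤ (c x) * e x ∣) + ∣ p ∣ * ∣ β ^ l * x₀ ∣ ≤⟨ +-mono-≤ (≤-trans (∑ˡ-mono xs (λ x → ≤-trans (≈⇒≤ (≈-trans (∣∣-* _ _) (*-comm _ _))) (*-monoʳ-≤ (∣∣-nonneg _) (e-bound x)))) (≈⇒≤ (∑ˡ-*ˡ xs _ _)))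
                                                                       (*-mono-≤ (∣∣-nonneg p) (fromℕ-nonneg (2 ℕ.^ L)) (≤-trans p≤ (<⇒≤ (proj₂ (archimedean (proj₁ projections))))) x-bound) ⟩
          fromℕ (B′ ℕ.* G ℕ.^ k) * ∑ˡ xs (λ x → ∣ fromℤ (c x) ∣) + fromℕ P′ * two ≤⟨ +-monoˡ-≤ _ (*-monoˡ-≤ (fromℕ-nonneg (B′ ℕ.* G ℕ.^ k)) c-bound) ⟩
          fromℕ (B′ ℕ.* G ℕ.^ k) * two + fromℕ P′ * two ≈⟨ solve 3 (λ a b t → a :* t :+ b :* t := t :* (a :+ b)) ≈-refl (fromℕ (B′ ℕ.* G ℕ.^ k)) (fromℕ P′) two ⟩
          two * (fromℕ (B′ ℕ.* G ℕ.^ k) + fromℕ P′) ≈⟨ ≈-sym (≈-trans (fromℕ-* (2 ℕ.^ L) _) (*-congˡ (fromℕ-+ (B′ ℕ.* G ℕ.^ k) P′))) ⟩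
          fromℕ bound-y ∎
          where
          e : X → ℝ
          e x = fromℤ (z (f x ℕ.+ l) j) - β ^ (f x ℕ.+ l) * p
          e-bound : ∀ x → ∣ e x ∣ ≤ fromℕ (B′ ℕ.* G ℕ.^ k)
          e-bound x = begin
            ∣ e x ∣ ≤⟨ h (f x ℕ.+ l) ⟩
            B * fromℕ (suc (f x ℕ.+ l)) ^ k ≤⟨ *-mono-≤ bound-nonneg (^-nonneg k (fromℕ-nonneg G)) (<⇒≤ (proj₂ (archimedean B)))
              (^-monoˡ-≤ k (fromℕ-nonneg (suc (f x ℕ.+ l))) (fromℕ-mono (ℕP.≤-trans (ℕP.≤-reflexive (≡.sym (ℕP.+-suc (f x) l))) (ℕP.+-mono-≤ (f-bound x) (ℕ.s≤s l≤))))) ⟩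
            fromℕ B′ * fromℕ G ^ k ≈⟨ ≈-sym (≈-trans (fromℕ-* B′ (G ℕ.^ k)) (*-congˡ (fromℕ-^ G k))) ⟩
            fromℕ (B′ ℕ.* G ℕ.^ k) ∎
          x-bound : ∣ β ^ l * x₀ ∣ ≤ two
          x-bound = begin
            ∣ β ^ l * x₀ ∣ ≈⟨ ≈-trans (∣∣-* _ _) (≈-trans (*-comm _ _) (*-congˡ (∣∣-of-nonneg (^-nonneg l 0≤β)))) ⟩
            ∣ x₀ ∣ * β ^ l ≤⟨ *-monoˡ-≤ (∣∣-nonneg x₀) (^-monoʳ-≤ (<⇒≤ 1<β) l≤) ⟩
            ∣ x₀ ∣ * β ^ (A ℕ.* L) ≤⟨ small-value ⟩
            two ∎

      bit : (Fin J → Fin 2) → ℕ → ℝ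
      bit s i with i ℕP.<? J
      ... | yes p = fromℕ (toℕ (s (fromℕ< p)))
      ... | no _ = 0#

      bit-toℕ : ∀ s i → bit s (toℕ i) ≈ fromℕ (toℕ (s i))
      bit-toℕ s i with toℕ i ℕP.<? J
      ... | yes p = ≈-reflexive (≡.cong (λ i → fromℕ (toℕ (s i))) (FinP.fromℕ<-toℕ i p))
      ... | no n = ⊥-elim (n (FinP.toℕ<n i))

      bit-01 : ∀ s i → bit s i ≈ 0# ⊎ bit s i ≈ 1#
      bit-01 s i with i ℕP.<? J
      ... | no _ = inj₁ ≈-refl
      ... | yes p with s (fromℕ< p)
      ... | Fin.zero = inj₁ ≈-refl
      ... | Fin.suc Fin.zero = inj₂ fromℕ-1

      bit-integer : ∀ s i → IsInteger (bit s i)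
      bit-integer s i with bit-01 s i
      ... | inj₁ e = integer-cong (≈-sym e) (integer-ℕ 0)
      ... | inj₂ e = integer-cong (≈-trans fromℕ-1 (≈-sym e)) (integer-ℕ 1)

      ∣bit∣≤1 : ∀ s i → ∣ bit s i ∣ ≤ 1#
      ∣bit∣≤1 s i with bit-01 s i
      ... | inj₁ e = ≤-trans (≈⇒≤ (≈-trans (∣∣-cong e) (∣∣-of-nonneg ≤-refl))) 0≤1
      ... | inj₂ e = ≈⇒≤ (≈-trans (∣∣-cong e) (∣∣-of-nonneg 0≤1))

      bit-sign : ∀ s t i → Sign (bit s i - bit t i)
      bit-sign s t i with bit-01 s i | bit-01 t i
      ... | inj₁ e | inj₁ f = inj₁ (x≈y⇒x-y≈0 (≈-trans e (≈-sym f)))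
      ... | inj₂ e | inj₂ f = inj₁ (x≈y⇒x-y≈0 (≈-trans e (≈-sym f)))
      ... | inj₂ e | inj₁ f = inj₂ (≈-trans (∣∣-cong (≈-trans (+-cong e (-‿cong f)) (solve 0 (:1 :- :0 := :1) ≈-refl))) (∣∣-of-nonneg 0≤1))
      ... | inj₁ e | inj₂ f = inj₂ (≈-trans (∣∣-cong (≈-trans (+-cong e (-‿cong f)) (+-identityˡ _))) (≈-trans (∣∣-neg 1#) (∣∣-of-nonneg 0≤1)))

      Y : (Fin J → Fin 2) → ℕ → ℝ
      Y s j = ∑ J (λ i → bit s i * y (κ ℕ.* i) j)

      Y-bound : ∀ s j → j ℕ.< d → ∣ Y s j ∣ ≤ fromℕ (J ℕ.* bound-y)
      Y-bound s j j<d = begin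
        ∣ Y s j ∣ ≤⟨ ∣∑∣ J _ ⟩
        ∑ J (λ i → ∣ bit s i * y (κ ℕ.* i) j ∣) ≤⟨ ∑-mono J (λ i i<J → ≤-trans (≈⇒≤ (∣∣-* _ _)) (≤-trans (*-mono-≤ (∣∣-nonneg _) (fromℕ-nonneg bound-y) (∣bit∣≤1 s i)
            (y-bound (κ ℕ.* i) j (ℕP.≤-trans (ℕP.*-monoʳ-≤ κ (ℕP.<⇒≤ i<J)) (ℕP.≤-reflexive (≡.sym (ℕP.*-assoc κ A₁ L)))) j<d)) (≈⇒≤ (*-identityˡ _)))) ⟩
        ∑ J (λ _ → fromℕ bound-y) ≈⟨ ≈-trans (∑-const J _) (≈-sym (fromℕ-* J bound-y)) ⟩
        fromℕ (J ℕ.* bound-y) ∎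

      Y-value : ∀ s → ∑ d (λ j → Y s j * β ^ j) ≈ ∑ J (λ i → bit s i * (β ^ κ) ^ i) * (fromℕ Δ * x₀)
      Y-value s = begin-equality
        ∑ d (λ j → Y s j * β ^ j)
          ≈⟨ ∑-cong d (λ j _ → ≈-trans (*-comm _ _) (≈-trans (≈-sym (∑-*ˡ J (β ^ j) _)) (∑-cong J (λ i _ → solve 3 (λ b c z → b :* (c :* z) := c :* (z :* b)) ≈-refl (β ^ j) (bit s i) (y (κ ℕ.* i) j))))) ⟩
        ∑ d (λ j → ∑ J (λ i → bit s i * (y (κ ℕ.* i) j * β ^ j)))
          ≈⟨ ∑-swap d J _ ⟩
        ∑ J (λ i → ∑ d (λ j → bit s i * (y (κ ℕ.* i) j * β ^ j)))
          ≈⟨ ∑-cong J (λ i _ → ≈-trans (∑-*ˡ d (bit s i) _) (≈-trans (*-congˡ (y-value (κ ℕ.* i))) (≈-trans (*-congˡ (*-congˡ (*-congʳ (≈-sym (^-assocʳ β κ i)))))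
               (solve 4 (λ b D p x → b :* (D :* (p :* x)) := (D :* x) :* (b :* p)) ≈-refl (bit s i) (fromℕ Δ) ((β ^ κ) ^ i) x₀)))) ⟩
        ∑ J (λ i → (fromℕ Δ * x₀) * (bit s i * (β ^ κ) ^ i))
          ≈⟨ ≈-trans (∑-*ˡ J _ _) (*-comm _ _) ⟩
        ∑ J (λ i → bit s i * (β ^ κ) ^ i) * (fromℕ Δ * x₀) ∎

      M = suc (2 ℕ.* (J ℕ.* bound-y))

      code : (Fin J → Fin 2) → Fin d → Fin M
      code s j = proj₁ (encode (J ℕ.* bound-y) (integer-∑ J (λ i → integer-* (bit-integer s i) (y-integer (κ ℕ.* i) (toℕ j)))) (Y-bound s (toℕ j) (FinP.toℕ<n j)))

      code-spec : ∀ s j → fromℕ (toℕ (code s j)) ≈ Y s (toℕ j) + fromℕ (J ℕ.* bound-y)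
      code-spec s j = proj₂ (encode (J ℕ.* bound-y) (integer-∑ J (λ i → integer-* (bit-integer s i) (y-integer (κ ℕ.* i) (toℕ j)))) (Y-bound s (toℕ j) (FinP.toℕ<n j)))

      1≤L : 1 ℕ.≤ L
      1≤L = ℕP.≤-trans (ℕ.s≤s ℕ.z≤n) L₀≤L

      M-bound : M ℕ.^ d ℕ.< 2 ℕ.^ J
      M-bound = ℕP.≤-<-trans (ℕP.^-monoˡ-≤ d (siegel-size k A₁ A B′ P′ L L₀≤L))
        (ℕP.≤-<-trans (ℕP.≤-reflexive (ℕP.^-*-assoc 2 ((k ℕ.+ 3) ℕ.* L) d)) (ℕP.^-monoʳ-< 2 (ℕ.s≤s (ℕ.s≤s ℕ.z≤n))
          (ℕP.≤-trans (ℕP.+-mono-≤ 1≤L (ℕP.≤-reflexive (exponent k d L))) (ℕP.≤-refl {J}))))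
        where
        exponent : ∀ k d L → (k ℕ.+ 3) ℕ.* L ℕ.* d ≡ (k ℕ.+ 3) ℕ.* d ℕ.* L
        exponent = solve-∀

      bits-differ : ∀ s t → Fin.toℕ s ℕ.< Fin.toℕ t → (∀ j → j ℕ.< d → Y (finToFun s) j ≈ Y (finToFun t) j) → x₀ ≈ 0#
      bits-differ s t s<t same = by-contradiction λ x₀≉0 →
        ℕP.<-irrefl (≡.cong Fin.toℕ (equal (no-short-relation (<⇒≤ (proj₂ (^-unbounded 1<β 2#))) J (λ i → bit (finToFun s) i - bit (finToFun t) i)
          (bit-sign (finToFun s) (finToFun t)) (*-cancel-0 {fromℕ Δ * x₀} (λ e → x₀≉0 (*-cancel-0 (>⇒≉ (fromℕ-pos denominator-pos)) e)) (relation s t same))))) s<t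
        where
        S : (Fin J → Fin 2) → ℝ
        S s = ∑ J (λ i → bit s i * (β ^ κ) ^ i)
        relation : ∀ s t → (∀ j → j ℕ.< d → Y (finToFun s) j ≈ Y (finToFun t) j) →
          fromℕ Δ * x₀ * ∑ J (λ i → (bit (finToFun s) i - bit (finToFun t) i) * (β ^ κ) ^ i) ≈ 0#
        relation s t same = begin-equality
          fromℕ Δ * x₀ * ∑ J (λ i → (bit (finToFun s) i - bit (finToFun t) i) * (β ^ κ) ^ i)
            ≈⟨ *-congˡ (≈-trans (∑-cong J (λ i _ → solve 3 (λ a b p → (a :- b) :* p := a :* p :+ (:- :1) :* (b :* p)) ≈-refl (bit (finToFun s) i) (bit (finToFun t) i) ((β ^ κ) ^ i)))
                 (≈-trans (∑-+ J _ _) (+-congˡ (∑-*ˡ J (- 1#) _)))) ⟩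
          fromℕ Δ * x₀ * (S (finToFun s) + - 1# * S (finToFun t))
            ≈⟨ solve 3 (λ x a b → x :* (a :+ (:- :1) :* b) := a :* x :- b :* x) ≈-refl (fromℕ Δ * x₀) (S (finToFun s)) (S (finToFun t)) ⟩
          S (finToFun s) * (fromℕ Δ * x₀) - S (finToFun t) * (fromℕ Δ * x₀)
            ≈⟨ x≈y⇒x-y≈0 (≈-trans (≈-sym (Y-value (finToFun s))) (≈-trans (∑-cong d (λ j p → *-congʳ (same j p))) (Y-value (finToFun t)))) ⟩
          0# ∎
        equal : (∀ i → i ℕ.< J → bit (finToFun s) i - bit (finToFun t) i ≈ 0#) → s ≡ t
        equal h = ≡.trans (≡.sym (FinP.funToFin-finToFin {J} {2} s)) (≡.trans (funToFin-cong (λ i → FinP.toℕ-injective (fromℕ-injective (finToFun s i) (finToFun t i)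
          (≈-trans (≈-sym (bit-toℕ (finToFun s) i)) (≈-trans (x-y≈0⇒x≈y (h (toℕ i) (FinP.toℕ<n i))) (bit-toℕ (finToFun t) i)))))) (FinP.funToFin-finToFin {J} {2} t))
          where
          fromℕ-injective : ∀ (a b : Fin 2) → fromℕ (toℕ a) ≈ fromℕ (toℕ b) → toℕ a ≡ toℕ b
          fromℕ-injective a b e = ℕP.≤-antisym (fromℕ-cancel-≤ {toℕ a} {toℕ b} (≈⇒≤ e)) (fromℕ-cancel-≤ {toℕ b} {toℕ a} (≈⇒≤ (≈-sym e)))
          funToFin-cong : ∀ {m n} {f g : Fin m → Fin n} → (∀ i → f i ≡ g i) → funToFin f ≡ funToFin g
          funToFin-cong {zero} e = ≡.refl
          funToFin-cong {suc m} e = ≡.cong₂ Fin.combine (e Fin.zero) (funToFin-cong (e ∘ Fin.suc))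

      vanishes : x₀ ≈ 0#
      vanishes = collide (FinP.pigeonhole M-bound (λ s → funToFin (code (finToFun s))))
        where
        collide : (∃₂ λ s t → s Fin.< t × funToFin (code (finToFun s)) ≡ funToFin (code (finToFun t))) → x₀ ≈ 0#
        collide (s , t , s<t , e) = bits-differ s t s<t (λ j j<d → ≡.subst (λ j → Y (finToFun s) j ≈ Y (finToFun t) j) (FinP.toℕ-fromℕ< j<d) (same (fromℕ< j<d)))
          where
          same : ∀ j → Y (finToFun s) (toℕ j) ≈ Y (finToFun t) (toℕ j)
          same j = ≈-trans (cancel (Y (finToFun s) (toℕ j))) (≈-trans (+-congʳ (≈-trans (≈-sym (code-spec (finToFun s) j))
              (≈-trans (≈-reflexive (≡.cong (fromℕ ∘ toℕ) codes)) (code-spec (finToFun t) j)))) (≈-sym (cancel (Y (finToFun t) (toℕ j)))))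
            where
            cancel : ∀ y → y ≈ (y + fromℕ (J ℕ.* bound-y)) - fromℕ (J ℕ.* bound-y)
            cancel y = solve 2 (λ y n → y := (y :+ n) :- n) ≈-refl y (fromℕ (J ℕ.* bound-y))
            codes : code (finToFun s) j ≡ code (finToFun t) j
            codes = ≡.trans (≡.sym (FinP.finToFun-funToFin (code (finToFun s)) j)) (≡.trans (≡.cong (λ c → finToFun c j) e) (FinP.finToFun-funToFin (code (finToFun t)) j))

  -- The exponents may be as large as 2^L, while the value has to be small only on the scale
  -- β^(-AL). This disparity is why gaps of length linear in H suffice.
  lower-bound : ∀ {β} → 1# < β → PowerExpansion β → ∃₂ λ A L₀ → ∀ L → L₀ ℕ.≤ L →
    ∀ {X : Set} (xs : List X) (c : X → ℤ) (f : X → ℕ) → ∑ˡ xs (λ x → ∣ fromℤ (c x) ∣) ≤ fromℕ (2 ℕ.^ L) → (∀ x → f x ℕ.≤ 2 ℕ.^ L) →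
    ∣ ∑ˡ xs (λ x → fromℤ (c x) * β ^ f x) ∣ * β ^ (A ℕ.* L) ≤ fromℕ (2 ℕ.^ L) → ∑ˡ xs (λ x → fromℤ (c x) * β ^ f x) ≈ 0#
  lower-bound 1<β ex = A , L₀ , vanishes
    where open LowerBound 1<β ex

  -- Expansion of polynomials in partial sums

  ∑ˡ-cong-∈ : {X : Set} (xs : List X) {f g : X → ℝ} → (∀ x → x ∈ xs → f x ≈ g x) → ∑ˡ xs f ≈ ∑ˡ xs g
  ∑ˡ-cong-∈ [] h = ≈-refl
  ∑ˡ-cong-∈ (x ∷ xs) h = +-cong (h x (here ≡.refl)) (∑ˡ-cong-∈ xs (λ y p → h y (there p)))

  ∑ˡ-mono-∈ : {X : Set} (xs : List X) {f g : X → ℝ} → (∀ x → x ∈ xs → f x ≤ g x) → ∑ˡ xs f ≤ ∑ˡ xs g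
  ∑ˡ-mono-∈ [] h = ≤-refl
  ∑ˡ-mono-∈ (x ∷ xs) h = +-mono-≤ (h x (here ≡.refl)) (∑ˡ-mono-∈ xs (λ y p → h y (there p)))

  ∑ˡ-pos : {X : Set} (xs : List X) {f : X → ℝ} → (∀ x → x ∈ xs → 0# ≤ f x) → ∀ {x} → x ∈ xs → 0# < f x → 0# < ∑ˡ xs f
  ∑ˡ-pos (x ∷ xs) h (here ≡.refl) q = +-pos q (≤-trans (≈⇒≤ (≈-sym (∑ˡ-zeros xs))) (∑ˡ-mono-∈ xs (λ y p → h y (there p))))
    where
    ∑ˡ-zeros : {X : Set} (xs : List X) → ∑ˡ xs (λ _ → 0#) ≈ 0#
    ∑ˡ-zeros [] = ≈-refl
    ∑ˡ-zeros (x ∷ xs) = ≈-trans (+-identityˡ _) (∑ˡ-zeros xs)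
  ∑ˡ-pos (x ∷ xs) {f} h (there p) q = <-respʳ (+-comm (∑ˡ xs f) (f x)) (+-pos (∑ˡ-pos xs (λ y p → h y (there p)) p q) (h x (here ≡.refl)))

  ∑ˡ-const : {X : Set} (xs : List X) (c : ℝ) → ∑ˡ xs (λ _ → c) ≈ fromℕ (length xs) * c
  ∑ˡ-const [] c = ≈-sym (zeroˡ c)
  ∑ˡ-const (x ∷ xs) c = ≈-trans (+-congˡ (∑ˡ-const xs c)) (solve 2 (λ n c → c :+ n :* c := (:1 :+ n) :* c) ≈-refl (fromℕ (length xs)) c)

  ∑ˡ-map : {X Y : Set} (g : X → Y) (xs : List X) (f : Y → ℝ) → ∑ˡ (map g xs) f ≈ ∑ˡ xs (f ∘ g)
  ∑ˡ-map g [] f = ≈-refl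
  ∑ˡ-map g (x ∷ xs) f = +-congˡ (∑ˡ-map g xs f)

  ∑ˡ-cartesianProduct : {X Y : Set} (xs : List X) (ys : List Y) (f : X × Y → ℝ) →
    ∑ˡ (cartesianProduct xs ys) f ≈ ∑ˡ xs (λ x → ∑ˡ ys (λ y → f (x , y)))
  ∑ˡ-cartesianProduct [] ys f = ≈-refl
  ∑ˡ-cartesianProduct (x ∷ xs) ys f = ≈-trans (∑ˡ-++ (map (x ,_) ys) _ f) (+-cong (∑ˡ-map (x ,_) ys f) (∑ˡ-cartesianProduct xs ys f))

  ∑ˡ-prepend : ∀ h L f → ∑ˡ (prepend h L) f ≈ ∑ h (λ n → ∑ˡ L (λ ns → f (n ∷ ns)))
  ∑ˡ-prepend zero L f = ≈-refl
  ∑ˡ-prepend (suc h) L f = ≈-trans (∑ˡ-++ (prepend h L) _ f) (+-cong (∑ˡ-prepend h L f) (∑ˡ-map (h ∷_) L f))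

  ∑ˡ-tuplesUpTo : ∀ h k f → ∑ˡ (tuplesUpTo h k) f ≈ ∑ (suc k) (λ d → ∑ˡ (tuples h d) f)
  ∑ˡ-tuplesUpTo h zero f = ≈-sym (+-identityˡ _)
  ∑ˡ-tuplesUpTo h (suc k) f = ≈-trans (∑ˡ-++ (tuplesUpTo h k) _ f) (+-congʳ (∑ˡ-tuplesUpTo h k f))

  ∑-*ʳ : ∀ n c f → ∑ n (λ i → f i * c) ≈ ∑ n f * c
  ∑-*ʳ n c f = ≈-trans (∑-cong n (λ _ _ → *-comm _ _)) (≈-trans (∑-*ˡ n c f) (*-comm _ _))

  ∑ˡ-*ʳ : {X : Set} (xs : List X) (c : ℝ) (f : X → ℝ) → ∑ˡ xs (λ x → f x * c) ≈ ∑ˡ xs f * c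
  ∑ˡ-*ʳ xs c f = ≈-trans (∑ˡ-cong xs (λ _ → *-comm _ _)) (≈-trans (∑ˡ-*ˡ xs c f) (*-comm _ _))

  truncation : ℝ → (ℕ → ℕ) → (ℕ → ℕ) → ℕ → ℝ
  truncation q u W H = ∑ H (λ n → fromℕ (u n) * q ^ W n)

  -- The coefficient of a tuple in S₁^i S₂^(d - i): its first i entries index terms of S₁, the
  -- others terms of S₂.
  mixed : (ℕ → ℕ) → (ℕ → ℕ) → ℕ → List ℕ → ℕ
  mixed u₁ u₂ i [] = 1
  mixed u₁ u₂ zero (n ∷ ns) = u₂ n ℕ.* mixed u₁ u₂ zero ns
  mixed u₁ u₂ (suc i) (n ∷ ns) = u₁ n ℕ.* mixed u₁ u₂ i ns

  module _ (q : ℝ) (W : ℕ → ℕ) where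

    expand-factor : ∀ u H d (m : List ℕ → ℕ) → truncation q u W H * ∑ˡ (tuples H d) (λ ns → fromℕ (m ns) * q ^ weight W ns) ≈
      ∑ˡ (tuples H (suc d)) (λ { [] → 0# ; (n ∷ ns) → fromℕ (u n ℕ.* m ns) * q ^ weight W (n ∷ ns) })
    expand-factor u H d m = ≈-sym (≈-trans (∑ˡ-prepend H (tuples H d) _) (≈-trans (∑-cong H (λ n _ → ≈-trans
      (∑ˡ-cong (tuples H d) (λ ns → ≈-trans (*-cong (fromℕ-* (u n) (m ns)) (^-homo-* q (W n) (weight W ns)))
        (solve 4 (λ a b c d → a :* b :* (c :* d) := a :* c :* (b :* d)) ≈-refl (fromℕ (u n)) (fromℕ (m ns)) (q ^ W n) (q ^ weight W ns))))
      (∑ˡ-*ˡ (tuples H d) _ _))) (∑-*ʳ H _ _)))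

    expand-mixed : ∀ u₁ u₂ H d i → i ℕ.≤ d → truncation q u₁ W H ^ i * truncation q u₂ W H ^ (d ℕ.∸ i) ≈
      ∑ˡ (tuples H d) (λ ns → fromℕ (mixed u₁ u₂ i ns) * q ^ weight W ns)
    expand-mixed u₁ u₂ H zero zero p = solve 0 (:1 :* :1 := (:1 :+ :0) :* :1 :+ :0) ≈-refl
    expand-mixed u₁ u₂ H (suc d) zero p = ≈-trans (solve 2 (λ s t → :1 :* (s :* t) := s :* (:1 :* t)) ≈-refl _ _)
      (≈-trans (*-congˡ (expand-mixed u₁ u₂ H d 0 ℕ.z≤n)) (≈-trans (expand-factor u₂ H d (mixed u₁ u₂ 0)) (∑ˡ-cong-∈ (tuples H (suc d)) λ
        { [] r → ⊥-elim (ℕP.0≢1+n (proj₁ (∈-tuples⁻ H (suc d) r))) ; (n ∷ ns) _ → ≈-refl })))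
    expand-mixed u₁ u₂ H (suc d) (suc i) (ℕ.s≤s p) = ≈-trans (*-assoc _ _ _)
      (≈-trans (*-congˡ (expand-mixed u₁ u₂ H d i p)) (≈-trans (expand-factor u₁ H d (mixed u₁ u₂ i)) (∑ˡ-cong-∈ (tuples H (suc d)) λ
        { [] r → ⊥-elim (ℕP.0≢1+n (proj₁ (∈-tuples⁻ H (suc d) r))) ; (n ∷ ns) _ → ≈-refl })))

    expand-power : ∀ u h k → truncation q u W h ^ k ≈ ∑ˡ (tuples h k) (λ ms → fromℕ (mixed u u 0 ms) * q ^ weight W ms)
    expand-power u h k = ≈-trans (≈-sym (*-identityˡ _)) (expand-mixed u u h k 0 ℕ.z≤n)

  graded : (ℕ → ℕ → ℕ → ℤ) → ℕ → ℕ → ℝ → ℝ → ℝ → ℝ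
  graded A D n x y z = ∑ (suc D) λ d → ∑ (suc n) λ k → ∑ (suc d) (λ i → fromℤ (A i (d ℕ.∸ i) k) * (x ^ i * y ^ (d ℕ.∸ i))) * z ^ k

  module Expansion (A : ℕ → ℕ → ℕ → ℤ) (u₁ u₂ u₃ : ℕ → ℕ) where

    block-coefficient : List ℕ → ℕ → ℝ
    block-coefficient ns k = ∑ (suc (length ns)) λ i → fromℤ (A i (length ns ℕ.∸ i) k) * fromℕ (mixed u₁ u₂ i ns)

    coefficient : Index → ℝ
    coefficient (ns , ms) = block-coefficient ns (length ms) * fromℕ (mixed u₃ u₃ 0 ms)

    coefficient-integer : ∀ τ → IsInteger (coefficient τ)
    coefficient-integer (ns , ms) = integer-* (integer-∑ (suc (length ns)) (λ i → integer-* (integer (A i (length ns ℕ.∸ i) (length ms)) ≈-refl) (integer-ℕ (mixed u₁ u₂ i ns)))) (integer-ℕ (mixed u₃ u₃ 0 ms))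

    expand-graded : ∀ q W V D n H h → graded A D n (truncation q u₁ W H) (truncation q u₂ W H) (truncation q u₃ V h) ≈
      ∑ˡ (indices H h D n) (λ τ → coefficient τ * q ^ total-exponent W V τ)
    expand-graded q W V D n H h = ≈-sym (begin-equality
      ∑ˡ (indices H h D n) (λ τ → coefficient τ * q ^ total-exponent W V τ)
        ≈⟨ ∑ˡ-cartesianProduct (tuplesUpTo H D) (tuplesUpTo h n) _ ⟩
      ∑ˡ (tuplesUpTo H D) (λ ns → ∑ˡ (tuplesUpTo h n) (λ ms → coefficient (ns , ms) * q ^ (weight W ns ℕ.+ weight V ms)))
        ≈⟨ ∑ˡ-cong (tuplesUpTo H D) inner ⟩
      ∑ˡ (tuplesUpTo H D) (λ ns → ∑ (suc n) (λ k → block-coefficient ns k * q ^ weight W ns * S₃ ^ k))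
        ≈⟨ ∑ˡ-tuplesUpTo H D _ ⟩
      ∑ (suc D) (λ d → ∑ˡ (tuples H d) (λ ns → ∑ (suc n) (λ k → block-coefficient ns k * q ^ weight W ns * S₃ ^ k)))
        ≈⟨ ∑-cong (suc D) (λ d _ → ≈-trans (∑ˡ-∑-swap (tuples H d) (suc n) _) (∑-cong (suc n) (λ k _ → ≈-trans (∑ˡ-*ʳ (tuples H d) (S₃ ^ k) _) (*-congʳ (outer d k))))) ⟩
      graded A D n S₁ S₂ S₃ ∎)
      where
      S₁ = truncation q u₁ W H
      S₂ = truncation q u₂ W H
      S₃ = truncation q u₃ V h
      inner : ∀ ns → ∑ˡ (tuplesUpTo h n) (λ ms → coefficient (ns , ms) * q ^ (weight W ns ℕ.+ weight V ms)) ≈ ∑ (suc n) (λ k → block-coefficient ns k * q ^ weight W ns * S₃ ^ k)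
      inner ns = ≈-trans (∑ˡ-tuplesUpTo h n _) (∑-cong (suc n) (λ k _ → begin-equality
        ∑ˡ (tuples h k) (λ ms → coefficient (ns , ms) * q ^ (weight W ns ℕ.+ weight V ms))
          ≈⟨ ∑ˡ-cong-∈ (tuples h k) (λ ms r → ≈-trans (*-cong (*-congʳ (≈-reflexive (≡.cong (block-coefficient ns) (proj₁ (∈-tuples⁻ h k r))))) (^-homo-* q (weight W ns) (weight V ms)))
               (solve 4 (λ a b c d → a :* b :* (c :* d) := a :* c :* (b :* d)) ≈-refl (block-coefficient ns k) (fromℕ (mixed u₃ u₃ 0 ms)) (q ^ weight W ns) (q ^ weight V ms))) ⟩
        ∑ˡ (tuples h k) (λ ms → block-coefficient ns k * q ^ weight W ns * (fromℕ (mixed u₃ u₃ 0 ms) * q ^ weight V ms))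
          ≈⟨ ∑ˡ-*ˡ (tuples h k) _ _ ⟩
        block-coefficient ns k * q ^ weight W ns * ∑ˡ (tuples h k) (λ ms → fromℕ (mixed u₃ u₃ 0 ms) * q ^ weight V ms)
          ≈⟨ *-congˡ (≈-sym (expand-power q V u₃ h k)) ⟩
        block-coefficient ns k * q ^ weight W ns * S₃ ^ k ∎))
      outer : ∀ d k → ∑ˡ (tuples H d) (λ ns → block-coefficient ns k * q ^ weight W ns) ≈ ∑ (suc d) (λ i → fromℤ (A i (d ℕ.∸ i) k) * (S₁ ^ i * S₂ ^ (d ℕ.∸ i)))
      outer d k = begin-equality
        ∑ˡ (tuples H d) (λ ns → block-coefficient ns k * q ^ weight W ns)
          ≈⟨ ∑ˡ-cong-∈ (tuples H d) (λ ns r → ≈-trans (*-congʳ (≈-reflexive (≡.cong (λ e → ∑ (suc e) (λ i → fromℤ (A i (e ℕ.∸ i) k) * fromℕ (mixed u₁ u₂ i ns))) (proj₁ (∈-tuples⁻ H d r)))))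
               (≈-trans (≈-sym (∑-*ʳ (suc d) (q ^ weight W ns) _)) (∑-cong (suc d) (λ i _ → *-assoc _ _ _)))) ⟩
        ∑ˡ (tuples H d) (λ ns → ∑ (suc d) (λ i → fromℤ (A i (d ℕ.∸ i) k) * (fromℕ (mixed u₁ u₂ i ns) * q ^ weight W ns)))
          ≈⟨ ∑ˡ-∑-swap (tuples H d) (suc d) _ ⟩
        ∑ (suc d) (λ i → ∑ˡ (tuples H d) (λ ns → fromℤ (A i (d ℕ.∸ i) k) * (fromℕ (mixed u₁ u₂ i ns) * q ^ weight W ns)))
          ≈⟨ ∑-cong (suc d) (λ i p → ≈-trans (∑ˡ-*ˡ (tuples H d) _ _) (*-congˡ (≈-sym (expand-mixed q W u₁ u₂ H d i (ℕP.≤-pred p))))) ⟩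
        ∑ (suc d) (λ i → fromℤ (A i (d ℕ.∸ i) k) * (S₁ ^ i * S₂ ^ (d ℕ.∸ i))) ∎

    mixed-bound : ∀ v w {H U} → 0 ℕ.< U → (∀ n → n ℕ.< H → v n ℕ.≤ U × w n ℕ.≤ U) → ∀ i ns → All (ℕ._< H) ns → mixed v w i ns ℕ.≤ U ℕ.^ length ns
    mixed-bound v w 0<U h i [] [] = ℕP.≤-refl
    mixed-bound v w 0<U h zero (n ∷ ns) (p ∷ ps) = ℕP.*-mono-≤ (proj₂ (h n p)) (mixed-bound v w 0<U h zero ns ps)
    mixed-bound v w 0<U h (suc i) (n ∷ ns) (p ∷ ps) = ℕP.*-mono-≤ (proj₁ (h n p)) (mixed-bound v w 0<U h i ns ps)

    coefficient-bound : ∀ {a D n H h U} → (∀ i j k → ∣ fromℤ (A i j k) ∣ ≤ fromℕ a) → 0 ℕ.< U → h ℕ.≤ H →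
      (∀ n → n ℕ.< H → u₁ n ℕ.≤ U × u₂ n ℕ.≤ U × u₃ n ℕ.≤ U) → ∀ τ → τ ∈ indices H h D n →
      ∣ coefficient τ ∣ ≤ fromℕ (suc D ℕ.* a ℕ.* U ℕ.^ (D ℕ.+ n))
    coefficient-bound {a} {D} {n} {H} {h} {U} A≤ 0<U h≤H u≤ (ns , ms) τ∈ = begin
      ∣ block-coefficient ns (length ms) * fromℕ (mixed u₃ u₃ 0 ms) ∣
        ≈⟨ ≈-trans (∣∣-* _ _) (*-congˡ (∣∣-of-nonneg (fromℕ-nonneg (mixed u₃ u₃ 0 ms)))) ⟩
      ∣ block-coefficient ns (length ms) ∣ * fromℕ (mixed u₃ u₃ 0 ms)
        ≤⟨ *-mono-≤ (∣∣-nonneg _) (fromℕ-nonneg (U ℕ.^ n)) (≤-trans (∣∑∣ (suc (length ns)) _) (≤-trans (∑-mono (suc (length ns)) (λ i _ → each i)) (≈⇒≤ (∑-const (suc (length ns)) _))))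
             (fromℕ-mono (ℕP.≤-trans (mixed-bound u₃ u₃ 0<U (λ n p → proj₂ (proj₂ (u≤ n (ℕP.<-≤-trans p h≤H))) , proj₂ (proj₂ (u≤ n (ℕP.<-≤-trans p h≤H)))) 0 ms ms<) (U-mono ms≤))) ⟩
      fromℕ (suc (length ns)) * (fromℕ a * fromℕ (U ℕ.^ D)) * fromℕ (U ℕ.^ n)
        ≤⟨ *-monoʳ-≤ (fromℕ-nonneg (U ℕ.^ n)) (*-monoʳ-≤ (*-nonNeg (fromℕ-nonneg a) (fromℕ-nonneg (U ℕ.^ D))) (fromℕ-mono (ℕ.s≤s ns≤))) ⟩
      fromℕ (suc D) * (fromℕ a * fromℕ (U ℕ.^ D)) * fromℕ (U ℕ.^ n)
        ≈⟨ solve 4 (λ d a x y → d :* (a :* x) :* y := d :* a :* (x :* y)) ≈-refl (fromℕ (suc D)) (fromℕ a) (fromℕ (U ℕ.^ D)) (fromℕ (U ℕ.^ n)) ⟩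
      fromℕ (suc D) * fromℕ a * (fromℕ (U ℕ.^ D) * fromℕ (U ℕ.^ n))
        ≈⟨ ≈-sym (≈-trans (fromℕ-* (suc D ℕ.* a) (U ℕ.^ (D ℕ.+ n))) (*-cong (fromℕ-* (suc D) a) (≈-trans (≈-reflexive (≡.cong fromℕ (ℕP.^-distribˡ-+-* U D n))) (fromℕ-* (U ℕ.^ D) (U ℕ.^ n))))) ⟩
      fromℕ (suc D ℕ.* a ℕ.* U ℕ.^ (D ℕ.+ n)) ∎
      where
      ∈× = ∈-cartesianProduct⁻ (tuplesUpTo H D) (tuplesUpTo h n) τ∈
      ns≤ = proj₁ (∈-tuplesUpTo⁻ H D (proj₁ ∈×))
      ns< = proj₂ (∈-tuplesUpTo⁻ H D (proj₁ ∈×))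
      ms≤ = proj₁ (∈-tuplesUpTo⁻ h n (proj₂ ∈×))
      ms< = proj₂ (∈-tuplesUpTo⁻ h n (proj₂ ∈×))
      U-mono : ∀ {a b} → a ℕ.≤ b → U ℕ.^ a ℕ.≤ U ℕ.^ b
      U-mono = ℕP.^-monoʳ-≤ U {{ℕ.>-nonZero 0<U}}
      each : ∀ i → ∣ fromℤ (A i (length ns ℕ.∸ i) (length ms)) * fromℕ (mixed u₁ u₂ i ns) ∣ ≤ fromℕ a * fromℕ (U ℕ.^ D)
      each i = ≤-trans (≈⇒≤ (≈-trans (∣∣-* _ _) (*-congˡ (∣∣-of-nonneg (fromℕ-nonneg (mixed u₁ u₂ i ns)))))) (*-mono-≤ (∣∣-nonneg _) (fromℕ-nonneg (U ℕ.^ D)) (A≤ i _ _)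
        (fromℕ-mono (ℕP.≤-trans (mixed-bound u₁ u₂ 0<U (λ n p → proj₁ (u≤ n p) , proj₁ (proj₂ (u≤ n p))) i ns ns<) (U-mono ns≤))))

    indices-length : ∀ H h D n → h ℕ.≤ H → length (indices H h D n) ℕ.≤ 2 ℕ.^ (H ℕ.* (D ℕ.+ n))
    indices-length H h D n h≤H = ℕP.≤-trans (ℕP.≤-reflexive (length-cartesianProduct (tuplesUpTo H D) (tuplesUpTo h n)))
      (ℕP.≤-trans (ℕP.*-mono-≤ (ℕP.≤-trans (length-tuplesUpTo H D) (ℕP.^-monoˡ-≤ D (n<2^n H)))
        (ℕP.≤-trans (length-tuplesUpTo h n) (ℕP.^-monoˡ-≤ n (ℕP.≤-trans (ℕ.s≤s h≤H) (n<2^n H)))))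
        (ℕP.≤-reflexive (≡.trans (≡.sym (ℕP.^-distribˡ-+-* (2 ℕ.^ H) D n)) (ℕP.^-*-assoc 2 H (D ℕ.+ n)))))

    module _ (D K i₀ a n₀ p : ℕ) (i₀≤D : i₀ ℕ.≤ D) (A≤ : ∀ i j k → ∣ fromℤ (A i j k) ∣ ≤ fromℕ a)
      (high-k : ∀ i k → i ℕ.≤ D → K ℕ.< k → A i (D ℕ.∸ i) k ≡ + 0) (high-i : ∀ i → i ℕ.≤ D → i₀ ℕ.< i → A i (D ℕ.∸ i) K ≡ + 0)
      (leading : A i₀ (D ℕ.∸ i₀) K ≡ + suc p) (dominance : ∀ n → n₀ ℕ.≤ n → 0 ℕ.< u₂ n × suc a ℕ.* u₂ n ℕ.≤ u₁ n) where

      mixed-grows : ∀ i ns → All (n₀ ℕ.≤_) ns → i ℕ.< length ns → suc a ℕ.* mixed u₁ u₂ i ns ℕ.≤ mixed u₁ u₂ (suc i) ns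
      mixed-grows zero (n ∷ ns) (q ∷ qs) _ = ℕP.≤-trans (ℕP.≤-reflexive (≡.sym (ℕP.*-assoc (suc a) (u₂ n) _))) (ℕP.*-mono-≤ (proj₂ (dominance n q)) (ℕP.≤-refl {mixed u₁ u₂ 0 ns}))
      mixed-grows (suc i) (n ∷ ns) (q ∷ qs) (ℕ.s≤s r) = ℕP.≤-trans (ℕP.≤-reflexive (swap (suc a) (u₁ n) _)) (ℕP.*-monoʳ-≤ (u₁ n) (mixed-grows i ns qs r))
        where
        swap : ∀ a b c → a ℕ.* (b ℕ.* c) ≡ b ℕ.* (a ℕ.* c)
        swap a b c = ≡.trans (≡.sym (ℕP.*-assoc a b c)) (≡.trans (≡.cong (ℕ._* c) (ℕP.*-comm a b)) (ℕP.*-assoc b a c))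

      mixed-pos : ∀ ns → All (n₀ ℕ.≤_) ns → 0 ℕ.< mixed u₁ u₂ 0 ns
      mixed-pos [] [] = ℕ.s≤s ℕ.z≤n
      mixed-pos (n ∷ ns) (q ∷ qs) = 0<-* (proj₁ (dominance n q)) (mixed-pos ns qs)

      -- With m(i) for the values of `mixed`, `mixed-grows` gives a m(i) ≤ m(i + 1) - m(i), and the
      -- sum telescopes; m(0) > 0 makes the inequality strict.
      mixed-dominates : ∀ m ns → All (n₀ ℕ.≤_) ns → m ℕ.≤ length ns → ∑ m (λ i → fromℕ a * fromℕ (mixed u₁ u₂ i ns)) < fromℕ (mixed u₁ u₂ m ns)
      mixed-dominates zero ns qs _ = fromℕ-pos (mixed-pos ns qs)
      mixed-dominates (suc m) ns qs r = begin-strict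
        ∑ m (λ i → fromℕ a * fromℕ (mixed u₁ u₂ i ns)) + fromℕ a * fromℕ (mixed u₁ u₂ m ns) <⟨ +-mono-<-≤ (mixed-dominates m ns qs (ℕP.<⇒≤ r)) ≤-refl ⟩
        fromℕ (mixed u₁ u₂ m ns) + fromℕ a * fromℕ (mixed u₁ u₂ m ns) ≈⟨ solve 2 (λ a m → m :+ a :* m := (:1 :+ a) :* m) ≈-refl (fromℕ a) (fromℕ (mixed u₁ u₂ m ns)) ⟩
        fromℕ (suc a) * fromℕ (mixed u₁ u₂ m ns) ≈⟨ ≈-sym (fromℕ-* (suc a) (mixed u₁ u₂ m ns)) ⟩
        fromℕ (suc a ℕ.* mixed u₁ u₂ m ns) ≤⟨ fromℕ-mono (mixed-grows m ns qs r) ⟩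
        fromℕ (mixed u₁ u₂ (suc m) ns) ∎

      block-positive : ∀ ns → length ns ≡ D → All (n₀ ℕ.≤_) ns → 0# < block-coefficient ns K
      block-positive ns ≡.refl qs = begin-strict
        0# <⟨ <⇒0<- (mixed-dominates i₀ ns qs i₀≤D) ⟩
        fromℕ (m i₀) - ∑ i₀ (λ i → fromℕ a * fromℕ (m i)) ≈⟨ +-comm _ _ ⟩
        - ∑ i₀ (λ i → fromℕ a * fromℕ (m i)) + fromℕ (m i₀) ≤⟨ +-mono-≤ lower top ⟩
        ∑ i₀ f + f i₀ ≈⟨ ≈-sym (≈-trans (+-congˡ (∑-zero (D ℕ.∸ i₀) (λ i r → zero-above (suc i₀ ℕ.+ i) (bound i r) (ℕ.s≤s (ℕP.m≤m+n i₀ i))))) (+-identityʳ _)) ⟩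
        ∑ (suc i₀) f + ∑ (D ℕ.∸ i₀) (f ∘ (suc i₀ ℕ.+_)) ≈⟨ ≈-sym (∑-split (suc i₀) (D ℕ.∸ i₀) f) ⟩
        ∑ (suc i₀ ℕ.+ (D ℕ.∸ i₀)) f ≡⟨ ≡.cong (λ e → ∑ (suc e) f) (ℕP.m+[n∸m]≡n i₀≤D) ⟩
        ∑ (suc D) f ∎
        where
        m : ℕ → ℕ
        m i = mixed u₁ u₂ i ns
        f : ℕ → ℝ
        f i = fromℤ (A i (D ℕ.∸ i) K) * fromℕ (m i)
        bound : ∀ i → i ℕ.< D ℕ.∸ i₀ → suc i₀ ℕ.+ i ℕ.≤ D
        bound i r = ℕP.≤-trans (ℕP.≤-reflexive (≡.sym (ℕP.+-suc i₀ i))) (ℕP.≤-trans (ℕP.+-monoʳ-≤ i₀ r) (ℕP.≤-reflexive (ℕP.m+[n∸m]≡n i₀≤D)))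
        zero-above : ∀ i → i ℕ.≤ D → i₀ ℕ.< i → f i ≈ 0#
        zero-above i r s = ≈-trans (*-congʳ (≈-reflexive (≡.cong fromℤ (high-i i r s)))) (zeroˡ _)
        lower : - ∑ i₀ (λ i → fromℕ a * fromℕ (m i)) ≤ ∑ i₀ f
        lower = ≤-respʳ-≈ (neg-involutive _) (neg-mono-≤ (≤-trans (-x≤∣x∣ _) (≤-trans (∣∑∣ i₀ f) (∑-mono i₀ (λ i _ →
          ≤-trans (≈⇒≤ (≈-trans (∣∣-* _ _) (*-congˡ (∣∣-of-nonneg (fromℕ-nonneg (m i)))))) (*-monoʳ-≤ (fromℕ-nonneg (m i)) (A≤ i _ _)))))))
        top : fromℕ (m i₀) ≤ f i₀
        top = ≤-trans (≈⇒≤ (≈-sym (*-identityˡ _))) (*-monoʳ-≤ (fromℕ-nonneg (m i₀)) (≤-respʳ-≈ (≈-reflexive (≡.cong fromℤ (≡.sym leading)))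
          (by≤ (fromℕ-nonneg p) (solve 1 (λ p → (:1 :+ p) :- :1 := p) ≈-refl (fromℕ p)))))

      -- With exactly K indices of V the coefficient of the W-part is positive; with more than K it
      -- is 0, because K is the largest degree in X₃ at the top degree.
      coefficient-nonneg : ∀ ns ms → length ns ≡ D → All (n₀ ℕ.≤_) ns → K ℕ.≤ length ms → 0# ≤ coefficient (ns , ms)
      coefficient-nonneg ns ms len qs K≤ = *-nonNeg (cases (ℕP.m≤n⇒m<n∨m≡n K≤)) (fromℕ-nonneg (mixed u₃ u₃ 0 ms))
        where
        cases : K ℕ.< length ms ⊎ K ≡ length ms → 0# ≤ block-coefficient ns (length ms)
        cases (inj₂ e) = ≡.subst (λ k → 0# ≤ block-coefficient ns k) e (<⇒≤ (block-positive ns len qs))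
        cases (inj₁ r) = ≈⇒≤ (≈-sym (∑-zero (suc (length ns)) (λ i s → ≈-trans (*-congʳ (≈-reflexive (≡.cong fromℤ (≡.trans (≡.cong (λ d → A i (d ℕ.∸ i) (length ms)) len) (high-k i (length ms) (ℕP.≤-trans (ℕP.≤-pred s) (ℕP.≤-reflexive len)) r))))) (zeroˡ _))))

      coefficient-pos : (∀ n → 0 ℕ.< n → 0 ℕ.< u₃ n) → ∀ ns ms → length ns ≡ D → All (n₀ ℕ.≤_) ns → length ms ≡ K → All (0 ℕ.<_) ms → 0# < coefficient (ns , ms)
      coefficient-pos u₃-pos ns ms len qs ≡.refl ps = *-pos (block-positive ns len qs) (fromℕ-pos (product-pos ms ps))
        where
        product-pos : ∀ ms → All (0 ℕ.<_) ms → 0 ℕ.< mixed u₃ u₃ 0 ms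
        product-pos [] [] = ℕ.s≤s ℕ.z≤n
        product-pos (n ∷ ms) (q ∷ qs) = 0<-* (u₃-pos n q) (product-pos ms qs)

  -- Polynomial relations between lacunary series

  module Lipschitz (ξ₁ ξ₂ ξ₃ : ℝ) where

    -- Lipschitz at the fixed point (ξ₁, ξ₂, ξ₃) and within distance 1. The property passes to
    -- products because values at that distance are bounded.
    data Lip (f : ℝ → ℝ → ℝ → ℝ) : Set where
      lip : ∀ Λ → 0# ≤ Λ → (∀ ε x y z → 0# ≤ ε → ε ≤ 1# → ∣ ξ₁ - x ∣ ≤ ε → ∣ ξ₂ - y ∣ ≤ ε → ∣ ξ₃ - z ∣ ≤ ε → ∣ f ξ₁ ξ₂ ξ₃ - f x y z ∣ ≤ Λ * ε) → Lip f

    lip-const : ∀ c → Lip (λ _ _ _ → c)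
    lip-const c = lip 0# ≤-refl λ ε x y z _ _ _ _ _ → ≈⇒≤ (≈-trans (≈-trans (∣∣-cong (-‿inverseʳ c)) (∣∣-of-nonneg ≤-refl)) (≈-sym (zeroˡ ε)))

    lip-+ : ∀ {f g} → Lip f → Lip g → Lip (λ x y z → f x y z + g x y z)
    lip-+ {f} {g} (lip Λ p h) (lip M q k) = lip (Λ + M) (+-nonneg p q) λ ε x y z 0≤ε ε≤1 a b c → begin
      ∣ (f ξ₁ ξ₂ ξ₃ + g ξ₁ ξ₂ ξ₃) - (f x y z + g x y z) ∣ ≈⟨ ∣∣-cong (solve 4 (λ a b c d → (a :+ b) :- (c :+ d) := (a :- c) :+ (b :- d)) ≈-refl _ _ _ _) ⟩
      ∣ (f ξ₁ ξ₂ ξ₃ - f x y z) + (g ξ₁ ξ₂ ξ₃ - g x y z) ∣ ≤⟨ ∣∣-+ _ _ ⟩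
      ∣ f ξ₁ ξ₂ ξ₃ - f x y z ∣ + ∣ g ξ₁ ξ₂ ξ₃ - g x y z ∣ ≤⟨ +-mono-≤ (h ε x y z 0≤ε ε≤1 a b c) (k ε x y z 0≤ε ε≤1 a b c) ⟩
      Λ * ε + M * ε ≈⟨ ≈-sym (distribʳ _ _ _) ⟩
      (Λ + M) * ε ∎

    lip-* : ∀ {f g} → Lip f → Lip g → Lip (λ x y z → f x y z * g x y z)
    lip-* {f} {g} (lip Λ p h) (lip M q k) = lip (Λ * (∣ g₀ ∣ + M) + ∣ f₀ ∣ * M) (+-nonneg (*-nonNeg p (+-nonneg (∣∣-nonneg g₀) q)) (*-nonNeg (∣∣-nonneg f₀) q)) λ ε x y z 0≤ε ε≤1 a b c →
      let f≤ = h ε x y z 0≤ε ε≤1 a b c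
          g≤ = k ε x y z 0≤ε ε≤1 a b c
          ∣g∣≤ : ∣ g x y z ∣ ≤ ∣ g₀ ∣ + M
          ∣g∣≤ = begin
            ∣ g x y z ∣ ≈⟨ ∣∣-cong (solve 2 (λ a b → b := a :- (a :- b)) ≈-refl g₀ (g x y z)) ⟩
            ∣ g₀ - (g₀ - g x y z) ∣ ≤⟨ ∣∣-+ _ _ ⟩
            ∣ g₀ ∣ + ∣ - (g₀ - g x y z) ∣ ≤⟨ +-monoʳ-≤ _ (≤-trans (≈⇒≤ (∣∣-neg _)) (≤-trans g≤ (≤-trans (*-monoˡ-≤ q ε≤1) (≈⇒≤ (*-identityʳ M))))) ⟩
            ∣ g₀ ∣ + M ∎
      in begin
      ∣ f₀ * g₀ - f x y z * g x y z ∣ ≈⟨ ∣∣-cong (solve 4 (λ a b c d → a :* b :- c :* d := (a :- c) :* d :+ a :* (b :- d)) ≈-refl f₀ g₀ (f x y z) (g x y z)) ⟩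
      ∣ (f₀ - f x y z) * g x y z + f₀ * (g₀ - g x y z) ∣ ≤⟨ ≤-trans (∣∣-+ _ _) (≈⇒≤ (+-cong (∣∣-* _ _) (∣∣-* _ _))) ⟩
      ∣ f₀ - f x y z ∣ * ∣ g x y z ∣ + ∣ f₀ ∣ * ∣ g₀ - g x y z ∣ ≤⟨ +-mono-≤ (*-mono-≤ (∣∣-nonneg _) (+-nonneg (∣∣-nonneg g₀) q) f≤ ∣g∣≤) (*-monoˡ-≤ (∣∣-nonneg f₀) g≤) ⟩
      Λ * ε * (∣ g₀ ∣ + M) + ∣ f₀ ∣ * (M * ε) ≈⟨ solve 5 (λ l e g m f → l :* e :* (g :+ m) :+ f :* (m :* e) := (l :* (g :+ m) :+ f :* m) :* e) ≈-refl Λ ε (∣ g₀ ∣) M (∣ f₀ ∣) ⟩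
      (Λ * (∣ g₀ ∣ + M) + ∣ f₀ ∣ * M) * ε ∎
      where
      f₀ = f ξ₁ ξ₂ ξ₃
      g₀ = g ξ₁ ξ₂ ξ₃

    lip-^ : ∀ {f} k → Lip f → Lip (λ x y z → f x y z ^ k)
    lip-^ zero h = lip-const 1#
    lip-^ (suc k) h = lip-* h (lip-^ k h)

    lip-∑ : ∀ n {f : ℕ → ℝ → ℝ → ℝ → ℝ} → (∀ i → Lip (f i)) → Lip (λ x y z → ∑ n (λ i → f i x y z))
    lip-∑ zero h = lip-const 0#
    lip-∑ (suc n) h = lip-+ (lip-∑ n h) (h n)

    lip-x : Lip (λ x y z → x)
    lip-x = lip 1# 0≤1 λ ε x y z _ _ a b c → ≤-trans a (≈⇒≤ (≈-sym (*-identityˡ ε)))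

    lip-y : Lip (λ x y z → y)
    lip-y = lip 1# 0≤1 λ ε x y z _ _ a b c → ≤-trans b (≈⇒≤ (≈-sym (*-identityˡ ε)))

    lip-z : Lip (λ x y z → z)
    lip-z = lip 1# 0≤1 λ ε x y z _ _ a b c → ≤-trans c (≈⇒≤ (≈-sym (*-identityˡ ε)))

    lip-graded : ∀ A D n → Lip (graded A D n)
    lip-graded A D n = lip-∑ (suc D) λ d → lip-∑ (suc n) λ k →
      lip-* (lip-∑ (suc d) λ i → lip-* (lip-const (fromℤ (A i (d ℕ.∸ i) k))) (lip-* (lip-^ i lip-x) (lip-^ (d ℕ.∸ i) lip-y))) (lip-^ k lip-z)

  -- M may be a quarter of the first omitted exponent; the rest of it absorbs u(n) and the summation
  -- of the tail.
  WellApproximated : ℝ → ℝ → (ℕ → ℕ) → (ℕ → ℕ) → Set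
  WellApproximated q ξ u W = ∃ λ H₀ → ∀ H → H₀ ℕ.≤ H → ∀ M → 4 ℕ.* M ℕ.≤ W H → ∣ ξ - truncation q u W H ∣ ≤ q ^ M

  record Admissible (β : ℝ) (W V u₁ u₂ u₃ : ℕ → ℕ) (ξ₁ ξ₂ ξ₃ : ℝ) : Set where
    field
      1<β : 1# < β
      powers : PowerExpansion β
      growth : Growth W V
      C : ℕ
      u-bound : ∀ n → fromℕ (u₁ n) ≤ fromℕ C * β ^ n × fromℕ (u₂ n) ≤ fromℕ C * β ^ n × fromℕ (u₃ n) ≤ fromℕ C * β ^ n
      dominates : ∀ M → ∃ λ n₀ → ∀ n → n₀ ℕ.≤ n → 0 ℕ.< u₂ n × M ℕ.* u₂ n ℕ.≤ u₁ n
      u₃-pos : ∀ n → 0 ℕ.< n → 0 ℕ.< u₃ n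
      approx₁ : WellApproximated (β ⁻¹) ξ₁ u₁ W
      approx₂ : WellApproximated (β ⁻¹) ξ₂ u₂ W
      approx₃ : WellApproximated (β ⁻¹) ξ₃ u₃ V

  module Relation {β W V u₁ u₂ u₃ ξ₁ ξ₂ ξ₃} (adm : Admissible β W V u₁ u₂ u₃ ξ₁ ξ₂ ξ₃) (A : ℕ → ℕ → ℕ → ℤ) (a D′ K′ n i₀ p : ℕ)
    (A≤ : ∀ i j k → ∣ fromℤ (A i j k) ∣ ≤ fromℕ a) (i₀≤D : i₀ ℕ.≤ suc D′) (K≤n : suc K′ ℕ.≤ n)
    (high-k : ∀ i k → i ℕ.≤ suc D′ → suc K′ ℕ.< k → A i (suc D′ ℕ.∸ i) k ≡ + 0)
    (high-i : ∀ i → i ℕ.≤ suc D′ → i₀ ℕ.< i → A i (suc D′ ℕ.∸ i) (suc K′) ≡ + 0)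
    (leading : A i₀ (suc D′ ℕ.∸ i₀) (suc K′) ≡ + suc p) where

    open Admissible adm
    open Expansion A u₁ u₂ u₃
    open Lipschitz ξ₁ ξ₂ ξ₃

    D = suc D′
    K = suc K′
    q = β ⁻¹
    0<β = <-trans 0<1 1<β
    βq : β * q ≈ 1#
    βq = ⁻¹-inverse 0<β
    0≤q = <⇒≤ (⁻¹-pos 0<β)
    q≤1 : q ≤ 1#
    q≤1 = ≤-trans (⁻¹-antitone 0<1 (<⇒≤ 1<β)) (≈⇒≤ (≈-sym (inverse-unique (*-identityˡ 1#))))

    VanishingBound : ℕ → ℕ → Set₁
    VanishingBound A₁ L₀ = ∀ L → L₀ ℕ.≤ L → ∀ {X : Set} (xs : List X) (c : X → ℤ) (f : X → ℕ) →
      ∑ˡ xs (λ x → ∣ fromℤ (c x) ∣) ≤ fromℕ (2 ℕ.^ L) → (∀ x → f x ℕ.≤ 2 ℕ.^ L) →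
      ∣ ∑ˡ xs (λ x → fromℤ (c x) * β ^ f x) ∣ * β ^ (A₁ ℕ.* L) ≤ fromℕ (2 ℕ.^ L) → ∑ˡ xs (λ x → fromℤ (c x) * β ^ f x) ≈ 0#

    -- With L = size · H, 2^L bounds the sum of the absolute values of all coefficients: 2^((D +
    -- n)H) counts the indices, 2^((D + 1)aH) bounds the contribution of the polynomial, and 2^((C +
    -- κ₁)(D + n)H) the products of values of u. The outer `suc` makes it positive.
    size : ℕ → ℕ
    size κ₁ = suc ((D ℕ.+ n) ℕ.+ (suc D ℕ.* a ℕ.+ (C ℕ.+ κ₁) ℕ.* (D ℕ.+ n)))

    module Constants (A₁ L₀ : ℕ) (vanishing : VanishingBound A₁ L₀) (κ₁ : ℕ) (β<κ₁ : β < fromℕ κ₁) (κ₂ : ℕ) (2<β^κ₂ : 2# < β ^ κ₂)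
      (Λ : ℝ) (0≤Λ : 0# ≤ Λ)
      (lipschitz : ∀ ε x y z → 0# ≤ ε → ε ≤ 1# → ∣ ξ₁ - x ∣ ≤ ε → ∣ ξ₂ - y ∣ ≤ ε → ∣ ξ₃ - z ∣ ≤ ε → ∣ graded A D n ξ₁ ξ₂ ξ₃ - graded A D n x y z ∣ ≤ Λ * ε)
      (λ₀ : ℕ) (Λ<β^λ₀ : Λ < β ^ λ₀)
      (H₁ : ℕ) (close₁ : ∀ H → H₁ ℕ.≤ H → ∀ M → 4 ℕ.* M ℕ.≤ W H → ∣ ξ₁ - truncation q u₁ W H ∣ ≤ q ^ M)
      (H₂ : ℕ) (close₂ : ∀ H → H₂ ℕ.≤ H → ∀ M → 4 ℕ.* M ℕ.≤ W H → ∣ ξ₂ - truncation q u₂ W H ∣ ≤ q ^ M)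
      (H₃ : ℕ) (close₃ : ∀ H → H₃ ℕ.≤ H → ∀ M → 4 ℕ.* M ℕ.≤ V H → ∣ ξ₃ - truncation q u₃ V H ∣ ≤ q ^ M)
      (n₀ : ℕ) (dominance : ∀ n → n₀ ℕ.≤ n → 0 ℕ.< u₂ n × suc a ℕ.* u₂ n ℕ.≤ u₁ n)
      -- A gap of length A₃H is A₁L + κ₂H: the first part is what `vanishing` asks for, the second
      -- turns the 2 in 1 + 2^L ≤ 2 · 2^L into a power of β.
      (A₂ A₃ : ℕ) (A₂≡ : A₂ ≡ size κ₁) (A₃≡ : A₃ ≡ A₁ ℕ.* A₂ ℕ.+ κ₂)
      (I : Isolable W V D K n n₀ A₃ (suc (L₀ ℕ.+ (λ₀ ℕ.+ (H₁ ℕ.+ (H₂ ℕ.+ H₃)))))) where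
      open Isolable I
      open IsolatedBlock block

      split : ∀ {x y z} → x ℕ.+ y ℕ.≤ z → x ℕ.≤ z × y ℕ.≤ z
      split {x} {y} p = ℕP.≤-trans (ℕP.m≤m+n x y) p , ℕP.≤-trans (ℕP.m≤n+m y x) p
      r₀ = split {1} H₀≤h
      r₁ = split {L₀} (proj₂ r₀)
      r₂ = split {λ₀} (proj₂ r₁)
      r₃ = split {H₁} (proj₂ r₂)
      r₄ = split {H₂} (proj₂ r₃)
      1≤H = ℕP.≤-trans (proj₁ r₀) h≤H
      L = A₂ ℕ.* H
      H≤L : H ℕ.≤ L
      H≤L = ℕP.m≤n*m H A₂ {{≡.subst ℕ.NonZero (≡.sym A₂≡) _}}
      L₀≤L = ℕP.≤-trans (proj₁ r₁) (ℕP.≤-trans h≤H H≤L)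
      gap = A₃ ℕ.* H
      J = indices H h D n
      two = fromℕ (2 ℕ.^ L)

      e : Index → ℕ
      e = total-exponent W V

      U = 2 ℕ.^ ((C ℕ.+ κ₁) ℕ.* H)

      u≤U : ∀ (u : ℕ → ℕ) → (∀ n → fromℕ (u n) ≤ fromℕ C * β ^ n) → ∀ n → n ℕ.< H → u n ℕ.≤ U
      u≤U u h n n<H = fromℕ-cancel-≤ {u n} {U} (begin
        fromℕ (u n) ≤⟨ h n ⟩
        fromℕ C * β ^ n ≤⟨ *-mono-≤ (fromℕ-nonneg C) (^-nonneg H (fromℕ-nonneg (2 ℕ.^ κ₁))) (fromℕ-mono (n≤2^n C))
          (≤-trans (^-monoʳ-≤ (<⇒≤ 1<β) (ℕP.<⇒≤ n<H)) (^-monoˡ-≤ H (<⇒≤ 0<β) (≤-trans (<⇒≤ β<κ₁) (fromℕ-mono (n≤2^n κ₁))))) ⟩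
        fromℕ (2 ℕ.^ C) * fromℕ (2 ℕ.^ κ₁) ^ H ≈⟨ ≈-sym (≈-trans (fromℕ-* (2 ℕ.^ C) ((2 ℕ.^ κ₁) ℕ.^ H)) (*-congˡ (fromℕ-^ (2 ℕ.^ κ₁) H))) ⟩
        fromℕ (2 ℕ.^ C ℕ.* (2 ℕ.^ κ₁) ℕ.^ H) ≤⟨ fromℕ-mono (ℕP.≤-trans (ℕP.*-mono-≤ (ℕP.^-monoʳ-≤ 2 (ℕP.m≤m*n C H {{ℕ.>-nonZero 1≤H}})) (ℕP.≤-reflexive (ℕP.^-*-assoc 2 κ₁ H)))
          (ℕP.≤-reflexive (≡.trans (≡.sym (ℕP.^-distribˡ-+-* 2 (C ℕ.* H) (κ₁ ℕ.* H))) (≡.cong (2 ℕ.^_) (≡.sym (ℕP.*-distribʳ-+ H C κ₁)))))) ⟩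
        fromℕ U ∎)

      ∑-coefficients : ∑ˡ J (λ τ → ∣ coefficient τ ∣) ≤ two
      ∑-coefficients = begin
        ∑ˡ J (λ τ → ∣ coefficient τ ∣)
          ≤⟨ ∑ˡ-mono-∈ J (coefficient-bound {a} {D} {n} {H} {h} {U} A≤ (1≤2^ ((C ℕ.+ κ₁) ℕ.* H)) h≤H (λ n n<H → u≤U u₁ (proj₁ ∘ u-bound) n n<H , u≤U u₂ (proj₁ ∘ proj₂ ∘ u-bound) n n<H , u≤U u₃ (proj₂ ∘ proj₂ ∘ u-bound) n n<H)) ⟩
        ∑ˡ J (λ _ → fromℕ X) ≈⟨ ≈-trans (∑ˡ-const J (fromℕ X)) (≈-sym (fromℕ-* (length J) X)) ⟩
        fromℕ (length J ℕ.* X) ≤⟨ fromℕ-mono (ℕP.≤-trans (ℕP.*-mono-≤ (indices-length H h D n h≤H) (ℕP.*-mono-≤ (ℕP.≤-trans (n≤2^n (suc D ℕ.* a)) (ℕP.^-monoʳ-≤ 2 (ℕP.m≤m*n (suc D ℕ.* a) H {{ℕ.>-nonZero 1≤H}})))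
                                                (ℕP.≤-reflexive (ℕP.^-*-assoc 2 ((C ℕ.+ κ₁) ℕ.* H) (D ℕ.+ n))))) (ℕP.≤-trans (ℕP.≤-reflexive collect) (ℕP.^-monoʳ-≤ 2 (ℕP.≤-trans (ℕP.≤-reflexive (exponents H (D ℕ.+ n) (suc D ℕ.* a) (C ℕ.+ κ₁))) (ℕP.≤-trans (ℕP.m≤n+m _ H) (ℕP.≤-reflexive (≡.cong (ℕ._* H) (≡.sym A₂≡)))))))) ⟩
        two ∎
        where
        X = suc D ℕ.* a ℕ.* U ℕ.^ (D ℕ.+ n)
        e₁ = H ℕ.* (D ℕ.+ n)
        e₂ = suc D ℕ.* a ℕ.* H
        e₃ = (C ℕ.+ κ₁) ℕ.* H ℕ.* (D ℕ.+ n)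
        collect : 2 ℕ.^ e₁ ℕ.* (2 ℕ.^ e₂ ℕ.* 2 ℕ.^ e₃) ≡ 2 ℕ.^ (e₁ ℕ.+ (e₂ ℕ.+ e₃))
        collect = ≡.trans (≡.cong (2 ℕ.^ e₁ ℕ.*_) (≡.sym (ℕP.^-distribˡ-+-* 2 e₂ e₃))) (≡.sym (ℕP.^-distribˡ-+-* 2 e₁ (e₂ ℕ.+ e₃)))
        exponents : ∀ h d s c → h ℕ.* d ℕ.+ (s ℕ.* h ℕ.+ c ℕ.* h ℕ.* d) ≡ (d ℕ.+ (s ℕ.+ c ℕ.* d)) ℕ.* h
        exponents = solve-∀

      P = graded A D n (truncation q u₁ W H) (truncation q u₂ W H) (truncation q u₃ V h)

      -- Truncation changes the value by at most Λ β^(-2N). Of the second N, the gap is kept, and λ₀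
      -- ≤ H pays for Λ.
      P-small : graded A D n ξ₁ ξ₂ ξ₃ ≈ 0# → ∣ P ∣ ≤ q ^ (N ℕ.+ gap)
      P-small root = begin
          ∣ P ∣ ≈⟨ ≈-sym (∣∣-neg P) ⟩
          ∣ - P ∣ ≈⟨ ∣∣-cong (≈-sym (≈-trans (+-congʳ root) (+-identityˡ _))) ⟩
          ∣ graded A D n ξ₁ ξ₂ ξ₃ - P ∣ ≤⟨ lipschitz (q ^ (N ℕ.+ N)) _ _ _ (^-nonneg (N ℕ.+ N) 0≤q) (^-≤1 (N ℕ.+ N) 0≤q q≤1)
                                                   (close₁ H (ℕP.≤-trans (proj₁ r₃) h≤H) (N ℕ.+ N) (8N 8N≤W)) (close₂ H (ℕP.≤-trans (proj₁ r₄) h≤H) (N ℕ.+ N) (8N 8N≤W)) (close₃ h (proj₂ r₄) (N ℕ.+ N) (8N 8N≤V)) ⟩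
          Λ * q ^ (N ℕ.+ N) ≤⟨ *-mono-≤ 0≤Λ (^-nonneg (N ℕ.+ (gap ℕ.+ λ₀)) 0≤q) (<⇒≤ Λ<β^λ₀) (^-antitone 0≤q q≤1 (ℕP.+-monoʳ-≤ N (ℕP.≤-trans (ℕP.+-monoʳ-≤ gap (ℕP.≤-trans (proj₁ r₂) h≤H)) ≤N))) ⟩
          β ^ λ₀ * q ^ (N ℕ.+ (gap ℕ.+ λ₀)) ≡⟨ ≡.cong (λ k → β ^ λ₀ * q ^ k) (≡.sym (ℕP.+-assoc N gap λ₀)) ⟩
          β ^ λ₀ * q ^ (N ℕ.+ gap ℕ.+ λ₀) ≈⟨ *-congˡ (^-homo-* q (N ℕ.+ gap) λ₀) ⟩
          β ^ λ₀ * (q ^ (N ℕ.+ gap) * q ^ λ₀) ≈⟨ solve 3 (λ b x y → b :* (x :* y) := x :* (b :* y)) ≈-refl (β ^ λ₀) (q ^ (N ℕ.+ gap)) (q ^ λ₀) ⟩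
          q ^ (N ℕ.+ gap) * (β ^ λ₀ * q ^ λ₀) ≈⟨ ≈-trans (*-congˡ (^-inverse λ₀ βq)) (*-identityʳ _) ⟩
          q ^ (N ℕ.+ gap) ∎
        where
        8N : ∀ {x} → 8 ℕ.* N ℕ.≤ x → 4 ℕ.* (N ℕ.+ N) ℕ.≤ x
        8N p = ℕP.≤-trans (ℕP.≤-reflexive (regroup N)) p
          where
          regroup : ∀ n → 4 ℕ.* (n ℕ.+ n) ≡ 8 ℕ.* n
          regroup = solve-∀

      c : Index → ℤ
      c τ = choose (+ 0) (λ k → coefficient τ ≈ fromℤ k)

      c-spec : ∀ τ → coefficient τ ≈ fromℤ (c τ)
      c-spec τ = go (coefficient-integer τ)
        where
        go : IsInteger (coefficient τ) → coefficient τ ≈ fromℤ (c τ)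
        go (integer k e) = choose-spec (+ 0) (λ k → coefficient τ ≈ fromℤ k) (k , e)

      -- Coefficients beyond M are set to 0, so that all partial sums run over the same list and can
      -- be subtracted term by term.
      cut : ℕ → Index → ℤ
      cut M τ with e τ ℕP.≤? M
      ... | yes _ = c τ
      ... | no _ = + 0

      cut-≤ : ∀ M τ → e τ ℕ.≤ M → fromℤ (cut M τ) ≈ coefficient τ
      cut-≤ M τ p with e τ ℕP.≤? M
      ... | yes _ = ≈-sym (c-spec τ)
      ... | no n = ⊥-elim (n p)

      cut-> : ∀ M τ → M ℕ.< e τ → fromℤ (cut M τ) ≈ 0#
      cut-> M τ p with e τ ℕP.≤? M
      ... | yes r = ⊥-elim (ℕP.<⇒≱ p r)
      ... | no _ = ≈-refl

      partial : ℕ → ℝ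
      partial M = ∑ˡ J (λ τ → fromℤ (cut M τ) * q ^ e τ)

      module _ (root : graded A D n ξ₁ ξ₂ ξ₃ ≈ 0#) where

        -- P is small, and it differs from the partial sum only by terms with exponents beyond M +
        -- gap, whose coefficients add up to at most 2^L.
        partial-small : ∀ M → M ℕ.≤ N → (∀ τ → τ ∈ J → M ℕ.< e τ → e τ ℕ.≤ M ℕ.+ gap → ⊥) → ∣ partial M ∣ ≤ (1# + two) * q ^ (M ℕ.+ gap)
        partial-small M M≤N no-exponent = begin
          ∣ partial M ∣
            ≈⟨ ∣∣-cong (solve 2 (λ t p → t := p :- (p :- t)) ≈-refl (partial M) P) ⟩
          ∣ P - (P - partial M) ∣
            ≤⟨ ≤-trans (∣∣-+ _ _) (+-mono-≤ (≤-trans (P-small root) (^-antitone 0≤q q≤1 (ℕP.+-monoˡ-≤ gap M≤N))) (≈⇒≤ (∣∣-neg _))) ⟩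
          q ^ (M ℕ.+ gap) + ∣ P - partial M ∣
            ≈⟨ +-congˡ (∣∣-cong (≈-trans (+-cong (expand-graded q W V D n H h) (≈-trans (-‿cong ≈-refl) (≈-trans (solve 1 (λ t → :- t := (:- :1) :* t) ≈-refl (partial M)) (≈-sym (∑ˡ-*ˡ J (- 1#) _))))) (≈-sym (∑ˡ-+ J _ _)))) ⟩
          q ^ (M ℕ.+ gap) + ∣ ∑ˡ J (λ τ → coefficient τ * q ^ e τ + - 1# * (fromℤ (cut M τ) * q ^ e τ)) ∣
            ≤⟨ +-monoʳ-≤ _ (≤-trans (∣∑ˡ∣ J _) (∑ˡ-mono-∈ J each)) ⟩
          q ^ (M ℕ.+ gap) + ∑ˡ J (λ τ → ∣ coefficient τ ∣ * q ^ (M ℕ.+ gap))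
            ≤⟨ +-monoʳ-≤ _ (≤-trans (≈⇒≤ (∑ˡ-*ʳ J _ _)) (*-monoʳ-≤ (^-nonneg (M ℕ.+ gap) 0≤q) ∑-coefficients)) ⟩
          q ^ (M ℕ.+ gap) + two * q ^ (M ℕ.+ gap)
            ≈⟨ solve 2 (λ x t → x :+ t :* x := (:1 :+ t) :* x) ≈-refl (q ^ (M ℕ.+ gap)) two ⟩
          (1# + two) * q ^ (M ℕ.+ gap) ∎
          where
          each : ∀ τ → τ ∈ J → ∣ coefficient τ * q ^ e τ + - 1# * (fromℤ (cut M τ) * q ^ e τ) ∣ ≤ ∣ coefficient τ ∣ * q ^ (M ℕ.+ gap)
          each τ τ∈ = go (e τ ℕP.≤? M)
            where
            go : Dec (e τ ℕ.≤ M) → ∣ coefficient τ * q ^ e τ + - 1# * (fromℤ (cut M τ) * q ^ e τ) ∣ ≤ ∣ coefficient τ ∣ * q ^ (M ℕ.+ gap)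
            go (yes r) = ≤-trans (≈⇒≤ (≈-trans (∣∣-cong (≈-trans (+-congˡ (*-congˡ (*-congʳ (cut-≤ M τ r)))) (solve 1 (λ x → x :+ (:- :1) :* x := :0) ≈-refl (coefficient τ * q ^ e τ)))) (∣∣-of-nonneg ≤-refl)))
              (*-nonNeg (∣∣-nonneg _) (^-nonneg (M ℕ.+ gap) 0≤q))
            go (no r) = ≤-trans (≈⇒≤ (≈-trans (∣∣-cong (≈-trans (+-congˡ (*-congˡ (*-congʳ (cut-> M τ (ℕP.≰⇒> r))))) (solve 2 (λ x y → x :+ (:- :1) :* (:0 :* y) := x) ≈-refl (coefficient τ * q ^ e τ) (q ^ e τ))))
                (≈-trans (∣∣-* _ _) (*-congˡ (∣∣-of-nonneg (^-nonneg (e τ) 0≤q))))))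
              (*-monoˡ-≤ (∣∣-nonneg _) (^-antitone 0≤q q≤1 (ℕP.<⇒≤ (ℕP.≰⇒> (no-exponent τ τ∈ (ℕP.≰⇒> r))))))

        partial-vanishes : ∀ M → M ℕ.≤ N → (∀ τ → τ ∈ J → M ℕ.< e τ → e τ ℕ.≤ M ℕ.+ gap → ⊥) → partial M ≈ 0#
        -- Multiplication by β^M gives an integer polynomial in β. The truncated subtraction is
        -- harmless: where e τ > M the coefficient is 0.
        partial-vanishes M M≤N no-exponent = *-cancel-0 (>⇒≉ (^-pos M 0<β)) (≈-trans (≈-sym scaled) (vanishing L L₀≤L J (cut M) (λ τ → M ℕ.∸ e τ)
            (≤-trans (∑ˡ-mono J cut≤) ∑-coefficients) (λ τ → ℕP.≤-trans (ℕP.m∸n≤m M (e τ)) (ℕP.≤-trans M≤N (ℕP.≤-trans N≤2^ (ℕP.^-monoʳ-≤ 2 H≤L)))) small-value))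
          where
          X = ∑ˡ J (λ τ → fromℤ (cut M τ) * β ^ (M ℕ.∸ e τ))
          cut≤ : ∀ τ → ∣ fromℤ (cut M τ) ∣ ≤ ∣ coefficient τ ∣
          cut≤ τ = go (e τ ℕP.≤? M)
            where
            go : Dec (e τ ℕ.≤ M) → ∣ fromℤ (cut M τ) ∣ ≤ ∣ coefficient τ ∣
            go (yes r) = ≈⇒≤ (∣∣-cong (cut-≤ M τ r))
            go (no r) = ≤-trans (≈⇒≤ (≈-trans (∣∣-cong (cut-> M τ (ℕP.≰⇒> r))) (∣∣-of-nonneg ≤-refl))) (∣∣-nonneg _)
          scaled : X ≈ β ^ M * partial M
          scaled = ≈-trans (∑ˡ-cong J (λ τ → go τ (e τ ℕP.≤? M))) (∑ˡ-*ˡ J (β ^ M) _)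
            where
            go : ∀ τ → Dec (e τ ℕ.≤ M) → fromℤ (cut M τ) * β ^ (M ℕ.∸ e τ) ≈ β ^ M * (fromℤ (cut M τ) * q ^ e τ)
            go τ (yes r) = ≈-sym (begin-equality
              β ^ M * (z * q ^ e τ) ≈⟨ *-congʳ (^-split β r) ⟩
              β ^ e τ * β ^ (M ℕ.∸ e τ) * (z * q ^ e τ) ≈⟨ solve 4 (λ a b z y → a :* b :* (z :* y) := z :* b :* (a :* y)) ≈-refl (β ^ e τ) (β ^ (M ℕ.∸ e τ)) z (q ^ e τ) ⟩
              z * β ^ (M ℕ.∸ e τ) * (β ^ e τ * q ^ e τ) ≈⟨ ≈-trans (*-congˡ (^-inverse (e τ) βq)) (*-identityʳ _) ⟩
              z * β ^ (M ℕ.∸ e τ) ∎)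
              where z = fromℤ (cut M τ)
            go τ (no r) = ≈-trans (*-congʳ z≈0) (≈-trans (zeroˡ _) (≈-sym (≈-trans (*-congˡ (≈-trans (*-congʳ z≈0) (zeroˡ _))) (zeroʳ _))))
              where z≈0 = cut-> M τ (ℕP.≰⇒> r)
          small-value : ∣ X ∣ * β ^ (A₁ ℕ.* L) ≤ two
          small-value = begin
            ∣ X ∣ * β ^ (A₁ ℕ.* L) ≈⟨ *-congʳ (≈-trans (∣∣-cong scaled) (≈-trans (∣∣-* _ _) (*-congʳ (∣∣-of-nonneg (^-nonneg M (<⇒≤ 0<β)))))) ⟩
            β ^ M * ∣ partial M ∣ * β ^ (A₁ ℕ.* L) ≤⟨ *-monoʳ-≤ (^-nonneg (A₁ ℕ.* L) (<⇒≤ 0<β)) (*-monoˡ-≤ (^-nonneg M (<⇒≤ 0<β)) (partial-small M M≤N no-exponent)) ⟩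
            β ^ M * ((1# + two) * q ^ (M ℕ.+ gap)) * β ^ (A₁ ℕ.* L) ≈⟨ *-congʳ (*-congˡ (*-congˡ (≈-trans (^-homo-* q M gap) (*-congˡ (≈-trans (≈-reflexive (≡.cong (q ^_) gap≡)) (^-homo-* q (A₁ ℕ.* L) (κ₂ ℕ.* H))))))) ⟩
            β ^ M * ((1# + two) * (q ^ M * (q ^ (A₁ ℕ.* L) * q ^ (κ₂ ℕ.* H)))) * β ^ (A₁ ℕ.* L)
              ≈⟨ solve 6 (λ b t x y z w → b :* (t :* (x :* (y :* z))) :* w := (b :* x) :* (w :* y) :* (t :* z)) ≈-refl (β ^ M) (1# + two) (q ^ M) (q ^ (A₁ ℕ.* L)) (q ^ (κ₂ ℕ.* H)) (β ^ (A₁ ℕ.* L)) ⟩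
            (β ^ M * q ^ M) * (β ^ (A₁ ℕ.* L) * q ^ (A₁ ℕ.* L)) * ((1# + two) * q ^ (κ₂ ℕ.* H))
              ≈⟨ ≈-trans (*-congʳ (≈-trans (*-cong (^-inverse M βq) (^-inverse (A₁ ℕ.* L) βq)) (*-identityˡ 1#))) (*-identityˡ _) ⟩
            (1# + two) * q ^ (κ₂ ℕ.* H)
              ≤⟨ *-monoʳ-≤ (^-nonneg (κ₂ ℕ.* H) 0≤q) (≤-trans (+-monoˡ-≤ two (≤-trans (≈⇒≤ (≈-sym fromℕ-1)) (fromℕ-mono (1≤2^ L)))) (≈⇒≤ (solve 1 (λ t → t :+ t := t :* (:1 :+ :1)) ≈-refl two))) ⟩
            two * 2# * q ^ (κ₂ ℕ.* H)
              ≤⟨ *-monoʳ-≤ (^-nonneg (κ₂ ℕ.* H) 0≤q) (*-monoˡ-≤ (fromℕ-nonneg (2 ℕ.^ L)) (≤-trans (<⇒≤ 2<β^κ₂) (^-monoʳ-≤ (<⇒≤ 1<β) (ℕP.m≤m*n κ₂ H {{ℕ.>-nonZero 1≤H}})))) ⟩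
            two * β ^ (κ₂ ℕ.* H) * q ^ (κ₂ ℕ.* H)
              ≈⟨ ≈-trans (*-assoc _ _ _) (≈-trans (*-congˡ (^-inverse (κ₂ ℕ.* H) βq)) (*-identityʳ two)) ⟩
            two ∎
            where
            gap≡ : gap ≡ A₁ ℕ.* L ℕ.+ κ₂ ℕ.* H
            gap≡ = ≡.trans (≡.cong (ℕ._* H) A₃≡) (≡.trans (ℕP.*-distribʳ-+ H (A₁ ℕ.* A₂) κ₂) (≡.cong (ℕ._+ κ₂ ℕ.* H) (ℕP.*-assoc A₁ A₂ H)))

        lower≤upper : lower ℕ.≤ upper
        lower≤upper = ℕP.<⇒≤ (ℕP.<-≤-trans lower< ≤upper)

        contradiction′ : ⊥
        contradiction′ = <-irrefl (<-respʳ difference≈0 positive)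
          where
          term-difference : Index → ℝ
          term-difference τ = fromℤ (cut upper τ) * q ^ e τ + - 1# * (fromℤ (cut lower τ) * q ^ e τ)
          difference≈0 : ∑ˡ J term-difference ≈ 0#
          difference≈0 = ≈-trans (∑ˡ-+ J _ _) (≈-trans (+-cong (partial-vanishes upper upper≤ upper-gap)
            (≈-trans (∑ˡ-*ˡ J (- 1#) _) (*-congˡ (partial-vanishes lower (ℕP.≤-trans lower≤upper upper≤) lower-gap)))) (solve 0 (:0 :+ (:- :1) :* :0 := :0) ≈-refl))
          inside : ∀ τ → lower ℕ.< e τ → e τ ℕ.≤ upper → term-difference τ ≈ coefficient τ * q ^ e τ
          inside τ r s = ≈-trans (+-cong (*-congʳ (cut-≤ upper τ s)) (*-congˡ (*-congʳ (cut-> lower τ r)))) (solve 2 (λ x y → x :+ (:- :1) :* (:0 :* y) := x) ≈-refl (coefficient τ * q ^ e τ) (q ^ e τ))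
          nonneg : ∀ τ → τ ∈ J → 0# ≤ term-difference τ
          nonneg τ τ∈ = go (e τ ℕP.≤? lower) (e τ ℕP.≤? upper)
            where
            go : Dec (e τ ℕ.≤ lower) → Dec (e τ ℕ.≤ upper) → 0# ≤ term-difference τ
            go (yes r) _ = ≈⇒≤ (≈-sym (≈-trans (+-cong (*-congʳ (cut-≤ upper τ (ℕP.≤-trans r lower≤upper))) (*-congˡ (*-congʳ (cut-≤ lower τ r)))) (solve 1 (λ x → x :+ (:- :1) :* x := :0) ≈-refl (coefficient τ * q ^ e τ))))
            go (no r) (yes s) = ≤-respʳ-≈ (≈-sym (inside τ (ℕP.≰⇒> r) s)) (*-nonNeg
              (coefficient-nonneg D K i₀ a n₀ p i₀≤D A≤ high-k high-i leading dominance (proj₁ τ) (proj₂ τ)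
                (proj₁ (top τ τ∈ (ℕP.≰⇒> r) s)) (proj₁ (proj₂ (top τ τ∈ (ℕP.≰⇒> r) s))) (proj₂ (proj₂ (top τ τ∈ (ℕP.≰⇒> r) s)))) (^-nonneg (e τ) 0≤q))
            go (no r) (no s) = ≈⇒≤ (≈-sym (≈-trans (+-cong (*-congʳ (cut-> upper τ (ℕP.≰⇒> s))) (*-congˡ (*-congʳ (cut-> lower τ (ℕP.≰⇒> r))))) (solve 1 (λ y → :0 :* y :+ (:- :1) :* (:0 :* y) := :0) ≈-refl (q ^ e τ))))
          positive : 0# < ∑ˡ J term-difference
          positive = ∑ˡ-pos J nonneg {ns , ms} (∈-cartesianProduct⁺ (∈-tuplesUpTo (ℕP.≤-reflexive ns-length) ns-<) (∈-tuplesUpTo (ℕP.≤-trans (ℕP.≤-reflexive ms-length) K≤n) ms-<))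
            (<-respʳ (≈-sym (inside (ns , ms) lower< ≤upper)) (*-pos (coefficient-pos D K i₀ a n₀ p i₀≤D A≤ high-k high-i leading dominance u₃-pos ns ms ns-length ns-≥ ms-length ms->) (^-pos (e (ns , ms)) (⁻¹-pos 0<β))))

    no-relation : ¬ graded A D n ξ₁ ξ₂ ξ₃ ≈ 0#
    no-relation root = go (lower-bound 1<β powers) (archimedean β) (^-unbounded 1<β 2#) (lip-graded A D n) approx₁ approx₂ approx₃ (dominates (suc a))
      where
      go : (∃₂ λ A₁ L₀ → VanishingBound A₁ L₀) → (∃ λ κ₁ → β < fromℕ κ₁) → (∃ λ κ₂ → 2# < β ^ κ₂) → Lip (graded A D n) →
        WellApproximated q ξ₁ u₁ W → WellApproximated q ξ₂ u₂ W → WellApproximated q ξ₃ u₃ V →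
        (∃ λ n₀ → ∀ n → n₀ ℕ.≤ n → 0 ℕ.< u₂ n × suc a ℕ.* u₂ n ℕ.≤ u₁ n) → ⊥
      go (A₁ , L₀ , v) (κ₁ , p₁) (κ₂ , p₂) (lip Λ 0≤Λ l) (H₁ , c₁) (H₂ , c₂) (H₃ , c₃) (n₀ , d) = last (^-unbounded 1<β Λ)
        where
        last : (∃ λ λ₀ → Λ < β ^ λ₀) → ⊥
        last (λ₀ , p₃) = Constants.contradiction′ A₁ L₀ v κ₁ p₁ κ₂ p₂ Λ 0≤Λ l λ₀ p₃ H₁ c₁ H₂ c₂ H₃ c₃ n₀ d (size κ₁) (A₁ ℕ.* size κ₁ ℕ.+ κ₂) ≡.refl ≡.refl
          (Choose.isolate growth D′ K′ n n₀ (A₁ ℕ.* size κ₁ ℕ.+ κ₂) (suc (L₀ ℕ.+ (λ₀ ℕ.+ (H₁ ℕ.+ (H₂ ℕ.+ H₃)))))) root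

  -- Polynomials in three variables

  sum-cong : ∀ {d} {f g : Fin d → ℝ} → (∀ i → f i ≈ g i) → sum f ≈ sum g
  sum-cong {zero} e = ≈-refl
  sum-cong {suc d} e = +-cong (e Fin.zero) (sum-cong (e ∘ Fin.suc))

  sumᶜ-fromℝ : ∀ {d} (f : Fin d → ℂ) (g : Fin d → ℝ) → (∀ i → f i ≈ᶜ fromℝ (g i)) → sumᶜ f ≈ᶜ fromℝ (sum g)
  sumᶜ-fromℝ {zero} f g e = ≈ᶜ-refl
  sumᶜ-fromℝ {suc d} f g e = ≈ᶜ-trans (+ᶜ-cong (e Fin.zero) (sumᶜ-fromℝ (f ∘ Fin.suc) (g ∘ Fin.suc) (e ∘ Fin.suc))) (≈ᶜ-sym (fromℝ-+ (g Fin.zero) (sum (g ∘ Fin.suc))))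

  ∑-pad : ∀ {m n f} → m ℕ.≤ n → (∀ i → m ℕ.≤ i → f i ≈ 0#) → ∑ n f ≈ ∑ m f
  ∑-pad {m} {n} {f} p z = ≈-trans (≈-reflexive (≡.cong (λ k → ∑ k f) (≡.sym (ℕP.m+[n∸m]≡n p)))) (≈-trans (∑-split m (n ℕ.∸ m) f)
    (≈-trans (+-congˡ (∑-zero (n ℕ.∸ m) (λ i _ → z (m ℕ.+ i) (ℕP.m≤m+n m i)))) (+-identityʳ _)))

  greatest : (Q : ℕ → Set) (b : ℕ) → (∀ m → Q m → m ℕ.≤ b) → ∃ Q → ∃ λ m → Q m × (∀ k → m ℕ.< k → ¬ Q k)
  greatest Q zero bound (m , q) = m , q , λ k m<k q′ → ℕP.<⇒≱ m<k (ℕP.≤-trans (bound k q′) ℕ.z≤n)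
  greatest Q (suc b) bound h with lem {Q (suc b)}
  ... | yes q = suc b , q , λ k p q′ → ℕP.<⇒≱ p (bound k q′)
  ... | no n = greatest Q b (λ m q → case m q (ℕP.m≤n⇒m<n∨m≡n (bound m q))) h
    where
    case : ∀ m → Q m → m ℕ.< suc b ⊎ m ≡ suc b → m ℕ.≤ b
    case m q (inj₁ p) = ℕP.≤-pred p
    case m q (inj₂ ≡.refl) = ⊥-elim (n q)

  ∣fromℤ∣ : ∀ k → ∣ fromℤ k ∣ ≈ fromℕ ℤ.∣ k ∣
  ∣fromℤ∣ (+ n) = ∣∣-of-nonneg (fromℕ-nonneg n)
  ∣fromℤ∣ -[1+ n ] = ≈-trans (∣∣-neg _) (∣∣-of-nonneg (fromℕ-nonneg (suc n)))

  nonzero-integer : ∀ k → k ≢ + 0 → (∃ λ p → k ≡ + suc p) ⊎ (∃ λ p → ℤ.- k ≡ + suc p)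
  nonzero-integer (+ zero) n = ⊥-elim (n ≡.refl)
  nonzero-integer (+ suc p) _ = inj₁ (p , ≡.refl)
  nonzero-integer -[1+ p ] _ = inj₂ (p , ≡.refl)

  module Coefficients {d : ℕ} (P : Polynomial₃ d) where

    at₁ : ∀ {A : Set} → A → (Fin d → A) → ℕ → A
    at₁ z f i with i ℕP.<? d
    ... | yes p = f (fromℕ< p)
    ... | no _ = z

    at₁-toℕ : ∀ {A : Set} (z : A) f i → at₁ z f (toℕ i) ≡ f i
    at₁-toℕ z f i with toℕ i ℕP.<? d
    ... | yes p = ≡.cong f (FinP.fromℕ<-toℕ i p)
    ... | no n = ⊥-elim (n (FinP.toℕ<n i))

    at₁-≥ : ∀ {A : Set} (z : A) f {i} → d ℕ.≤ i → at₁ z f i ≡ z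
    at₁-≥ z f {i} p with i ℕP.<? d
    ... | yes q = ⊥-elim (ℕP.<⇒≱ q p)
    ... | no _ = ≡.refl

    B : ℕ → ℕ → ℕ → ℤ
    B i j k = at₁ (+ 0) (λ k → at₁ (+ 0) (λ j → at₁ (+ 0) (λ i → P i j k) i) j) k

    B-toℕ : ∀ i j k → B (toℕ i) (toℕ j) (toℕ k) ≡ P i j k
    B-toℕ i j k = ≡.trans (at₁-toℕ (+ 0) _ k) (≡.trans (at₁-toℕ (+ 0) _ j) (at₁-toℕ (+ 0) _ i))

    at₁-zero : ∀ (f : Fin d → ℤ) i → (∀ j → f j ≡ + 0) → at₁ (+ 0) f i ≡ + 0
    at₁-zero f i h with i ℕP.<? d
    ... | yes p = h (fromℕ< p)
    ... | no _ = ≡.refl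

    B-k : ∀ i j k → d ℕ.≤ k → B i j k ≡ + 0
    B-k i j k p = at₁-≥ (+ 0) _ p

    B-j : ∀ i j k → d ℕ.≤ j → B i j k ≡ + 0
    B-j i j k p = at₁-zero _ k (λ k → at₁-≥ (+ 0) _ p)

    B-i : ∀ i j k → d ℕ.≤ i → B i j k ≡ + 0
    B-i i j k p = at₁-zero _ k (λ k → at₁-zero _ j (λ j → at₁-≥ (+ 0) _ p))

    -- The polynomial X₁ X₃ P, whose leading degrees are positive.
    A : ℕ → ℕ → ℕ → ℤ
    A (suc i) j (suc k) = B i j k
    A zero j k = + 0
    A (suc i) j zero = + 0

    A-vanishes : ∀ i j k → d ℕ.< i ⊎ d ℕ.≤ j ⊎ d ℕ.< k → A i j k ≡ + 0
    A-vanishes zero j k _ = ≡.refl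
    A-vanishes (suc i) j zero _ = ≡.refl
    A-vanishes (suc i) j (suc k) (inj₁ p) = B-i i j k (ℕP.≤-pred p)
    A-vanishes (suc i) j (suc k) (inj₂ (inj₁ p)) = B-j i j k p
    A-vanishes (suc i) j (suc k) (inj₂ (inj₂ p)) = B-k i j k (ℕP.≤-pred p)

    module Evaluate (x y z : ℝ) where

      monomial : Fin d → Fin d → Fin d → ℝ
      monomial i j k = fromℤ (P i j k) * (x ^ toℕ i * (y ^ toℕ j * z ^ toℕ k))

      value : ℝ
      value = sum λ i → sum λ j → sum λ k → monomial i j k

      valueᶜ : evalPolynomial₃ P (fromℝ x) (fromℝ y) (fromℝ z) ≈ᶜ fromℝ value
      valueᶜ = sumᶜ-fromℝ _ (λ i → sum λ j → sum λ k → monomial i j k) λ i → sumᶜ-fromℝ _ (λ j → sum λ k → monomial i j k) λ j → sumᶜ-fromℝ _ (monomial i j) λ k →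
        ≈ᶜ-sym (≈ᶜ-trans (fromℝ-* _ _) (*ᶜ-congˡ (≈ᶜ-trans (fromℝ-* _ _) (*ᶜ-cong (fromℝ-^ x (toℕ i)) (≈ᶜ-trans (fromℝ-* _ _) (*ᶜ-cong (fromℝ-^ y (toℕ j)) (fromℝ-^ z (toℕ k))))))))

      value-∑ : value ≈ ∑ d λ i → ∑ d λ j → ∑ d λ k → fromℤ (B i j k) * (x ^ i * (y ^ j * z ^ k))
      value-∑ = ≈-trans (sum-cong {d} (λ i → ≈-trans (sum-cong {d} (λ j → ≈-trans (sum-cong {d} (λ k →
          *-congʳ (≈-reflexive (≡.cong fromℤ (≡.sym (B-toℕ i j k)))))) (sum≈∑ d _))) (sum≈∑ d _))) (sum≈∑ d _)

      G : ℕ → ℕ → ℝ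
      G i j = ∑ (suc d) λ k → fromℤ (A i j k) * (x ^ i * y ^ j) * z ^ k

      zero-term : ∀ i j k → A i j k ≡ + 0 → fromℤ (A i j k) * (x ^ i * y ^ j) * z ^ k ≈ 0#
      zero-term i j k e = ≈-trans (*-congʳ (≈-trans (*-congʳ (≈-reflexive (≡.cong fromℤ e))) (zeroˡ _))) (zeroˡ _)

      G-zero : ∀ i j → (∀ k → A i j k ≡ + 0) → G i j ≈ 0#
      G-zero i j h = ∑-zero (suc d) (λ k _ → zero-term i j k (h k))

      square : ∑ (suc d) (λ i → ∑ (suc d) (G i)) ≈ x * z * value
      square = begin-equality
        ∑ (suc d) (λ i → ∑ (suc d) (G i)) ≈⟨ ≈-trans (∑-head d _) (≈-trans (+-congʳ (∑-zero (suc d) (λ j _ → G-zero 0 j (λ k → ≡.refl)))) (+-identityˡ _)) ⟩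
        ∑ d (λ i → ∑ d (G (suc i)) + G (suc i) d) ≈⟨ ∑-cong d (λ i _ → ≈-trans (+-congˡ (G-zero (suc i) d (λ k → A-vanishes (suc i) d k (inj₂ (inj₁ ℕP.≤-refl))))) (+-identityʳ _)) ⟩
        ∑ d (λ i → ∑ d (G (suc i))) ≈⟨ ∑-cong d (λ i _ → ≈-trans (∑-cong d (λ j _ → shifted i j)) (∑-*ˡ d (x * z) _)) ⟩
        ∑ d (λ i → x * z * ∑ d (λ j → ∑ d λ k → fromℤ (B i j k) * (x ^ i * (y ^ j * z ^ k)))) ≈⟨ ∑-*ˡ d (x * z) _ ⟩
        x * z * _ ≈⟨ *-congˡ (≈-sym value-∑) ⟩
        x * z * value ∎
        where
        shifted : ∀ i j → G (suc i) j ≈ x * z * ∑ d (λ k → fromℤ (B i j k) * (x ^ i * (y ^ j * z ^ k)))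
        shifted i j = ≈-trans (∑-head d _) (≈-trans (+-congʳ (zero-term (suc i) j 0 ≡.refl)) (≈-trans (+-identityˡ _)
          (≈-trans (∑-cong d (λ k _ → solve 6 (λ b p q r x z → b :* (x :* p :* q) :* (z :* r) := x :* z :* (b :* (p :* (q :* r)))) ≈-refl (fromℤ (B i j k)) (x ^ i) (y ^ j) (z ^ k) x z)) (∑-*ˡ d (x * z) _))))

      -- The square i, j ≤ d is padded with zeros to the triangle i + j < 2(d + 1), which
      -- `∑-triangle` regroups by total degree; degrees above D contribute nothing.
      graded-value : ∀ D → D ℕ.< suc d ℕ.+ suc d → (∀ e i k → D ℕ.< e → i ℕ.≤ e → A i (e ℕ.∸ i) k ≡ + 0) → graded A D d x y z ≈ x * z * value
      graded-value D D<2N high = ≈-sym (≈-trans (≈-sym square) (begin-equality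
        ∑ N (λ i → ∑ N (G i)) ≈⟨ ∑-cong N (λ i i<N → ≈-sym (∑-pad (ℕP.≤-trans (ℕP.m≤m+n N (N ℕ.∸ i)) (ℕP.≤-reflexive (≡.sym (ℕP.+-∸-assoc N (ℕP.<⇒≤ i<N)))))
                                                                 (λ j N≤j → G-zero i j (λ k → A-vanishes i j k (inj₂ (inj₁ (ℕP.<⇒≤ N≤j))))))) ⟩
        ∑ N (λ i → ∑ (N ℕ.+ N ℕ.∸ i) (G i)) ≈⟨ ≈-sym (∑-pad (ℕP.m≤m+n N N) (λ i N≤i → ∑-zero (N ℕ.+ N ℕ.∸ i) (λ j _ → G-zero i j (λ k → A-vanishes i j k (inj₁ N≤i))))) ⟩
        ∑ (N ℕ.+ N) (λ i → ∑ (N ℕ.+ N ℕ.∸ i) (G i)) ≈⟨ ∑-triangle (N ℕ.+ N) G ⟩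
        ∑ (N ℕ.+ N) (λ e → ∑ (suc e) (λ i → G i (e ℕ.∸ i))) ≈⟨ ∑-pad D<2N (λ e D<e → ∑-zero (suc e) (λ i i≤e → G-zero i (e ℕ.∸ i) (λ k → high e i k D<e (ℕP.≤-pred i≤e)))) ⟩
        ∑ (suc D) (λ e → ∑ (suc e) (λ i → G i (e ℕ.∸ i))) ≈⟨ ∑-cong (suc D) (λ e _ → ≈-trans (∑-swap (suc e) (suc d) _) (∑-cong (suc d) (λ k _ → ∑-*ʳ (suc e) (z ^ k) _))) ⟩
        graded A D d x y z ∎))
        where N = suc d

    largest : ℕ → ℕ
    largest i = proj₁ (upper-bound (λ j → proj₁ (upper-bound (λ k → ℤ.∣ A i j k ∣) (suc d))) (suc d))

    a = proj₁ (upper-bound largest (suc d))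

    A≤a : ∀ i j k → ∣ fromℤ (A i j k) ∣ ≤ fromℕ a
    A≤a i j k = ≤-trans (≈⇒≤ (∣fromℤ∣ (A i j k))) (fromℕ-mono (go (i ℕP.<? suc d) (j ℕP.<? suc d) (k ℕP.<? suc d)))
      where
      when-zero : A i j k ≡ + 0 → ℤ.∣ A i j k ∣ ℕ.≤ a
      when-zero e = ℕP.≤-trans (ℕP.≤-reflexive (≡.cong ℤ.∣_∣ e)) ℕ.z≤n
      go : Dec (i ℕ.< suc d) → Dec (j ℕ.< suc d) → Dec (k ℕ.< suc d) → ℤ.∣ A i j k ∣ ℕ.≤ a
      go (yes p) (yes q) (yes r) = ℕP.<⇒≤ (ℕP.<-trans (proj₂ (upper-bound (λ k → ℤ.∣ A i j k ∣) (suc d)) k r)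
        (ℕP.<-trans (proj₂ (upper-bound (λ j → proj₁ (upper-bound (λ k → ℤ.∣ A i j k ∣) (suc d))) (suc d)) j q) (proj₂ (upper-bound largest (suc d)) i p)))
      go (no n) _ _ = when-zero (A-vanishes i j k (inj₁ (ℕP.≮⇒≥ n)))
      go (yes _) (no n) _ = when-zero (A-vanishes i j k (inj₂ (inj₁ (ℕP.<⇒≤ (ℕP.≮⇒≥ n)))))
      go (yes _) (yes _) (no n) = when-zero (A-vanishes i j k (inj₂ (inj₂ (ℕP.≮⇒≥ n))))

  graded-neg : ∀ A D n x y z → graded (λ i j k → ℤ.- A i j k) D n x y z ≈ - graded A D n x y z
  graded-neg A D n x y z = ≈-trans (∑-cong (suc D) (λ d _ → ≈-trans (∑-cong (suc n) (λ k _ → ≈-trans (*-congʳ (≈-trans (∑-cong (suc d) (λ i _ →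
      ≈-trans (*-congʳ (fromℤ-neg (A i (d ℕ.∸ i) k))) (solve 2 (λ a p → (:- a) :* p := (:- :1) :* (a :* p)) ≈-refl _ _))) (∑-*ˡ (suc d) (- 1#) _))) (*-assoc _ _ _))) (∑-*ˡ (suc n) (- 1#) _)))
    (≈-trans (∑-*ˡ (suc D) (- 1#) _) (solve 1 (λ g → (:- :1) :* g := :- g) ≈-refl _))

  independent : ∀ {β W V u₁ u₂ u₃ ξ₁ ξ₂ ξ₃} → Admissible β W V u₁ u₂ u₃ ξ₁ ξ₂ ξ₃ → AlgebraicallyIndependent (fromℝ ξ₁) (fromℝ ξ₂) (fromℝ ξ₃)
  independent {ξ₁ = ξ₁} {ξ₂} {ξ₃} adm {d} P (i , j , k , P≢0) root = by-degree (greatest InDegree (suc d ℕ.+ d) degree-bound (suc (toℕ i ℕ.+ toℕ j) , suc (toℕ i) , suc (toℕ k) , ℕ.s≤s (ℕP.m≤m+n (toℕ i) (toℕ j)) , nonzero))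
    where
    open Coefficients P
    open Evaluate ξ₁ ξ₂ ξ₃
    value≈0 : value ≈ 0#
    value≈0 = proj₁ (≈ᶜ-trans (≈ᶜ-sym valueᶜ) root)
    InDegree : ℕ → Set
    InDegree e = ∃₂ λ i k → i ℕ.≤ e × A i (e ℕ.∸ i) k ≢ + 0
    nonzero : A (suc (toℕ i)) (suc (toℕ i ℕ.+ toℕ j) ℕ.∸ suc (toℕ i)) (suc (toℕ k)) ≢ + 0
    nonzero e = P≢0 (≡.trans (≡.sym (B-toℕ i j k)) (≡.trans (≡.cong (λ j → B (toℕ i) j (toℕ k)) (≡.sym (ℕP.m+n∸m≡n (toℕ i) (toℕ j)))) e))
    degree-bound : ∀ e → InDegree e → e ℕ.≤ suc d ℕ.+ d
    degree-bound e (i , k , i≤e , n) = ℕP.≮⇒≥ λ 2d+1<e → n (go 2d+1<e (i ℕP.≤? d))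
      where
      go : suc d ℕ.+ d ℕ.< e → Dec (i ℕ.≤ d) → A i (e ℕ.∸ i) k ≡ + 0
      go p (no i>d) = A-vanishes i _ k (inj₁ (ℕP.≰⇒> i>d))
      go p (yes i≤d) = A-vanishes i _ k (inj₂ (inj₁ (ℕP.m+n≤o⇒n≤o (suc (suc d) ℕ.∸ i) (ℕP.≤-trans (ℕP.≤-reflexive (≡.sym (ℕP.+-∸-comm d (ℕP.≤-trans i≤d (ℕP.≤-trans (ℕP.n≤1+n d) (ℕP.n≤1+n _)))))) (ℕP.∸-monoˡ-≤ i p)))))
    module Top (D : ℕ) (in-D : InDegree D) (above-D : ∀ e → D ℕ.< e → ¬ InDegree e) where
      InK : ℕ → Set
      InK k = ∃ λ i → i ℕ.≤ D × A i (D ℕ.∸ i) k ≢ + 0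
      module TopK (K : ℕ) (in-K : InK K) (above-K : ∀ k → K ℕ.< k → ¬ InK k) where
        InI : ℕ → Set
        InI i = i ℕ.≤ D × A i (D ℕ.∸ i) K ≢ + 0
        high : ∀ e i k → D ℕ.< e → i ℕ.≤ e → A i (e ℕ.∸ i) k ≡ + 0
        high e i k D<e i≤e = by-contradiction λ n → above-D e D<e (i , k , i≤e , n)
        graded≈0 : graded A D d ξ₁ ξ₂ ξ₃ ≈ 0#
        graded≈0 = ≈-trans (graded-value D (ℕ.s≤s (ℕP.≤-trans (degree-bound D in-D) (ℕP.≤-reflexive (≡.sym (ℕP.+-suc d d))))) high) (≈-trans (*-congˡ value≈0) (zeroʳ _))
        high-k : ∀ i k → i ℕ.≤ D → K ℕ.< k → A i (D ℕ.∸ i) k ≡ + 0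
        high-k i k i≤D K<k = by-contradiction λ n → above-K k K<k (i , i≤D , n)
        module TopI (i₀ : ℕ) (in-I : InI i₀) (above-I : ∀ i → i₀ ℕ.< i → ¬ InI i) where
          high-i : ∀ i → i ℕ.≤ D → i₀ ℕ.< i → A i (D ℕ.∸ i) K ≡ + 0
          high-i i i≤D i₀<i = by-contradiction λ n → above-I i i₀<i (i≤D , n)
          K≤d : K ℕ.≤ d
          K≤d = ℕP.≮⇒≥ λ d<K → proj₂ in-I (A-vanishes i₀ _ K (inj₂ (inj₂ d<K)))
    by-degree : (∃ λ D → InDegree D × (∀ e → D ℕ.< e → ¬ InDegree e)) → ⊥
    by-degree (D , in-D , above-D) = by-K (greatest InK d K-bound (let i , k , p , n = in-D in k , i , p , n))
      where
      open Top D in-D above-D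
      K-bound : ∀ k → InK k → k ℕ.≤ d
      K-bound k (i , _ , n) = ℕP.≮⇒≥ λ d<k → n (A-vanishes i _ k (inj₂ (inj₂ d<k)))
      by-K : (∃ λ K → InK K × (∀ k → K ℕ.< k → ¬ InK k)) → ⊥
      by-K (K , in-K , above-K) = by-I (greatest InI D (λ _ → proj₁) in-K)
        where
        open TopK K in-K above-K
        by-I : (∃ λ i₀ → InI i₀ × (∀ i → i₀ ℕ.< i → ¬ InI i)) → ⊥
        by-I (i₀ , in-I , above-I) = cases D K i₀ ≡.refl ≡.refl ≡.refl (nonzero-integer (A i₀ (D ℕ.∸ i₀) K) (proj₂ in-I))
          where
          open TopI i₀ in-I above-I
          cases : ∀ D′ K′ i′ → D ≡ D′ → K ≡ K′ → i₀ ≡ i′ → (∃ λ p → A i₀ (D ℕ.∸ i₀) K ≡ + suc p) ⊎ (∃ λ p → ℤ.- A i₀ (D ℕ.∸ i₀) K ≡ + suc p) → ⊥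
          -- The factor X₁X₃ excludes i₀ = 0 and K = 0, and i₀ ≤ D then excludes D = 0.
          cases _ _ zero _ _ ≡.refl _ = proj₂ in-I ≡.refl
          cases zero _ (suc i) ≡.refl _ ≡.refl _ = ℕP.<⇒≱ (ℕ.s≤s ℕ.z≤n) (proj₁ in-I)
          cases (suc D′) zero (suc i) _ ≡.refl ≡.refl _ = proj₂ in-I ≡.refl
          cases (suc D′) (suc K′) (suc i) ≡.refl ≡.refl ≡.refl (inj₁ (p , e)) = Relation.no-relation adm A a D′ K′ d i₀ p A≤a (proj₁ in-I) K≤d high-k high-i e graded≈0
          -- A negative leading coefficient is made positive by passing to -A.
          cases (suc D′) (suc K′) (suc i) ≡.refl ≡.refl ≡.refl (inj₂ (p , e)) = Relation.no-relation adm (λ i j k → ℤ.- A i j k) a D′ K′ d i₀ p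
            (λ i j k → ≤-trans (≈⇒≤ (≈-trans (∣∣-cong (fromℤ-neg (A i j k))) (∣∣-neg _))) (A≤a i j k)) (proj₁ in-I) K≤d
            (λ i k q r → ≡.cong ℤ.-_ (high-k i k q r)) (λ i q r → ≡.cong ℤ.-_ (high-i i q r)) e (≈-trans (graded-neg A D d ξ₁ ξ₂ ξ₃) (≈-trans (-‿cong graded≈0) neg-0))

  -- Growth of the exponents

  -- exp m = exp(m/2)² ≥ (m/2)², which exceeds (|a| + |b|)m once m/2 ≥ 2(|a| + |b|).
  affine≤exp : ∀ a b → ∃ λ M → 0# < M × (∀ m → M ≤ m → a + b * m ≤ exp m)
  affine≤exp a b = M , +-pos 0<1 0≤4c , bound
    where
    c = ∣ a ∣ + ∣ b ∣
    0≤4c : 0# ≤ 2# * (2# * c)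
    0≤4c = *-nonNeg (<⇒≤ 0<2) (*-nonNeg (<⇒≤ 0<2) (+-nonneg (∣∣-nonneg a) (∣∣-nonneg b)))
    M = 1# + 2# * (2# * c)
    bound : ∀ m → M ≤ m → a + b * m ≤ exp m
    bound m M≤m = begin
      a + b * m ≤⟨ +-mono-≤ (x≤∣x∣ a) (*-monoʳ-≤ 0≤m (x≤∣x∣ b)) ⟩
      ∣ a ∣ + ∣ b ∣ * m ≤⟨ +-monoˡ-≤ _ (≤-trans (≈⇒≤ (≈-sym (*-identityʳ _))) (*-monoˡ-≤ (∣∣-nonneg a) 1≤m)) ⟩
      ∣ a ∣ * m + ∣ b ∣ * m ≈⟨ ≈-sym (distribʳ m ∣ a ∣ ∣ b ∣) ⟩
      c * m ≈⟨ *-congˡ (≈-sym (half+half m)) ⟩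
      c * (g + g) ≈⟨ solve 2 (λ c g → c :* (g :+ g) := (:1 :+ :1) :* c :* g) ≈-refl c g ⟩
      2# * c * g ≤⟨ *-monoʳ-≤ 0≤g 2c≤g ⟩
      g * g ≤⟨ *-mono-≤ 0≤g (<⇒≤ (exp-pos g)) g≤exp g≤exp ⟩
      exp g * exp g ≈⟨ ≈-sym (exp-+ g g) ⟩
      exp (g + g) ≈⟨ exp-cong (half+half m) ⟩
      exp m ∎
      where
      g = half m
      1≤m = ≤-trans (by≤ 0≤4c (solve 1 (λ c → (:1 :+ c) :- :1 := c) ≈-refl _)) M≤m
      0≤m = ≤-trans 0≤1 1≤m
      0≤g : 0# ≤ g
      0≤g = <⇒≤ (half-pos (<-≤-trans 0<1 1≤m))
      g≤exp : g ≤ exp g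
      g≤exp = ≤-trans (by≤ 0≤1 (solve 1 (λ g → (:1 :+ g) :- g := :1) ≈-refl g)) (exp-≥1+ g)
      2c≤g : 2# * c ≤ g
      2c≤g = *-cancelˡ-≤ 0<2 (begin
        2# * (2# * c) ≤⟨ by≤ 0≤1 (solve 1 (λ c → (:1 :+ c) :- c := :1) ≈-refl _) ⟩
        M ≤⟨ M≤m ⟩
        m ≈⟨ ≈-sym (half+half m) ⟩
        g + g ≈⟨ solve 1 (λ g → g :+ g := (:1 :+ :1) :* g) ≈-refl g ⟩
        2# * g ∎)

  log-large : ∀ M → Eventually λ n → 0 ℕ.< n × M ≤ log (fromℕ n)
  log-large M = proj₁ (archimedean (exp M)) , λ n N≤n →
    let exp≤n = ≤-trans (<⇒≤ (proj₂ (archimedean (exp M)))) (fromℕ-mono N≤n)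
    in fromℕ-cancel-< {0} (<-≤-trans (exp-pos M) exp≤n) , ≤-respˡ-≈ (log-exp M) (log-mono-≤ (exp-pos M) exp≤n)

  exp-log-fromℕ : ∀ {n} → 0 ℕ.< n → exp (log (fromℕ n)) ≈ fromℕ n
  exp-log-fromℕ p = exp-log (fromℕ-pos p)

  log-fromℕ-^ : ∀ n k → 0 ℕ.< n → log (fromℕ (n ℕ.^ k)) ≈ fromℕ k * log (fromℕ n)
  log-fromℕ-^ n k p = ≈-trans (log-cong (<-respʳ (≈-sym (fromℕ-^ n k)) (^-pos k (fromℕ-pos p))) (fromℕ-^ n k)) (log-^ k (fromℕ-pos p))

  IsFloor : ℝ → ℕ → Set
  IsFloor x k = fromℕ k ≤ x × x < fromℕ k + 1#

  ≤-floor : ∀ {x k m} → IsFloor x k → fromℕ m ≤ x → m ℕ.≤ k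
  ≤-floor (_ , x<k+1) m≤x = ℕP.≤-pred (fromℕ-cancel-< (<-respʳ (+-comm _ _) (≤-<-trans m≤x x<k+1)))

  floor-double : ∀ {x k} → IsFloor x k → 0 ℕ.< k → x ≤ fromℕ (2 ℕ.* k)
  floor-double {x} {k} (_ , x<k+1) 0<k = ≤-trans (<⇒≤ x<k+1) (≤-trans (≈⇒≤ (≈-trans (+-comm _ _) ≈-refl))
    (fromℕ-mono (ℕP.≤-trans (ℕP.+-monoˡ-≤ k 0<k) (ℕP.≤-reflexive (≡.cong (k ℕ.+_) (≡.sym (ℕP.+-identityʳ k)))))))

  -- The exponents have the form exp(ℓ ψ(ℓ)) with ℓ = log n.
  record Accelerating (ψ : ℝ → ℝ) : Set where
    field
      monotone : ∀ {x y} → 0# < x → x ≤ y → ψ x ≤ ψ y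
      unbounded : ∀ M → ∃ λ L → 0# < L × M ≤ ψ L

    exponent : ℝ → ℝ
    exponent x = x * ψ x

    exponent-≤ : ∀ {x y} → 0# < x → x ≤ y → y * ψ x ≤ exponent y
    exponent-≤ 0<x x≤y = *-monoˡ-≤ (<⇒≤ (<-≤-trans 0<x x≤y)) (monotone 0<x x≤y)

    exponent-cong : ∀ {x y} → 0# < x → x ≈ y → exponent x ≈ exponent y
    exponent-cong 0<x e = *-cong e (antisym (monotone 0<x (≈⇒≤ e)) (monotone (<-respʳ e 0<x) (≈⇒≤ (≈-sym e))))

    FloorOfExp : (ℕ → ℕ) → Set
    FloorOfExp W = Eventually λ n → IsFloor (exp (exponent (log (fromℕ n)))) (W n)

  record Large (ψ : ℝ → ℝ) (W : ℕ → ℕ) (E n : ℕ) : Set where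
    field
      positive : 0 ℕ.< n
      floor : IsFloor (exp (log (fromℕ n) * ψ (log (fromℕ n)))) (W n)
      log-positive : 0# < log (fromℕ n)
      ψ-large : fromℕ E ≤ ψ (log (fromℕ n))

  module Accelerated {ψ : ℝ → ℝ} (acc : Accelerating ψ) (W : ℕ → ℕ) (floors : Accelerating.FloorOfExp acc W) where

    open Accelerating acc
    open Large

    large : ∀ E → Eventually (Large ψ W E)
    large E = proj₁ floors ℕ.+ proj₁ logs , λ n p →
      let 0<n , L≤log = proj₂ logs n (ℕP.≤-trans (ℕP.m≤n+m _ _) p)
          _ , 0<L , E≤ψ = unbounded (fromℕ E)
      in record { positive = 0<n ; floor = proj₂ floors n (ℕP.≤-trans (ℕP.m≤m+n _ _) p)
                ; log-positive = <-≤-trans 0<L L≤log ; ψ-large = ≤-trans E≤ψ (monotone 0<L L≤log) }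
      where logs = log-large (proj₁ (unbounded (fromℕ E)))

    squares : Eventually λ n → 0 ℕ.< n × n ℕ.* n ℕ.≤ W n
    squares = proj₁ (large 2) , λ n p → let l = proj₂ (large 2) n p in positive l , ≤-floor (floor l) (begin
      fromℕ (n ℕ.* n) ≈⟨ fromℕ-* n n ⟩
      fromℕ n * fromℕ n ≈⟨ ≈-sym (*-cong (exp-log-fromℕ (positive l)) (exp-log-fromℕ (positive l))) ⟩
      exp (log (fromℕ n)) * exp (log (fromℕ n)) ≈⟨ ≈-sym (exp-+ _ _) ⟩
      exp (log (fromℕ n) + log (fromℕ n)) ≈⟨ exp-cong (solve 1 (λ x → x :+ x := x :* (:1 :+ (:1 :+ :0))) ≈-refl (log (fromℕ n))) ⟩
      exp (log (fromℕ n) * fromℕ 2) ≤⟨ exp-mono-≤ (*-monoˡ-≤ (<⇒≤ (log-positive l)) (ψ-large l)) ⟩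
      exp (exponent (log (fromℕ n))) ∎)

    -- For x = log n and y = log(n + 1), the exponent grows by at least (y - x)ψ(x) ≥ 2(y - x). So
    -- before rounding W grows by the factor (1 + 1/n)², as `gap-arithmetic` expects.
    gap : ∃ (Gap W)
    gap = proj₁ (large 2) ℕ.+ proj₁ squares , λ n p →
      let l = proj₂ (large 2) n (ℕP.≤-trans (ℕP.m≤m+n _ _) p)
          l′ = proj₂ (large 2) (suc n) (ℕP.m≤n⇒m≤1+n (ℕP.≤-trans (ℕP.m≤m+n _ _) p))
          0<n , n²≤W = proj₂ squares n (ℕP.≤-trans (ℕP.m≤n+m _ (proj₁ (large 2))) p)
      in gap-arithmetic n (W n) (W (suc n)) 0<n (ℕP.≤-trans (ℕP.≤-trans (ℕP.≤-reflexive (≡.sym (ℕP.*-identityˡ n))) (ℕP.*-monoˡ-≤ n 0<n)) n²≤W)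
           (fromℕ-cancel-≤ (step n l l′))
      where
      step : ∀ n → Large ψ W 2 n → Large ψ W 2 (suc n) → fromℕ (suc n ℕ.* suc n ℕ.* W n) ≤ fromℕ (n ℕ.* n ℕ.* suc (W (suc n)))
      step n l l′ = begin
        fromℕ (suc n ℕ.* suc n ℕ.* W n) ≈⟨ ≈-trans (fromℕ-* (suc n ℕ.* suc n) (W n)) (*-congʳ (fromℕ-* (suc n) (suc n))) ⟩
        fromℕ (suc n) * fromℕ (suc n) * fromℕ (W n) ≤⟨ *-monoˡ-≤ (*-nonNeg (fromℕ-nonneg (suc n)) (fromℕ-nonneg (suc n))) (proj₁ (floor l)) ⟩
        fromℕ (suc n) * fromℕ (suc n) * exp (x * ψ x) ≈⟨ *-congʳ (≈-sym (*-cong (exp-log-fromℕ (positive l′)) (exp-log-fromℕ (positive l′)))) ⟩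
        exp y * exp y * exp (x * ψ x) ≈⟨ ≈-trans (*-congʳ (≈-sym (exp-+ y y))) (≈-sym (exp-+ (y + y) (x * ψ x))) ⟩
        exp ((y + y) + x * ψ x) ≤⟨ exp-mono-≤ key ⟩
        exp ((x + x) + exponent y) ≈⟨ ≈-trans (exp-+ (x + x) (exponent y)) (*-congʳ (exp-+ x x)) ⟩
        exp x * exp x * exp (exponent y) ≈⟨ *-congʳ (*-cong (exp-log-fromℕ (positive l)) (exp-log-fromℕ (positive l))) ⟩
        fromℕ n * fromℕ n * exp (exponent y) ≤⟨ *-monoˡ-≤ (*-nonNeg (fromℕ-nonneg n) (fromℕ-nonneg n)) (≤-trans (<⇒≤ (proj₂ (floor l′))) (≈⇒≤ (+-comm _ _))) ⟩
        fromℕ n * fromℕ n * fromℕ (suc (W (suc n))) ≈⟨ ≈-sym (≈-trans (fromℕ-* (n ℕ.* n) (suc (W (suc n)))) (*-congʳ (fromℕ-* n n))) ⟩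
        fromℕ (n ℕ.* n ℕ.* suc (W (suc n))) ∎
        where
        x = log (fromℕ n)
        y = log (fromℕ (suc n))
        x≤y : x ≤ y
        x≤y = log-mono-≤ (fromℕ-pos (positive l)) (fromℕ-mono (ℕP.n≤1+n n))
        key : (y + y) + x * ψ x ≤ (x + x) + exponent y
        key = ≤-trans
          (by≤ (*-nonNeg (≤⇒0≤- x≤y) (≤⇒0≤- (ψ-large l)))
            (solve 3 (λ x y p → ((x :+ x) :+ y :* p) :- ((y :+ y) :+ x :* p) := (y :- x) :* (p :- (:1 :+ (:1 :+ :0)))) ≈-refl x y (ψ x)))
          (+-monoʳ-≤ (x + x) (exponent-≤ (log-positive l) x≤y))

    -- ψ(log t^j) ≥ ψ(log t) because log t^j = j log t.
    at-power : ∀ {E t} → (∀ n → t ℕ.≤ n → Large ψ W E n) → ∀ j → 0 ℕ.< j → Large ψ W E (t ℕ.^ j)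
    at-power {E} {t} h (suc j) _ = h _ (ℕP.≤-trans (pow-1 t ℕP.≤-refl) (pow-monoʳ {t} {1} {suc j} (positive (h t ℕP.≤-refl)) (ℕ.s≤s ℕ.z≤n)))

    onwards : ∀ E {t} → proj₁ (large E) ℕ.≤ t → ∀ n → t ℕ.≤ n → Large ψ W E n
    onwards E p n q = proj₂ (large E) n (ℕP.≤-trans p q)

    log-fromℕ-^-suc : ∀ {t} → 0 ℕ.< t → ∀ j → log (fromℕ (t ℕ.^ suc j)) ≈ log (fromℕ t) + log (fromℕ (t ℕ.^ j))
    log-fromℕ-^-suc {t} 0<t j = ≈-trans (log-cong (fromℕ-pos (pow-≥1 (suc j) 0<t)) (fromℕ-* t (t ℕ.^ j)))
      (log-* (fromℕ-pos 0<t) (fromℕ-pos (pow-≥1 j 0<t)))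

    -- With a = log t and y = a + x, exponent(y) ≥ yψ(x) = aψ(x) + exponent(x), and aψ(x) ≥ E a.
    steep : ∀ E → Eventually λ t → ∀ j → 0 ℕ.< j → t ℕ.^ E ℕ.* W (t ℕ.^ j) ℕ.≤ W (t ℕ.^ suc j)
    steep E = proj₁ (large E) , λ t p j 0<j → let h = onwards E p in
      ≤-floor (floor (at-power h (suc j) (ℕ.s≤s ℕ.z≤n))) (step t (h t ℕP.≤-refl) j (at-power h j 0<j) (at-power h (suc j) (ℕ.s≤s ℕ.z≤n)))
      where
      step : ∀ t → Large ψ W E t → ∀ j → Large ψ W E (t ℕ.^ j) → Large ψ W E (t ℕ.^ suc j) → fromℕ (t ℕ.^ E ℕ.* W (t ℕ.^ j)) ≤ exp (exponent (log (fromℕ (t ℕ.^ suc j))))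
      step t l j lⱼ lⱼ₊₁ = begin
        fromℕ (t ℕ.^ E ℕ.* W (t ℕ.^ j)) ≈⟨ ≈-trans (fromℕ-* (t ℕ.^ E) (W (t ℕ.^ j))) (*-congʳ (≈-trans (fromℕ-^ t E) (^-congˡ E (≈-sym (exp-log-fromℕ (positive l)))))) ⟩
        exp a ^ E * fromℕ (W (t ℕ.^ j)) ≤⟨ *-mono-≤ (^-nonneg E (<⇒≤ (exp-pos a))) (<⇒≤ (exp-pos _)) ≤-refl (proj₁ (floor lⱼ)) ⟩
        exp a ^ E * exp (x * ψ x) ≈⟨ ≈-trans (*-congʳ (≈-sym (exp-fromℕ* E a))) (≈-sym (exp-+ _ _)) ⟩
        exp (fromℕ E * a + x * ψ x) ≤⟨ exp-mono-≤ (≤-trans (+-monoˡ-≤ _ (*-monoʳ-≤ (<⇒≤ (log-positive l)) (ψ-large lⱼ)))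
                                                         (≈⇒≤ (≈-trans (solve 3 (λ a x p → p :* a :+ x :* p := (a :+ x) :* p) ≈-refl a x (ψ x)) (*-congʳ (≈-sym y≈))))) ⟩
        exp (y * ψ x) ≤⟨ exp-mono-≤ (exponent-≤ (log-positive lⱼ) x≤y) ⟩
        exp (exponent y) ∎
        where
        a = log (fromℕ t)
        x = log (fromℕ (t ℕ.^ j))
        y = log (fromℕ (t ℕ.^ suc j))
        y≈ : y ≈ a + x
        y≈ = log-fromℕ-^-suc (positive l) j
        x≤y : x ≤ y
        x≤y = by≤ (<⇒≤ (log-positive l)) (≈-trans (+-congʳ y≈) (solve 2 (λ a x → (a :+ x) :- x := a) ≈-refl a x))

    -- As x = j log t and y = (j + 1) log t, (j + 1) exponent(x) = j y ψ(x) ≤ j exponent(y). The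
    -- factor 2^j comes from rounding.
    convex : Eventually λ t → ∀ j → 0 ℕ.< j → W (t ℕ.^ j) ℕ.^ suc j ℕ.≤ 2 ℕ.^ j ℕ.* W (t ℕ.^ suc j) ℕ.^ j
    convex = proj₁ squares ℕ.+ proj₁ (large 1) , λ t p j 0<j →
      let h = onwards 1 (ℕP.≤-trans (ℕP.m≤n+m _ (proj₁ squares)) p)
          l = at-power h (suc j) (ℕ.s≤s ℕ.z≤n)
          tʲ≥ = ℕP.≤-trans (ℕP.≤-trans (ℕP.m≤m+n _ _) p) (ℕP.≤-trans (pow-1 t ℕP.≤-refl) (pow-monoʳ {t} {1} {suc j} (positive (h t ℕP.≤-refl)) (ℕ.s≤s ℕ.z≤n)))
          0<n , n²≤W = proj₂ squares (t ℕ.^ suc j) tʲ≥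
      in ℕP.≤-trans (fromℕ-cancel-≤ (step t (h t ℕP.≤-refl) j (at-power h j 0<j) l (ℕP.<-≤-trans (ℕP.*-mono-< 0<n 0<n) n²≤W)))
           (ℕP.≤-reflexive (*-^ 2 (W (t ℕ.^ suc j)) j))
      where
      step : ∀ t → Large ψ W 1 t → ∀ j → Large ψ W 1 (t ℕ.^ j) → Large ψ W 1 (t ℕ.^ suc j) → 0 ℕ.< W (t ℕ.^ suc j) →
        fromℕ (W (t ℕ.^ j) ℕ.^ suc j) ≤ fromℕ ((2 ℕ.* W (t ℕ.^ suc j)) ℕ.^ j)
      step t l j lⱼ lⱼ₊₁ 0<W = begin
        fromℕ (W (t ℕ.^ j) ℕ.^ suc j) ≈⟨ fromℕ-^ (W (t ℕ.^ j)) (suc j) ⟩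
        fromℕ (W (t ℕ.^ j)) ^ suc j ≤⟨ ^-monoˡ-≤ (suc j) (fromℕ-nonneg (W (t ℕ.^ j))) (proj₁ (floor lⱼ)) ⟩
        exp (x * ψ x) ^ suc j ≈⟨ ≈-sym (exp-fromℕ* (suc j) _) ⟩
        exp (fromℕ (suc j) * (x * ψ x)) ≤⟨ exp-mono-≤ (≤-trans (≈⇒≤ exponents) (*-monoˡ-≤ (fromℕ-nonneg j) (exponent-≤ (log-positive lⱼ) x≤y))) ⟩
        exp (fromℕ j * exponent y) ≈⟨ exp-fromℕ* j _ ⟩
        exp (exponent y) ^ j ≤⟨ ^-monoˡ-≤ j (<⇒≤ (exp-pos _)) (floor-double {k = W (t ℕ.^ suc j)} (floor lⱼ₊₁) 0<W) ⟩
        fromℕ (2 ℕ.* W (t ℕ.^ suc j)) ^ j ≈⟨ ≈-sym (fromℕ-^ _ j) ⟩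
        fromℕ ((2 ℕ.* W (t ℕ.^ suc j)) ℕ.^ j) ∎
        where
        a = log (fromℕ t)
        x = log (fromℕ (t ℕ.^ j))
        y = log (fromℕ (t ℕ.^ suc j))
        x≈ = log-fromℕ-^ t j (positive l)
        y≈ = log-fromℕ-^ t (suc j) (positive l)
        x≤y : x ≤ y
        x≤y = by≤ (<⇒≤ (log-positive l)) (≈-trans (+-cong y≈ (-‿cong x≈)) (solve 2 (λ j a → (:1 :+ j) :* a :- j :* a := a) ≈-refl (fromℕ j) a))
        exponents : fromℕ (suc j) * (x * ψ x) ≈ fromℕ j * (y * ψ x)
        exponents = ≈-trans (*-congˡ (*-congʳ x≈)) (≈-trans (solve 3 (λ j a p → (:1 :+ j) :* (j :* a :* p) := j :* ((:1 :+ j) :* a :* p)) ≈-refl (fromℕ j) a (ψ x)) (*-congˡ (*-congʳ (≈-sym y≈))))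

    faster : ∀ {f : ℕ → ℝ} {V : ℕ → ℕ} → Eventually (λ n → IsFloor (exp (f n)) (V n)) → Eventually (λ n → n ℕ.* n ℕ.≤ V n) →
      (∀ k → 0 ℕ.< k → Eventually λ n → 0 ℕ.< n × fromℕ k * log (fromℕ n) * ψ (fromℕ k * log (fromℕ n)) ≤ f n) →
      ∀ Q → Eventually λ n → W (n ℕ.^ Q) ℕ.≤ V n
    -- For Q = 0 the left side is the constant W(1).
    faster {f} {V} V-floor V-square dominated zero = suc (proj₁ V-square ℕ.+ W 1) , λ n p →
      let W<n = ℕP.≤-trans (ℕ.s≤s (ℕP.m≤n+m (W 1) (proj₁ V-square))) p
      in ℕP.≤-trans (ℕP.<⇒≤ W<n) (ℕP.≤-trans (ℕP.≤-trans (ℕP.≤-reflexive (≡.sym (ℕP.*-identityˡ n))) (ℕP.*-monoˡ-≤ n (ℕP.≤-<-trans ℕ.z≤n W<n)))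
           (proj₂ V-square n (ℕP.≤-trans (ℕP.≤-trans (ℕP.m≤m+n _ (W 1)) (ℕP.n≤1+n _)) p)))
    faster {f} {V} V-floor V-square dominated Q@(suc _) = proj₁ (large 0) ℕ.+ (proj₁ V-floor ℕ.+ proj₁ d) , λ n p →
      let h = onwards 0 (ℕP.≤-trans (ℕP.m≤m+n _ _) p)
          p′ = ℕP.≤-trans (ℕP.m≤n+m _ (proj₁ (large 0))) p
          l = at-power h Q (ℕ.s≤s ℕ.z≤n)
          0<n , D = proj₂ d n (ℕP.≤-trans (ℕP.m≤n+m _ (proj₁ V-floor)) p′)
          e = log-fromℕ-^ n Q 0<n
      in ≤-floor (proj₂ V-floor n (ℕP.≤-trans (ℕP.m≤m+n _ _) p′)) (≤-trans (proj₁ (floor l)) (exp-mono-≤ (≤-trans (≈⇒≤ (exponent-cong (log-positive l) e)) D)))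
      where
      d = dominated Q (ℕ.s≤s ℕ.z≤n)

  record Fast (V : ℕ → ℕ) : Set where
    field
      gap : ∃ (Gap V)
      squares : Eventually λ n → n ℕ.* n ℕ.≤ V n
      slow : ∃ λ k → Eventually λ n → V n ℕ.≤ 2 ℕ.^ (k ℕ.* n)
      blocks : ∀ K e s₀ → 0 ℕ.< K → 0 ℕ.< e → SpreadBlocks V K e s₀

  growth : ∀ {ψ W V} (acc : Accelerating ψ) → Accelerating.FloorOfExp acc W → Fast V → (∀ Q → Eventually λ n → W (n ℕ.^ Q) ℕ.≤ V n) → Growth W V
  growth {ψ} {W} {V} acc floors fast V-faster = record
    { n₁ = n₁ ; 0<n₁ = ℕ.s≤s ℕ.z≤n
    ; gapW = λ n p → proj₂ gap n (ℕP.≤-trans (ℕP.≤-trans (ℕP.m≤m+n _ _) (ℕP.n≤1+n _)) p)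
    ; gapV = λ n p → proj₂ (Fast.gap fast) n (ℕP.≤-trans (ℕP.≤-trans (ℕP.≤-trans (ℕP.m≤m+n _ _) (ℕP.m≤n+m _ (proj₁ gap))) (ℕP.n≤1+n _)) p)
    ; W-pos = λ n p → let 0<n , n²≤W = proj₂ squares n (ℕP.≤-trans (ℕP.≤-trans (ℕP.≤-trans (ℕP.m≤n+m _ (proj₁ (Fast.gap fast))) (ℕP.m≤n+m _ (proj₁ gap))) (ℕP.n≤1+n _)) p) in ℕP.<-≤-trans (ℕP.*-mono-< 0<n 0<n) n²≤W
    ; W-steep = steep ; W-convex = convex ; V-faster = V-faster ; V-slow = Fast.slow fast ; V-blocks = Fast.blocks fast }
    where
    open Accelerated acc W floors
    n₁ = suc (proj₁ gap ℕ.+ (proj₁ (Fast.gap fast) ℕ.+ proj₁ squares))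

  binary-exponent : ∀ x → ∃ λ k → x < fromℕ (2 ℕ.^ k)
  binary-exponent x = let k , p = ^-unbounded {fromℕ 2} (<-respˡ fromℕ-1 (fromℕ-mono-< {1} {2} ℕP.≤-refl)) x in k , <-respʳ (≈-sym (fromℕ-^ 2 k)) p

  -- Exponents exp((log n)^{1+y})

  module PowerOfLog (y : ℝ) (0<y : 0# < y) where

    -- z^y, so that the exponent at log n is (log n)^(1 + y).
    ψ : ℝ → ℝ
    ψ z = exp (y * log z)

    accelerating : Accelerating ψ
    accelerating = record
      { monotone = λ 0<a a≤b → exp-mono-≤ (*-monoˡ-≤ (<⇒≤ 0<y) (log-mono-≤ 0<a a≤b))
      ; unbounded = λ M → exp (M * y ⁻¹) , exp-pos _ , (begin
          M ≤⟨ by≤ 0≤1 (solve 1 (λ M → (:1 :+ M) :- M := :1) ≈-refl M) ⟩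
          1# + M ≤⟨ exp-≥1+ M ⟩
          exp M ≈⟨ exp-cong (≈-sym (≈-trans (*-congˡ (log-exp _)) (≈-trans (solve 3 (λ y M i → y :* (M :* i) := M :* (y :* i)) ≈-refl y M (y ⁻¹)) (≈-trans (*-congˡ (⁻¹-inverse 0<y)) (*-identityʳ M))))) ⟩
          ψ (exp (M * y ⁻¹)) ∎) }

    open Accelerating accelerating using (exponent; exponent-cong; FloorOfExp) public

    exponent-≈ : ∀ {z} → 0# < z → exponent z ≈ exp ((1# + y) * log z)
    exponent-≈ {z} 0<z = begin-equality
      z * exp (y * log z) ≈⟨ *-congʳ (≈-sym (exp-log 0<z)) ⟩
      exp (log z) * exp (y * log z) ≈⟨ ≈-sym (exp-+ _ _) ⟩
      exp (log z + y * log z) ≈⟨ exp-cong (solve 2 (λ l y → l :+ y :* l := (:1 :+ y) :* l) ≈-refl (log z) y) ⟩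
      exp ((1# + y) * log z) ∎

    -- (1 + D/p)^{1+y} ≤ 1 + 1/e once (1 + y) D (e + 1) ≤ p.
    flat-exponent : ∀ e p D z → 0 ℕ.< p → 0# < z → (1# + y) * fromℕ D * fromℕ (suc e) ≤ fromℕ p → fromℕ e * exponent (fromℕ (p ℕ.+ D) * z) ≤ fromℕ (suc e) * exponent (fromℕ p * z)
    flat-exponent e p D z 0<p 0<z large = begin
      fromℕ e * exponent (fromℕ (p ℕ.+ D) * z) ≈⟨ *-congˡ (exponent-≈ (*-pos 0<q 0<z)) ⟩
      fromℕ e * exp ((1# + y) * log (fromℕ (p ℕ.+ D) * z)) ≤⟨ *-monoˡ-≤ (fromℕ-nonneg e) (exp-mono-≤ logs) ⟩
      fromℕ e * exp (δ + (1# + y) * log (fromℕ p * z)) ≈⟨ ≈-trans (*-congˡ (exp-+ _ _)) (≈-trans (≈-sym (*-assoc _ _ _)) (*-congˡ (≈-sym (exponent-≈ (*-pos 0<P 0<z))))) ⟩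
      fromℕ e * exp δ * exponent (fromℕ p * z) ≤⟨ *-monoʳ-≤ (*-nonNeg (<⇒≤ (*-pos 0<P 0<z)) (<⇒≤ (exp-pos _))) e-exp ⟩
      fromℕ (suc e) * exponent (fromℕ p * z) ∎
      where
      0<P = fromℕ-pos {p} 0<p
      0<q = fromℕ-pos {p ℕ.+ D} (ℕP.≤-trans 0<p (ℕP.m≤m+n p D))
      0<e+1 = fromℕ-pos {suc e} (ℕ.s≤s ℕ.z≤n)
      δ = fromℕ (suc e) ⁻¹
      0<δ = ⁻¹-pos 0<e+1
      δ-inverse = ⁻¹-inverse 0<e+1
      δ≤1 : δ ≤ 1#
      δ≤1 = *-cancelˡ-≤ 0<e+1 (≤-trans (≈⇒≤ δ-inverse) (≤-trans (by≤ (fromℕ-nonneg e) (solve 1 (λ e → (:1 :+ e) :- :1 := e) ≈-refl (fromℕ e))) (≈⇒≤ (≈-sym (*-identityʳ _)))))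
      -- exp δ ≤ 1/(1 - δ) = (e + 1)/e for δ = 1/(e + 1).
      e-exp : fromℕ e * exp δ ≤ fromℕ (suc e)
      e-exp = begin
        fromℕ e * exp δ ≈⟨ *-congʳ (≈-trans (solve 1 (λ e → e := (:1 :+ e) :- :1) ≈-refl (fromℕ e)) (+-congˡ (-‿cong (≈-sym δ-inverse)))) ⟩
        (fromℕ (suc e) - fromℕ (suc e) * δ) * exp δ ≈⟨ solve 3 (λ e d x → (e :- e :* d) :* x := e :* (x :* (:1 :- d))) ≈-refl (fromℕ (suc e)) δ (exp δ) ⟩
        fromℕ (suc e) * (exp δ * (1# - δ)) ≤⟨ *-monoˡ-≤ (<⇒≤ 0<e+1) (exp-*-1- (<⇒≤ 0<δ) δ≤1) ⟩
        fromℕ (suc e) * 1# ≈⟨ *-identityʳ _ ⟩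
        fromℕ (suc e) ∎
      r = fromℕ D * fromℕ p ⁻¹
      ratio : fromℕ (p ℕ.+ D) ≤ fromℕ p * exp r
      ratio = begin
        fromℕ (p ℕ.+ D) ≈⟨ fromℕ-+ p D ⟩
        fromℕ p + fromℕ D ≈⟨ +-congˡ (≈-sym (≈-trans (*-congˡ (⁻¹-inverse 0<P)) (*-identityʳ _))) ⟩
        fromℕ p + fromℕ D * (fromℕ p * fromℕ p ⁻¹) ≈⟨ solve 3 (λ p d i → p :+ d :* (p :* i) := p :* (:1 :+ d :* i)) ≈-refl (fromℕ p) (fromℕ D) (fromℕ p ⁻¹) ⟩
        fromℕ p * (1# + r) ≤⟨ *-monoˡ-≤ (<⇒≤ 0<P) (exp-≥1+ r) ⟩
        fromℕ p * exp r ∎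
      r≤δ : (1# + y) * r ≤ δ
      r≤δ = *-cancelˡ-≤ (*-pos 0<P 0<e+1) (begin
        fromℕ p * fromℕ (suc e) * ((1# + y) * r) ≈⟨ solve 5 (λ p e y d i → p :* e :* ((:1 :+ y) :* (d :* i)) := (p :* i) :* ((:1 :+ y) :* d :* e)) ≈-refl (fromℕ p) (fromℕ (suc e)) y (fromℕ D) (fromℕ p ⁻¹) ⟩
        fromℕ p * fromℕ p ⁻¹ * ((1# + y) * fromℕ D * fromℕ (suc e)) ≈⟨ ≈-trans (*-congʳ (⁻¹-inverse 0<P)) (*-identityˡ _) ⟩
        (1# + y) * fromℕ D * fromℕ (suc e) ≤⟨ large ⟩
        fromℕ p ≈⟨ ≈-sym (≈-trans (*-assoc _ _ _) (≈-trans (*-congˡ δ-inverse) (*-identityʳ _))) ⟩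
        fromℕ p * fromℕ (suc e) * δ ∎)
      logs : (1# + y) * log (fromℕ (p ℕ.+ D) * z) ≤ δ + (1# + y) * log (fromℕ p * z)
      logs = begin
        (1# + y) * log (fromℕ (p ℕ.+ D) * z) ≤⟨ *-monoˡ-≤ (+-nonneg 0≤1 (<⇒≤ 0<y)) (log-mono-≤ (*-pos 0<q 0<z) (≤-trans (*-monoʳ-≤ (<⇒≤ 0<z) ratio)
                                                                 (≈⇒≤ (solve 3 (λ p x z → p :* x :* z := x :* (p :* z)) ≈-refl (fromℕ p) (exp r) z)))) ⟩
        (1# + y) * log (exp r * (fromℕ p * z)) ≈⟨ *-congˡ (≈-trans (log-* (exp-pos r) (*-pos 0<P 0<z)) (+-congʳ (log-exp r))) ⟩
        (1# + y) * (r + log (fromℕ p * z)) ≈⟨ distribˡ _ _ _ ⟩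
        (1# + y) * r + (1# + y) * log (fromℕ p * z) ≤⟨ +-monoˡ-≤ _ r≤δ ⟩
        δ + (1# + y) * log (fromℕ p * z) ∎

    module _ (V : ℕ → ℕ) (floors : FloorOfExp V) where

      open Accelerated accelerating V floors
      open Large

      -- With m = log log n, eventually (1 + y)m ≤ exp m = log n, whence V(n) ≤ exp n.
      slow : ∃ λ k → Eventually λ n → V n ℕ.≤ 2 ℕ.^ (k ℕ.* n)
      slow = k , proj₁ (large 0) ℕ.+ proj₁ logs , λ n p → let l = proj₂ (large 0) n (ℕP.≤-trans (ℕP.m≤m+n _ _) p) in
        fromℕ-cancel-≤ (step n l (proj₂ (proj₂ logs n (ℕP.≤-trans (ℕP.m≤n+m _ (proj₁ (large 0))) p))))
        where
        k = proj₁ (binary-exponent (exp 1#))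
        a = affine≤exp 0# (1# + y)
        logs = log-large (exp (proj₁ a))
        step : ∀ n → Large ψ V 0 n → exp (proj₁ a) ≤ log (fromℕ n) → fromℕ (V n) ≤ fromℕ (2 ℕ.^ (k ℕ.* n))
        step n l p = begin
          fromℕ (V n) ≤⟨ proj₁ (floor l) ⟩
          exp (exponent (log (fromℕ n))) ≈⟨ exp-cong (exponent-≈ (log-positive l)) ⟩
          exp (exp ((1# + y) * m)) ≤⟨ exp-mono-≤ (exp-mono-≤ (≤-trans (≈⇒≤ (≈-sym (+-identityˡ _))) (proj₂ (proj₂ a) m
                                                         (≤-trans (≈⇒≤ (≈-sym (log-exp _))) (log-mono-≤ (exp-pos _) p))))) ⟩
          exp (exp (exp m)) ≈⟨ exp-cong (≈-trans (exp-cong (exp-log (log-positive l))) (≈-trans (exp-log-fromℕ (positive l)) (≈-sym (*-identityʳ _)))) ⟩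
          exp (fromℕ n * 1#) ≈⟨ exp-fromℕ* n 1# ⟩
          exp 1# ^ n ≤⟨ ^-monoˡ-≤ n (<⇒≤ (exp-pos 1#)) (<⇒≤ (proj₂ (binary-exponent (exp 1#)))) ⟩
          fromℕ (2 ℕ.^ k) ^ n ≈⟨ ≈-sym (fromℕ-^ (2 ℕ.^ k) n) ⟩
          fromℕ ((2 ℕ.^ k) ℕ.^ n) ≡⟨ ≡.cong fromℕ (ℕP.^-*-assoc 2 k n) ⟩
          fromℕ (2 ℕ.^ (k ℕ.* n)) ∎
          where m = log (log (fromℕ n))

      blocks : ∀ K e s₀ → 0 ℕ.< K → 0 ℕ.< e → SpreadBlocks V K e s₀
      blocks (suc k) e s₀ _ _ = geometric-blocks V k p s e s₀ (ℕP.m≤m+n s₀ _) 2≤s (ℕP.m≤n+m _ (proj₁ arch))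
        (proj₂ (steep (2 ℕ.+ (q ℕ.+ q))) s (ℕP.≤-trans (ℕP.m≤m+n _ _) s≥))
        (fromℕ-cancel-≤ flat)
        where
        D = 2 ℕ.* suc k
        arch = archimedean ((1# + y) * fromℕ D * fromℕ (suc e))
        -- The first summand is for `flat-exponent`, the second for `geometric-blocks`.
        p = proj₁ arch ℕ.+ (2 ℕ.* (k ℕ.* k) ℕ.+ 3 ℕ.* k ℕ.+ 2)
        q = raise p (suc k)
        sq = proj₁ squares
        s = s₀ ℕ.+ (2 ℕ.+ (proj₁ (steep (2 ℕ.+ (q ℕ.+ q))) ℕ.+ (proj₁ (large 0) ℕ.+ sq)))
        2≤s : 2 ℕ.≤ s
        2≤s = ℕP.≤-trans (ℕP.m≤m+n 2 _) (ℕP.m≤n+m _ s₀)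
        s≥ : proj₁ (steep (2 ℕ.+ (q ℕ.+ q))) ℕ.+ (proj₁ (large 0) ℕ.+ sq) ℕ.≤ s
        s≥ = ℕP.≤-trans (ℕP.m≤n+m _ 2) (ℕP.m≤n+m _ s₀)
        s≥′ : proj₁ (large 0) ℕ.+ sq ℕ.≤ s
        s≥′ = ℕP.≤-trans (ℕP.m≤n+m _ (proj₁ (steep (2 ℕ.+ (q ℕ.+ q))))) s≥
        h = onwards 0 (ℕP.≤-trans (ℕP.m≤m+n _ _) s≥′)
        l = h s ℕP.≤-refl
        0<p : 0 ℕ.< p
        0<p = ℕP.≤-trans (ℕP.≤-trans (ℕ.s≤s ℕ.z≤n) (ℕP.m≤n+m 2 (2 ℕ.* (k ℕ.* k) ℕ.+ 3 ℕ.* k))) (ℕP.m≤n+m _ (proj₁ arch))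
        p≤q : p ℕ.≤ q
        p≤q = raise-mono p {0} {suc k} ℕ.z≤n
        lq = at-power h q (ℕP.≤-trans 0<p p≤q)
        lp = at-power h p 0<p
        a = log (fromℕ s)
        0<V : 0 ℕ.< V (s ℕ.^ p)
        0<V = let 0<n , n²≤V = proj₂ squares (s ℕ.^ p) (ℕP.≤-trans (ℕP.≤-trans (ℕP.m≤n+m _ (proj₁ (large 0))) s≥′) (s≤s^ p 0<p)) in ℕP.<-≤-trans (ℕP.*-mono-< 0<n 0<n) n²≤V
          where
          s≤s^ : ∀ p → 0 ℕ.< p → s ℕ.≤ s ℕ.^ p
          s≤s^ (suc p) _ = ℕP.m≤m*n s (s ℕ.^ p) {{ℕ.>-nonZero (ℕP.m^n>0 s {{ℕ.>-nonZero (positive l)}} p)}}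
        flat : fromℕ (V (s ℕ.^ q) ℕ.^ e) ≤ fromℕ (2 ℕ.^ suc e ℕ.* V (s ℕ.^ p) ℕ.^ suc e)
        flat = begin
          fromℕ (V (s ℕ.^ q) ℕ.^ e) ≈⟨ fromℕ-^ (V (s ℕ.^ q)) e ⟩
          fromℕ (V (s ℕ.^ q)) ^ e ≤⟨ ^-monoˡ-≤ e (fromℕ-nonneg (V (s ℕ.^ q))) (proj₁ (floor lq)) ⟩
          exp (exponent (log (fromℕ (s ℕ.^ q)))) ^ e ≈⟨ ≈-sym (exp-fromℕ* e _) ⟩
          exp (fromℕ e * exponent (log (fromℕ (s ℕ.^ q)))) ≈⟨ exp-cong (*-congˡ (exponent-cong (log-positive lq) (≈-trans (log-fromℕ-^ s q (positive l)) (*-congʳ (≈-reflexive (≡.cong fromℕ (raise-≡ p (suc k)))))))) ⟩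
          exp (fromℕ e * exponent (fromℕ (p ℕ.+ D) * a)) ≤⟨ exp-mono-≤ (flat-exponent e p D a 0<p (log-positive l) (≤-trans (<⇒≤ (proj₂ arch)) (fromℕ-mono (ℕP.m≤m+n (proj₁ arch) _)))) ⟩
          exp (fromℕ (suc e) * exponent (fromℕ p * a)) ≈⟨ exp-cong (*-congˡ (exponent-cong (*-pos (fromℕ-pos 0<p) (log-positive l)) (≈-sym (log-fromℕ-^ s p (positive l))))) ⟩
          exp (fromℕ (suc e) * exponent (log (fromℕ (s ℕ.^ p)))) ≈⟨ exp-fromℕ* (suc e) _ ⟩
          exp (exponent (log (fromℕ (s ℕ.^ p)))) ^ suc e ≤⟨ ^-monoˡ-≤ (suc e) (<⇒≤ (exp-pos _)) (floor-double {k = V (s ℕ.^ p)} (floor lp) 0<V) ⟩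
          fromℕ (2 ℕ.* V (s ℕ.^ p)) ^ suc e ≈⟨ ≈-sym (fromℕ-^ (2 ℕ.* V (s ℕ.^ p)) (suc e)) ⟩
          fromℕ ((2 ℕ.* V (s ℕ.^ p)) ℕ.^ suc e) ≡⟨ ≡.cong fromℕ (*-^ 2 (V (s ℕ.^ p)) (suc e)) ⟩
          fromℕ (2 ℕ.^ suc e ℕ.* V (s ℕ.^ p) ℕ.^ suc e) ∎

      fast : Fast V
      fast = record { gap = gap ; squares = proj₁ squares , (λ n p → proj₂ (proj₂ squares n p)) ; slow = slow ; blocks = blocks }

  -- Exponents rⁿ

  module Geometric (r : ℝ) (1<r : 1# < r) (V : ℕ → ℕ) (floor : ∀ n → IsFloor (r ^ n) (V n)) where

    0<r = <-trans 0<1 1<r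
    κ = log r

    0<κ : 0# < κ
    0<κ = ≰⇒> λ κ≤0 → <⇒≱ 1<r (≤-trans (≈⇒≤ (≈-sym (exp-log 0<r))) (≤-trans (exp-mono-≤ κ≤0) (≈⇒≤ exp-0)))

    r^ : ∀ n → r ^ n ≈ exp (fromℕ n * κ)
    r^ n = ≈-trans (^-congˡ n (≈-sym (exp-log 0<r))) (≈-sym (exp-fromℕ* n κ))

    -- After taking logarithms, log(c + 1) + 2 log n ≤ κn is an instance of `affine≤exp` at log n.
    polynomial≤ : ∀ c → Eventually λ n → 0 ℕ.< n × fromℕ (c ℕ.* (n ℕ.* n)) ≤ r ^ n
    polynomial≤ c = proj₁ logs , λ n p → let 0<n , M≤ = proj₂ logs n p in 0<n , step n 0<n M≤
      where
      L = log (fromℕ (suc c))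
      a = affine≤exp (L * κ ⁻¹) (2# * κ ⁻¹)
      logs = log-large (proj₁ a)
      step : ∀ n → 0 ℕ.< n → proj₁ a ≤ log (fromℕ n) → fromℕ (c ℕ.* (n ℕ.* n)) ≤ r ^ n
      step n 0<n M≤ = begin
        fromℕ (c ℕ.* (n ℕ.* n)) ≤⟨ fromℕ-mono (ℕP.*-monoˡ-≤ (n ℕ.* n) (ℕP.n≤1+n c)) ⟩
        fromℕ (suc c ℕ.* (n ℕ.* n)) ≈⟨ ≈-trans (fromℕ-* (suc c) (n ℕ.* n)) (*-congˡ (fromℕ-* n n)) ⟩
        fromℕ (suc c) * (fromℕ n * fromℕ n) ≈⟨ ≈-sym (*-cong (exp-log-fromℕ {suc c} (ℕ.s≤s ℕ.z≤n)) (*-cong (exp-log-fromℕ 0<n) (exp-log-fromℕ 0<n))) ⟩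
        exp L * (exp x * exp x) ≈⟨ ≈-trans (*-congˡ (≈-sym (exp-+ x x))) (≈-sym (exp-+ L (x + x))) ⟩
        exp (L + (x + x)) ≈⟨ exp-cong (≈-trans (≈-sym (*-identityʳ _)) (≈-trans (*-congˡ (≈-sym (⁻¹-inverse 0<κ)))
                                                        (solve 4 (λ l x k i → (l :+ (x :+ x)) :* (k :* i) := (l :* i :+ (:1 :+ :1) :* i :* x) :* k) ≈-refl L x κ (κ ⁻¹)))) ⟩
        exp ((L * κ ⁻¹ + 2# * κ ⁻¹ * x) * κ) ≤⟨ exp-mono-≤ (*-monoʳ-≤ (<⇒≤ 0<κ) (proj₂ (proj₂ a) x M≤)) ⟩
        exp (exp x * κ) ≈⟨ exp-cong (*-congʳ (exp-log-fromℕ 0<n)) ⟩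
        exp (fromℕ n * κ) ≈⟨ ≈-sym (r^ n) ⟩
        r ^ n ∎
        where x = log (fromℕ n)

    squares : Eventually λ n → n ℕ.* n ℕ.≤ V n
    squares = proj₁ (polynomial≤ 1) , λ n p → ≤-floor (floor n) (≤-trans (fromℕ-mono (ℕP.≤-reflexive (≡.sym (ℕP.+-identityʳ (n ℕ.* n))))) (proj₂ (proj₂ (polynomial≤ 1) n p)))

    -- With N = 2n, N(r - 1) ≥ 2 gives (1 + N)r^n + r^n ≤ N r^(n + 1). The extra r^n ≥ N pays for
    -- rounding V(n + 1), which can cost N.
    gap : ∃ (Gap V)
    gap = proj₁ arch ℕ.+ proj₁ (polynomial≤ 2) , λ n p → let 0<n , 2n²≤ = proj₂ (polynomial≤ 2) n (ℕP.≤-trans (ℕP.m≤n+m _ (proj₁ arch)) p) in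
      ℕP.+-cancelʳ-≤ (2 ℕ.* n) _ _ (fromℕ-cancel-≤ (step n 0<n
        (≤-trans (fromℕ-mono (ℕP.*-monoʳ-≤ 2 (ℕP.≤-trans (ℕP.≤-reflexive (≡.sym (ℕP.*-identityˡ n))) (ℕP.*-monoˡ-≤ n 0<n)))) 2n²≤)
        (≤-trans (<⇒≤ (proj₂ arch)) (fromℕ-mono (ℕP.≤-trans (ℕP.m≤m+n (proj₁ arch) _) p)))))
      where
      d = r - 1#
      0<d = <⇒0<- 1<r
      arch = archimedean (d ⁻¹)
      step : ∀ n → 0 ℕ.< n → fromℕ (2 ℕ.* n) ≤ r ^ n → d ⁻¹ ≤ fromℕ n → fromℕ (suc (2 ℕ.* n) ℕ.* V n ℕ.+ 2 ℕ.* n) ≤ fromℕ (2 ℕ.* n ℕ.* V (suc n) ℕ.+ 2 ℕ.* n)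
      step n 0<n 2n≤ d≤ = begin
        fromℕ (suc (2 ℕ.* n) ℕ.* V n ℕ.+ 2 ℕ.* n) ≈⟨ ≈-trans (fromℕ-+ (suc (2 ℕ.* n) ℕ.* V n) (2 ℕ.* n)) (+-congʳ (fromℕ-* (suc (2 ℕ.* n)) (V n))) ⟩
        (1# + N) * fromℕ (V n) + N ≤⟨ +-mono-≤ (*-monoˡ-≤ (fromℕ-nonneg (suc (2 ℕ.* n))) (proj₁ (floor n))) 2n≤ ⟩
        (1# + N) * r ^ n + r ^ n ≤⟨ by≤ (*-nonNeg (^-nonneg n (<⇒≤ 0<r)) (≤⇒0≤- 2≤)) (solve 3 (λ N r p → N :* (r :* p) :- ((:1 :+ N) :* p :+ p) := p :* (N :* (r :- :1) :- (:1 :+ :1))) ≈-refl N r (r ^ n)) ⟩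
        N * r ^ suc n ≤⟨ *-monoˡ-≤ (fromℕ-nonneg (2 ℕ.* n)) (<⇒≤ (proj₂ (floor (suc n)))) ⟩
        N * (fromℕ (V (suc n)) + 1#) ≈⟨ solve 2 (λ N v → N :* (v :+ :1) := N :* v :+ N) ≈-refl N (fromℕ (V (suc n))) ⟩
        N * fromℕ (V (suc n)) + N ≈⟨ ≈-sym (≈-trans (fromℕ-+ (2 ℕ.* n ℕ.* V (suc n)) (2 ℕ.* n)) (+-congʳ (fromℕ-* (2 ℕ.* n) (V (suc n))))) ⟩
        fromℕ (2 ℕ.* n ℕ.* V (suc n) ℕ.+ 2 ℕ.* n) ∎
        where
        N = fromℕ (2 ℕ.* n)
        2≤ : 2# ≤ N * d
        2≤ = begin
          2# ≈⟨ ≈-sym (≈-trans (*-congˡ (⁻¹-inverse 0<d)) (*-identityʳ _)) ⟩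
          2# * (d * d ⁻¹) ≤⟨ *-monoˡ-≤ (<⇒≤ 0<2) (*-monoˡ-≤ (<⇒≤ 0<d) d≤) ⟩
          2# * (d * fromℕ n) ≈⟨ solve 2 (λ d n → (:1 :+ :1) :* (d :* n) := (:1 :+ (:1 :+ :0)) :* n :* d) ≈-refl d (fromℕ n) ⟩
          fromℕ 2 * fromℕ n * d ≈⟨ *-congʳ (≈-sym (fromℕ-* 2 n)) ⟩
          N * d ∎

    slow : ∃ λ k → Eventually λ n → V n ℕ.≤ 2 ℕ.^ (k ℕ.* n)
    slow = k , 0 , λ n _ → fromℕ-cancel-≤ (begin
      fromℕ (V n) ≤⟨ proj₁ (floor n) ⟩
      r ^ n ≤⟨ ^-monoˡ-≤ n (<⇒≤ 0<r) (<⇒≤ (proj₂ (binary-exponent r))) ⟩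
      fromℕ (2 ℕ.^ k) ^ n ≈⟨ ≈-sym (fromℕ-^ (2 ℕ.^ k) n) ⟩
      fromℕ ((2 ℕ.^ k) ℕ.^ n) ≡⟨ ≡.cong fromℕ (ℕP.^-*-assoc 2 k n) ⟩
      fromℕ (2 ℕ.^ (k ℕ.* n)) ∎)
      where k = proj₁ (binary-exponent r)

    blocks : ∀ K e s₀ → 0 ℕ.< K → 0 ℕ.< e → SpreadBlocks V K e s₀
    blocks (suc k) e@(suc e′) s₀ _ _ = arithmetic-blocks V k p s e s₀ (ℕP.m≤m+n s₀ _) 2≤s (ℕP.m≤m*n D e)
      (ℕP.≤-trans (ℕP.m≤m+n (suc (suc q ℕ.^ k)) _) (ℕP.≤-trans (ℕP.m≤n+m _ 2) (ℕP.m≤n+m _ s₀)))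
      (λ j _ → ≤-floor (floor (suc j ℕ.* s)) (step j))
      (fromℕ-cancel-≤ flat)
      where
      D = 2 ℕ.* suc k
      -- With q = p + D this makes q e equal to p(e + 1), so the two powers of r in `flat` agree.
      p = D ℕ.* e
      q = raise p (suc k)
      c = 4 ℕ.* (q ℕ.* q)
      s = s₀ ℕ.+ (2 ℕ.+ (suc (suc q ℕ.^ k) ℕ.+ (proj₁ (polynomial≤ c) ℕ.+ proj₁ squares)))
      2≤s : 2 ℕ.≤ s
      2≤s = ℕP.≤-trans (ℕP.m≤m+n 2 _) (ℕP.m≤n+m _ s₀)
      s≥ : proj₁ (polynomial≤ c) ℕ.+ proj₁ squares ℕ.≤ s
      s≥ = ℕP.≤-trans (ℕP.m≤n+m _ (suc (suc q ℕ.^ k))) (ℕP.≤-trans (ℕP.m≤n+m _ 2) (ℕP.m≤n+m _ s₀))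
      step : ∀ j → fromℕ (4 ℕ.* ((q ℕ.* s) ℕ.* (q ℕ.* s)) ℕ.* V (j ℕ.* s)) ≤ r ^ (suc j ℕ.* s)
      step j = begin
        fromℕ (4 ℕ.* ((q ℕ.* s) ℕ.* (q ℕ.* s)) ℕ.* V (j ℕ.* s)) ≈⟨ fromℕ-* (4 ℕ.* ((q ℕ.* s) ℕ.* (q ℕ.* s))) (V (j ℕ.* s)) ⟩
        fromℕ (4 ℕ.* ((q ℕ.* s) ℕ.* (q ℕ.* s))) * fromℕ (V (j ℕ.* s)) ≤⟨ *-mono-≤ (fromℕ-nonneg (4 ℕ.* ((q ℕ.* s) ℕ.* (q ℕ.* s)))) (^-nonneg (j ℕ.* s) (<⇒≤ 0<r))
          (≤-trans (≈⇒≤ (≈-reflexive (≡.cong fromℕ (4q²s² q s)))) (proj₂ (proj₂ (polynomial≤ c) s (ℕP.≤-trans (ℕP.m≤m+n _ _) s≥)))) (proj₁ (floor (j ℕ.* s))) ⟩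
        r ^ s * r ^ (j ℕ.* s) ≈⟨ ≈-sym (^-homo-* r s (j ℕ.* s)) ⟩
        r ^ (suc j ℕ.* s) ∎
      0<V : 0 ℕ.< V (p ℕ.* s)
      0<V = ℕP.<-≤-trans (ℕP.*-mono-< 0<ps 0<ps) (proj₂ squares (p ℕ.* s) (ℕP.≤-trans (ℕP.≤-trans (ℕP.m≤n+m _ (proj₁ (polynomial≤ c))) s≥) (ℕP.m≤n*m s p)))
        where
        0<ps : 0 ℕ.< p ℕ.* s
        0<ps = ℕP.*-mono-< {0} {p} {0} {s} (ℕ.s≤s ℕ.z≤n) (ℕP.≤-trans (ℕ.s≤s ℕ.z≤n) 2≤s)
      flat : fromℕ (V (q ℕ.* s) ℕ.^ e) ≤ fromℕ (2 ℕ.^ suc e ℕ.* V (p ℕ.* s) ℕ.^ suc e)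
      flat = begin
        fromℕ (V (q ℕ.* s) ℕ.^ e) ≈⟨ fromℕ-^ (V (q ℕ.* s)) e ⟩
        fromℕ (V (q ℕ.* s)) ^ e ≤⟨ ^-monoˡ-≤ e (fromℕ-nonneg (V (q ℕ.* s))) (proj₁ (floor (q ℕ.* s))) ⟩
        (r ^ (q ℕ.* s)) ^ e ≈⟨ ^-assocʳ r (q ℕ.* s) e ⟩
        r ^ (q ℕ.* s ℕ.* e) ≡⟨ ≡.cong (r ^_) (≡.trans (≡.cong (λ q → q ℕ.* s ℕ.* e) (raise-≡ p (suc k))) (flat-product D e s)) ⟩
        r ^ (p ℕ.* s ℕ.* suc e) ≈⟨ ≈-sym (^-assocʳ r (p ℕ.* s) (suc e)) ⟩
        (r ^ (p ℕ.* s)) ^ suc e ≤⟨ ^-monoˡ-≤ (suc e) (^-nonneg (p ℕ.* s) (<⇒≤ 0<r)) (floor-double {k = V (p ℕ.* s)} (floor (p ℕ.* s)) 0<V) ⟩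
        fromℕ (2 ℕ.* V (p ℕ.* s)) ^ suc e ≈⟨ ≈-sym (fromℕ-^ (2 ℕ.* V (p ℕ.* s)) (suc e)) ⟩
        fromℕ ((2 ℕ.* V (p ℕ.* s)) ℕ.^ suc e) ≡⟨ ≡.cong fromℕ (*-^ 2 (V (p ℕ.* s)) (suc e)) ⟩
        fromℕ (2 ℕ.^ suc e ℕ.* V (p ℕ.* s) ℕ.^ suc e) ∎

    fast : Fast V
    fast = record { gap = gap ; squares = squares ; slow = slow ; blocks = blocks }

  -- Comparison of the three kinds of exponents

  logarithm-accelerating : Accelerating log
  logarithm-accelerating = record { monotone = log-mono-≤ ; unbounded = λ M → exp M , exp-pos M , ≈⇒≤ (≈-sym (log-exp M)) }

  loglog-large : ∀ M → Eventually λ n → 0 ℕ.< n × 0# < log (fromℕ n) × M ≤ log (log (fromℕ n))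
  loglog-large M = proj₁ (log-large (exp M)) , λ n p → let 0<n , M≤ = proj₂ (log-large (exp M)) n p in
    0<n , <-≤-trans (exp-pos M) M≤ , ≤-respˡ-≈ (log-exp M) (log-mono-≤ (exp-pos M) M≤)

  module _ {x y : ℝ} (0<x : 0# < x) (x<y : x < y) where
    private
      module A = PowerOfLog x 0<x
      module B = PowerOfLog y (<-trans 0<x x<y)

    -- After two logarithms the comparison is affine in m = log log n: c + (1 + x)m ≤ (1 + y)m as
    -- soon as m ≥ c/(y - x).
    power-dominates-power : ∀ k → 0 ℕ.< k → Eventually λ n → 0 ℕ.< n × A.exponent (fromℕ k * log (fromℕ n)) ≤ B.exponent (log (fromℕ n))
    power-dominates-power k 0<k = proj₁ large , λ n p → let 0<n , 0<ℓ , M≤ = proj₂ large n p in 0<n , step n 0<ℓ M≤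
      where
      d = y - x
      0<d = <⇒0<- x<y
      c = (1# + x) * log (fromℕ k)
      large = loglog-large (c * d ⁻¹)
      step : ∀ n → 0# < log (fromℕ n) → c * d ⁻¹ ≤ log (log (fromℕ n)) → A.exponent (fromℕ k * log (fromℕ n)) ≤ B.exponent (log (fromℕ n))
      step n 0<ℓ M≤ = begin
        A.exponent (fromℕ k * log (fromℕ n)) ≈⟨ A.exponent-≈ (*-pos (fromℕ-pos 0<k) 0<ℓ) ⟩
        exp ((1# + x) * log (fromℕ k * log (fromℕ n))) ≈⟨ exp-cong (≈-trans (*-congˡ (log-* (fromℕ-pos 0<k) 0<ℓ)) (distribˡ _ _ _)) ⟩
        exp (c + (1# + x) * m) ≤⟨ exp-mono-≤ (+-monoˡ-≤ _ c≤) ⟩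
        exp (d * m + (1# + x) * m) ≈⟨ exp-cong (solve 3 (λ x y m → (y :- x) :* m :+ (:1 :+ x) :* m := (:1 :+ y) :* m) ≈-refl x y m) ⟩
        exp ((1# + y) * m) ≈⟨ ≈-sym (B.exponent-≈ 0<ℓ) ⟩
        B.exponent (log (fromℕ n)) ∎
        where
        m = log (log (fromℕ n))
        c≤ : c ≤ d * m
        c≤ = begin
          c ≈⟨ ≈-sym (≈-trans (*-congˡ (⁻¹-inverse 0<d)) (*-identityʳ c)) ⟩
          c * (d * d ⁻¹) ≈⟨ solve 3 (λ c d i → c :* (d :* i) := d :* (c :* i)) ≈-refl c d (d ⁻¹) ⟩
          d * (c * d ⁻¹) ≤⟨ *-monoˡ-≤ (<⇒≤ 0<d) M≤ ⟩
          d * m ∎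

  module Square = PowerOfLog 1# 0<1

  -- Divided by log n = exp m, the comparison is k log k + km ≤ exp m, which `affine≤exp` provides.
  square-dominates-log : ∀ k → 0 ℕ.< k → Eventually λ n → 0 ℕ.< n × fromℕ k * log (fromℕ n) * log (fromℕ k * log (fromℕ n)) ≤ Square.exponent (log (fromℕ n))
  square-dominates-log k 0<k = proj₁ large , λ n p → let 0<n , 0<ℓ , M≤ = proj₂ large n p in 0<n , step n 0<ℓ M≤
    where
    a = affine≤exp (fromℕ k * log (fromℕ k)) (fromℕ k)
    large = loglog-large (proj₁ a)
    step : ∀ n → 0# < log (fromℕ n) → proj₁ a ≤ log (log (fromℕ n)) → fromℕ k * log (fromℕ n) * log (fromℕ k * log (fromℕ n)) ≤ Square.exponent (log (fromℕ n))
    step n 0<ℓ M≤ = begin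
      fromℕ k * log (fromℕ n) * log (fromℕ k * log (fromℕ n)) ≈⟨ *-congˡ (log-* (fromℕ-pos 0<k) 0<ℓ) ⟩
      fromℕ k * log (fromℕ n) * (log (fromℕ k) + m) ≈⟨ solve 4 (λ k l a m → k :* l :* (a :+ m) := l :* (k :* a :+ k :* m)) ≈-refl (fromℕ k) (log (fromℕ n)) (log (fromℕ k)) m ⟩
      log (fromℕ n) * (fromℕ k * log (fromℕ k) + fromℕ k * m) ≤⟨ *-monoˡ-≤ (<⇒≤ 0<ℓ) (proj₂ (proj₂ a) m M≤) ⟩
      log (fromℕ n) * exp m ≈⟨ *-congˡ (exp-cong (≈-sym (*-identityˡ m))) ⟩
      Square.exponent (log (fromℕ n)) ∎
      where m = log (log (fromℕ n))

  -- One logarithm turns (k log n)² ≤ κn into 2 log k - log κ + 2m ≤ exp m with m = log log n.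
  geometric-dominates-square : ∀ {κ} → 0# < κ → ∀ k → 0 ℕ.< k → Eventually λ n → 0 ℕ.< n × Square.exponent (fromℕ k * log (fromℕ n)) ≤ fromℕ n * κ
  geometric-dominates-square {κ} 0<κ k 0<k = proj₁ large , λ n p → let 0<n , 0<ℓ , M≤ = proj₂ large n p in 0<n , step n 0<n 0<ℓ M≤
    where
    a = affine≤exp (2# * log (fromℕ k) - log κ) 2#
    large = loglog-large (proj₁ a)
    step : ∀ n → 0 ℕ.< n → 0# < log (fromℕ n) → proj₁ a ≤ log (log (fromℕ n)) → Square.exponent (fromℕ k * log (fromℕ n)) ≤ fromℕ n * κ
    step n 0<n 0<ℓ M≤ = begin
      Square.exponent (fromℕ k * log (fromℕ n)) ≈⟨ Square.exponent-≈ (*-pos (fromℕ-pos 0<k) 0<ℓ) ⟩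
      exp (2# * log (fromℕ k * log (fromℕ n))) ≈⟨ exp-cong (≈-trans (*-congˡ (log-* (fromℕ-pos 0<k) 0<ℓ))
                                                         (solve 3 (λ a m c → (:1 :+ :1) :* (a :+ m) := ((:1 :+ :1) :* a :- c :+ (:1 :+ :1) :* m) :+ c) ≈-refl (log (fromℕ k)) m (log κ))) ⟩
      exp (2# * log (fromℕ k) - log κ + 2# * m + log κ) ≤⟨ exp-mono-≤ (+-monoˡ-≤ _ (proj₂ (proj₂ a) m M≤)) ⟩
      exp (exp m + log κ) ≈⟨ ≈-trans (exp-+ _ _) (*-cong (≈-trans (exp-cong (exp-log 0<ℓ)) (exp-log-fromℕ 0<n)) (exp-log 0<κ)) ⟩
      fromℕ n * κ ∎
      where m = log (log (fromℕ n))

  IsFloor-cong : ∀ {x y k} → x ≈ y → IsFloor x k → IsFloor y k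
  IsFloor-cong e (p , q) = ≤-trans p (≈⇒≤ e) , ≤-<-trans (≈⇒≤ (≈-sym e)) q

  abstract
    -- `abstract` keeps the exponents from unfolding into the choice made by excluded middle.
    floor-of : ∀ {w : ℕ → ℝ} → (∀ n → 0# ≤ w n) → ℕ → ℕ
    floor-of w≥0 n = proj₁ (floor-nonneg (w≥0 n))

    floor-of-≡ : ∀ {w : ℕ → ℝ} (w≥0 : ∀ n → 0# ≤ w n) n → ⌊ w n ⌋ ≡ + floor-of w≥0 n
    floor-of-≡ w≥0 n = proj₁ (proj₂ (floor-nonneg (w≥0 n)))

    is-floor : ∀ {w : ℕ → ℝ} (w≥0 : ∀ n → 0# ≤ w n) n → IsFloor (w n) (floor-of w≥0 n)
    is-floor w≥0 n = proj₂ (proj₂ (floor-nonneg (w≥0 n)))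

  ^ʳ-nonneg : ∀ x y → 0# ≤ x ^ʳ y
  ^ʳ-nonneg x y with lem {x ≈ 0#}
  ... | yes _ = ≤-refl
  ... | no _ = <⇒≤ (exp-pos _)

  -- Series with rapidly growing exponents

  module Tail {β : ℝ} (1<β : 1# < β) (u W : ℕ → ℕ) (u-bound : Eventually λ n → fromℕ (u n) ≤ β ^ n)
    (squares : Eventually λ n → n ℕ.* n ℕ.≤ W n) (mono : ∃ λ n₁ → ∀ m n → n₁ ℕ.≤ m → m ℕ.≤ n → W m ℕ.≤ W n) where

    q = β ⁻¹
    0<β = <-trans 0<1 1<β
    βq = ⁻¹-inverse 0<β
    0<q = ⁻¹-pos 0<β
    0≤q = <⇒≤ 0<q

    0<1-q : 0# < 1# - q
    0<1-q = *-cancelˡ-< (<⇒≤ 0<β) (<-respˡ (≈-sym (zeroʳ β)) (<-respʳ (≈-trans (+-congˡ (-‿cong (≈-sym βq))) (solve 2 (λ b q → b :- b :* q := b :* (:1 :- q)) ≈-refl β q)) (<⇒0<- 1<β)))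

    q≤1 : q ≤ 1#
    q≤1 = 0≤-⇒≤ (<⇒≤ 0<1-q)

    -- The factor q^c pays for the sum of the geometric series.
    c = proj₁ (^-unbounded 1<β ((1# - q) ⁻¹))

    qᶜ≤ : q ^ c ≤ 1# - q
    qᶜ≤ = *-cancelˡ-≤ (⁻¹-pos 0<1-q) (begin
      (1# - q) ⁻¹ * q ^ c ≤⟨ *-monoʳ-≤ (^-nonneg c 0≤q) (<⇒≤ (proj₂ (^-unbounded 1<β ((1# - q) ⁻¹)))) ⟩
      β ^ c * q ^ c ≈⟨ ^-inverse c βq ⟩
      1# ≈⟨ ≈-sym (≈-trans (*-comm _ _) (⁻¹-inverse 0<1-q)) ⟩
      (1# - q) ⁻¹ * (1# - q) ∎)

    T : ℕ → ℝ
    T = truncation q u W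

    a : ℕ → ℝ
    a n = fromℕ (u n) * q ^ W n

    a≥0 : ∀ n → 0# ≤ a n
    a≥0 n = *-nonNeg (fromℕ-nonneg (u n)) (^-nonneg (W n) 0≤q)

    H₀ = (4 ℕ.+ 2 ℕ.* c) ℕ.+ (proj₁ u-bound ℕ.+ (proj₁ squares ℕ.+ proj₁ mono))

    a-≤ : ∀ {H M} → H₀ ℕ.≤ H → 4 ℕ.* M ℕ.≤ W H → ∀ i → a (H ℕ.+ i) ≤ q ^ M * q ^ c * q ^ i
    a-≤ {H} {M} H₀≤H 4M≤W i = begin
      fromℕ (u n) * q ^ W n ≤⟨ *-mono-≤ (fromℕ-nonneg (u n)) (^-nonneg (M ℕ.+ c ℕ.+ 2 ℕ.* n) 0≤q) (proj₂ u-bound n u≥) (^-antitone 0≤q q≤1 exponent≤) ⟩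
      β ^ n * q ^ (M ℕ.+ c ℕ.+ 2 ℕ.* n) ≈⟨ *-congˡ (≈-trans (^-homo-* q (M ℕ.+ c) (2 ℕ.* n)) (*-cong (^-homo-* q M c) (≈-trans (^-homo-* q n (n ℕ.+ 0)) (*-congˡ (≈-reflexive (≡.cong (q ^_) (ℕP.+-identityʳ n))))))) ⟩
      β ^ n * (q ^ M * q ^ c * (q ^ n * q ^ n)) ≈⟨ solve 4 (λ b m c n → b :* (m :* c :* (n :* n)) := (b :* n) :* (m :* c :* n)) ≈-refl (β ^ n) (q ^ M) (q ^ c) (q ^ n) ⟩
      β ^ n * q ^ n * (q ^ M * q ^ c * q ^ n) ≈⟨ ≈-trans (*-congʳ (^-inverse n βq)) (*-identityˡ _) ⟩
      q ^ M * q ^ c * q ^ n ≤⟨ *-monoˡ-≤ (*-nonNeg (^-nonneg M 0≤q) (^-nonneg c 0≤q)) (^-antitone 0≤q q≤1 (ℕP.m≤n+m i H)) ⟩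
      q ^ M * q ^ c * q ^ i ∎
      where
      n = H ℕ.+ i
      H≤n = ℕP.m≤m+n H i
      rest : proj₁ u-bound ℕ.+ (proj₁ squares ℕ.+ proj₁ mono) ℕ.≤ H
      rest = ℕP.≤-trans (ℕP.m≤n+m _ (4 ℕ.+ 2 ℕ.* c)) H₀≤H
      u≥ = ℕP.≤-trans (ℕP.≤-trans (ℕP.m≤m+n _ _) rest) H≤n
      rest′ : proj₁ squares ℕ.+ proj₁ mono ℕ.≤ H
      rest′ = ℕP.≤-trans (ℕP.m≤n+m _ (proj₁ u-bound)) rest
      exponent≤ : M ℕ.+ c ℕ.+ 2 ℕ.* n ℕ.≤ W n
      exponent≤ = tail-exponent M c n (W n) (ℕP.≤-trans (ℕP.≤-trans (ℕP.m≤m+n _ _) H₀≤H) H≤n)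
        (ℕP.≤-trans 4M≤W (proj₂ mono H n (ℕP.≤-trans (ℕP.m≤n+m _ (proj₁ squares)) rest′) H≤n))
        (proj₂ squares n (ℕP.≤-trans (ℕP.≤-trans (ℕP.m≤m+n _ _) rest′) H≤n))

    tail-≤ : ∀ {H M} → H₀ ℕ.≤ H → 4 ℕ.* M ℕ.≤ W H → ∀ k → T (H ℕ.+ k) ≤ T H + q ^ M
    tail-≤ {H} {M} H₀≤H 4M≤W k = begin
      T (H ℕ.+ k) ≈⟨ ∑-split H k a ⟩
      T H + ∑ k (a ∘ (H ℕ.+_)) ≤⟨ +-monoʳ-≤ _ (∑-mono k (λ i _ → a-≤ {H} {M} H₀≤H 4M≤W i)) ⟩
      T H + ∑ k (λ i → q ^ M * q ^ c * q ^ i) ≈⟨ +-congˡ (≈-trans (∑-*ˡ k (q ^ M * q ^ c) (q ^_)) (*-assoc _ _ _)) ⟩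
      T H + q ^ M * (q ^ c * ∑ k (q ^_)) ≤⟨ +-monoʳ-≤ _ (*-monoˡ-≤ (^-nonneg M 0≤q) (≤-trans (*-monoʳ-≤ (∑-nonneg k (λ i → ^-nonneg i 0≤q)) qᶜ≤) (≤-trans (≈⇒≤ (*-comm _ _)) (geometric-≤ k 0≤q)))) ⟩
      T H + q ^ M * 1# ≈⟨ +-congˡ (*-identityʳ _) ⟩
      T H + q ^ M ∎

    convergent : ∃ λ ξ → ConvergesTo T ξ × (∀ n → T n ≤ ξ)
    -- M = 0 is always allowed and bounds all partial sums by T(H₀) + 1.
    convergent = monotone-converges (λ m n → ∑-monoˡ a≥0) (λ n → ≤-trans (∑-monoˡ a≥0 (ℕP.m≤n+m n H₀)) (tail-≤ {H₀} {0} ℕP.≤-refl ℕ.z≤n n))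

    ξ = proj₁ convergent

    approximated : WellApproximated q ξ u W
    approximated = H₀ , λ H H₀≤H M 4M≤W → ≤-trans (≈⇒≤ (∣∣-of-nonneg (≤⇒0≤- (proj₂ (proj₂ convergent) H))))
      (by≤ (≤⇒0≤- (lim-≤ H (proj₁ (proj₂ convergent)) (λ n H≤n → ≤-trans (≈⇒≤ (≈-reflexive (≡.cong T (≡.sym (ℕP.m+[n∸m]≡n H≤n))))) (tail-≤ {H} {M} H₀≤H 4M≤W (n ℕ.∸ H)))))
        (solve 3 (λ x t p → p :- (x :- t) := (t :+ p) :- x) ≈-refl ξ (T H) (q ^ M)))

  -- Zeros in front of u let a series that starts at m be treated as one that starts at 0, as the
  -- truncations do.
  start-at : ℕ → (ℕ → ℕ) → ℕ → ℕ
  start-at zero u n = u n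
  start-at (suc m) u zero = 0
  start-at (suc m) u (suc n) = start-at m (u ∘ suc) n

  start-at-≥ : ∀ m u {n} → m ℕ.≤ n → start-at m u n ≡ u n
  start-at-≥ zero u _ = ≡.refl
  start-at-≥ (suc m) u {suc n} (ℕ.s≤s p) = start-at-≥ m (u ∘ suc) p

  start-at-< : ∀ m u {n} → n ℕ.< m → start-at m u n ≡ 0
  start-at-< (suc m) u {zero} _ = ≡.refl
  start-at-< (suc m) u {suc n} (ℕ.s≤s p) = start-at-< m (u ∘ suc) p

  start-at-≤ : ∀ m u n → start-at m u n ℕ.≤ u n
  start-at-≤ zero u n = ℕP.≤-refl
  start-at-≤ (suc m) u zero = ℕ.z≤n
  start-at-≤ (suc m) u (suc n) = start-at-≤ m (u ∘ suc) n

  -- What the sum ∑∞ m in lacunary stands for, with exponents that are unknowns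
  -- and may depend on the number N of terms.
  series : ℝ → ℕ → (ℕ → ℕ) → (∀ N → Fin N → ℝ) → ℝ
  series β m u w = choose 0# (ConvergesTo λ N → sum {N} λ k → fromℕ (u (m ℕ.+ toℕ k)) * β ^ᶻ (ℤ.- ⌊ w N k ⌋))

  series-approximated : ∀ {β} → 1# < β → ∀ m u {w : ℕ → ℝ} (w≥0 : ∀ n → 0# ≤ w n) → Eventually (λ n → fromℕ (u n) ≤ β ^ n) →
    Eventually (λ n → n ℕ.* n ℕ.≤ floor-of w≥0 n) → (∃ λ n₁ → ∀ m n → n₁ ℕ.≤ m → m ℕ.≤ n → floor-of w≥0 m ℕ.≤ floor-of w≥0 n) →
    ∀ {w′} → (∀ N k → w′ N k ≡ w (m ℕ.+ toℕ k)) → WellApproximated (β ⁻¹) (series β m u w′) (start-at m u) (floor-of w≥0)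
  series-approximated {β} 1<β m u {w} w≥0 u-bound squares mono {w′} w′≡w = H₀ , λ H H₀≤H M 4M≤W → ≤-trans (≈⇒≤ (∣∣-cong (+-congʳ series≈ξ))) (proj₂ approximated H H₀≤H M 4M≤W)
    where
    open Tail 1<β (start-at m u) (floor-of w≥0) (proj₁ u-bound , λ n p → ≤-trans (fromℕ-mono (start-at-≤ m u n)) (proj₂ u-bound n p)) squares mono
    power : ℝ → ℝ
    power z = β ^ᶻ (ℤ.- ⌊ z ⌋)
    negative-power : ∀ {z k} → z ≡ + k → β ^ᶻ (ℤ.- z) ≈ q ^ k
    negative-power {k = zero} ≡.refl = ≈-refl
    negative-power {k = suc k} ≡.refl = ≈-refl
    term≈ : ∀ k → a (m ℕ.+ k) ≈ fromℕ (u (m ℕ.+ k)) * power (w (m ℕ.+ k))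
    term≈ k = *-cong (≈-reflexive (≡.cong fromℕ (start-at-≥ m u (ℕP.m≤m+n m k)))) (≈-sym (negative-power (floor-of-≡ w≥0 (m ℕ.+ k))))
    partial : ∀ n → T (m ℕ.+ n) ≈ sum {n} (λ k → fromℕ (u (m ℕ.+ toℕ k)) * power (w′ n k))
    partial n = begin-equality
      T (m ℕ.+ n) ≈⟨ ∑-split m n a ⟩
      T m + ∑ n (a ∘ (m ℕ.+_)) ≈⟨ +-cong (∑-zero m (λ i i<m → ≈-trans (*-congʳ (≈-reflexive (≡.cong fromℕ (start-at-< m u i<m)))) (zeroˡ _))) (∑-cong n (λ k _ → term≈ k)) ⟩
      0# + ∑ n (λ k → fromℕ (u (m ℕ.+ k)) * power (w (m ℕ.+ k))) ≈⟨ ≈-trans (+-identityˡ _) (≈-sym (sum≈∑ n _)) ⟩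
      sum {n} (λ k → fromℕ (u (m ℕ.+ toℕ k)) * power (w (m ℕ.+ toℕ k))) ≈⟨ sum-cong {n} (λ k → *-congˡ (≈-reflexive (≡.cong power (≡.sym (w′≡w n k))))) ⟩
      sum {n} (λ k → fromℕ (u (m ℕ.+ toℕ k)) * power (w′ n k)) ∎
    converges : ConvergesTo (λ n → sum {n} (λ k → fromℕ (u (m ℕ.+ toℕ k)) * power (w′ n k))) ξ
    converges = conv-cong partial (λ ε 0<ε → let N , h = proj₁ (proj₂ convergent) ε 0<ε in N , λ n p → h (m ℕ.+ n) (ℕP.≤-trans p (ℕP.m≤n+m n m)))
    series≈ξ : series β m u w′ ≈ ξ
    series≈ξ = conv-unique (choose-spec 0# (ConvergesTo (λ n → sum {n} (λ k → fromℕ (u (m ℕ.+ toℕ k)) * power (w′ n k)))) (ξ , converges)) converges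

  floors-of : ∀ {ψ} (acc : Accelerating ψ) {w : ℕ → ℝ} (w≥0 : ∀ n → 0# ≤ w n) → Eventually (λ n → w n ≈ exp (Accelerating.exponent acc (log (fromℕ n)))) → Accelerating.FloorOfExp acc (floor-of w≥0)
  floors-of acc w≥0 (N , h) = N , λ n p → IsFloor-cong {k = floor-of w≥0 n} (h n p) (is-floor w≥0 n)

  -- The sequences of the theorem

  module Sequences {β : ℝ} (1<β : 1# < β) (powers : PowerExpansion β) (u : Fin 3 → ℕ → ℕ) (u-pos : ∀ i n → 1 ℕ.≤ n → 0 ℕ.< u i n)
    (subexponential : ∃ λ C → 0# < C × C < 1# × (∀ i → (λ n → log⁺ (fromℕ (u i n))) =o (λ n → fromℕ n ^ʳ (1# - C))))
    (ratio→∞ : TendsToInfinity (λ n → fromℕ (u 0F n) / fromℕ (u 1F n))) where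

    0<β : 0# < β
    0<β = <-trans 0<1 1<β

    0<log-β : 0# < log β
    0<log-β = ≰⇒> λ log≤0 → <⇒≱ 1<β (≤-trans (≈⇒≤ (≈-sym (exp-log 0<β))) (≤-trans (exp-mono-≤ log≤0) (≈⇒≤ exp-0)))

    -- For n ≥ 1, n^(1 - C) ≤ n. The choice ε = log β in the o then gives log u(n) ≤ n log β.
    eventually-≤ : ∀ i → Eventually λ n → fromℕ (u i n) ≤ β ^ n
    eventually-≤ i = suc (proj₁ (o i (log β) 0<log-β)) , λ n p → step n (ℕP.≤-trans (ℕ.s≤s ℕ.z≤n) p) (proj₂ (o i (log β) 0<log-β) n (ℕP.<⇒≤ p))
      where
      C = proj₁ subexponential
      0<C = proj₁ (proj₂ subexponential)
      o = proj₂ (proj₂ (proj₂ subexponential))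
      step : ∀ n → 1 ℕ.≤ n → ∣ log⁺ (fromℕ (u i n)) ∣ ≤ log β * ∣ fromℕ n ^ʳ (1# - C) ∣ → fromℕ (u i n) ≤ β ^ n
      step n 1≤n bound = begin
        fromℕ (u i n) ≤⟨ x≤y⊔x 1# (fromℕ (u i n)) ⟩
        1# ⊔ fromℕ (u i n) ≈⟨ ≈-sym (exp-log (<-≤-trans 0<1 (x≤x⊔y 1# (fromℕ (u i n))))) ⟩
        exp (log⁺ (fromℕ (u i n))) ≤⟨ exp-mono-≤ (≤-trans (x≤∣x∣ _) bound) ⟩
        exp (log β * ∣ fromℕ n ^ʳ (1# - C) ∣) ≤⟨ exp-mono-≤ (*-monoˡ-≤ (<⇒≤ 0<log-β) power≤) ⟩
        exp (log β * fromℕ n) ≈⟨ ≈-trans (exp-cong (*-comm _ _)) (exp-fromℕ* n _) ⟩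
        exp (log β) ^ n ≈⟨ ^-congˡ n (exp-log 0<β) ⟩
        β ^ n ∎
        where
        0≤log : 0# ≤ log (fromℕ n)
        0≤log = ≤-respˡ-≈ log-1 (log-mono-≤ 0<1 (≤-trans (≈⇒≤ (≈-sym fromℕ-1)) (fromℕ-mono 1≤n)))
        power≤ : ∣ fromℕ n ^ʳ (1# - C) ∣ ≤ fromℕ n
        power≤ = begin
          ∣ fromℕ n ^ʳ (1# - C) ∣ ≈⟨ ∣∣-of-nonneg (^ʳ-nonneg _ _) ⟩
          fromℕ n ^ʳ (1# - C) ≡⟨ ^ʳ-pos-base (1# - C) (fromℕ-pos 1≤n) ⟩
          exp ((1# - C) * log (fromℕ n)) ≤⟨ exp-mono-≤ (by≤ (*-nonNeg (<⇒≤ 0<C) 0≤log) (solve 2 (λ c l → l :- (:1 :- c) :* l := c :* l) ≈-refl C (log (fromℕ n)))) ⟩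
          exp (log (fromℕ n)) ≈⟨ exp-log-fromℕ 1≤n ⟩
          fromℕ n ∎

    bounded-by-power : ∀ i → ∃ λ C → ∀ n → fromℕ (u i n) ≤ fromℕ C * β ^ n
    bounded-by-power i = suc B , λ n → split n (n ℕP.<? N)
      where
      N = proj₁ (eventually-≤ i)
      B = proj₁ (upper-bound (u i) N)
      split : ∀ n → Dec (n ℕ.< N) → fromℕ (u i n) ≤ fromℕ (suc B) * β ^ n
      split n (yes n<N) = ≤-trans (fromℕ-mono (ℕP.m≤n⇒m≤1+n (ℕP.<⇒≤ (proj₂ (upper-bound (u i) N) n n<N))))
        (≤-trans (≈⇒≤ (≈-sym (*-identityʳ _))) (*-monoˡ-≤ (fromℕ-nonneg (suc B)) (1≤^ n (<⇒≤ 1<β))))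
      split n (no n≮N) = ≤-trans (proj₂ (eventually-≤ i) n (ℕP.≮⇒≥ n≮N))
        (≤-trans (≈⇒≤ (≈-sym (*-identityˡ _))) (*-monoʳ-≤ (^-nonneg n (<⇒≤ 0<β)) (≤-trans (≈⇒≤ (≈-sym fromℕ-1)) (fromℕ-mono {1} {suc B} (ℕ.s≤s ℕ.z≤n)))))

    C = proj₁ (bounded-by-power 0F) ℕ.+ (proj₁ (bounded-by-power 1F) ℕ.+ proj₁ (bounded-by-power 2F))

    bounded-start : ∀ i m → proj₁ (bounded-by-power i) ℕ.≤ C → ∀ n → fromℕ (start-at m (u i) n) ≤ fromℕ C * β ^ n
    bounded-start i m p n = ≤-trans (fromℕ-mono (start-at-≤ m (u i) n)) (≤-trans (proj₂ (bounded-by-power i) n) (*-monoʳ-≤ (^-nonneg n (<⇒≤ 0<β)) (fromℕ-mono p)))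

    dominates : ∀ m M → ∃ λ n₀ → ∀ n → n₀ ℕ.≤ n → 0 ℕ.< start-at m (u 1F) n × M ℕ.* start-at m (u 1F) n ℕ.≤ start-at m (u 0F) n
    dominates m M = m ℕ.+ suc N , λ n p → transport n (ℕP.≤-trans (ℕP.m≤m+n m _) p) (ℕP.≤-trans (ℕP.m≤n+m _ m) p)
      where
      N = proj₁ (ratio→∞ (fromℕ M))
      transport : ∀ n → m ℕ.≤ n → suc N ℕ.≤ n → 0 ℕ.< start-at m (u 1F) n × M ℕ.* start-at m (u 1F) n ℕ.≤ start-at m (u 0F) n
      transport n m≤n N<n rewrite start-at-≥ m (u 1F) m≤n | start-at-≥ m (u 0F) m≤n = 0<u , fromℕ-cancel-≤ (begin
        fromℕ (M ℕ.* u 1F n) ≈⟨ fromℕ-* M (u 1F n) ⟩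
        fromℕ M * fromℕ (u 1F n) ≤⟨ *-monoʳ-≤ (fromℕ-nonneg (u 1F n)) (<⇒≤ (proj₂ (ratio→∞ (fromℕ M)) n (ℕP.<⇒≤ N<n))) ⟩
        fromℕ (u 0F n) * fromℕ (u 1F n) ⁻¹ * fromℕ (u 1F n) ≈⟨ ≈-trans (solve 3 (λ a i b → a :* i :* b := a :* (b :* i)) ≈-refl (fromℕ (u 0F n)) (fromℕ (u 1F n) ⁻¹) (fromℕ (u 1F n))) (≈-trans (*-congˡ (⁻¹-inverse (fromℕ-pos 0<u))) (*-identityʳ _)) ⟩
        fromℕ (u 0F n) ∎)
        where 0<u = u-pos 1F n (ℕP.≤-trans (ℕ.s≤s ℕ.z≤n) N<n)

    u₃-pos : ∀ n → 0 ℕ.< n → 0 ℕ.< start-at 1 (u 2F) n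
    u₃-pos (suc n) p = u-pos 2F (suc n) p

    -- The relation precedes the equations for the exponents, because it determines
    -- them: equations between the sums themselves would be unfolded completely.
    Independent : ℕ → (ℕ → ℝ) → (ℕ → ℝ) → Set
    Independent m w v = ∀ {d} (P : Polynomial₃ d) → NonzeroPolynomial₃ P → ∀ {w₁ w₂ v′ : ∀ N → Fin N → ℝ} →
      evalPolynomial₃ P (fromℝ (series β m (u 0F) w₁)) (fromℝ (series β m (u 1F) w₂)) (fromℝ (series β 1 (u 2F) v′)) ≈ᶜ 0ᶜ →
      (∀ N k → w₁ N k ≡ w (m ℕ.+ toℕ k)) → (∀ N k → w₂ N k ≡ w (m ℕ.+ toℕ k)) → (∀ N k → v′ N k ≡ v (1 ℕ.+ toℕ k)) → ⊥

    independent-series : ∀ m {w v : ℕ → ℝ} (w≥0 : ∀ n → 0# ≤ w n) (v≥0 : ∀ n → 0# ≤ v n) → Growth (floor-of w≥0) (floor-of v≥0) →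
      Eventually (λ n → n ℕ.* n ℕ.≤ floor-of w≥0 n) → Eventually (λ n → n ℕ.* n ℕ.≤ floor-of v≥0 n) → Independent m w v
    independent-series m w≥0 v≥0 growth W-squares V-squares P nonzero {w₁} {w₂} {v′} root w₁≡w w₂≡w v′≡v = independent (record
      { 1<β = 1<β ; powers = powers ; growth = growth ; C = C
      ; u-bound = λ n → bounded-start 0F m (ℕP.m≤m+n _ _) n , bounded-start 1F m (ℕP.≤-trans (ℕP.m≤m+n _ _) (ℕP.m≤n+m _ (proj₁ (bounded-by-power 0F)))) n
                        , bounded-start 2F 1 (ℕP.≤-trans (ℕP.m≤n+m _ (proj₁ (bounded-by-power 1F))) (ℕP.m≤n+m _ (proj₁ (bounded-by-power 0F)))) n
      ; dominates = dominates m ; u₃-pos = u₃-pos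
      ; approx₁ = series-approximated 1<β m (u 0F) w≥0 (eventually-≤ 0F) W-squares (n₁ , λ i j → gap-mono {floor-of w≥0} 0<n₁ gapW) {w₁} w₁≡w
      ; approx₂ = series-approximated 1<β m (u 1F) w≥0 (eventually-≤ 1F) W-squares (n₁ , λ i j → gap-mono {floor-of w≥0} 0<n₁ gapW) {w₂} w₂≡w
      ; approx₃ = series-approximated 1<β 1 (u 2F) v≥0 (eventually-≤ 2F) V-squares (n₁ , λ i j → gap-mono {floor-of v≥0} 0<n₁ gapV) {v′} v′≡v }) P nonzero root
      where open Growth growth

    accelerated : ∀ {ψ} (acc : Accelerating ψ) m {w v : ℕ → ℝ} (w≥0 : ∀ n → 0# ≤ w n) (v≥0 : ∀ n → 0# ≤ v n) →
      Eventually (λ n → w n ≈ exp (Accelerating.exponent acc (log (fromℕ n)))) → Fast (floor-of v≥0) →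
      ∀ (f : ℕ → ℝ) → Eventually (λ n → v n ≈ exp (f n)) →
      (∀ k → 0 ℕ.< k → Eventually λ n → 0 ℕ.< n × Accelerating.exponent acc (fromℕ k * log (fromℕ n)) ≤ f n) →
      Independent m w v
    accelerated acc m {w} {v} w≥0 v≥0 w≈ fast f v≈ dominated = independent-series m {w} {v} w≥0 v≥0
      (growth acc floors fast (faster {f} {floor-of v≥0} (proj₁ v≈ , λ n p → IsFloor-cong {k = floor-of v≥0 n} (proj₂ v≈ n p) (is-floor v≥0 n)) (Fast.squares fast) dominated))
      (proj₁ squares , λ n p → proj₂ (proj₂ squares n p)) (Fast.squares fast)
      where
      floors = floors-of acc w≥0 w≈
      open Accelerated acc (floor-of w≥0) floors

    exp-power≥0 : ∀ x n → 0# ≤ exp (log (fromℕ n) ^ʳ (1# + x))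
    exp-power≥0 x n = <⇒≤ (exp-pos _)

    exp-power≈ : ∀ x (0<x : 0# < x) → Eventually λ n → exp (log (fromℕ n) ^ʳ (1# + x)) ≈ exp (PowerOfLog.exponent x 0<x (log (fromℕ n)))
    exp-power≈ x 0<x = proj₁ (loglog-large 0#) , λ n p → let _ , 0<ℓ , _ = proj₂ (loglog-large 0#) n p in
      exp-cong (≈-trans (≈-reflexive (^ʳ-pos-base (1# + x) 0<ℓ)) (≈-sym (PowerOfLog.exponent-≈ x 0<x 0<ℓ)))

    self-power≥0 : ∀ n → 0# ≤ fromℕ n ^ʳ log (fromℕ n)
    self-power≥0 n = ^ʳ-nonneg _ _

    -- n^(log n) = exp((log n)²) is the case y = 1 of `PowerOfLog`.
    self-power≈ : Eventually λ n → fromℕ n ^ʳ log (fromℕ n) ≈ exp (Square.exponent (log (fromℕ n)))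
    self-power≈ = proj₁ (loglog-large 0#) , λ n p → let 0<n , 0<ℓ , _ = proj₂ (loglog-large 0#) n p in
      ≈-trans (≈-reflexive (^ʳ-pos-base (log (fromℕ n)) (fromℕ-pos 0<n))) (exp-cong (*-congˡ (≈-sym (≈-trans (exp-cong (*-identityˡ _)) (exp-log 0<ℓ)))))

    loglog-power≥0 : ∀ n → 0# ≤ fromℕ n ^ʳ log (log (fromℕ n))
    loglog-power≥0 n = ^ʳ-nonneg _ _

    loglog-power≈ : Eventually λ n → fromℕ n ^ʳ log (log (fromℕ n)) ≈ exp (log (fromℕ n) * log (log (fromℕ n)))
    loglog-power≈ = 1 , λ n p → ≈-trans (≈-reflexive (^ʳ-pos-base (log (log (fromℕ n))) (fromℕ-pos p))) (exp-cong (*-comm _ _))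

    powers-of-log : ∀ x y → 0# < x → x < y → Independent 1 (λ n → exp (log (fromℕ n) ^ʳ (1# + x))) (λ n → exp (log (fromℕ n) ^ʳ (1# + y)))
    powers-of-log x y 0<x x<y = accelerated (PowerOfLog.accelerating x 0<x) 1 (exp-power≥0 x) (exp-power≥0 y) (exp-power≈ x 0<x)
      (PowerOfLog.fast y 0<y (floor-of (exp-power≥0 y)) (floors-of (PowerOfLog.accelerating y 0<y) (exp-power≥0 y) (exp-power≈ y 0<y))) (λ n → PowerOfLog.exponent y 0<y (log (fromℕ n))) (exp-power≈ y 0<y) (power-dominates-power 0<x x<y)
      where 0<y = <-trans 0<x x<y

    iterated-logarithms : Independent 3 (λ n → fromℕ n ^ʳ log (log (fromℕ n))) (λ n → fromℕ n ^ʳ log (fromℕ n))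
    iterated-logarithms = accelerated logarithm-accelerating 3 loglog-power≥0 self-power≥0 loglog-power≈
      (PowerOfLog.fast 1# 0<1 (floor-of self-power≥0) (floors-of Square.accelerating self-power≥0 self-power≈)) (λ n → Square.exponent (log (fromℕ n))) self-power≈ square-dominates-log

    logarithm-and-geometric : ∀ r → 1# < r → Independent 1 (λ n → fromℕ n ^ʳ log (fromℕ n)) (λ n → r ^ n)
    logarithm-and-geometric r 1<r = accelerated Square.accelerating 1 self-power≥0 r≥0 self-power≈ (Geometric.fast r 1<r (floor-of r≥0) (is-floor r≥0))
      (λ n → fromℕ n * log r) (0 , λ n _ → Geometric.r^ r 1<r (floor-of r≥0) (is-floor r≥0) n) (geometric-dominates-square (Geometric.0<κ r 1<r (floor-of r≥0) (is-floor r≥0)))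
      where
      r≥0 : ∀ n → 0# ≤ r ^ n
      r≥0 n = ^-nonneg n (<⇒≤ (<-trans 0<1 1<r))

  -- Pisot and Salem numbers share the bound |γ| ≤ 1 for their proper conjugates, and
  -- `power-expansion` takes it in this form; excluded middle separates γ = β from the proper
  -- conjugates.
  pisot-or-salem : ∀ {β} → Pisot β ⊎ Salem β → 1# < β × PowerExpansion β
  pisot-or-salem {β} (inj₁ (integral , 1<β , conjugates≤1)) = 1<β , power-expansion β integral λ γ conjugate → case γ conjugate (lem {γ ≈ᶜ fromℝ β})
    where
    case : ∀ γ → γ ConjugateOf fromℝ β → Dec (γ ≈ᶜ fromℝ β) → γ ≈ᶜ fromℝ β ⊎ ∣ γ ∣ᶜ ≤ 1#
    case γ conjugate (yes e) = inj₁ e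
    case γ conjugate (no n) = inj₂ (<⇒≤ (conjugates≤1 γ (conjugate , n)))
  pisot-or-salem {β} (inj₂ (integral , 1<β , conjugates≤1 , _)) = 1<β , power-expansion β integral λ γ conjugate → case γ conjugate (lem {γ ≈ᶜ fromℝ β})
    where
    case : ∀ γ → γ ConjugateOf fromℝ β → Dec (γ ≈ᶜ fromℝ β) → γ ≈ᶜ fromℝ β ⊎ ∣ γ ∣ᶜ ≤ 1#
    case γ conjugate (yes e) = inj₁ e
    case γ conjugate (no n) = inj₂ (conjugates≤1 γ (conjugate , n))

theorem1 : (lem : ExcludedMiddle 0ℓ) (R : CompleteOrderedField) →
  let open Analysis lem R in
  (β : ℝ) → Pisot β ⊎ Salem β →
  (u : Fin 3 → ℕ → ℕ) → (∀ i n → 1 ℕ.≤ n → 0 ℕ.< u i n) →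
  (∃ λ C → 0# < C × C < 1# × (∀ i → (λ n → log⁺ (fromℕ (u i n))) =o (λ n → fromℕ n ^ʳ (1# - C)))) →
  TendsToInfinity (λ n → fromℕ (u 0F n) / fromℕ (u 1F n)) →
  (∀ x y → 0# < x → x < y →
    AlgebraicallyIndependent
      (lacunary β 1 (u 0F) (λ n → exp (log (fromℕ n) ^ʳ (1# + x))))
      (lacunary β 1 (u 1F) (λ n → exp (log (fromℕ n) ^ʳ (1# + x))))
      (lacunary β 1 (u 2F) (λ n → exp (log (fromℕ n) ^ʳ (1# + y)))))
  ×
  AlgebraicallyIndependent
    (lacunary β 3 (u 0F) (λ n → fromℕ n ^ʳ log (log (fromℕ n))))
    (lacunary β 3 (u 1F) (λ n → fromℕ n ^ʳ log (log (fromℕ n))))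
    (lacunary β 1 (u 2F) (λ n → fromℕ n ^ʳ log (fromℕ n)))
  ×
  (∀ r → 1# < r →
    AlgebraicallyIndependent
      (lacunary β 1 (u 0F) (λ n → fromℕ n ^ʳ log (fromℕ n)))
      (lacunary β 1 (u 1F) (λ n → fromℕ n ^ʳ log (fromℕ n)))
      (lacunary β 1 (u 2F) (λ n → r ^ n)))
theorem1 lem R β pisot⊎salem u u-pos subexponential ratio→∞ =
  (λ x y 0<x x<y P nonzero root → Proof.Sequences.powers-of-log lem R 1<β powers u u-pos subexponential ratio→∞
    x y 0<x x<y P nonzero root (λ _ _ → ≡.refl) (λ _ _ → ≡.refl) (λ _ _ → ≡.refl)) ,
  (λ P nonzero root → Proof.Sequences.iterated-logarithms lem R 1<β powers u u-pos subexponential ratio→∞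
    P nonzero root (λ _ _ → ≡.refl) (λ _ _ → ≡.refl) (λ _ _ → ≡.refl)) ,
  (λ r 1<r P nonzero root → Proof.Sequences.logarithm-and-geometric lem R 1<β powers u u-pos subexponential ratio→∞
    r 1<r P nonzero root (λ _ _ → ≡.refl) (λ _ _ → ≡.refl) (λ _ _ → ≡.refl))
  where
  1<β = proj₁ (Proof.pisot-or-salem lem R pisot⊎salem)
  powers = proj₂ (Proof.pisot-or-salem lem R pisot⊎salem)
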